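{- Let $k\ge 2$ and $r$ be positive integers. (i) Let $s>1$ and let $F$ be a graph consisting of $s$ connected components of chromatic number $k+1$, each of which has a color-critical edge, together with any number of connected components of chromatic number at most $k$. Then for all sufficiently large $n$, $\mathrm{ex}_r(n,F)=e_r(T)$ for some $n$-vertex complete $(s+k-1)$-partite graph $T$ having $s-1$ parts of order $1$. (ii) Let $a$ be a positive integer and $F=K_{1,a,\dots,a}$ the complete $(k+1)$-partite graph with one part of order $1$ and $k$ parts of order $a$. Then for all sufficiently large $n$, $\mathrm{ex}_r(n,F)=e_r(T)$ for some $T\in\mathcal{T}_0(n,k,a-1)$. (iii) For all sufficiently large $n$, $\mathrm{ex}_r(n,B_{k+1,1})=e_r(T')$ for some $n$-vertex graph $T'$ obtained from a complete $k$-partite graph by adding one edge inside one of its parts.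
   Context: For a graph $G$ with degree sequence $d_1,\dots,d_n$, $e_r(G)=\sum_i d_i^r$; $\mathrm{ex}_r(n,F)$ is the maximum of $e_r(G)$ over $n$-vertex $F$-free graphs $G$. An edge of a graph is color-critical if deleting it decreases the chromatic number. A graph is almost $\ell$-regular if either every vertex has degree $\ell$, or one vertex has degree $\ell-1$ and all other vertices have degree $\ell$. $\mathcal{T}_0(n,k,a-1)$ is the family of $n$-vertex graphs obtained from a complete $k$-partite graph by adding an almost $(a-1)$-regular graph inside each part. $B_{k+1,1}$ denotes two copies of $K_{k+1}$ sharing exactly one vertex. -}

module Defs where

open import Data.Bool using (Bool; true; false; _∧_; _∨_; not; if_then_else_)
open import Data.Bool.Properties using (∨-comm)
open import Data.Nat using (ℕ; zero; suc; _+_; _*_; _∸_; _^_; _≤_; _<_)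
open import Data.Fin using (Fin; zero; suc; _≟_; splitAt; quotient)
open import Data.Sum using (_⊎_; inj₁; inj₂)
open import Data.Product using (Σ; ∃; ∃-syntax; _×_; _,_)
open import Data.List using (List; []; _∷_)
open import Data.Empty using (⊥)
open import Relation.Nullary using (¬_; yes; no)
open import Relation.Nullary.Decidable using (⌊_⌋)
open import Relation.Binary.PropositionalEquality using (_≡_; refl; _≢_; cong; sym)
open import Function.Definitions using (Injective)

record Graph (n : ℕ) : Set where
  field
    adj    : Fin n → Fin n → Bool
    adj-sym : ∀ u v → adj u v ≡ adj v u
    irrefl : ∀ u → adj u u ≡ false
open Graph public

_==_ : ∀ {n} → Fin n → Fin n → Bool
i == j = ⌊ i ≟ j ⌋

==-sym : ∀ {n} (i j : Fin n) → (i == j) ≡ (j == i)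
==-sym i j with i ≟ j | j ≟ i
... | yes _ | yes _ = refl
... | no _  | no _  = refl
... | yes p | no q  with q (sym p)
...   | ()
==-sym i j | no q | yes p with q (sym p)
...   | ()

==-refl : ∀ {n} (i : Fin n) → (i == i) ≡ true
==-refl i with i ≟ i
... | yes _ = refl
... | no q with q refl
...   | ()

mkGraph : ∀ {n} → (Fin n → Fin n → Bool) → Graph n
mkGraph r = record
  { adj    = λ u v → (r u v ∨ r v u) ∧ not (u == v)
  ; adj-sym = λ u v → lemma u v
  ; irrefl = λ u → lemma₂ u
  }
  where
  lemma : ∀ u v → ((r u v ∨ r v u) ∧ not (u == v)) ≡ ((r v u ∨ r u v) ∧ not (v == u))
  lemma u v rewrite ∨-comm (r u v) (r v u) | ==-sym u v = refl
  lemma₂ : ∀ u → ((r u u ∨ r u u) ∧ not (u == u)) ≡ false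
  lemma₂ u rewrite ==-refl u with r u u
  ... | true = refl
  ... | false = refl

count : ∀ {n} → (Fin n → Bool) → ℕ
count {zero}  f = 0
count {suc n} f = (if f zero then 1 else 0) + count (λ i → f (suc i))

sumFin : ∀ {n} → (Fin n → ℕ) → ℕ
sumFin {zero}  f = 0
sumFin {suc n} f = f zero + sumFin (λ i → f (suc i))

deg : ∀ {n} → Graph n → Fin n → ℕ
deg G v = count (λ w → adj G v w)

e : ∀ {n} → ℕ → Graph n → ℕ
e r G = sumFin (λ v → deg G v ^ r)

_⊆G_ : ∀ {m n} → Graph m → Graph n → Set
_⊆G_ {m} {n} F G =
  Σ (Fin m → Fin n) λ f → Injective _≡_ _≡_ f ×
    (∀ u v → adj F u v ≡ true → adj G (f u) (f v) ≡ true)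

_-free : ∀ {m n} → Graph m → Graph n → Set
(F -free) G = ¬ (F ⊆G G)

IsExr : ∀ {m} → (n r : ℕ) → Graph m → ℕ → Set
IsExr n r F x =
  (Σ (Graph n) λ G → (F -free) G × e r G ≡ x) ×
  (∀ (G : Graph n) → (F -free) G → e r G ≤ x)

Colorable : ∀ {n} → Graph n → ℕ → Set
Colorable {n} G c =
  Σ (Fin n → Fin c) λ f → ∀ u v → adj G u v ≡ true → f u ≢ f v

ChromaticNumber : ∀ {n} → Graph n → ℕ → Set
ChromaticNumber G c = Colorable G c × (∀ c′ → c′ < c → ¬ Colorable G c′)

deleteEdge : ∀ {n} → Graph n → Fin n → Fin n → Graph n
deleteEdge G x y = mkGraph λ u v →
  adj G u v ∧ not ((u == x ∧ v == y) ∨ (u == y ∧ v == x))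

ColorCriticalEdge : ∀ {n} → Graph n → Fin n → Fin n → Set
ColorCriticalEdge G x y =
  adj G x y ≡ true ×
  Σ ℕ λ c → ChromaticNumber G (suc c) × Colorable (deleteEdge G x y) c

HasColorCriticalEdge : ∀ {n} → Graph n → Set
HasColorCriticalEdge {n} G = Σ (Fin n) λ x → Σ (Fin n) λ y → ColorCriticalEdge G x y

data Reach {n} (G : Graph n) : Fin n → Fin n → Set where
  here : ∀ {u} → Reach G u u
  step : ∀ {u w v} → adj G u w ≡ true → Reach G w v → Reach G u v

Connected : ∀ {n} → Graph n → Set
Connected {n} G = Fin n × (∀ u v → Reach G u v)

record AGraph : Set where
  constructor ⟨_,_⟩
  field
    size  : ℕ
    graph : Graph size
open AGraph public

emptyGraph : Graph 0
emptyGraph = mkGraph λ ()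

disjointUnion : ∀ {m n} → Graph m → Graph n → Graph (m + n)
disjointUnion {m} {n} G H = mkGraph λ u v → side (splitAt m u) (splitAt m v)
  where
  side : Fin m ⊎ Fin n → Fin m ⊎ Fin n → Bool
  side (inj₁ a) (inj₁ b) = adj G a b
  side (inj₂ a) (inj₂ b) = adj H a b
  side _        _        = false

⨆ : List AGraph → AGraph
⨆ []       = ⟨ 0 , emptyGraph ⟩
⨆ (G ∷ Gs) = ⟨ size G + size (⨆ Gs) , disjointUnion (graph G) (graph (⨆ Gs)) ⟩

Surjective : ∀ {n t} → (Fin n → Fin t) → Set
Surjective {n} p = ∀ j → Σ (Fin n) λ v → p v ≡ j

completeMP : ∀ {n t} → (Fin n → Fin t) → Graph n
completeMP p = mkGraph λ u v → not (p u == p v)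

partSize : ∀ {n t} → (Fin n → Fin t) → Fin t → ℕ
partSize p j = count (λ v → p v == j)

K1a : (k a : ℕ) → Graph (suc (k * a))
K1a k a = completeMP part
  where
  part : Fin (suc (k * a)) → Fin (suc k)
  part zero    = zero
  part (suc i) = suc (quotient {k} a i)

-- B_{k+1,1}: two copies of K_{k+1} sharing exactly one vertex (vertex 0);
-- the remaining 2k vertices are split by splitAt k into the two copies.
B : (k : ℕ) → Graph (suc (k + k))
B k = mkGraph r
  where
  same : Fin k ⊎ Fin k → Fin k ⊎ Fin k → Bool
  same (inj₁ _) (inj₁ _) = true
  same (inj₂ _) (inj₂ _) = true
  same _        _        = false
  r : Fin (suc (k + k)) → Fin (suc (k + k)) → Bool
  r zero    _       = true
  r (suc i) zero    = true
  r (suc i) (suc j) = same (splitAt k i) (splitAt k j)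

innerDeg : ∀ {n t} → Graph n → (Fin n → Fin t) → Fin n → ℕ
innerDeg G p v = count (λ w → adj G v w ∧ (p w == p v))

AlmostRegularPart : ∀ {n t} → Graph n → (Fin n → Fin t) → ℕ → Fin t → Set
AlmostRegularPart {n} G p ℓ j =
  (∀ v → p v ≡ j → innerDeg G p v ≡ ℓ)
  ⊎ (Σ (Fin n) λ v₀ → p v₀ ≡ j × suc (innerDeg G p v₀) ≡ ℓ ×
       (∀ v → p v ≡ j → v ≢ v₀ → innerDeg G p v ≡ ℓ))

InT0 : (n k ℓ : ℕ) → Graph n → Set
InT0 n k ℓ G =
  Σ (Fin n → Fin k) λ p → Surjective p ×
    (∀ u v → p u ≢ p v → adj G u v ≡ true) ×
    (∀ j → AlmostRegularPart G p ℓ j)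

completeMPplusEdge : ∀ {n t} → (Fin n → Fin t) → Fin n → Fin n → Graph n
completeMPplusEdge p x y = mkGraph λ u v → not (p u == p v) ∨ (u == x ∧ v == y)

{-# OPTIONS --safe #-}
module Submission where

-- Let G be F-free on n vertices, with e_r(G) at least the value of every complete
-- k-partite graph. Since F is contained in a blow-up of K_{k+1}, G has o(n^{k+1})
-- copies of K_{k+1}. Erdős' degree majorisation, run with a vertex of largest
-- degree among those in few cliques, then gives a k-partition whose complete
-- k-partite graph dominates the degrees of G up to a small total error. As e_r(G) is
-- at least the value of that graph, few cross edges are missing and few edges are
-- inner, and all parts have linear size. For a partition minimising the number
-- of inner edges, a vertex with many inner neighbours has many neighbours in
-- every part, so greedy embedding finds F at forbidden configurations of inner edges.
-- A vertex missing linearly many cross edges loses more than all inner edges at such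
-- vertices can gain, because x ↦ x ^ r has comparable slopes on [n / C , n].
-- What remains is a bounded combinatorial comparison in each of the three cases.
-- For (ii) the inner graphs of the extremal graph must be chosen without 4-cycles:
-- for a ≥ 3, a K_{a-1,a-1} in one part and a triangle in another one already
-- create K_{1,a,…,a}.

open import Defs
open import Data.Bool using (Bool; true; false; _∧_; _∨_; not; if_then_else_)
open import Data.Nat
open import Data.Nat.Properties
open import Data.Nat.Tactic.RingSolver using (solve-∀)
open import Data.Fin using (Fin; zero; suc; _↑ˡ_; _↑ʳ_; splitAt; inject≤; quotient; remainder; combine)
import Data.Fin as F
import Data.Bool.Properties as BP
import Data.Fin.Permutation.Components as PC
open import Relation.Binary.Definitions using (tri<; tri≈; tri>)
import Data.Fin.Properties as FP
open import Data.Sum using (_⊎_; inj₁; inj₂; [_,_]′)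
open import Data.Product using (Σ; ∃; _×_; _,_; proj₁; proj₂)
open import Data.List using (List; []; _∷_; length; _++_)
import Data.List as L
open import Data.List.Membership.Propositional using (_∈_)
import Data.List.Membership.Propositional.Properties as MP
open import Data.List.Relation.Unary.Any using (here; there)
open import Data.List.Relation.Unary.All using (All; []; _∷_)
open import Data.Vec using (Vec; []; _∷_; lookup; tabulate)
import Data.Vec.Properties as VP
open import Data.Empty using (⊥; ⊥-elim)
open import Data.Unit using (⊤; tt)
open import Relation.Nullary using (¬_; Dec; yes; no)
open import Relation.Nullary.Decidable using (⌊_⌋; _×-dec_; ¬?)
open import Relation.Binary.PropositionalEquality
open import Function using (_∘_; case_of_)
open import Function.Definitions using (Injective)

-- For large r the best complete k-partite graph can be unbalanced, so no part sizes can be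
-- prescribed. The competitor of G is therefore built on a partition read off from G itself, and the
-- extremal graph is a maximiser over the finitely many graphs of the required shape. An upper bound
-- is needed only for a free G whose value is at least this maximum; such a G is at least as good as
-- every complete k-partite graph, which is exactly the hypothesis of `structure`. A second obstacle
-- is that degrees of G may be close to 0, where x ↦ x ^ r has no useful slope. There deficits are
-- controlled by superadditivity; only when the competitor is known to have all degrees at least n /
-- C can gains and losses be compared linearly. The constants are fixed in the order C (from k and r
-- alone), R = r C ^ (r - 1) (the loss that outweighs one unit of gained degree), the thresholds for
-- inner and missing degrees (from R and the size of F), and c, the least size of a part in units η.
-- As η is an integer and a fixed fraction of n, all estimates are inequalities between natural
-- numbers.

⟦_⟧ : Bool → ℕ
⟦ b ⟧ = if b then 1 else 0

true⊎false : (b : Bool) → (b ≡ true) ⊎ (b ≡ false)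
true⊎false true  = inj₁ refl
true⊎false false = inj₂ refl

true≢false : ∀ {b} → b ≡ true → b ≡ false → ⊥
true≢false refl ()

≢true⇒false : ∀ {b} → ¬ (b ≡ true) → b ≡ false
≢true⇒false {true}  h = ⊥-elim (h refl)
≢true⇒false {false} h = refl

∧-intro : ∀ {a b} → a ≡ true → b ≡ true → a ∧ b ≡ true
∧-intro refl refl = refl

∧-elimˡ : ∀ {a b} → a ∧ b ≡ true → a ≡ true
∧-elimˡ {true} _ = refl

∧-elimʳ : ∀ {a b} → a ∧ b ≡ true → b ≡ true
∧-elimʳ {true} h = h

∨-introˡ : ∀ {a b} → a ≡ true → a ∨ b ≡ true
∨-introˡ refl = refl

∨-introʳ : ∀ {a b} → b ≡ true → a ∨ b ≡ true
∨-introʳ {true}  _ = refl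
∨-introʳ {false} h = h

∨-elim : ∀ {a b} → a ∨ b ≡ true → (a ≡ true) ⊎ (b ≡ true)
∨-elim {true}  _ = inj₁ refl
∨-elim {false} h = inj₂ h

not-intro : ∀ {a} → a ≡ false → not a ≡ true
not-intro refl = refl

not-elim : ∀ {a} → not a ≡ true → a ≡ false
not-elim {false} _ = refl

⇔⇒≡ : ∀ {a b} → (a ≡ true → b ≡ true) → (b ≡ true → a ≡ true) → a ≡ b
⇔⇒≡ {true}  {b}     f g = sym (f refl)
⇔⇒≡ {false} {true}  f g = g refl
⇔⇒≡ {false} {false} f g = refl

⟦⟧-mono : ∀ {a b} → (a ≡ true → b ≡ true) → ⟦ a ⟧ ≤ ⟦ b ⟧
⟦⟧-mono {true}  {b} f = ≤-reflexive (cong ⟦_⟧ (sym (f refl)))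
⟦⟧-mono {false}     f = z≤n

⟦⟧-true : ∀ {a} → a ≡ true → ⟦ a ⟧ ≡ 1
⟦⟧-true refl = refl

⟦⟧-false : ∀ {a} → a ≡ false → ⟦ a ⟧ ≡ 0
⟦⟧-false refl = refl

⟦⟧≤1 : ∀ a → ⟦ a ⟧ ≤ 1
⟦⟧≤1 true  = ≤-refl
⟦⟧≤1 false = z≤n

⟦⟧-∧ : ∀ a b → ⟦ a ∧ b ⟧ ≡ ⟦ a ⟧ * ⟦ b ⟧
⟦⟧-∧ true  b = sym (+-identityʳ ⟦ b ⟧)
⟦⟧-∧ false b = refl

⟦⟧-∨≤ : ∀ a b → ⟦ a ∨ b ⟧ ≤ ⟦ a ⟧ + ⟦ b ⟧
⟦⟧-∨≤ true  b = m≤m+n 1 _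
⟦⟧-∨≤ false b = ≤-refl

⟦⟧-split : ∀ a b → ⟦ a ⟧ ≡ ⟦ a ∧ b ⟧ + ⟦ a ∧ not b ⟧
⟦⟧-split true  true  = refl
⟦⟧-split true  false = refl
⟦⟧-split false _     = refl

==⇒≡ : ∀ {n} {i j : Fin n} → (i == j) ≡ true → i ≡ j
==⇒≡ {i = i} {j} h with i F.≟ j
... | yes e = e

≡⇒== : ∀ {n} {i j : Fin n} → i ≡ j → (i == j) ≡ true
≡⇒== {i = i} refl = ==-refl i

==false⇒≢ : ∀ {n} {i j : Fin n} → (i == j) ≡ false → i ≢ j
==false⇒≢ h e = true≢false (≡⇒== e) h

≢⇒==false : ∀ {n} {i j : Fin n} → i ≢ j → (i == j) ≡ false
≢⇒==false ne = ≢true⇒false (ne ∘ ==⇒≡)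

suc-== : ∀ {n} (i j : Fin n) → (suc i == suc j) ≡ (i == j)
suc-== i j = ⇔⇒≡ (λ h → ≡⇒== (FP.suc-injective (==⇒≡ h))) (λ h → ≡⇒== (cong suc (==⇒≡ h)))

le : ℕ → ℕ → Bool
le m n = ⌊ m ≤? n ⌋

le⇒≤ : ∀ {m n} → le m n ≡ true → m ≤ n
le⇒≤ {m} {n} h with m ≤? n
... | yes p = p

≤⇒le : ∀ {m n} → m ≤ n → le m n ≡ true
≤⇒le {m} {n} h with m ≤? n
... | yes _ = refl
... | no q  = ⊥-elim (q h)

nle⇒> : ∀ {m n} → le m n ≡ false → n < m
nle⇒> h = ≰⇒> (λ p → true≢false (≤⇒le p) h)

-- Moves every term of a linear inequality to the side where it is added: the
-- remaining identity is then checked by the ring solver.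
lin : ∀ {a b L R} s → L ≤ R → a + R + s ≡ b + L → a ≤ b
lin {a} {b} {L} {R} s L≤R eq = +-cancelʳ-≤ R a b (begin
  a + R      ≤⟨ m≤m+n (a + R) s ⟩
  a + R + s  ≡⟨ eq ⟩
  b + L      ≤⟨ +-monoʳ-≤ b L≤R ⟩
  b + R      ∎)
  where open ≤-Reasoning

-- Finite sums

sum-cong : ∀ {n} {f g : Fin n → ℕ} → (∀ i → f i ≡ g i) → sumFin f ≡ sumFin g
sum-cong {zero}  h = refl
sum-cong {suc n} h = cong₂ _+_ (h zero) (sum-cong (h ∘ suc))

sum-mono : ∀ {n} {f g : Fin n → ℕ} → (∀ i → f i ≤ g i) → sumFin f ≤ sumFin g
sum-mono {zero}  h = z≤n
sum-mono {suc n} h = +-mono-≤ (h zero) (sum-mono (h ∘ suc))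

+-interchange : ∀ a b c d → (a + b) + (c + d) ≡ (a + c) + (b + d)
+-interchange = solve-∀

sum-+ : ∀ {n} (f g : Fin n → ℕ) → sumFin (λ i → f i + g i) ≡ sumFin f + sumFin g
sum-+ {zero}  f g = refl
sum-+ {suc n} f g = trans (cong (f zero + g zero +_) (sum-+ (f ∘ suc) (g ∘ suc)))
  (+-interchange (f zero) (g zero) (sumFin (f ∘ suc)) (sumFin (g ∘ suc)))

sum-* : ∀ {n} c (f : Fin n → ℕ) → sumFin (λ i → c * f i) ≡ c * sumFin f
sum-* {zero}  c f = sym (*-zeroʳ c)
sum-* {suc n} c f = trans (cong (c * f zero +_) (sum-* c (f ∘ suc)))
  (sym (*-distribˡ-+ c (f zero) (sumFin (f ∘ suc))))

sum-const : ∀ n c → sumFin {n} (λ _ → c) ≡ n * c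
sum-const zero    c = refl
sum-const (suc n) c = cong (c +_) (sum-const n c)

sum-0 : ∀ n → sumFin {n} (λ _ → 0) ≡ 0
sum-0 n = trans (sum-const n 0) (*-zeroʳ n)

sum-≤const : ∀ {n} {f : Fin n → ℕ} c → (∀ i → f i ≤ c) → sumFin f ≤ n * c
sum-≤const {n} c h = ≤-trans (sum-mono h) (≤-reflexive (sum-const n c))

sum-swap : ∀ {m n} (f : Fin m → Fin n → ℕ) →
  sumFin (λ i → sumFin (f i)) ≡ sumFin (λ j → sumFin (λ i → f i j))
sum-swap {zero}  {n} f = sym (sum-0 n)
sum-swap {suc m} f = trans (cong (sumFin (f zero) +_) (sum-swap (f ∘ suc)))
  (sym (sum-+ (f zero) (λ j → sumFin (λ i → f (suc i) j))))

term≤sum : ∀ {n} (f : Fin n → ℕ) i → f i ≤ sumFin f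
term≤sum f zero    = m≤m+n _ _
term≤sum f (suc i) = ≤-trans (term≤sum (f ∘ suc) i) (m≤n+m _ _)

sum-delta : ∀ {n} (i : Fin n) (f : Fin n → ℕ) → sumFin (λ j → ⟦ i == j ⟧ * f j) ≡ f i
sum-delta {suc n} zero    f = trans (cong₂ _+_ (+-identityʳ (f zero)) (sum-0 n)) (+-identityʳ (f zero))
sum-delta {suc n} (suc i) f = trans
  (sum-cong (λ j → cong (λ b → ⟦ b ⟧ * f (suc j)) (suc-== i j))) (sum-delta i (f ∘ suc))

sum-fibres : ∀ {n t} (p : Fin n → Fin t) (f : Fin n → ℕ) →
  sumFin f ≡ sumFin (λ j → sumFin (λ v → ⟦ p v == j ⟧ * f v))
sum-fibres p f = trans (sum-cong (λ v → sym (sum-delta (p v) (λ _ → f v))))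
  (sum-swap (λ v j → ⟦ p v == j ⟧ * f v))

count≡sum : ∀ {n} (f : Fin n → Bool) → count f ≡ sumFin (λ i → ⟦ f i ⟧)
count≡sum {zero}  f = refl
count≡sum {suc n} f = cong (⟦ f zero ⟧ +_) (count≡sum (f ∘ suc))

count-cong : ∀ {n} {f g : Fin n → Bool} → (∀ i → f i ≡ g i) → count f ≡ count g
count-cong {zero}  h = refl
count-cong {suc n} h = cong₂ _+_ (cong ⟦_⟧ (h zero)) (count-cong (h ∘ suc))

count-mono : ∀ {n} {f g : Fin n → Bool} → (∀ i → f i ≡ true → g i ≡ true) → count f ≤ count g
count-mono {zero}  h = z≤n
count-mono {suc n} h = +-mono-≤ (⟦⟧-mono (h zero)) (count-mono (h ∘ suc))

count-∨≤ : ∀ {n} (f g : Fin n → Bool) → count (λ i → f i ∨ g i) ≤ count f + count g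
count-∨≤ f g = begin
  count (λ i → f i ∨ g i)              ≡⟨ count≡sum (λ i → f i ∨ g i) ⟩
  sumFin (λ i → ⟦ f i ∨ g i ⟧)         ≤⟨ sum-mono (λ i → ⟦⟧-∨≤ (f i) (g i)) ⟩
  sumFin (λ i → ⟦ f i ⟧ + ⟦ g i ⟧)     ≡⟨ sum-+ (λ i → ⟦ f i ⟧) (λ i → ⟦ g i ⟧) ⟩
  sumFin (λ i → ⟦ f i ⟧) + sumFin (λ i → ⟦ g i ⟧) ≡⟨ cong₂ _+_ (count≡sum f) (count≡sum g) ⟨
  count f + count g ∎
  where open ≤-Reasoning

count-split : ∀ {n} (f g : Fin n → Bool) →
  count f ≡ count (λ i → f i ∧ g i) + count (λ i → f i ∧ not (g i))
count-split {zero}  f g = refl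
count-split {suc n} f g = trans (cong₂ _+_ (⟦⟧-split (f zero) (g zero)) (count-split (f ∘ suc) (g ∘ suc)))
  (+-interchange ⟦ f zero ∧ g zero ⟧ _ _ _)

count-all : ∀ {n} {f : Fin n → Bool} → (∀ i → f i ≡ true) → count f ≡ n
count-all {zero}  h = refl
count-all {suc n} h = cong₂ _+_ (⟦⟧-true (h zero)) (count-all (h ∘ suc))

count-none : ∀ {n} {f : Fin n → Bool} → (∀ i → f i ≡ false) → count f ≡ 0
count-none {zero}  h = refl
count-none {suc n} h = cong₂ _+_ (⟦⟧-false (h zero)) (count-none (h ∘ suc))

count≤n : ∀ {n} (f : Fin n → Bool) → count f ≤ n
count≤n {n} f = ≤-trans (count-mono {n} {f} {λ _ → true} (λ _ _ → refl)) (≤-reflexive (count-all {n} (λ _ → refl)))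

count-≡ : ∀ {n} (i : Fin n) → count (λ j → i == j) ≡ 1
count-≡ i = trans (count≡sum (i ==_))
  (trans (sum-cong (λ j → sym (*-identityʳ ⟦ i == j ⟧))) (sum-delta i (λ _ → 1)))

count-≡ʳ : ∀ {n} (i : Fin n) → count (λ j → j == i) ≡ 1
count-≡ʳ i = trans (count-cong (λ j → ==-sym j i)) (count-≡ i)

findTrue : ∀ {n} (f : Fin n → Bool) → (∃ λ i → f i ≡ true) ⊎ (∀ i → f i ≡ false)
findTrue {zero}  f = inj₂ λ ()
findTrue {suc n} f with true⊎false (f zero) | findTrue (f ∘ suc)
... | inj₁ h | _            = inj₁ (zero , h)
... | inj₂ h | inj₁ (i , e) = inj₁ (suc i , e)
... | inj₂ h | inj₂ e       = inj₂ λ { zero → h ; (suc i) → e i }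

-- A Boolean existential quantifier, so that unions of sets can themselves be counted.
someF : ∀ {n} → (Fin n → Bool) → Bool
someF {zero}  f = false
someF {suc n} f = f zero ∨ someF (f ∘ suc)

someF-intro : ∀ {n} (f : Fin n → Bool) i → f i ≡ true → someF f ≡ true
someF-intro f zero    h = ∨-introˡ h
someF-intro f (suc i) h = ∨-introʳ {f zero} (someF-intro (f ∘ suc) i h)

someF-elim : ∀ {n} (f : Fin n → Bool) → someF f ≡ true → ∃ λ i → f i ≡ true
someF-elim {suc n} f h with ∨-elim {f zero} h
... | inj₁ e = zero , e
... | inj₂ e with someF-elim (f ∘ suc) e
...   | i , e′ = suc i , e′

someF-none : ∀ {n} (f : Fin n → Bool) i → someF f ≡ false → f i ≡ false
someF-none f i h = ≢true⇒false (λ e → true≢false (someF-intro f i e) h)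

not-false : ∀ {b} → not b ≡ false → b ≡ true
not-false {true} _ = refl

count-someF≤ : ∀ {m n} (f : Fin m → Fin n → Bool) →
  count (λ v → someF (λ i → f i v)) ≤ sumFin (λ i → count (f i))
count-someF≤ {zero} {n} f = ≤-reflexive (count-none {n} (λ _ → refl))
count-someF≤ {suc m} f = ≤-trans (count-∨≤ (f zero) _) (+-monoʳ-≤ (count (f zero)) (count-someF≤ (f ∘ suc)))

sum>const⇒term> : ∀ {n} (f : Fin n → ℕ) c → n * c < sumFin f → ∃ λ i → c < f i
sum>const⇒term> {n} f c h with findTrue (λ i → le (suc c) (f i))
... | inj₁ (i , e) = i , le⇒≤ e
... | inj₂ e = ⊥-elim (<⇒≱ h (sum-≤const c (λ i → s≤s⁻¹ (nle⇒> (e i)))))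

count>0⇒some : ∀ {n} (f : Fin n → Bool) → 0 < count f → ∃ λ i → f i ≡ true
count>0⇒some f h with findTrue f
... | inj₁ r = r
... | inj₂ e = ⊥-elim (<⇒≢ h (sym (count-none e)))

-- Union bound; greedy choices of vertices below take this form. A single forbidden set is passed
-- with `m = 1`.
count>⇒avoiding : ∀ {n m} (f : Fin n → Bool) (bad : Fin m → Fin n → Bool) →
  sumFin (λ j → count (bad j)) < count f → ∃ λ v → f v ≡ true × (∀ j → bad j v ≡ false)
count>⇒avoiding f bad h with findTrue (λ v → f v ∧ not (someF (λ j → bad j v)))
... | inj₁ (v , e) = v , ∧-elimˡ e , λ j → someF-none (λ j → bad j v) j (not-elim (∧-elimʳ {f v} e))
... | inj₂ e = ⊥-elim (<⇒≱ h (≤-trans (count-mono λ v fv →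
        ≢true⇒false→true (e v) fv) (count-someF≤ bad)))
  where
  ≢true⇒false→true : ∀ {a b} → a ∧ not b ≡ false → a ≡ true → b ≡ true
  ≢true⇒false→true h refl = not-false h

argmaxF : ∀ {n} (f : Fin (suc n) → ℕ) → ∃ λ i → ∀ j → f j ≤ f i
argmaxF {zero}  f = zero , λ { zero → ≤-refl }
argmaxF {suc n} f with argmaxF (f ∘ suc)
... | i , h with ≤-total (f zero) (f (suc i))
...   | inj₁ le₁ = suc i , λ { zero → le₁ ; (suc j) → h j }
...   | inj₂ ge₁ = zero , λ { zero → ≤-refl ; (suc j) → ≤-trans (h j) ge₁ }

-- Enumeration of a decidable subset

-- Turns a decidable set into the type `Fin (count f)`, so that injections and the pigeonhole
-- principle become available for sets.
record Enumeration {n} (f : Fin n → Bool) : Set where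
  field
    elem     : Fin (count f) → Fin n
    elem-inj : Injective _≡_ _≡_ elem
    elem-∈   : ∀ i → f (elem i) ≡ true
    rank     : ∀ v → f v ≡ true → Fin (count f)
    elem-rank : ∀ v h → elem (rank v h) ≡ v
open Enumeration

if-elem : ∀ {m n} b → (Fin m → Fin n) → Fin (⟦ b ⟧ + m) → Fin (suc n)
if-elem true  α zero    = zero
if-elem true  α (suc i) = suc (α i)
if-elem false α i       = suc (α i)

if-elem-inj : ∀ {m n} b (α : Fin m → Fin n) → Injective _≡_ _≡_ α → Injective _≡_ _≡_ (if-elem b α)
if-elem-inj true  α h {zero}  {zero}  e = refl
if-elem-inj true  α h {suc i} {suc j} e = cong suc (h (FP.suc-injective e))
if-elem-inj false α h e = h (FP.suc-injective e)

if-elem-zero : ∀ {m n} b (α : Fin m → Fin n) → b ≡ true → ∃ λ i → if-elem b α i ≡ zero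
if-elem-zero true α h = zero , refl

if-elem-suc : ∀ {m n} b (α : Fin m → Fin n) i → ∃ λ j → if-elem b α j ≡ suc (α i)
if-elem-suc true  α i = suc i , refl
if-elem-suc false α i = i , refl

if-elem-∈ : ∀ {m n} (f : Fin (suc n) → Bool) b (α : Fin m → Fin n) → f zero ≡ b →
  (∀ i → f (suc (α i)) ≡ true) → ∀ i → f (if-elem b α i) ≡ true
if-elem-∈ f true  α e h zero    = e
if-elem-∈ f true  α e h (suc i) = h i
if-elem-∈ f false α e h i       = h i

enumerate : ∀ {n} (f : Fin n → Bool) → Enumeration f
enumerate {zero} f = record
  { elem = λ () ; elem-inj = λ { {()} } ; elem-∈ = λ () ; rank = λ () ; elem-rank = λ () }
enumerate {suc n} f = record
  { elem      = if-elem (f zero) (elem E)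
  ; elem-inj  = if-elem-inj (f zero) (elem E) (elem-inj E)
  ; elem-∈    = if-elem-∈ f (f zero) (elem E) refl (elem-∈ E)
  ; rank      = λ v h → proj₁ (pos v h)
  ; elem-rank = λ v h → proj₂ (pos v h)
  }
  where
  E = enumerate (f ∘ suc)
  pos : ∀ v → f v ≡ true → ∃ λ i → if-elem (f zero) (elem E) i ≡ v
  pos zero    h = if-elem-zero (f zero) (elem E) h
  pos (suc v) h with if-elem-suc (f zero) (elem E) (rank E v h)
  ... | j , e = j , trans e (cong suc (elem-rank E v h))

count-inj : ∀ {m n} (f : Fin m → Bool) (g : Fin n → Bool) (φ : Fin m → Fin n) →
  (∀ u v → f u ≡ true → f v ≡ true → φ u ≡ φ v → u ≡ v) →
  (∀ v → f v ≡ true → g (φ v) ≡ true) → count f ≤ count g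
count-inj f g φ inj h = FP.injective⇒≤ {f = ψ} ψ-inj
  where
  E = enumerate f
  E′ = enumerate g
  ψ : Fin (count f) → Fin (count g)
  ψ i = rank E′ (φ (elem E i)) (h _ (elem-∈ E i))
  ψ-inj : Injective _≡_ _≡_ ψ
  ψ-inj {i} {j} e = elem-inj E (inj _ _ (elem-∈ E i) (elem-∈ E j)
    (trans (sym (elem-rank E′ _ _)) (trans (cong (elem E′) e) (elem-rank E′ _ _))))

count≥⇒injection : ∀ {n m} (f : Fin n → Bool) → m ≤ count f →
  Σ (Fin m → Fin n) λ φ → Injective _≡_ _≡_ φ × (∀ i → f (φ i) ≡ true)
count≥⇒injection f h = (λ i → elem E (inject≤ i h))
  , (λ e → FP.inject≤-injective h h _ _ (elem-inj E e))
  , (λ i → elem-∈ E (inject≤ i h))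
  where E = enumerate f

count-image≤ : ∀ {m n} (φ : Fin m → Fin n) → count (λ v → someF (λ i → φ i == v)) ≤ m
count-image≤ {m} φ = ≤-trans (count-someF≤ (λ i v → φ i == v))
  (≤-reflexive (trans (sum-cong (λ i → count-≡ (φ i))) (trans (sum-const m 1) (*-identityʳ m))))

subset-of-size : ∀ {n} (f : Fin n → Bool) h → h ≤ count f →
  Σ (Fin n → Bool) λ g → (∀ v → g v ≡ true → f v ≡ true) × count g ≡ h
subset-of-size {zero} f zero    le₁ = f , (λ v e → e) , refl
subset-of-size {suc n} f zero   le₁ = (λ _ → false) , (λ v ()) , count-none {suc n} (λ _ → refl)
subset-of-size {suc n} f (suc h) le₁ with true⊎false (f zero)
... | inj₁ e with subset-of-size (f ∘ suc) h (s≤s⁻¹ (≤-trans le₁ (≤-reflexive (cong (λ b → ⟦ b ⟧ + count (f ∘ suc)) e))))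
...   | g , g⊆f , cg = (λ { zero → true ; (suc v) → g v }) , (λ { zero _ → e ; (suc v) → g⊆f v }) , cong suc cg
subset-of-size {suc n} f (suc h) le₁ | inj₂ e with subset-of-size (f ∘ suc) (suc h) (≤-trans le₁ (≤-reflexive (cong (λ b → ⟦ b ⟧ + count (f ∘ suc)) e)))
...   | g , g⊆f , cg = (λ { zero → false ; (suc v) → g v }) , (λ { zero () ; (suc v) → g⊆f v }) , cg

count-not : ∀ {n} (f : Fin n → Bool) → count f + count (not ∘ f) ≡ n
count-not {n} f = trans (sym (count-split (λ _ → true) f)) (count-all {n} (λ _ → refl))

-- Obtained as the complement of a subset of size `n ∸ h` of the complement of `f`.
superset-of-size : ∀ {n} (f : Fin n → Bool) h → count f ≤ h → h ≤ n →
  Σ (Fin n → Bool) λ g → (∀ v → f v ≡ true → g v ≡ true) × count g ≡ h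
superset-of-size {n} f h f≤h h≤n with subset-of-size (not ∘ f) (n ∸ h) (begin
      n ∸ h                                ≤⟨ ∸-monoʳ-≤ n f≤h ⟩
      n ∸ count f                          ≡⟨ cong (_∸ count f) (count-not f) ⟨
      (count f + count (not ∘ f)) ∸ count f ≡⟨ m+n∸m≡n (count f) _ ⟩
      count (not ∘ f) ∎)
  where open ≤-Reasoning
... | g , g⊆ , cg = not ∘ g , (λ v fv → not-intro (≢true⇒false λ gv → true≢false fv (not-elim (g⊆ v gv))))
    , +-cancelˡ-≡ (count g) _ _ (trans (count-not g) (sym (trans (cong (_+ h) cg) (m∸n+n≡m h≤n))))

-- Maximisation over finite lists

-- The value may depend on the proof of `P`: for K_{1,a,...,a} a partition is valued by an inner
-- graph constructed from the proof that its parts are large. Two proofs of `P y` are not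
-- identified, so the maximum is compared with one proof that the search returns, not with all of
-- them.
argmaxL : ∀ {X : Set} {P : X → Set} (P? : ∀ x → Dec (P x)) (val : ∀ x → P x → ℕ) (xs : List X) →
  (∀ y → y ∈ xs → ¬ P y) ⊎
  (Σ X λ x → Σ (P x) λ px → ∀ y → y ∈ xs → P y → Σ (P y) λ py → val y py ≤ val x px)
argmaxL P? val [] = inj₁ λ y ()
argmaxL P? val (x ∷ xs) with P? x | argmaxL P? val xs
... | no ¬p | inj₁ none = inj₁ λ { y (here refl) → ¬p ; y (there m) → none y m }
... | no ¬p | inj₂ (z , pz , h) = inj₂ (z , pz , λ { y (here refl) p → ⊥-elim (¬p p) ; y (there m) → h y m })
... | yes p | inj₁ none = inj₂ (x , p , λ { y (here refl) _ → p , ≤-refl ; y (there m) py → ⊥-elim (none y m py) })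
... | yes p | inj₂ (z , pz , h) with ≤-total (val x p) (val z pz)
...   | inj₁ le₁ = inj₂ (z , pz , λ { y (here refl) _ → p , le₁ ; y (there m) → h y m })
...   | inj₂ ge₁ = inj₂ (x , p , λ { y (here refl) _ → p , ≤-refl
                                 ; y (there m) py → proj₁ (h y m py) , ≤-trans (proj₂ (h y m py)) ge₁ })

allVecs : ∀ m n → List (Vec (Fin m) n)
allVecs m zero    = [] ∷ []
allVecs m (suc n) = L.cartesianProductWith _∷_ (L.allFin m) (allVecs m n)

∈-allVecs : ∀ {m n} (v : Vec (Fin m) n) → v ∈ allVecs m n
∈-allVecs []      = here refl
∈-allVecs (x ∷ v) = MP.∈-cartesianProductWith⁺ _∷_ (MP.∈-allFin x) (∈-allVecs v)

-- Powers

-- Mean value estimate: on [0 , n] the slope of the power function is at most (1 + ρ) n ^ ρ.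
pow-+-≤ : ∀ ρ n y z → y + z ≤ n → (y + z) ^ suc ρ ≤ y ^ suc ρ + suc ρ * (n ^ ρ * z)
pow-+-≤ zero    n y z h = ≤-reflexive (eq y z)
  where
  eq : ∀ y z → (y + z) * 1 ≡ y * 1 + 1 * (1 * z)
  eq = solve-∀
pow-+-≤ (suc ρ) n y z h = begin
  (y + z) * (y + z) ^ suc ρ               ≤⟨ *-monoʳ-≤ (y + z) (pow-+-≤ ρ n y z h) ⟩
  (y + z) * (Y + suc ρ * (N * z))         ≡⟨ expand y z Y (suc ρ) N ⟩
  y * Y + (z * Y + (y + z) * (suc ρ * (N * z)))
    ≤⟨ +-monoʳ-≤ (y * Y) (+-mono-≤ (*-monoʳ-≤ z (^-monoˡ-≤ (suc ρ) (≤-trans (m≤m+n y z) h)))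
         (*-monoˡ-≤ (suc ρ * (N * z)) h)) ⟩
  y * Y + (z * (n * N) + n * (suc ρ * (N * z)))  ≡⟨ collect (y * Y) z n N ρ ⟩
  y * Y + suc (suc ρ) * (n * N * z)       ∎
  where
  open ≤-Reasoning
  Y = y ^ suc ρ
  N = n ^ ρ
  expand : ∀ y z Y r N → (y + z) * (Y + r * (N * z)) ≡ y * Y + (z * Y + (y + z) * (r * (N * z)))
  expand = solve-∀
  collect : ∀ A z n N ρ → A + (z * (n * N) + n * ((1 + ρ) * (N * z))) ≡ A + (2 + ρ) * (n * N * z)
  collect = solve-∀

-- By convexity the increment is at least that of the chord from 0, whose slope (y + z) ^ ρ depends
-- on the upper end only; this is the end for which a lower bound is known.
pow-+-≥ : ∀ ρ y z → y ^ suc ρ + z * (y + z) ^ ρ ≤ (y + z) ^ suc ρ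
pow-+-≥ ρ y z = begin
  y * y ^ ρ + z * (y + z) ^ ρ       ≤⟨ +-monoˡ-≤ (z * (y + z) ^ ρ) (*-monoʳ-≤ y (^-monoˡ-≤ ρ (m≤m+n y z))) ⟩
  y * (y + z) ^ ρ + z * (y + z) ^ ρ ≡⟨ *-distribʳ-+ ((y + z) ^ ρ) y z ⟨
  (y + z) * (y + z) ^ ρ             ∎
  where open ≤-Reasoning

pow-superadditive : ∀ ρ y z → y ^ suc ρ + z ^ suc ρ ≤ (y + z) ^ suc ρ
pow-superadditive ρ y z = ≤-trans
  (+-monoʳ-≤ (y ^ suc ρ) (*-monoʳ-≤ z (^-monoˡ-≤ ρ (m≤n+m z y)))) (pow-+-≥ ρ y z)

pow-* : ∀ a b ρ → (a * b) ^ ρ ≡ a ^ ρ * b ^ ρ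
pow-* a b zero    = refl
pow-* a b (suc ρ) = trans (cong (a * b *_) (pow-* a b ρ)) (swap a b (a ^ ρ) (b ^ ρ))
  where
  swap : ∀ a b A B → a * b * (A * B) ≡ a * A * (b * B)
  swap = solve-∀

pow>0 : ∀ a ρ → 0 < a → 0 < a ^ ρ
pow>0 a zero    h = s≤s z≤n
pow>0 a (suc ρ) h = *-mono-< h (pow>0 a ρ h)

*-cancelˡ : ∀ {a b c} → 0 < c → c * a ≤ c * b → a ≤ b
*-cancelˡ {a} {b} {suc c} h = *-cancelˡ-≤ (suc c)

monus-split : ∀ a b → (Σ ℕ λ z → a ≡ b + z × a ∸ b ≡ z × b ∸ a ≡ 0) ⊎ (Σ ℕ λ z → b ≡ a + z × b ∸ a ≡ z × a ∸ b ≡ 0)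
monus-split a b with ≤-total a b
... | inj₁ a≤b = inj₂ (b ∸ a , sym (m+[n∸m]≡n a≤b) , refl , m≤n⇒m∸n≡0 a≤b)
... | inj₂ b≤a = inj₁ (a ∸ b , sym (m+[n∸m]≡n b≤a) , refl , m≤n⇒m∸n≡0 b≤a)

-- The derivative of x ↦ x ^ (1 + ρ) varies by a factor at most (1 + ρ) C ^ ρ
-- on the interval [n / C , n].
power-sum-compare : ∀ {n N} ρ C (d τ : Fin N → ℕ) → 0 < C →
  (∀ v → d v ≤ n) → (∀ v → n ≤ C * τ v) →
  suc ρ * C ^ ρ * sumFin (λ v → d v ∸ τ v) ≤ sumFin (λ v → τ v ∸ d v) →
  sumFin (λ v → d v ^ suc ρ) ≤ sumFin (λ v → τ v ^ suc ρ)
power-sum-compare {n} ρ C d τ C>0 d≤n n≤τ h =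
  *-cancelˡ {c = C ^ ρ} (pow>0 C ρ C>0)
    (+-cancelʳ-≤ (n ^ ρ * sumFin lo) (C ^ ρ * sumFin dr) (C ^ ρ * sumFin τr) main)
  where
  open ≤-Reasoning
  lo up dr τr : Fin _ → ℕ
  lo v = τ v ∸ d v
  up v = d v ∸ τ v
  dr v = d v ^ suc ρ
  τr v = τ v ^ suc ρ
  K = suc ρ * C ^ ρ
  -- Multiplying by C ^ ρ clears the denominator of the least slope (n / C) ^ ρ. Gains and losses
  -- stand on opposite sides, so summing over v needs no pairing of gaining with losing vertices.
  point : ∀ a t → a ≤ n → n ≤ C * t →
    C ^ ρ * a ^ suc ρ + n ^ ρ * (t ∸ a) ≤ C ^ ρ * t ^ suc ρ + n ^ ρ * (K * (a ∸ t))
  point a t a≤n n≤t with monus-split a t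
  ... | inj₁ (z , refl , e₁ , e₂) rewrite e₁ | e₂ = begin
    C ^ ρ * (t + z) ^ suc ρ + n ^ ρ * 0   ≡⟨ trans (cong (C ^ ρ * (t + z) ^ suc ρ +_) (*-zeroʳ (n ^ ρ))) (+-identityʳ _) ⟩
    C ^ ρ * (t + z) ^ suc ρ               ≤⟨ *-monoʳ-≤ (C ^ ρ) (pow-+-≤ ρ n t z a≤n) ⟩
    C ^ ρ * (t ^ suc ρ + suc ρ * (n ^ ρ * z)) ≡⟨ eq (C ^ ρ) (t ^ suc ρ) (suc ρ) (n ^ ρ) z ⟩
    C ^ ρ * t ^ suc ρ + n ^ ρ * (K * z)   ∎
    where
    eq : ∀ c t r m z → c * (t + r * (m * z)) ≡ c * t + m * (r * c * z)
    eq = solve-∀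
  ... | inj₂ (z , refl , e₁ , e₂) rewrite e₁ | e₂ = begin
    C ^ ρ * a ^ suc ρ + n ^ ρ * z              ≤⟨ +-monoʳ-≤ (C ^ ρ * a ^ suc ρ) (*-monoˡ-≤ z (^-monoˡ-≤ ρ n≤t)) ⟩
    C ^ ρ * a ^ suc ρ + (C * (a + z)) ^ ρ * z  ≡⟨ cong (λ x → C ^ ρ * a ^ suc ρ + x * z) (pow-* C (a + z) ρ) ⟩
    C ^ ρ * a ^ suc ρ + C ^ ρ * (a + z) ^ ρ * z ≡⟨ eq (C ^ ρ) (a ^ suc ρ) ((a + z) ^ ρ) z ⟩
    C ^ ρ * (a ^ suc ρ + z * (a + z) ^ ρ)      ≤⟨ *-monoʳ-≤ (C ^ ρ) (pow-+-≥ ρ a z) ⟩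
    C ^ ρ * (a + z) ^ suc ρ                    ≤⟨ m≤m+n _ _ ⟩
    C ^ ρ * (a + z) ^ suc ρ + n ^ ρ * (K * 0)  ∎
    where
    eq : ∀ c A B z → c * A + c * B * z ≡ c * (A + z * B)
    eq = solve-∀
  main : C ^ ρ * sumFin dr + n ^ ρ * sumFin lo ≤ C ^ ρ * sumFin τr + n ^ ρ * sumFin lo
  main = begin
    C ^ ρ * sumFin dr + n ^ ρ * sumFin lo
      ≡⟨ cong₂ _+_ (sum-* (C ^ ρ) dr) (sum-* (n ^ ρ) lo) ⟨
    sumFin (λ v → C ^ ρ * dr v) + sumFin (λ v → n ^ ρ * lo v)
      ≡⟨ sum-+ (λ v → C ^ ρ * dr v) (λ v → n ^ ρ * lo v) ⟨
    sumFin (λ v → C ^ ρ * dr v + n ^ ρ * lo v)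
      ≤⟨ sum-mono (λ v → point (d v) (τ v) (d≤n v) (n≤τ v)) ⟩
    sumFin (λ v → C ^ ρ * τr v + n ^ ρ * (K * up v))
      ≡⟨ sum-+ (λ v → C ^ ρ * τr v) (λ v → n ^ ρ * (K * up v)) ⟩
    sumFin (λ v → C ^ ρ * τr v) + sumFin (λ v → n ^ ρ * (K * up v))
      ≡⟨ cong₂ _+_ (sum-* (C ^ ρ) τr) (trans (sum-* (n ^ ρ) (λ v → K * up v)) (cong (n ^ ρ *_) (sum-* K up))) ⟩
    C ^ ρ * sumFin τr + n ^ ρ * (K * sumFin up)
      ≤⟨ +-monoʳ-≤ (C ^ ρ * sumFin τr) (*-monoʳ-≤ (n ^ ρ) h) ⟩
    C ^ ρ * sumFin τr + n ^ ρ * sumFin lo ∎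

-- Only the excess of d over h can raise the sum, and it does so at no more than the largest slope.
power-sum-≤ : ∀ {n N} ρ (d h : Fin N → ℕ) → (∀ v → d v ≤ n) →
  sumFin (λ v → d v ^ suc ρ) ≤
  sumFin (λ v → h v ^ suc ρ) + suc ρ * (n ^ ρ * sumFin (λ v → d v ∸ h v))
power-sum-≤ {n} ρ d h d≤n = begin
  sumFin (λ v → d v ^ suc ρ)
    ≤⟨ sum-mono (λ v → point (d v) (h v) (d≤n v)) ⟩
  sumFin (λ v → h v ^ suc ρ + suc ρ * (n ^ ρ * (d v ∸ h v)))
    ≡⟨ sum-+ (λ v → h v ^ suc ρ) (λ v → suc ρ * (n ^ ρ * (d v ∸ h v))) ⟩
  sumFin (λ v → h v ^ suc ρ) + sumFin (λ v → suc ρ * (n ^ ρ * (d v ∸ h v)))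
    ≡⟨ cong (sumFin (λ v → h v ^ suc ρ) +_) (trans (sum-* (suc ρ) (λ v → n ^ ρ * (d v ∸ h v)))
         (cong (suc ρ *_) (sum-* (n ^ ρ) (λ v → d v ∸ h v)))) ⟩
  sumFin (λ v → h v ^ suc ρ) + suc ρ * (n ^ ρ * sumFin (λ v → d v ∸ h v)) ∎
  where
  open ≤-Reasoning
  point : ∀ a b → a ≤ n → a ^ suc ρ ≤ b ^ suc ρ + suc ρ * (n ^ ρ * (a ∸ b))
  point a b a≤n with monus-split a b
  ... | inj₁ (z , refl , e₁ , e₂) rewrite e₁ = pow-+-≤ ρ n b z a≤n
  ... | inj₂ (z , refl , e₁ , e₂) = ≤-trans (^-monoˡ-≤ (suc ρ) (m≤m+n a z)) (m≤m+n _ _)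

-- Near 0 the power function has no linear lower bound, so a deficit z is credited only with z ^ (1
-- + ρ), by superadditivity. The excesses, at slope at most (1 + ρ) n ^ ρ, have to pay for all these
-- credits.
power-sum-deficit : ∀ {n N} ρ (d h : Fin N → ℕ) → (∀ v → d v ≤ n) →
  sumFin (λ v → h v ^ suc ρ) ≤ sumFin (λ v → d v ^ suc ρ) →
  sumFin (λ v → (h v ∸ d v) ^ suc ρ) ≤ suc ρ * (n ^ ρ * sumFin (λ v → d v ∸ h v))
power-sum-deficit {n} ρ d h d≤n hyp = +-cancelˡ-≤ (sumFin (λ v → d v ^ suc ρ)) _ _ (begin
  sumFin (λ v → d v ^ suc ρ) + sumFin (λ v → (h v ∸ d v) ^ suc ρ)
    ≡⟨ sum-+ (λ v → d v ^ suc ρ) (λ v → (h v ∸ d v) ^ suc ρ) ⟨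
  sumFin (λ v → d v ^ suc ρ + (h v ∸ d v) ^ suc ρ)
    ≤⟨ sum-mono (λ v → point (d v) (h v) (d≤n v)) ⟩
  sumFin (λ v → h v ^ suc ρ + suc ρ * (n ^ ρ * (d v ∸ h v)))
    ≡⟨ sum-+ (λ v → h v ^ suc ρ) (λ v → suc ρ * (n ^ ρ * (d v ∸ h v))) ⟩
  sumFin (λ v → h v ^ suc ρ) + sumFin (λ v → suc ρ * (n ^ ρ * (d v ∸ h v)))
    ≤⟨ +-mono-≤ hyp (≤-reflexive (trans (sum-* (suc ρ) (λ v → n ^ ρ * (d v ∸ h v)))
         (cong (suc ρ *_) (sum-* (n ^ ρ) (λ v → d v ∸ h v))))) ⟩
  sumFin (λ v → d v ^ suc ρ) + suc ρ * (n ^ ρ * sumFin (λ v → d v ∸ h v)) ∎)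
  where
  open ≤-Reasoning
  point : ∀ a b → a ≤ n → a ^ suc ρ + (b ∸ a) ^ suc ρ ≤ b ^ suc ρ + suc ρ * (n ^ ρ * (a ∸ b))
  point a b a≤n with monus-split a b
  ... | inj₁ (z , refl , e₁ , e₂) rewrite e₁ | e₂ = ≤-trans (≤-reflexive (+-identityʳ _)) (pow-+-≤ ρ n b z a≤n)
  ... | inj₂ (z , refl , e₁ , e₂) rewrite e₁ | e₂ = ≤-trans (pow-superadditive ρ a z) (m≤m+n _ _)

-- Splits the sum of x v at n / g: small terms contribute at most n / g each,
-- large ones at most x v ^ (1 + ρ) (g / n) ^ ρ.
sum-by-powers : ∀ {n} ρ g (x : Fin n → ℕ) →
  g * n ^ ρ * sumFin x ≤ n * n ^ suc ρ + g ^ suc ρ * sumFin (λ v → x v ^ suc ρ)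
sum-by-powers {n} ρ g x = begin
  g * n ^ ρ * sumFin x                 ≡⟨ sum-* (g * n ^ ρ) x ⟨
  sumFin (λ v → g * n ^ ρ * x v)       ≤⟨ sum-mono (λ v → point (x v)) ⟩
  sumFin (λ v → n ^ suc ρ + g ^ suc ρ * x v ^ suc ρ)
    ≡⟨ sum-+ (λ _ → n ^ suc ρ) (λ v → g ^ suc ρ * x v ^ suc ρ) ⟩
  sumFin {n} (λ _ → n ^ suc ρ) + sumFin (λ v → g ^ suc ρ * x v ^ suc ρ)
    ≡⟨ cong₂ _+_ (sum-const n (n ^ suc ρ)) (sum-* (g ^ suc ρ) (λ v → x v ^ suc ρ)) ⟩
  n * n ^ suc ρ + g ^ suc ρ * sumFin (λ v → x v ^ suc ρ) ∎
  where
  open ≤-Reasoning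
  swap : ∀ g N y → g * N * y ≡ g * y * N
  swap = solve-∀
  point : ∀ y → g * n ^ ρ * y ≤ n ^ suc ρ + g ^ suc ρ * y ^ suc ρ
  point y with ≤-total (g * y) n
  ... | inj₁ small = ≤-trans (≤-reflexive (swap g (n ^ ρ) y))
                       (≤-trans (*-monoˡ-≤ (n ^ ρ) small) (m≤m+n _ _))
  ... | inj₂ large = begin
    g * n ^ ρ * y            ≡⟨ swap g (n ^ ρ) y ⟩
    g * y * n ^ ρ            ≤⟨ *-monoʳ-≤ (g * y) (^-monoˡ-≤ ρ large) ⟩
    (g * y) ^ suc ρ          ≡⟨ pow-* g y (suc ρ) ⟩
    g ^ suc ρ * y ^ suc ρ    ≤⟨ m≤n+m _ _ ⟩
    n ^ suc ρ + g ^ suc ρ * y ^ suc ρ ∎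

-- `power-sum-deficit` bounds the power sum of the deficits, and `sum-by-powers` turns this into a
-- bound for their plain sum. The parameter g is free: an excess of order n ^ 2 / g ^ (1 + ρ) forces
-- a deficit of order n ^ 2 / g.
deficit-small : ∀ {n} ρ g (d h : Fin n → ℕ) → 0 < n → (∀ v → d v ≤ n) →
  sumFin (λ v → h v ^ suc ρ) ≤ sumFin (λ v → d v ^ suc ρ) →
  g ^ suc ρ * suc ρ * sumFin (λ v → d v ∸ h v) ≤ n * n →
  g * sumFin (λ v → h v ∸ d v) ≤ 2 * (n * n)
deficit-small {n} ρ g d h n>0 d≤n hyp small = *-cancelˡ (pow>0 n ρ n>0) (begin
  n ^ ρ * (g * X)                           ≡⟨ swap (n ^ ρ) g X ⟩
  g * n ^ ρ * X                             ≤⟨ sum-by-powers ρ g (λ v → h v ∸ d v) ⟩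
  n * n ^ suc ρ + g ^ suc ρ * sumFin (λ v → (h v ∸ d v) ^ suc ρ)
    ≤⟨ +-monoʳ-≤ (n * n ^ suc ρ) (*-monoʳ-≤ (g ^ suc ρ) (power-sum-deficit ρ d h d≤n hyp)) ⟩
  n * n ^ suc ρ + g ^ suc ρ * (suc ρ * (n ^ ρ * Y)) ≡⟨ collect n (n ^ ρ) (g ^ suc ρ) (suc ρ) Y ⟩
  n ^ ρ * (n * n + g ^ suc ρ * suc ρ * Y)   ≤⟨ *-monoʳ-≤ (n ^ ρ) (+-monoʳ-≤ (n * n) small) ⟩
  n ^ ρ * (n * n + n * n)                   ≡⟨ double (n ^ ρ) (n * n) ⟩
  n ^ ρ * (2 * (n * n))                     ∎)
  where
  open ≤-Reasoning
  X = sumFin (λ v → h v ∸ d v)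
  Y = sumFin (λ v → d v ∸ h v)
  swap : ∀ a b c → a * (b * c) ≡ b * a * c
  swap = solve-∀
  collect : ∀ n N G r Y → n * (n * N) + G * (r * (N * Y)) ≡ N * (n * n + G * r * Y)
  collect = solve-∀
  double : ∀ a b → a * (b + b) ≡ a * (2 * b)
  double = solve-∀

-- Blow-ups in dense hypergraphs

sumT : ∀ {n} m → (Vec (Fin n) m → ℕ) → ℕ
sumT zero    f = f []
sumT (suc m) f = sumFin (λ x → sumT m (λ w → f (x ∷ w)))

sumT-cong : ∀ {n} m {f g : Vec (Fin n) m → ℕ} → (∀ w → f w ≡ g w) → sumT m f ≡ sumT m g
sumT-cong zero    h = h []
sumT-cong (suc m) h = sum-cong (λ x → sumT-cong m (λ w → h (x ∷ w)))

sumT-mono : ∀ {n} m {f g : Vec (Fin n) m → ℕ} → (∀ w → f w ≤ g w) → sumT m f ≤ sumT m g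
sumT-mono zero    h = h []
sumT-mono (suc m) h = sum-mono (λ x → sumT-mono m (λ w → h (x ∷ w)))

sumT-+ : ∀ {n} m (f g : Vec (Fin n) m → ℕ) → sumT m (λ w → f w + g w) ≡ sumT m f + sumT m g
sumT-+ zero    f g = refl
sumT-+ (suc m) f g = trans (sum-cong (λ x → sumT-+ m (λ w → f (x ∷ w)) (λ w → g (x ∷ w))))
  (sum-+ (λ x → sumT m (λ w → f (x ∷ w))) (λ x → sumT m (λ w → g (x ∷ w))))

sumT-* : ∀ {n} m c (f : Vec (Fin n) m → ℕ) → sumT m (λ w → c * f w) ≡ c * sumT m f
sumT-* zero    c f = refl
sumT-* (suc m) c f = trans (sum-cong (λ x → sumT-* m c (λ w → f (x ∷ w))))
  (sum-* c (λ x → sumT m (λ w → f (x ∷ w))))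

sumT-const : ∀ {n} m c → sumT {n} m (λ _ → c) ≡ n ^ m * c
sumT-const zero    c = sym (+-identityʳ c)
sumT-const {n} (suc m) c = trans (sum-cong {n} (λ _ → sumT-const m c))
  (trans (sum-const n (n ^ m * c)) (sym (*-assoc n (n ^ m) c)))

sumT-swap : ∀ {n k} m (f : Fin k → Vec (Fin n) m → ℕ) →
  sumFin (λ i → sumT m (f i)) ≡ sumT m (λ w → sumFin (λ i → f i w))
sumT-swap zero    f = refl
sumT-swap (suc m) f = trans (sum-swap (λ i x → sumT m (λ w → f i (x ∷ w))))
  (sum-cong (λ x → sumT-swap m (λ i w → f i (x ∷ w))))

2ab≤a²+b² : ∀ a b → 2 * (a * b) ≤ a * a + b * b
2ab≤a²+b² a b with monus-split a b
... | inj₁ (z , refl , _) = lin (z * z) (z≤n {0}) (eq b z)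
  where
  eq : ∀ b z → 2 * ((b + z) * b) + 0 + z * z ≡ (b + z) * (b + z) + b * b + 0
  eq = solve-∀
... | inj₂ (z , refl , _) = lin (z * z) (z≤n {0}) (eq a z)
  where
  eq : ∀ a z → 2 * (a * (a + z)) + 0 + z * z ≡ a * a + (a + z) * (a + z) + 0
  eq = solve-∀

-- One vertex is chosen by a second moment: the x-average of the weight of
-- the neighbourhood of x, weighted by D, is at least the average of D squared.
choose-one : ∀ {n} m q u (f : Fin n → Vec (Fin n) m → Bool) (g : Vec (Fin n) m → Bool)
  (U : Fin n → Bool) → count U ≤ u → 2 * (q * q) * u < n →
  n * n ^ m ≤ q * sumT m (λ w → ⟦ g w ⟧ * sumFin (λ x → ⟦ f x w ⟧)) →
  ∃ λ x → U x ≡ false ×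
    n * n ^ m ≤ 2 * (q * q) * sumT m (λ w → ⟦ g w ∧ f x w ⟧ * sumFin (λ y → ⟦ f y w ⟧))
choose-one {n} m q u f g U U≤u n-large dense =
  result (findTrue (λ x → not (U x) ∧ le (n * W) (2 * (q * q) * T x)))
  where
  open ≤-Reasoning
  W = n ^ m
  d D : Vec (Fin n) m → ℕ
  d w = sumFin (λ x → ⟦ f x w ⟧)
  D w = ⟦ g w ⟧ * d w
  S = sumT m D
  S₂ = sumT m (λ w → D w * D w)
  T : Fin n → ℕ
  T x = sumT m (λ w → ⟦ f x w ⟧ * D w)
  n>0 : 0 < n
  n>0 = ≤-<-trans z≤n n-large
  d≤n : ∀ w → d w ≤ n
  d≤n w = ≤-trans (sum-≤const 1 (λ x → ⟦⟧≤1 (f x w))) (≤-reflexive (*-identityʳ n))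
  ⟦⟧*≤ : ∀ b c → ⟦ b ⟧ * c ≤ c
  ⟦⟧*≤ b c = ≤-trans (*-monoˡ-≤ c (⟦⟧≤1 b)) (≤-reflexive (+-identityʳ c))
  T≤ : ∀ x → T x ≤ n * W
  T≤ x = begin
    T x                   ≤⟨ sumT-mono m (λ w → ≤-trans (⟦⟧*≤ (f x w) (D w)) (≤-trans (⟦⟧*≤ (g w) (d w)) (d≤n w))) ⟩
    sumT m (λ _ → n)      ≡⟨ sumT-const m n ⟩
    W * n                 ≡⟨ *-comm W n ⟩
    n * W                 ∎
  ΣT≥S₂ : S₂ ≤ sumFin T
  ΣT≥S₂ = begin
    S₂ ≤⟨ sumT-mono m (λ w → *-monoˡ-≤ (D w) (⟦⟧*≤ (g w) (d w))) ⟩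
    sumT m (λ w → d w * D w)
      ≡⟨ sumT-cong m (λ w → trans (*-comm (d w) (D w))
           (trans (sym (sum-* (D w) (λ x → ⟦ f x w ⟧))) (sum-cong (λ x → *-comm (D w) ⟦ f x w ⟧)))) ⟩
    sumT m (λ w → sumFin (λ x → ⟦ f x w ⟧ * D w)) ≡⟨ sumT-swap m (λ x w → ⟦ f x w ⟧ * D w) ⟨
    sumFin T ∎
  amgm : 2 * (q * n) * S ≤ q * q * S₂ + n * (n * W)
  amgm = begin
    2 * (q * n) * S ≡⟨ sumT-* m (2 * (q * n)) D ⟨
    sumT m (λ w → 2 * (q * n) * D w) ≤⟨ sumT-mono m (λ w → point (D w)) ⟩
    sumT m (λ w → q * q * (D w * D w) + n * n) ≡⟨ sumT-+ m (λ w → q * q * (D w * D w)) (λ _ → n * n) ⟩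
    sumT m (λ w → q * q * (D w * D w)) + sumT {n} m (λ _ → n * n)
      ≡⟨ cong₂ _+_ (sumT-* m (q * q) (λ w → D w * D w)) (trans (sumT-const m (n * n)) (trans (*-comm W (n * n)) (*-assoc n n W))) ⟩
    q * q * S₂ + n * (n * W) ∎
    where
    eq₁ : ∀ q n x → 2 * (q * n) * x ≡ 2 * ((q * x) * n)
    eq₁ = solve-∀
    eq₂ : ∀ q n x → (q * x) * (q * x) + n * n ≡ q * q * (x * x) + n * n
    eq₂ = solve-∀
    point : ∀ x → 2 * (q * n) * x ≤ q * q * (x * x) + n * n
    point x = begin
      2 * (q * n) * x               ≡⟨ eq₁ q n x ⟩
      2 * ((q * x) * n)             ≤⟨ 2ab≤a²+b² (q * x) n ⟩
      (q * x) * (q * x) + n * n     ≡⟨ eq₂ q n x ⟩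
      q * q * (x * x) + n * n       ∎
  -- Cauchy-Schwarz for `D` over all tuples: `amgm` combined with two copies of the density
  -- hypothesis, multiplied by n.
  second-moment : n * (n * W) ≤ q * q * S₂
  second-moment = lin 0 (+-mono-≤ amgm (+-mono-≤ nd nd)) (eq n W q S (q * q * S₂))
    where
    nd : n * (n * W) ≤ n * (q * S)
    nd = *-monoʳ-≤ n dense
    eq : ∀ n W q S B → n * (n * W) + (B + n * (n * W) + (n * (q * S) + n * (q * S))) + 0
                       ≡ B + (2 * (q * n) * S + (n * (n * W) + n * (n * W)))
    eq = solve-∀
  result : (∃ λ x → not (U x) ∧ le (n * W) (2 * (q * q) * T x) ≡ true) ⊎
           (∀ x → not (U x) ∧ le (n * W) (2 * (q * q) * T x) ≡ false) →
    ∃ λ x → U x ≡ false × n * W ≤ 2 * (q * q) * sumT m (λ w → ⟦ g w ∧ f x w ⟧ * d w)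
  result (inj₁ (x , h)) = x , not-elim (∧-elimˡ h) ,
    ≤-trans (le⇒≤ (∧-elimʳ {not (U x)} h)) (≤-reflexive (cong (2 * (q * q) *_)
      (sumT-cong m (λ w → sym (trans (cong (_* d w) (trans (⟦⟧-∧ (g w) (f x w)) (*-comm ⟦ g w ⟧ ⟦ f x w ⟧)))
        (*-assoc ⟦ f x w ⟧ ⟦ g w ⟧ (d w)))))))
  -- If no vertex outside `U` has enough weight, then apart from `U` the weights sum to at most half
  -- of what the second moment demands; the vertices of `U` cannot make up for it because n > 2 q ^
  -- 2 u.
  result (inj₂ none) = ⊥-elim (<⇒≱ n-large (*-cancelˡ (*-mono-< n>0 (pow>0 n m n>0)) bound))
    where
    c = 2 * (q * q)
    point : ∀ x → c * T x ≤ c * (n * W) * ⟦ U x ⟧ + n * W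
    point x with true⊎false (U x)
    ... | inj₁ e rewrite e = ≤-trans (*-monoʳ-≤ c (T≤ x))
            (≤-trans (≤-reflexive (sym (*-identityʳ (c * (n * W))))) (m≤m+n _ _))
    ... | inj₂ e = ≤-trans (<⇒≤ (nle⇒> (trans (cong (λ b → not b ∧ le (n * W) (c * T x)) (sym e)) (none x)))) (m≤n+m _ _)
    upper : c * sumFin T ≤ c * (n * W) * u + n * (n * W)
    upper = begin
      c * sumFin T                 ≡⟨ sum-* c T ⟨
      sumFin (λ x → c * T x)       ≤⟨ sum-mono point ⟩
      sumFin (λ x → c * (n * W) * ⟦ U x ⟧ + n * W) ≡⟨ sum-+ (λ x → c * (n * W) * ⟦ U x ⟧) (λ _ → n * W) ⟩
      sumFin (λ x → c * (n * W) * ⟦ U x ⟧) + sumFin {n} (λ _ → n * W)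
        ≡⟨ cong₂ _+_ (trans (sum-* (c * (n * W)) (λ x → ⟦ U x ⟧)) (cong (c * (n * W) *_) (sym (count≡sum U)))) (sum-const n (n * W)) ⟩
      c * (n * W) * count U + n * (n * W) ≤⟨ +-monoˡ-≤ (n * (n * W)) (*-monoʳ-≤ (c * (n * W)) U≤u) ⟩
      c * (n * W) * u + n * (n * W) ∎
    bound : n * W * n ≤ n * W * (2 * (q * q) * u)
    bound = lin 0 (+-mono-≤ upper (+-mono-≤ (*-monoʳ-≤ c ΣT≥S₂) (+-mono-≤ second-moment second-moment)))
      (eq n W (q * q) u (sumFin T) S₂)
      where
      eq : ∀ n W Q u T S → n * W * n + (2 * Q * (n * W) * u + n * (n * W) + (2 * Q * T + (Q * S + Q * S))) + 0
                           ≡ n * W * (2 * Q * u) + (2 * Q * T + (2 * Q * S + (n * (n * W) + n * (n * W))))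
      eq = solve-∀

-- Iterates `choose-one`. Each choice replaces q by 2 q ^ 2, cuts the weight `g` down to the link of
-- the chosen vertex, and adds that vertex to `U`, which makes the choices distinct. The factor
-- summing over x keeps the density hypothesis in the same form throughout and is estimated by n at
-- the end.
choose-many : ∀ m t u q → Σ ℕ λ q′ → Σ ℕ λ N → ∀ {n} → N ≤ n →
  (f : Fin n → Vec (Fin n) m → Bool) (g : Vec (Fin n) m → Bool) (U : Fin n → Bool) → count U ≤ u →
  n * n ^ m ≤ q * sumT m (λ w → ⟦ g w ⟧ * sumFin (λ x → ⟦ f x w ⟧)) →
  Σ (Fin t → Fin n) λ x → Injective _≡_ _≡_ x × (∀ i → U (x i) ≡ false) ×
  Σ (Vec (Fin n) m → Bool) λ h → (∀ w → h w ≡ true → g w ≡ true × (∀ i → f (x i) w ≡ true)) ×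
    n ^ m ≤ q′ * sumT m (λ w → ⟦ h w ⟧)
choose-many m zero u q = q , 1 , λ {n} n≥1 f g U _ dense →
  (λ ()) , (λ { {()} }) , (λ ()) , g , (λ w gw → gw , λ ()) , *-cancelˡ n≥1 (begin
    n * n ^ m ≤⟨ dense ⟩
    q * sumT m (λ w → ⟦ g w ⟧ * sumFin (λ x → ⟦ f x w ⟧))
      ≤⟨ *-monoʳ-≤ q (sumT-mono m λ w → ≤-trans (*-monoʳ-≤ ⟦ g w ⟧ (sum-≤const 1 (λ x → ⟦⟧≤1 (f x w))))
           (≤-reflexive (trans (cong (⟦ g w ⟧ *_) (*-identityʳ n)) (*-comm ⟦ g w ⟧ n)))) ⟩
    q * sumT m (λ w → n * ⟦ g w ⟧) ≡⟨ cong (q *_) (sumT-* m n (λ w → ⟦ g w ⟧)) ⟩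
    q * (n * sumT m (λ w → ⟦ g w ⟧)) ≡⟨ swap q n (sumT m (λ w → ⟦ g w ⟧)) ⟩
    n * (q * sumT m (λ w → ⟦ g w ⟧)) ∎)
  where
  open ≤-Reasoning
  swap : ∀ a b c → a * (b * c) ≡ b * (a * c)
  swap = solve-∀
choose-many m (suc t) u q with choose-many m t (suc u) (2 * (q * q))
... | q′ , N , rec = q′ , N + suc (2 * (q * q) * u) , extend
  where
  extend : ∀ {n} → N + suc (2 * (q * q) * u) ≤ n →
    (f : Fin n → Vec (Fin n) m → Bool) (g : Vec (Fin n) m → Bool) (U : Fin n → Bool) → count U ≤ u →
    n * n ^ m ≤ q * sumT m (λ w → ⟦ g w ⟧ * sumFin (λ x → ⟦ f x w ⟧)) →
    Σ (Fin (suc t) → Fin n) λ x → Injective _≡_ _≡_ x × (∀ i → U (x i) ≡ false) ×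
    Σ (Vec (Fin n) m → Bool) λ h → (∀ w → h w ≡ true → g w ≡ true × (∀ i → f (x i) w ≡ true)) ×
      n ^ m ≤ q′ * sumT m (λ w → ⟦ h w ⟧)
  extend {n} large f g U U≤u dense with choose-one m q u f g U U≤u (≤-trans (m≤n+m _ N) large) dense
  ... | x₀ , x₀∉U , dense′ with rec (≤-trans (m≤m+n N _) large) f (λ w → g w ∧ f x₀ w) (λ v → U v ∨ (v == x₀))
          (≤-trans (count-∨≤ U (_== x₀)) (≤-trans (+-mono-≤ U≤u (≤-reflexive (count-≡ʳ x₀))) (≤-reflexive (+-comm u 1)))) dense′
  ... | x , x-inj , x∉ , h , h⇒ , big = y , y-inj , y∉ , h , h⇒′ , big
    where
    y : Fin (suc t) → Fin n
    y zero    = x₀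
    y (suc i) = x i
    x≢x₀ : ∀ i → x i ≢ x₀
    x≢x₀ i e = true≢false (∨-introʳ {U (x i)} (≡⇒== e)) (x∉ i)
    y-inj : Injective _≡_ _≡_ y
    y-inj {zero}  {zero}  e = refl
    y-inj {zero}  {suc j} e = ⊥-elim (x≢x₀ j (sym e))
    y-inj {suc i} {zero}  e = ⊥-elim (x≢x₀ i e)
    y-inj {suc i} {suc j} e = cong suc (x-inj e)
    y∉ : ∀ i → U (y i) ≡ false
    y∉ zero    = x₀∉U
    y∉ (suc i) = ≢true⇒false (λ e → true≢false (∨-introˡ e) (x∉ i))
    h⇒′ : ∀ w → h w ≡ true → g w ≡ true × (∀ i → f (y i) w ≡ true)
    h⇒′ w hw = ∧-elimˡ (proj₁ (h⇒ w hw)) ,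
      λ { zero → ∧-elimʳ {g w} (proj₁ (h⇒ w hw)) ; (suc i) → proj₂ (h⇒ w hw) i }

-- Erdős' theorem on complete m-partite subhypergraphs: t first coordinates with a dense common link
-- are chosen, and the link, a hypergraph of one dimension less, is treated by induction.
dense⇒blowup : ∀ m t q → Σ ℕ λ N → ∀ {n} → N ≤ n → (f : Vec (Fin n) m → Bool) →
  n ^ m ≤ q * sumT m (λ w → ⟦ f w ⟧) →
  Σ (Fin m → Fin t → Fin n) λ X → (∀ i → Injective _≡_ _≡_ (X i)) ×
    (∀ (a : Fin m → Fin t) → f (tabulate (λ i → X i (a i))) ≡ true)
dense⇒blowup zero t q = 0 , λ _ f h → (λ ()) , (λ ()) , λ a →
  case true⊎false (f []) of λ
    { (inj₁ e) → e
    ; (inj₂ e) → ⊥-elim (<⇒≱ (s≤s (z≤n {0})) (≤-trans h (≤-reflexive (trans (cong (λ b → q * ⟦ b ⟧) e) (*-zeroʳ q))))) }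
dense⇒blowup (suc m) t q with choose-many m t 0 q
... | q′ , N₁ , choose with dense⇒blowup m t q′
... | N₂ , rec = N₁ + N₂ , extend
  where
  extend : ∀ {n} → N₁ + N₂ ≤ n → (f : Vec (Fin n) (suc m) → Bool) →
    n ^ suc m ≤ q * sumT (suc m) (λ w → ⟦ f w ⟧) →
    Σ (Fin (suc m) → Fin t → Fin n) λ X → (∀ i → Injective _≡_ _≡_ (X i)) ×
      (∀ (a : Fin (suc m) → Fin t) → f (tabulate (λ i → X i (a i))) ≡ true)
  extend {n} large f dense with choose (≤-trans (m≤m+n N₁ N₂) large) (λ x w → f (x ∷ w)) (λ _ → true) (λ _ → false)
      (≤-reflexive (count-none {n} (λ _ → refl)))
      (≤-trans dense (≤-reflexive (cong (q *_) (trans (sumT-swap m (λ x w → ⟦ f (x ∷ w) ⟧))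
        (sumT-cong m (λ w → sym (+-identityʳ _)))))))
  ... | x , x-inj , _ , h , h⇒ , dense′ with rec (≤-trans (m≤n+m N₂ N₁) large) h dense′
  ... | X , X-inj , X-h = X′ , (λ { zero → x-inj ; (suc i) → X-inj i }) ,
          λ a → proj₂ (h⇒ _ (X-h (a ∘ suc))) (a zero)
    where
    X′ : Fin (suc m) → Fin t → Fin n
    X′ zero    = x
    X′ (suc i) = X i

-- Disjointness of the blocks is implicit: vertices of different blocks are adjacent, hence
-- distinct.
Blowup : ∀ {n} → Graph n → ℕ → ℕ → Set
Blowup {n} G m t = Σ (Fin m → Fin t → Fin n) λ X → (∀ i → Injective _≡_ _≡_ (X i)) ×
  (∀ {i j} → i ≢ j → ∀ a b → adj G (X i a) (X j b) ≡ true)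

-- Ordered cliques. The set shrinks to the common neighbourhood, so that the cliques in `A` starting
-- at x are the smaller cliques in the neighbourhood of x in `A`, as the induction in `stability`
-- requires.
clique : ∀ {n m} → Graph n → (Fin n → Bool) → Vec (Fin n) m → Bool
clique G A []      = true
clique G A (x ∷ w) = A x ∧ clique G (λ v → A v ∧ adj G x v) w

cliques : ∀ {n} → Graph n → ℕ → (Fin n → Bool) → ℕ
cliques G m A = sumT m (λ w → ⟦ clique G A w ⟧)

clique-∈ : ∀ {n m} (G : Graph n) A (x : Fin m → Fin n) → clique G A (tabulate x) ≡ true → ∀ i → A (x i) ≡ true
clique-∈ G A x h zero    = ∧-elimˡ h
clique-∈ G A x h (suc i) = ∧-elimˡ (clique-∈ G _ (x ∘ suc) (∧-elimʳ {A (x zero)} h) i)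

clique-adj : ∀ {n m} (G : Graph n) A (x : Fin m → Fin n) → clique G A (tabulate x) ≡ true →
  ∀ i j → i ≢ j → adj G (x i) (x j) ≡ true
clique-adj G A x h zero    zero    ne = ⊥-elim (ne refl)
clique-adj G A x h zero    (suc j) ne = ∧-elimʳ {A (x (suc j))} (clique-∈ G _ (x ∘ suc) (∧-elimʳ {A (x zero)} h) j)
clique-adj G A x h (suc i) zero    ne = trans (adj-sym G (x (suc i)) (x zero)) (clique-adj G A x h zero (suc i) (λ ()))
clique-adj G A x h (suc i) (suc j) ne = clique-adj G _ (x ∘ suc) (∧-elimʳ {A (x zero)} h) i j (ne ∘ cong suc)

cliques⇒blowup : ∀ m t q → Σ ℕ λ N → ∀ {n} → N ≤ n → (G : Graph n) →
  n ^ m ≤ q * cliques G m (λ _ → true) → Blowup G m t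
cliques⇒blowup m t q with dense⇒blowup m t q
... | N , blow = N , λ {n} large G dense → convert G (blow large (clique G (λ _ → true)) dense)
  where
  convert : ∀ {n} (G : Graph n) →
    (Σ (Fin m → Fin t → Fin n) λ X → (∀ i → Injective _≡_ _≡_ (X i)) ×
      (∀ (a : Fin m → Fin t) → clique G (λ _ → true) (tabulate (λ i → X i (a i))) ≡ true)) → Blowup G m t
  convert {n} G (X , X-inj , X-clique) = X , X-inj , λ {i} {j} i≢j a b →
    subst₂ (λ u v → adj G u v ≡ true) (cong (X i) (α-i i a b)) (cong (X j) (α-j i j a b i≢j))
      (clique-adj G _ (λ l → X l (α i a b l)) (X-clique (α i a b)) i j i≢j)
    where
    -- Index a in block i and b in all other blocks: the resulting clique runs through both vertices
    -- whose adjacency is wanted.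
    α : Fin m → Fin t → Fin t → Fin m → Fin t
    α i a b l = if l == i then a else b
    α-i : ∀ i a b → α i a b i ≡ a
    α-i i a b rewrite ==-refl i = refl
    α-j : ∀ i j a b → i ≢ j → α i a b j ≡ b
    α-j i j a b ne rewrite ≢⇒==false (ne ∘ sym) = refl

-- Stability

degIn : ∀ {n} → Graph n → (Fin n → Bool) → Fin n → ℕ
degIn G A v = count (λ w → A w ∧ adj G v w)

crossIn : ∀ {n k} → (Fin n → Bool) → (Fin n → Fin k) → Fin n → ℕ
crossIn A p v = count (λ w → A w ∧ not (p v == p w))

innerIn : ∀ {n k} → Graph n → (Fin n → Bool) → (Fin n → Fin k) → Fin n → ℕ
innerIn G A p v = count (λ w → A w ∧ (adj G v w ∧ (p v == p w)))

excess deficit innerSum : ∀ {n k} → Graph n → (Fin n → Bool) → (Fin n → Fin k) → ℕ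
excess   G A p = sumFin (λ v → ⟦ A v ⟧ * (degIn G A v ∸ crossIn A p v))
deficit  G A p = sumFin (λ v → ⟦ A v ⟧ * (crossIn A p v ∸ degIn G A v))
innerSum G A p = sumFin (λ v → ⟦ A v ⟧ * innerIn G A p v)

-- The last clause links two unknown quantities: inner edges are bounded by the deficit up to ε, so
-- once optimality makes the deficit small there are few inner edges as well.
NearPartite : ∀ {n} → Graph n → (Fin n → Bool) → ℕ → ℕ → Set
NearPartite {n} G A k q = Σ (Fin n → Fin k) λ p → Σ ℕ λ ε →
  q * ε ≤ n * n × excess G A p ≤ ε × innerSum G A p ≤ deficit G A p + ε

degIn≤ : ∀ {n k} (G : Graph n) A (p : Fin n → Fin k) v → degIn G A v ≤ crossIn A p v + innerIn G A p v
degIn≤ G A p v = begin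
  degIn G A v ≡⟨ count-split (λ w → A w ∧ adj G v w) (λ w → p v == p w) ⟩
  count (λ w → (A w ∧ adj G v w) ∧ (p v == p w)) + count (λ w → (A w ∧ adj G v w) ∧ not (p v == p w))
    ≤⟨ +-mono-≤ (≤-reflexive (count-cong (λ w → BP.∧-assoc (A w) (adj G v w) (p v == p w))))
         (count-mono (λ w h → ∧-intro (∧-elimˡ {A w} (∧-elimˡ h)) (∧-elimʳ {A w ∧ adj G v w} h))) ⟩
  innerIn G A p v + crossIn A p v ≡⟨ +-comm _ (crossIn A p v) ⟩
  crossIn A p v + innerIn G A p v ∎
  where open ≤-Reasoning

excess≤innerSum : ∀ {n k} (G : Graph n) A (p : Fin n → Fin k) → excess G A p ≤ innerSum G A p
excess≤innerSum G A p = sum-mono (λ v → *-monoʳ-≤ ⟦ A v ⟧ (m≤n+o⇒m∸n≤o (degIn G A v) (crossIn A p v) (degIn≤ G A p v)))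

innerSum≤ : ∀ {n k} (G : Graph n) A (p : Fin n → Fin k) → innerSum G A p ≤ n * count A
innerSum≤ {n} G A p = begin
  innerSum G A p              ≤⟨ sum-mono (λ v → *-monoʳ-≤ ⟦ A v ⟧ (count≤n (λ w → A w ∧ (adj G v w ∧ (p v == p w))))) ⟩
  sumFin (λ v → ⟦ A v ⟧ * n)  ≡⟨ trans (sum-cong (λ v → *-comm ⟦ A v ⟧ n)) (sum-* n (λ v → ⟦ A v ⟧)) ⟩
  n * sumFin (λ v → ⟦ A v ⟧)  ≡⟨ cong (n *_) (count≡sum A) ⟨
  n * count A                 ∎
  where open ≤-Reasoning

argmaxOn : ∀ {n} (f : Fin n → Bool) (val : Fin n → ℕ) {x₀ : Fin n} → f x₀ ≡ true →
  ∃ λ x → f x ≡ true × (∀ y → f y ≡ true → val y ≤ val x)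
argmaxOn {suc n} f val {x₀} fx₀ = go (argmaxF w)
  where
  w : Fin (suc n) → ℕ
  w x = ⟦ f x ⟧ * suc (val x)
  go : (∃ λ x → ∀ y → w y ≤ w x) → ∃ λ x → f x ≡ true × (∀ y → f y ≡ true → val y ≤ val x)
  go (x , h) with true⊎false (f x)
  ... | inj₁ fx = x , fx , λ y fy → s≤s⁻¹ (≤-trans (≤-reflexive (sym (+-identityʳ _)))
      (≤-trans (≤-reflexive (cong (λ b → ⟦ b ⟧ * suc (val y)) (sym fy)))
        (≤-trans (h y) (≤-reflexive (trans (cong (λ b → ⟦ b ⟧ * suc (val x)) fx) (+-identityʳ _))))))
  ... | inj₂ fx = ⊥-elim (<⇒≱ (s≤s (z≤n {val x₀ + 0}))
      (≤-trans (≤-reflexive (cong (λ b → ⟦ b ⟧ * suc (val x₀)) (sym fx₀)))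
        (≤-trans (h x₀) (≤-reflexive (cong (λ b → ⟦ b ⟧ * suc (val x)) fx)))))

-- Over the integers h - d = (a - b) + m. Truncating a - b adds b ∸ a, which is the price on the
-- right.
deficit-shift : ∀ {a b c h d m} → h ≡ a + c → d + m ≡ b + c → (a ∸ b) + m ≤ (h ∸ d) + (b ∸ a)
deficit-shift {a} {b} {c} {h} {d} {m} refl e with monus-split a b
... | inj₁ (z , refl , e₁ , e₂) rewrite e₁ | e₂ = ≤-trans (≤-reflexive (sym (trans (cong (_∸ d) eq) (m+n∸m≡n d (z + m))))) (m≤m+n _ 0)
  where
  swap : ∀ b z c → b + z + c ≡ b + c + z
  swap = solve-∀
  swap′ : ∀ d m z → d + m + z ≡ d + (z + m)
  swap′ = solve-∀
  eq : b + z + c ≡ d + (z + m)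
  eq = trans (swap b z c) (trans (cong (_+ z) (sym e)) (swap′ d m z))
... | inj₂ (z , refl , e₁ , e₂) rewrite e₁ | e₂ = +-cancelˡ-≤ d m _ (begin
    d + m                     ≡⟨ e ⟩
    a + z + c                 ≡⟨ swap a z c ⟩
    (a + c) + z               ≤⟨ +-monoˡ-≤ z (m≤n+m∸n (a + c) d) ⟩
    d + (a + c ∸ d) + z       ≡⟨ +-assoc d _ z ⟩
    d + ((a + c ∸ d) + z)     ∎)
  where
  open ≤-Reasoning
  swap : ∀ a z c → a + z + c ≡ (a + c) + z
  swap = solve-∀

∸-cancel-≤ : ∀ a b {c d} → c ≤ d → (a + c) ∸ (d + b) ≤ a ∸ b
∸-cancel-≤ a b {c} {d} c≤d = ≤-trans (∸-monoˡ-≤ (d + b) (+-monoʳ-≤ a c≤d))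
  (≤-reflexive (trans (cong (_∸ (d + b)) (+-comm a d)) ([m+n]∸[m+o]≡n∸o d a b)))

-- One step of Erdős' degree majorisation: x has (almost) maximal degree in A,
-- its neighbourhood A₂ carries the partition p₂, and A ∖ A₂ is a new part.
module MajorisationStep {n : ℕ} {k : ℕ} (G : Graph n) (A : Fin n → Bool) (bad : Fin n → Bool) (x : Fin n)
  (x-max : ∀ y → A y ≡ true → bad y ≡ false → degIn G A y ≤ degIn G A x) (p₂ : Fin n → Fin k) where

  open ≤-Reasoning

  A₂ : Fin n → Bool
  A₂ w = A w ∧ adj G x w

  p : Fin n → Fin (suc k)
  p v = if A₂ v then suc (p₂ v) else zero

  first : Fin n → Bool
  first w = A w ∧ not (A₂ w)

  nbr₁ non₁ non₂ : Fin n → ℕ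
  nbr₁ v = count (λ w → first w ∧ adj G v w)
  non₁ v = count (λ w → first w ∧ not (adj G v w))
  non₂ v = count (λ w → A₂ w ∧ not (adj G v w))

  first-count : ∀ v → count first ≡ nbr₁ v + non₁ v
  first-count v = count-split first (adj G v)

  A₂-count : ∀ v → count A₂ ≡ degIn G A₂ v + non₂ v
  A₂-count v = count-split A₂ (adj G v)

  ∧-absorb : ∀ a b c → (a ∧ c) ∧ (a ∧ b) ≡ (a ∧ b) ∧ c
  ∧-absorb true  b c = BP.∧-comm c b
  ∧-absorb false b c = refl

  ∧-rotate : ∀ a b c → (a ∧ c) ∧ not (a ∧ b) ≡ (a ∧ not (a ∧ b)) ∧ c
  ∧-rotate true  b c = BP.∧-comm c (not b)
  ∧-rotate false b c = refl

  split₂ : ∀ (f : Fin n → Bool) → count (λ w → A w ∧ f w) ≡ count (λ w → A₂ w ∧ f w) + count (λ w → first w ∧ f w)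
  split₂ f = trans (count-split (λ w → A w ∧ f w) A₂)
    (cong₂ _+_ (count-cong (λ w → ∧-absorb (A w) (adj G x w) (f w))) (count-cong (λ w → ∧-rotate (A w) (adj G x w) (f w))))

  deg-split : ∀ v → degIn G A v ≡ degIn G A₂ v + nbr₁ v
  deg-split v = split₂ (adj G v)

  p-in : ∀ {v} → A₂ v ≡ true → p v ≡ suc (p₂ v)
  p-in e rewrite e = refl

  p-out : ∀ {v} → A₂ v ≡ false → p v ≡ zero
  p-out e rewrite e = refl

  first⇒¬A₂ : ∀ w → first w ≡ true → A₂ w ≡ false
  first⇒¬A₂ w h = not-elim (∧-elimʳ {A w} h)

  count-on : ∀ (S f g : Fin n → Bool) → (∀ w → S w ≡ true → f w ≡ g w) →
    count (λ w → S w ∧ f w) ≡ count (λ w → S w ∧ g w)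
  count-on S f g h = count-cong (λ w → lemma w (true⊎false (S w)))
    where
    lemma : ∀ w → (S w ≡ true) ⊎ (S w ≡ false) → S w ∧ f w ≡ S w ∧ g w
    lemma w (inj₁ e) = cong (S w ∧_) (h w e)
    lemma w (inj₂ e) rewrite e = refl

  count-on-true : ∀ (S f : Fin n → Bool) → (∀ w → S w ≡ true → f w ≡ true) → count (λ w → S w ∧ f w) ≡ count S
  count-on-true S f h = count-cong (λ w → ⇔⇒≡ ∧-elimˡ (λ e → ∧-intro e (h w e)))

  count-on-false : ∀ (S f : Fin n → Bool) → (∀ w → S w ≡ true → f w ≡ false) → count (λ w → S w ∧ f w) ≡ 0
  count-on-false S f h = count-none (λ w → ≢true⇒false (λ e → true≢false (∧-elimʳ {S w} e) (h w (∧-elimˡ e))))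

  cross-in : ∀ v → A₂ v ≡ true → crossIn A p v ≡ crossIn A₂ p₂ v + count first
  cross-in v e = trans (split₂ (λ w → not (p v == p w))) (cong₂ _+_
    (count-on A₂ _ _ (λ w e′ → cong not (trans (cong₂ _==_ (p-in e) (p-in e′)) (suc-== (p₂ v) (p₂ w)))))
    (count-on-true first _ (λ w e′ → cong not (cong₂ _==_ (p-in e) (p-out (first⇒¬A₂ w e′))))))

  cross-out : ∀ v → A₂ v ≡ false → crossIn A p v ≡ count A₂
  cross-out v e = trans (split₂ (λ w → not (p v == p w))) (trans (cong₂ _+_
    (count-on-true A₂ _ (λ w e′ → cong not (cong₂ _==_ (p-out e) (p-in e′))))
    (count-on-false first _ (λ w e′ → cong not (cong₂ _==_ (p-out e) (p-out (first⇒¬A₂ w e′)))))) (+-identityʳ _))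

  inner-in : ∀ v → A₂ v ≡ true → innerIn G A p v ≡ innerIn G A₂ p₂ v
  inner-in v e = trans (split₂ (λ w → adj G v w ∧ (p v == p w))) (trans (cong₂ _+_
    (count-on A₂ _ _ (λ w e′ → cong (adj G v w ∧_) (trans (cong₂ _==_ (p-in e) (p-in e′)) (suc-== (p₂ v) (p₂ w)))))
    (count-on-false first _ (λ w e′ → trans (cong (adj G v w ∧_) (cong₂ _==_ (p-in e) (p-out (first⇒¬A₂ w e′))))
      (BP.∧-zeroʳ (adj G v w))))) (+-identityʳ _))

  inner-out : ∀ v → A₂ v ≡ false → innerIn G A p v ≡ nbr₁ v
  inner-out v e = trans (split₂ (λ w → adj G v w ∧ (p v == p w))) (cong₂ _+_
    (count-on-false A₂ _ (λ w e′ → trans (cong (adj G v w ∧_) (cong₂ _==_ (p-out e) (p-in e′)))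
      (BP.∧-zeroʳ (adj G v w))))
    (count-on first _ _ (λ w e′ → trans (cong (adj G v w ∧_) (cong₂ _==_ (p-out e) (p-out (first⇒¬A₂ w e′))))
      (BP.∧-identityʳ (adj G v w)))))

  -- The degree of x in `A` is the size of `A₂`. By maximality v has no larger degree, so its
  -- neighbours outside `A₂` cannot outnumber the vertices of `A₂` that it misses.
  nbr₁≤non₂ : ∀ v → A v ≡ true → bad v ≡ false → nbr₁ v ≤ non₂ v
  nbr₁≤non₂ v Av gv = +-cancelˡ-≤ (degIn G A₂ v) _ _ (begin
    degIn G A₂ v + nbr₁ v ≡⟨ deg-split v ⟨
    degIn G A v           ≤⟨ x-max v Av gv ⟩
    count A₂              ≡⟨ A₂-count v ⟩
    degIn G A₂ v + non₂ v ∎)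

  -- Double counting of the missing pairs between the new part and `A₂`. It moves the charge for
  -- inner edges of the new part to the deficits of vertices in `A₂`.
  non-swap : sumFin (λ v → ⟦ first v ⟧ * non₂ v) ≡ sumFin (λ v → ⟦ A₂ v ⟧ * non₁ v)
  non-swap = begin-equality
    sumFin (λ v → ⟦ first v ⟧ * non₂ v) ≡⟨ sum-cong (λ v → expand first A₂ v) ⟩
    sumFin (λ v → sumFin (λ w → ⟦ first v ⟧ * ⟦ A₂ w ∧ not (adj G v w) ⟧))
      ≡⟨ sum-swap (λ v w → ⟦ first v ⟧ * ⟦ A₂ w ∧ not (adj G v w) ⟧) ⟩
    sumFin (λ w → sumFin (λ v → ⟦ first v ⟧ * ⟦ A₂ w ∧ not (adj G v w) ⟧))
      ≡⟨ sum-cong (λ w → sum-cong (λ v → entry v w)) ⟩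
    sumFin (λ w → sumFin (λ v → ⟦ A₂ w ⟧ * ⟦ first v ∧ not (adj G w v) ⟧))
      ≡⟨ sum-cong (λ v → expand A₂ first v) ⟨
    sumFin (λ v → ⟦ A₂ v ⟧ * non₁ v) ∎
    where
    expand : ∀ (S T : Fin n → Bool) v → ⟦ S v ⟧ * count (λ w → T w ∧ not (adj G v w)) ≡
      sumFin (λ w → ⟦ S v ⟧ * ⟦ T w ∧ not (adj G v w) ⟧)
    expand S T v = trans (cong (⟦ S v ⟧ *_) (count≡sum (λ w → T w ∧ not (adj G v w))))
      (sym (sum-* ⟦ S v ⟧ (λ w → ⟦ T w ∧ not (adj G v w) ⟧)))
    swap : ∀ a b c → a * (b * c) ≡ b * (a * c)
    swap = solve-∀
    entry : ∀ v w → ⟦ first v ⟧ * ⟦ A₂ w ∧ not (adj G v w) ⟧ ≡ ⟦ A₂ w ⟧ * ⟦ first v ∧ not (adj G w v) ⟧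
    entry v w rewrite ⟦⟧-∧ (A₂ w) (not (adj G v w)) | ⟦⟧-∧ (first v) (not (adj G w v)) | adj-sym G w v =
      swap ⟦ first v ⟧ ⟦ A₂ w ⟧ ⟦ not (adj G v w) ⟧

  ⟦bad⟧-bound : ∀ {v m} → bad v ≡ true → m ≤ n → m ≤ ⟦ bad v ⟧ * n
  ⟦bad⟧-bound {v} e h rewrite e = ≤-trans h (m≤m+n n 0)

  bad-sum : sumFin (λ v → ⟦ bad v ⟧ * n) ≡ n * count bad
  bad-sum = trans (sum-cong (λ v → *-comm ⟦ bad v ⟧ n)) (trans (sum-* n (λ v → ⟦ bad v ⟧)) (cong (n *_) (sym (count≡sum bad))))

  data Position (v : Fin n) : Set where
    outside : A v ≡ false → Position v
    second  : A v ≡ true → A₂ v ≡ true → first v ≡ false → Position v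
    initial : A v ≡ true → A₂ v ≡ false → first v ≡ true → Position v

  position : ∀ v → Position v
  position v with true⊎false (A v) | true⊎false (A₂ v)
  ... | inj₂ e | _       = outside e
  ... | inj₁ e | inj₁ e₂ = second e e₂ (≢true⇒false λ h → true≢false e₂ (first⇒¬A₂ v h))
  ... | inj₁ e | inj₂ e₂ = initial e e₂ (∧-intro e (not-intro e₂))

  -- A vertex of `A₂` gains at most the size of the new part in degree and exactly this size in
  -- cross degree. A vertex of the new part has cross degree equal to the degree of x, so it has no
  -- excess unless it is bad.
  excess-step : excess G A p ≤ excess G A₂ p₂ + n * count bad
  excess-step = begin
    excess G A p ≤⟨ sum-mono point ⟩
    sumFin (λ v → ⟦ A₂ v ⟧ * (degIn G A₂ v ∸ crossIn A₂ p₂ v) + ⟦ bad v ⟧ * n)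
      ≡⟨ sum-+ (λ v → ⟦ A₂ v ⟧ * (degIn G A₂ v ∸ crossIn A₂ p₂ v)) (λ v → ⟦ bad v ⟧ * n) ⟩
    excess G A₂ p₂ + sumFin (λ v → ⟦ bad v ⟧ * n) ≡⟨ cong (excess G A₂ p₂ +_) bad-sum ⟩
    excess G A₂ p₂ + n * count bad ∎
    where
    point : ∀ v → ⟦ A v ⟧ * (degIn G A v ∸ crossIn A p v) ≤
      ⟦ A₂ v ⟧ * (degIn G A₂ v ∸ crossIn A₂ p₂ v) + ⟦ bad v ⟧ * n
    point v with position v
    ... | outside e = ≤-trans (≤-reflexive (cong (λ b → ⟦ b ⟧ * (degIn G A v ∸ crossIn A p v)) e)) z≤n
    ... | second e e₂ _ = begin
      ⟦ A v ⟧ * (degIn G A v ∸ crossIn A p v)   ≡⟨ cong (λ b → ⟦ b ⟧ * (degIn G A v ∸ crossIn A p v)) e ⟩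
      1 * (degIn G A v ∸ crossIn A p v)
        ≡⟨ cong (1 *_) (cong₂ _∸_ (deg-split v) (trans (cross-in v e₂) (+-comm _ (count first)))) ⟩
      1 * ((degIn G A₂ v + nbr₁ v) ∸ (count first + crossIn A₂ p₂ v))
        ≤⟨ *-monoʳ-≤ 1 (∸-cancel-≤ (degIn G A₂ v) (crossIn A₂ p₂ v) (≤-trans (m≤m+n (nbr₁ v) _) (≤-reflexive (sym (first-count v))))) ⟩
      1 * (degIn G A₂ v ∸ crossIn A₂ p₂ v)      ≡⟨ cong (λ b → ⟦ b ⟧ * (degIn G A₂ v ∸ crossIn A₂ p₂ v)) e₂ ⟨
      ⟦ A₂ v ⟧ * (degIn G A₂ v ∸ crossIn A₂ p₂ v) ≤⟨ m≤m+n _ _ ⟩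
      _ ∎
    ... | initial e e₂ _ with true⊎false (bad v)
    ...   | inj₁ b = ≤-trans (⟦bad⟧-bound {v} b (≤-trans (≤-reflexive (cong (λ b → ⟦ b ⟧ * (degIn G A v ∸ crossIn A p v)) e))
                       (≤-trans (≤-reflexive (+-identityʳ _)) (≤-trans (m∸n≤m _ (crossIn A p v)) (count≤n _))))) (m≤n+m _ _)
    ...   | inj₂ g = ≤-trans (≤-reflexive (trans (cong (⟦ A v ⟧ *_) (m≤n⇒m∸n≡0 (≤-trans (x-max v e g) (≤-reflexive (sym (cross-out v e₂))))))
                       (*-zeroʳ ⟦ A v ⟧))) z≤n

  inner-step : innerSum G A p ≤ innerSum G A₂ p₂ + sumFin (λ v → ⟦ A₂ v ⟧ * non₁ v) + n * count bad
  inner-step = begin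
    innerSum G A p ≤⟨ sum-mono point ⟩
    sumFin (λ v → ⟦ A₂ v ⟧ * innerIn G A₂ p₂ v + ⟦ first v ⟧ * non₂ v + ⟦ bad v ⟧ * n)
      ≡⟨ sum-+ (λ v → ⟦ A₂ v ⟧ * innerIn G A₂ p₂ v + ⟦ first v ⟧ * non₂ v) (λ v → ⟦ bad v ⟧ * n) ⟩
    sumFin (λ v → ⟦ A₂ v ⟧ * innerIn G A₂ p₂ v + ⟦ first v ⟧ * non₂ v) + sumFin (λ v → ⟦ bad v ⟧ * n)
      ≡⟨ cong₂ _+_ (trans (sum-+ (λ v → ⟦ A₂ v ⟧ * innerIn G A₂ p₂ v) (λ v → ⟦ first v ⟧ * non₂ v))
           (cong (innerSum G A₂ p₂ +_) non-swap)) bad-sum ⟩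
    innerSum G A₂ p₂ + sumFin (λ v → ⟦ A₂ v ⟧ * non₁ v) + n * count bad ∎
    where
    point : ∀ v → ⟦ A v ⟧ * innerIn G A p v ≤ ⟦ A₂ v ⟧ * innerIn G A₂ p₂ v + ⟦ first v ⟧ * non₂ v + ⟦ bad v ⟧ * n
    point v with position v
    ... | outside e = ≤-trans (≤-reflexive (cong (λ b → ⟦ b ⟧ * innerIn G A p v) e)) z≤n
    ... | second e e₂ _ = ≤-trans (≤-reflexive (trans (cong₂ (λ b c → ⟦ b ⟧ * c) e (inner-in v e₂))
                            (cong (λ b → ⟦ b ⟧ * innerIn G A₂ p₂ v) (sym e₂)))) (≤-trans (m≤m+n _ _) (m≤m+n _ _))
    ... | initial e e₂ f with true⊎false (bad v)
    ...   | inj₁ b = ≤-trans (⟦bad⟧-bound {v} b (≤-trans (≤-reflexive (cong (λ b → ⟦ b ⟧ * innerIn G A p v) e))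
                       (≤-trans (≤-reflexive (+-identityʳ _)) (count≤n _)))) (m≤n+m _ _)
    ...   | inj₂ g = ≤-trans (≤-reflexive (trans (cong (λ b → ⟦ b ⟧ * innerIn G A p v) e) (+-identityʳ _)))
        (≤-trans (≤-reflexive (inner-out v e₂)) (≤-trans (nbr₁≤non₂ v e g)
          (≤-trans (≤-reflexive (sym (trans (cong (λ b → ⟦ b ⟧ * non₂ v) f) (+-identityʳ _))))
            (≤-trans (m≤n+m (⟦ first v ⟧ * non₂ v) (⟦ A₂ v ⟧ * innerIn G A₂ p₂ v)) (m≤m+n _ _)))))

  -- On `A₂` the cross degree grows by the whole new part, the degree only by the neighbours there;
  -- the signed deficit thus grows by `non₁`, and the excess pays for the truncation.
  deficit-step : deficit G A₂ p₂ + sumFin (λ v → ⟦ A₂ v ⟧ * non₁ v) ≤ deficit G A p + excess G A₂ p₂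
  deficit-step = begin
    deficit G A₂ p₂ + sumFin (λ v → ⟦ A₂ v ⟧ * non₁ v)
      ≡⟨ sum-+ (λ v → ⟦ A₂ v ⟧ * (crossIn A₂ p₂ v ∸ degIn G A₂ v)) (λ v → ⟦ A₂ v ⟧ * non₁ v) ⟨
    sumFin (λ v → ⟦ A₂ v ⟧ * (crossIn A₂ p₂ v ∸ degIn G A₂ v) + ⟦ A₂ v ⟧ * non₁ v) ≤⟨ sum-mono point ⟩
    sumFin (λ v → ⟦ A v ⟧ * (crossIn A p v ∸ degIn G A v) + ⟦ A₂ v ⟧ * (degIn G A₂ v ∸ crossIn A₂ p₂ v))
      ≡⟨ sum-+ (λ v → ⟦ A v ⟧ * (crossIn A p v ∸ degIn G A v)) (λ v → ⟦ A₂ v ⟧ * (degIn G A₂ v ∸ crossIn A₂ p₂ v)) ⟩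
    deficit G A p + excess G A₂ p₂ ∎
    where
    shift : ∀ v → A₂ v ≡ true → (crossIn A₂ p₂ v ∸ degIn G A₂ v) + non₁ v ≤
      (crossIn A p v ∸ degIn G A v) + (degIn G A₂ v ∸ crossIn A₂ p₂ v)
    shift v e₂ = deficit-shift {c = count first} {d = degIn G A v} (cross-in v e₂)
      (trans (cong (_+ non₁ v) (deg-split v)) (trans (+-assoc (degIn G A₂ v) _ _) (cong (degIn G A₂ v +_) (sym (first-count v)))))
    point : ∀ v → ⟦ A₂ v ⟧ * (crossIn A₂ p₂ v ∸ degIn G A₂ v) + ⟦ A₂ v ⟧ * non₁ v ≤
      ⟦ A v ⟧ * (crossIn A p v ∸ degIn G A v) + ⟦ A₂ v ⟧ * (degIn G A₂ v ∸ crossIn A₂ p₂ v)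
    point v with true⊎false (A₂ v)
    ... | inj₂ e rewrite e = z≤n
    ... | inj₁ e = begin
      ⟦ A₂ v ⟧ * (crossIn A₂ p₂ v ∸ degIn G A₂ v) + ⟦ A₂ v ⟧ * non₁ v ≡⟨ cong₂ _+_ (one _ e) (one _ e) ⟩
      (crossIn A₂ p₂ v ∸ degIn G A₂ v) + non₁ v ≤⟨ shift v e ⟩
      (crossIn A p v ∸ degIn G A v) + (degIn G A₂ v ∸ crossIn A₂ p₂ v) ≡⟨ cong₂ _+_ (one _ (∧-elimˡ {A v} e)) (one _ e) ⟨
      _ ∎
      where
      one : ∀ {b} c → b ≡ true → ⟦ b ⟧ * c ≡ c
      one c refl = +-identityʳ c

  inner-≤-deficit : ∀ {ε} → excess G A₂ p₂ ≤ ε → innerSum G A₂ p₂ ≤ deficit G A₂ p₂ + ε →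
    innerSum G A p ≤ deficit G A p + (2 * ε + n * count bad)
  inner-≤-deficit {ε} Y≤ I≤ = lin 0 (+-mono-≤ inner-step (+-mono-≤ I≤ (+-mono-≤ deficit-step Y≤)))
    (eq (innerSum G A p) (innerSum G A₂ p₂) (sumFin (λ v → ⟦ A₂ v ⟧ * non₁ v)) (n * count bad)
        (deficit G A₂ p₂) ε (deficit G A p) (excess G A₂ p₂))
    where
    eq : ∀ I I₂ M B X₂ ε X Y → I + (I₂ + M + B + (X₂ + ε + (X + Y + ε))) + 0 ≡ X + (2 * ε + B) + (I + (I₂ + (X₂ + M + Y)))
    eq = solve-∀

-- A vertex is bad if its neighbourhood spans many cliques. Many bad vertices yield many cliques of
-- the next size; few of them cost only n each in the majorisation step. The neighbourhood of a
-- vertex that is not bad falls under the second alternative of the induction hypothesis.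
stability : ∀ j q → Σ ℕ λ Q → ∀ {n} (G : Graph n) (A : Fin n → Bool) →
  (n ^ suc (suc j) ≤ Q * cliques G (suc (suc j)) A) ⊎ NearPartite G A (suc j) q
stability zero q = q , base
  where
  open ≤-Reasoning
  p₀ : ∀ {n} → Fin n → Fin 1
  p₀ _ = zero
  base : ∀ {n} (G : Graph n) (A : Fin n → Bool) → (n ^ 2 ≤ q * cliques G 2 A) ⊎ NearPartite G A 1 q
  base {n} G A with ≤-total (q * innerSum G A p₀) (n * n)
  ... | inj₁ small = inj₂ (p₀ , innerSum G A p₀ , small , excess≤innerSum G A p₀ , m≤n+m _ (deficit G A p₀))
  ... | inj₂ large = inj₁ (begin
    n ^ 2     ≡⟨ cong (n *_) (*-identityʳ n) ⟩
    n * n     ≤⟨ large ⟩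
    q * innerSum G A p₀ ≤⟨ *-monoʳ-≤ q (sum-mono (λ v → ≤-reflexive (row v))) ⟩
    q * cliques G 2 A ∎)
    where
    row : ∀ v → ⟦ A v ⟧ * innerIn {k = 1} G A (λ _ → zero) v ≡ sumFin (λ w → ⟦ A v ∧ ((A w ∧ adj G v w) ∧ true) ⟧)
    row v = trans (cong (⟦ A v ⟧ *_) (count≡sum (λ w → A w ∧ (adj G v w ∧ true))))
      (trans (sym (sum-* ⟦ A v ⟧ (λ w → ⟦ A w ∧ (adj G v w ∧ true) ⟧)))
        (sum-cong (λ w → trans (sym (⟦⟧-∧ (A v) _)) (cong (λ b → ⟦ A v ∧ b ⟧) (sym (BP.∧-assoc (A w) (adj G v w) true))))))
-- The new error is 2ε + n |bad|; with ε ≤ n ^ 2 / 4q and |bad| ≤ n / 2q each of the two terms uses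
-- up one half of n ^ 2 / q.
stability (suc j) q with stability j (4 * q)
... | Q , rec = 2 * q * Q , extend
  where
  open ≤-Reasoning
  extend : ∀ {n} (G : Graph n) (A : Fin n → Bool) →
    (n ^ suc (suc (suc j)) ≤ 2 * q * Q * cliques G (suc (suc (suc j))) A) ⊎ NearPartite G A (suc (suc j)) q
  extend {n} G A = result (≤-total n (2 * q * count bad))
    where
    nbrs : Fin n → Fin n → Bool
    nbrs x w = A w ∧ adj G x w
    bad : Fin n → Bool
    bad x = A x ∧ le (n ^ suc (suc j)) (Q * cliques G (suc (suc j)) (nbrs x))
    bad-weight : ∀ x → ⟦ bad x ⟧ * n ^ suc (suc j) ≤
      Q * sumT (suc (suc j)) (λ w → ⟦ A x ∧ clique G (nbrs x) w ⟧)
    bad-weight x with true⊎false (bad x)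
    ... | inj₂ e = ≤-trans (≤-reflexive (cong (λ b → ⟦ b ⟧ * n ^ suc (suc j)) e)) z≤n
    ... | inj₁ e = begin
      ⟦ bad x ⟧ * n ^ suc (suc j)  ≡⟨ trans (cong (λ b → ⟦ b ⟧ * n ^ suc (suc j)) e) (+-identityʳ _) ⟩
      n ^ suc (suc j)              ≤⟨ le⇒≤ (∧-elimʳ {A x} e) ⟩
      Q * cliques G (suc (suc j)) (nbrs x)
        ≡⟨ cong (Q *_) (sumT-cong (suc (suc j)) (λ w → cong (λ b → ⟦ b ∧ clique G (nbrs x) w ⟧) (sym (∧-elimˡ {A x} e)))) ⟩
      Q * sumT (suc (suc j)) (λ w → ⟦ A x ∧ clique G (nbrs x) w ⟧) ∎
    Goal = (n ^ suc (suc (suc j)) ≤ 2 * q * Q * cliques G (suc (suc (suc j))) A) ⊎ NearPartite G A (suc (suc j)) q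
    error-small : ∀ ε → 4 * q * ε ≤ n * n → 2 * q * count bad ≤ n → q * (2 * ε + n * count bad) ≤ n * n
    error-small ε h₁ h₂ = *-cancelˡ {c = 4} (s≤s z≤n) (lin 0
      (+-mono-≤ (+-mono-≤ h₁ h₁) (+-mono-≤ (*-monoʳ-≤ n h₂) (*-monoʳ-≤ n h₂))) (eq q ε n (count bad) ))
      where
      eq : ∀ q ε n b → 4 * (q * (2 * ε + n * b)) + (n * n + n * n + (n * n + n * n)) + 0
        ≡ 4 * (n * n) + (4 * q * ε + 4 * q * ε + (n * (2 * q * b) + n * (2 * q * b)))
      eq = solve-∀
    few-bad : 2 * q * count bad ≤ n → (∃ λ x → A x ∧ not (bad x) ≡ true) ⊎ (∀ x → A x ∧ not (bad x) ≡ false) → Goal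
    -- All of `A` is bad and hence small, so a single part holding everything has few inner edges.
    few-bad small (inj₂ none) = inj₂ (p₀ , n * count bad , h ,
        ≤-trans (excess≤innerSum G A p₀) A-bound , ≤-trans A-bound (m≤n+m _ (deficit G A p₀)))
      where
      p₀ : Fin n → Fin (suc (suc j))
      p₀ _ = zero
      h : q * (n * count bad) ≤ n * n
      h = ≤-trans (*-monoʳ-≤ q (m≤n+m (n * count bad) (2 * 0))) (error-small 0 (≤-trans (≤-reflexive (*-zeroʳ (4 * q))) z≤n) small)
      A⊆bad : ∀ v → A v ≡ true → bad v ≡ true
      A⊆bad v Av = not-false (trans (cong (_∧ not (bad v)) (sym Av)) (none v))
      A-bound : innerSum G A p₀ ≤ n * count bad
      A-bound = ≤-trans (innerSum≤ G A p₀) (*-monoʳ-≤ n (count-mono A⊆bad))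
    few-bad small (inj₁ (x₀ , good₀)) with argmaxOn (λ x → A x ∧ not (bad x)) (degIn G A) good₀
    ... | x , good , x-max with rec G (nbrs x)
    ...   | inj₁ many = ⊥-elim (true≢false (∧-intro {A x} (∧-elimˡ good) (≤⇒le many)) (not-elim (∧-elimʳ {A x} good)))
    ...   | inj₂ (p₂ , ε , ε-small , Y≤ , I≤) = inj₂ (p , 2 * ε + n * count bad , error-small ε ε-small small ,
              ≤-trans excess-step (+-monoˡ-≤ _ (≤-trans Y≤ (m≤m+n ε _))) , inner-≤-deficit Y≤ I≤)
      where open MajorisationStep G A bad x (λ y Ay gy → x-max y (∧-intro Ay (not-intro gy))) p₂
    result : (n ≤ 2 * q * count bad) ⊎ (2 * q * count bad ≤ n) → Goal
    result (inj₂ small) = few-bad small (findTrue (λ x → A x ∧ not (bad x)))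
    result (inj₁ many) = inj₁ (begin
      n * N                         ≤⟨ *-monoˡ-≤ N many ⟩
      2 * q * count bad * N         ≡⟨ trans (*-assoc (2 * q) (count bad) N) (cong (2 * q *_) (*-comm (count bad) N)) ⟩
      2 * q * (N * count bad)       ≡⟨ cong (2 * q *_) (trans (cong (N *_) (count≡sum bad))
                                        (trans (sym (sum-* N (λ x → ⟦ bad x ⟧))) (sum-cong (λ x → *-comm N ⟦ bad x ⟧)))) ⟩
      2 * q * sumFin (λ x → ⟦ bad x ⟧ * N) ≤⟨ *-monoʳ-≤ (2 * q) (sum-mono bad-weight) ⟩
      2 * q * sumFin (λ x → Q * sumT (suc (suc j)) (λ w → ⟦ A x ∧ clique G (nbrs x) w ⟧))
        ≡⟨ cong (2 * q *_) (sum-* Q (λ x → sumT (suc (suc j)) (λ w → ⟦ A x ∧ clique G (nbrs x) w ⟧))) ⟩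
      2 * q * (Q * cliques G (suc (suc (suc j))) A) ≡⟨ *-assoc (2 * q) Q _ ⟨
      2 * q * Q * cliques G (suc (suc (suc j))) A ∎)
      where N = n ^ suc (suc j)

-- Complete multipartite graphs

cross : ∀ {n k} → (Fin n → Fin k) → Fin n → ℕ
cross p v = count (λ w → not (p v == p w))

inn : ∀ {n k} → Graph n → (Fin n → Fin k) → Fin n → ℕ
inn G p v = count (λ w → adj G v w ∧ (p v == p w))

miss : ∀ {n k} → Graph n → (Fin n → Fin k) → Fin n → ℕ
miss G p v = count (λ w → not (p v == p w) ∧ not (adj G v w))

nbrsIn : ∀ {n k} → Graph n → (Fin n → Fin k) → Fin n → Fin k → ℕ
nbrsIn G p v i = count (λ w → adj G v w ∧ (p w == i))

completeMP-adj : ∀ {n k} (p : Fin n → Fin k) u v → adj (completeMP p) u v ≡ not (p u == p v)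
completeMP-adj p u v rewrite ==-sym (p v) (p u) with true⊎false (p u == p v)
... | inj₁ e rewrite e = refl
... | inj₂ e rewrite e | ≢⇒==false {i = u} {v} (λ u≡v → ==false⇒≢ e (cong p u≡v)) = refl

deg-completeMP : ∀ {n k} (p : Fin n → Fin k) v → deg (completeMP p) v ≡ cross p v
deg-completeMP p v = count-cong (completeMP-adj p v)

e-completeMP : ∀ {n k} r (p : Fin n → Fin k) → e r (completeMP p) ≡ sumFin (λ v → cross p v ^ r)
e-completeMP r p = sum-cong (λ v → cong (_^ r) (deg-completeMP p v))

cross+part : ∀ {n k} (p : Fin n → Fin k) v → cross p v + partSize p (p v) ≡ n
cross+part p v = trans (+-comm (cross p v) _)
  (trans (cong (_+ cross p v) (count-cong (λ w → ==-sym (p w) (p v)))) (count-not (λ w → p v == p w)))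

-- Both sides count the inner neighbours, the joined cross vertices and the missed ones. Estimates
-- of what a vertex gains or loses against a multipartite competitor start from this identity.
deg-balance : ∀ {n k} (G : Graph n) (p : Fin n → Fin k) v → deg G v + miss G p v ≡ cross p v + inn G p v
deg-balance G p v = begin-equality
  deg G v + miss G p v ≡⟨ cong (_+ miss G p v) (count-split (adj G v) (λ w → p v == p w)) ⟩
  inn G p v + c + miss G p v ≡⟨ +-assoc (inn G p v) c _ ⟩
  inn G p v + (c + miss G p v) ≡⟨ cong (λ x → inn G p v + (x + miss G p v)) (count-cong (λ w → BP.∧-comm (adj G v w) _)) ⟩
  inn G p v + (count (λ w → not (p v == p w) ∧ adj G v w) + miss G p v)
    ≡⟨ cong (inn G p v +_) (count-split (λ w → not (p v == p w)) (adj G v)) ⟨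
  inn G p v + cross p v ≡⟨ +-comm (inn G p v) _ ⟩
  cross p v + inn G p v ∎
  where
  open ≤-Reasoning
  c = count (λ w → adj G v w ∧ not (p v == p w))

sum-partSize : ∀ {n k} (p : Fin n → Fin k) → sumFin (partSize p) ≡ n
sum-partSize {n} p = begin-equality
  sumFin (partSize p) ≡⟨ sum-cong (λ j → trans (count≡sum (λ v → p v == j)) (sum-cong (λ v → sym (*-identityʳ ⟦ p v == j ⟧)))) ⟩
  sumFin (λ j → sumFin (λ v → ⟦ p v == j ⟧ * 1)) ≡⟨ sum-fibres p (λ _ → 1) ⟨
  sumFin {n} (λ _ → 1) ≡⟨ trans (sum-const n 1) (*-identityʳ n) ⟩
  n ∎
  where open ≤-Reasoning

crossPower : ∀ {n k} → ℕ → (Fin n → Fin k) → ℕ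
crossPower r p = sumFin (λ v → cross p v ^ r)

cross-cong : ∀ {n k} {p q : Fin n → Fin k} → (∀ v → p v ≡ q v) → ∀ v → cross p v ≡ cross q v
cross-cong h v = count-cong (λ w → cong not (cong₂ _==_ (h v) (h w)))

crossPower-cong : ∀ {n k} r {p q : Fin n → Fin k} → (∀ v → p v ≡ q v) → crossPower r p ≡ crossPower r q
crossPower-cong r h = sum-cong (λ v → cong (_^ r) (cross-cong h v))

cross≤ : ∀ {n k} (p : Fin n → Fin k) v → cross p v ≤ n
cross≤ p v = count≤n _

deg≤ : ∀ {n} (G : Graph n) v → deg G v ≤ n
deg≤ G v = count≤n _

-- Moving half of a largest part into a small part increases the power sum.
abstract
  partConst : ℕ → ℕ → ℕ
  partConst k ρ = 2 * (3 * k) ^ suc (suc ρ)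

  partConst-def : ∀ k ρ → partConst k ρ ≡ 2 * (3 * k) ^ suc (suc ρ)
  partConst-def k ρ = refl

⌊/2⌋-bounds : ∀ m → ⌊ m /2⌋ + ⌈ m /2⌉ ≡ m × ⌊ m /2⌋ ≤ ⌈ m /2⌉ × ⌈ m /2⌉ ≤ suc ⌊ m /2⌋
⌊/2⌋-bounds m = ⌊n/2⌋+⌈n/2⌉≡n m , ⌊n/2⌋-mono (n≤1+n m) , upper m
  where
  upper : ∀ m → ⌈ m /2⌉ ≤ suc ⌊ m /2⌋
  upper zero          = z≤n
  upper (suc zero)    = ≤-refl
  upper (suc (suc m)) = s≤s (upper m)

-- The half that stays behind gains h in cross degree, hence at least h ^ r per vertex by
-- superadditivity. Only the old vertices of part i lose, at most n ^ r each, and n ≤ 3kh together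
-- with the size of `partConst` makes this at most half of the gain.
rebalance : ∀ {n} j ρ (p : Fin n → Fin (suc j)) i → suc j < n → partConst (suc j) ρ * partSize p i < n →
  Σ (Fin n → Fin (suc j)) λ p′ → Σ ℕ λ h → n ≤ 3 * suc j * h ×
    2 * crossPower (suc ρ) p + h ^ suc (suc ρ) ≤ 2 * crossPower (suc ρ) p′
rebalance {n} j ρ p i k<n small = p′ , h , n≤Kh , conclusion
  where
  open ≤-Reasoning
  k = suc j
  K = 3 * k
  C = partConst k ρ
  r = suc ρ
  x = partSize p i
  largest = argmaxF (partSize p)
  l = proj₁ largest
  m = partSize p l
  h = ⌊ m /2⌋
  h′ = ⌈ m /2⌉
  h+h′ : h + h′ ≡ m
  h+h′ = proj₁ (⌊/2⌋-bounds m)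
  h≤h′ : h ≤ h′
  h≤h′ = proj₁ (proj₂ (⌊/2⌋-bounds m))
  n≤km : n ≤ k * m
  n≤km = ≤-trans (≤-reflexive (sym (sum-partSize p))) (sum-≤const m (proj₂ largest))
  m≥2 : 2 ≤ m
  m≥2 with ≤-total 2 m
  ... | inj₁ q = q
  ... | inj₂ q with m≤n⇒m<n∨m≡n q
  ...   | inj₁ m<2 = ⊥-elim (<⇒≱ k<n (≤-trans n≤km (≤-trans (*-monoʳ-≤ k (s≤s⁻¹ m<2)) (≤-reflexive (*-identityʳ k)))))
  ...   | inj₂ m≡2 = ≤-reflexive (sym m≡2)
  h≥1 : 1 ≤ h
  h≥1 = ⌊n/2⌋-mono m≥2
  m≤3h : m ≤ 3 * h
  m≤3h = begin
    m           ≡⟨ h+h′ ⟨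
    h + h′      ≤⟨ +-monoʳ-≤ h (proj₂ (proj₂ (⌊/2⌋-bounds m))) ⟩
    h + (1 + h) ≤⟨ +-monoʳ-≤ h (+-monoˡ-≤ h h≥1) ⟩
    h + (h + h) ≡⟨ eq h ⟩
    3 * h       ∎
    where
    eq : ∀ h → h + (h + h) ≡ 3 * h
    eq = solve-∀
  n≤Kh : n ≤ K * h
  n≤Kh = begin
    n           ≤⟨ n≤km ⟩
    k * m       ≤⟨ *-monoʳ-≤ k m≤3h ⟩
    k * (3 * h) ≡⟨ trans (sym (*-assoc k 3 h)) (cong (_* h) (*-comm k 3)) ⟩
    K * h       ∎
  K>0 : 0 < K
  K>0 = s≤s z≤n
  K≤C : K ≤ C
  K≤C = begin
    K                     ≡⟨ *-identityʳ K ⟨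
    K * 1                 ≤⟨ *-monoʳ-≤ K (pow>0 K r K>0) ⟩
    K * K ^ r             ≤⟨ m≤m+n _ _ ⟩
    2 * (K * K ^ r)       ≡⟨ partConst-def k ρ ⟨
    C                     ∎
  x≤h : x ≤ h
  x≤h with ≤-total x h
  ... | inj₁ q = q
  ... | inj₂ q = ⊥-elim (<⇒≱ small (≤-trans n≤Kh (*-mono-≤ K≤C q)))
  x+h≤m : x + h ≤ m
  x+h≤m = begin
    x + h  ≤⟨ +-monoˡ-≤ h (≤-trans x≤h h≤h′) ⟩
    h′ + h ≡⟨ +-comm h′ h ⟩
    h + h′ ≡⟨ h+h′ ⟩
    m      ∎
  i≢l : i ≢ l
  i≢l e = <⇒≱ (≤-trans (m<m+n x h≥1) x+h≤m) (≤-reflexive (cong (partSize p) (sym e)))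
  chosen = subset-of-size (λ w → p w == l) h (≤-trans (m≤n+m h x) x+h≤m)
  g = proj₁ chosen
  g⊆ : ∀ v → g v ≡ true → p v ≡ l
  g⊆ v e = ==⇒≡ (proj₁ (proj₂ chosen) v e)
  g-size : count g ≡ h
  g-size = proj₂ (proj₂ chosen)
  p′ : Fin n → Fin k
  p′ v = if g v then i else p v
  p′-in : ∀ {v} → g v ≡ true → p′ v ≡ i
  p′-in e rewrite e = refl
  p′-out : ∀ {v} → g v ≡ false → p′ v ≡ p v
  p′-out e rewrite e = refl
  remain : Fin n → Bool
  remain w = (p w == l) ∧ not (g w)
  remain-size : count remain ≡ h′
  remain-size = +-cancelˡ-≡ h _ _ (begin-equality
    h + count remain ≡⟨ cong (_+ count remain) (trans (sym g-size) (count-cong (λ w → ⇔⇒≡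
        (λ e → ∧-intro (≡⇒== (g⊆ w e)) e) (∧-elimʳ {p w == l})))) ⟩
    count (λ w → (p w == l) ∧ g w) + count remain ≡⟨ count-split (λ w → p w == l) g ⟨
    m ≡⟨ h+h′ ⟨
    h + h′ ∎)
  part-i : partSize p′ i ≤ x + h
  part-i = begin
    partSize p′ i ≤⟨ count-mono (λ w → lemma w (true⊎false (g w))) ⟩
    count (λ w → (p w == i) ∨ g w) ≤⟨ count-∨≤ (λ w → p w == i) g ⟩
    x + count g ≡⟨ cong (x +_) g-size ⟩
    x + h ∎
    where
    lemma : ∀ w → (g w ≡ true) ⊎ (g w ≡ false) → (p′ w == i) ≡ true → (p w == i) ∨ g w ≡ true
    lemma w (inj₁ e) _ = ∨-introʳ {p w == i} e
    lemma w (inj₂ e) q = ∨-introˡ (trans (cong (_== i) (sym (p′-out e))) q)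
  part-l : partSize p′ l ≤ h′
  part-l = ≤-trans (count-mono (λ w → lemma w (true⊎false (g w)))) (≤-reflexive remain-size)
    where
    lemma : ∀ w → (g w ≡ true) ⊎ (g w ≡ false) → (p′ w == l) ≡ true → remain w ≡ true
    lemma w (inj₁ e) q = ⊥-elim (i≢l (trans (sym (p′-in e)) (==⇒≡ q)))
    lemma w (inj₂ e) q = ∧-intro (trans (cong (_== l) (sym (p′-out e))) q) (not-intro e)
  part-other : ∀ a → a ≢ i → partSize p′ a ≤ partSize p a
  part-other a a≢i = count-mono (λ w → lemma w (true⊎false (g w)))
    where
    lemma : ∀ w → (g w ≡ true) ⊎ (g w ≡ false) → (p′ w == a) ≡ true → (p w == a) ≡ true
    lemma w (inj₁ e) q = ⊥-elim (a≢i (trans (sym (==⇒≡ q)) (p′-in e)))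
    lemma w (inj₂ e) q = trans (cong (_== a) (sym (p′-out e))) q
  gain : ∀ v δ → partSize p′ (p′ v) + δ ≤ partSize p (p v) → cross p v + δ ≤ cross p′ v
  gain v δ q = lin 0 (+-mono-≤ q (+-mono-≤ (≤-reflexive (cross+part p v)) (≤-reflexive (sym (cross+part p′ v)))))
    (eq (cross p v) δ (partSize p (p v)) n (cross p′ v) (partSize p′ (p′ v)))
    where
    eq : ∀ c d P n c′ P′ → c + d + (P + (n + (c′ + P′))) + 0 ≡ c′ + (P′ + d + (c + P + n))
    eq = solve-∀
  -- The moved vertices lose nothing: part i has at most x + h vertices afterwards, no more than the
  -- part they came from.
  point : ∀ v → cross p v ^ r + h ^ r * ⟦ remain v ⟧ ≤ cross p′ v ^ r + n ^ r * ⟦ p v == i ⟧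
  point v with true⊎false (p v == i) | true⊎false (g v) | true⊎false (p v == l)
  ... | inj₁ e | _ | inj₁ e″ = ⊥-elim (i≢l (trans (sym (==⇒≡ e)) (==⇒≡ e″)))
  ... | inj₁ e | _ | inj₂ e″ rewrite e | e″ = ≤-trans (≤-reflexive (trans (cong (cross p v ^ r +_) (*-zeroʳ (h ^ r))) (+-identityʳ _)))
        (≤-trans (^-monoˡ-≤ r (cross≤ p v)) (≤-trans (≤-reflexive (sym (*-identityʳ (n ^ r)))) (m≤n+m _ _)))
  ... | inj₂ e | inj₁ e′ | inj₂ e″ = ⊥-elim (==false⇒≢ e″ (g⊆ v e′))
  ... | inj₂ e | inj₁ e′ | inj₁ e″ rewrite e | e″ = ≤-trans
        (≤-reflexive (trans (cong (λ b → cross p v ^ r + h ^ r * ⟦ not b ⟧) e′) (trans (cong (cross p v ^ r +_) (*-zeroʳ (h ^ r))) (+-identityʳ _))))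
        (≤-trans (^-monoˡ-≤ r (≤-trans (m≤m+n _ 0) (gain v 0 (begin
           partSize p′ (p′ v) + 0 ≡⟨ trans (+-identityʳ _) (cong (partSize p′) (p′-in e′)) ⟩
           partSize p′ i ≤⟨ ≤-trans part-i x+h≤m ⟩
           m ≡⟨ cong (partSize p) (==⇒≡ e″) ⟨
           partSize p (p v) ∎)))) (m≤m+n _ _))
  ... | inj₂ e | inj₂ e′ | inj₁ e″ rewrite e | e″ = begin
        cross p v ^ r + h ^ r * ⟦ not (g v) ⟧ ≡⟨ cong (cross p v ^ r +_) (trans (cong (λ b → h ^ r * ⟦ not b ⟧) e′) (*-identityʳ (h ^ r))) ⟩
        cross p v ^ r + h ^ r ≤⟨ pow-superadditive ρ (cross p v) h ⟩
        (cross p v + h) ^ r ≤⟨ ^-monoˡ-≤ r (gain v h (begin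
           partSize p′ (p′ v) + h ≡⟨ cong (λ a → partSize p′ a + h) (trans (p′-out e′) (==⇒≡ e″)) ⟩
           partSize p′ l + h ≤⟨ +-monoˡ-≤ h part-l ⟩
           h′ + h ≡⟨ trans (+-comm h′ h) h+h′ ⟩
           m ≡⟨ cong (partSize p) (==⇒≡ e″) ⟨
           partSize p (p v) ∎)) ⟩
        cross p′ v ^ r ≤⟨ m≤m+n _ _ ⟩
        cross p′ v ^ r + n ^ r * 0 ∎
  ... | inj₂ e | inj₂ e′ | inj₂ e″ rewrite e | e″ = ≤-trans
        (≤-reflexive (trans (cong (cross p v ^ r +_) (*-zeroʳ (h ^ r))) (+-identityʳ _)))
        (≤-trans (^-monoˡ-≤ r (≤-trans (m≤m+n _ 0) (gain v 0 (≤-trans (≤-reflexive (+-identityʳ _))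
          (≤-trans (part-other (p′ v) (λ q → ==false⇒≢ e (trans (sym (p′-out e′)) q)))
            (≤-reflexive (cong (partSize p) (p′-out e′)))))))) (m≤m+n _ _))
  weighted : ∀ c (S : Fin n → Bool) → sumFin (λ v → c * ⟦ S v ⟧) ≡ c * count S
  weighted c S = trans (sum-* c (λ v → ⟦ S v ⟧)) (cong (c *_) (sym (count≡sum S)))
  summed : crossPower r p + h ^ r * h′ ≤ crossPower r p′ + n ^ r * x
  summed = begin
    crossPower r p + h ^ r * h′ ≡⟨ cong (λ y → crossPower r p + h ^ r * y) remain-size ⟨
    crossPower r p + h ^ r * count remain ≡⟨ cong (crossPower r p +_) (weighted (h ^ r) remain) ⟨
    crossPower r p + sumFin (λ v → h ^ r * ⟦ remain v ⟧) ≡⟨ sum-+ (λ v → cross p v ^ r) (λ v → h ^ r * ⟦ remain v ⟧) ⟨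
    sumFin (λ v → cross p v ^ r + h ^ r * ⟦ remain v ⟧) ≤⟨ sum-mono point ⟩
    sumFin (λ v → cross p′ v ^ r + n ^ r * ⟦ p v == i ⟧) ≡⟨ sum-+ (λ v → cross p′ v ^ r) (λ v → n ^ r * ⟦ p v == i ⟧) ⟩
    crossPower r p′ + sumFin (λ v → n ^ r * ⟦ p v == i ⟧) ≡⟨ cong (crossPower r p′ +_) (weighted (n ^ r) (λ v → p v == i)) ⟩
    crossPower r p′ + n ^ r * x ∎
  loss-small : 2 * (n ^ r * x) ≤ h ^ suc r
  loss-small = *-cancelˡ (pow>0 K (suc r) K>0) (begin
    K ^ suc r * (2 * (n ^ r * x)) ≡⟨ eq (K ^ suc r) (n ^ r) x ⟩
    n ^ r * (2 * K ^ suc r * x)   ≡⟨ cong (λ a → n ^ r * (a * x)) (partConst-def k ρ) ⟨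
    n ^ r * (C * x)               ≤⟨ *-monoʳ-≤ (n ^ r) (<⇒≤ small) ⟩
    n ^ r * n                     ≡⟨ *-comm (n ^ r) n ⟩
    n ^ suc r                     ≤⟨ ^-monoˡ-≤ (suc r) n≤Kh ⟩
    (K * h) ^ suc r               ≡⟨ pow-* K h (suc r) ⟩
    K ^ suc r * h ^ suc r         ∎)
    where
    eq : ∀ a b c → a * (2 * (b * c)) ≡ b * (2 * a * c)
    eq = solve-∀
  conclusion : 2 * crossPower r p + h ^ suc r ≤ 2 * crossPower r p′
  conclusion = lin 0 (+-mono-≤ (+-mono-≤ summed summed) (+-mono-≤ loss-small (+-mono-≤ hh hh)))
    (eq (crossPower r p) (h ^ suc r) (crossPower r p′) (n ^ r * x) (h ^ r * h′))
    where
    hh : h ^ suc r ≤ h ^ r * h′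
    hh = ≤-trans (≤-reflexive (*-comm h (h ^ r))) (*-monoʳ-≤ (h ^ r) h≤h′)
    eq : ∀ E H E′ L M → 2 * E + H + (E′ + L + (E′ + L) + (H + (M + M))) + 0 ≡ 2 * E′ + (E + M + (E + M) + (2 * L + (H + H)))
    eq = solve-∀

-- Partitions are vectors so that they can be listed. A maximiser with a small part would be
-- improved by `rebalance`, strictly, because n ≤ 3kh forces h > 0.
maximal-crossPower : ∀ {n} j ρ → suc j < n → Σ (Vec (Fin (suc j)) n) λ pv →
  (∀ (p : Fin n → Fin (suc j)) → crossPower (suc ρ) p ≤ crossPower (suc ρ) (lookup pv)) ×
  (∀ i → n ≤ partConst (suc j) ρ * partSize (lookup pv) i)
maximal-crossPower {n} j ρ k<n =
  finish (argmaxL {P = λ _ → ⊤} (λ _ → yes tt) (λ pv _ → crossPower (suc ρ) (lookup pv)) (allVecs (suc j) n))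
  where
  Val : Vec (Fin (suc j)) n → ℕ
  Val pv = crossPower (suc ρ) (lookup pv)
  Result : Set
  Result = Σ (Vec (Fin (suc j)) n) λ pv →
    (∀ (p : Fin n → Fin (suc j)) → crossPower (suc ρ) p ≤ Val pv) ×
    (∀ i → n ≤ partConst (suc j) ρ * partSize (lookup pv) i)
  module _ (pv : Vec (Fin (suc j)) n) (max : ∀ (p : Fin n → Fin (suc j)) → crossPower (suc ρ) p ≤ Val pv) (i : Fin (suc j)) where
    no-better : (Σ (Fin n → Fin (suc j)) λ p′ → Σ ℕ λ h → n ≤ 3 * suc j * h ×
      2 * Val pv + h ^ suc (suc ρ) ≤ 2 * crossPower (suc ρ) p′) → ⊥
    no-better (p′ , zero , n≤Kh , better) = <⇒≱ k<n (≤-trans n≤Kh (≤-trans (≤-reflexive (*-zeroʳ (3 * suc j))) z≤n))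
    no-better (p′ , suc h , n≤Kh , better) = <⇒≱ (pow>0 (suc h) (suc (suc ρ)) (s≤s z≤n))
      (+-cancelˡ-≤ (2 * Val pv) _ _ (≤-trans better (≤-trans (*-monoʳ-≤ 2 (max p′)) (m≤m+n _ 0))))
    parts : (n ≤ partConst (suc j) ρ * partSize (lookup pv) i) ⊎ (partConst (suc j) ρ * partSize (lookup pv) i < n) →
      n ≤ partConst (suc j) ρ * partSize (lookup pv) i
    parts (inj₁ large) = large
    parts (inj₂ small) = ⊥-elim (no-better (rebalance j ρ (lookup pv) i k<n small))
  finish : (∀ y → y ∈ allVecs (suc j) n → ¬ ⊤) ⊎
    (Σ (Vec (Fin (suc j)) n) λ x → Σ ⊤ λ _ → ∀ y → y ∈ allVecs (suc j) n → ⊤ → Σ ⊤ λ _ → Val y ≤ Val x) → Result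
  finish (inj₁ none) = ⊥-elim (none (tabulate (λ _ → zero)) (∈-allVecs _) tt)
  finish (inj₂ (pv , _ , max)) = pv , max′ , λ i → parts pv max′ i (≤-<-connex n _)
    where
    max′ : ∀ (p : Fin n → Fin (suc j)) → crossPower (suc ρ) p ≤ Val pv
    max′ p = ≤-trans (≤-reflexive (crossPower-cong (suc ρ) (λ v → sym (VP.lookup∘tabulate p v))))
      (proj₂ (max (tabulate p) (∈-allVecs _) tt))

-- Partitions minimising the number of inner edges

-- A pair through v is met once from either side. The identity isolates the effect of recolouring v
-- alone.
sum-pairs-split : ∀ {n} (B : Fin n → Fin n → Bool) (v : Fin n) → (∀ u w → B u w ≡ B w u) → B v v ≡ false →
  sumFin (λ u → count (B u)) ≡
  sumFin (λ u → count (λ w → B u w ∧ (not (v == u) ∧ not (v == w)))) + 2 * count (B v)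
sum-pairs-split {n} B v B-sym Bvv = begin-equality
  sumFin (λ u → count (B u)) ≡⟨ sum-cong (λ u → count≡sum (B u)) ⟩
  sumFin (λ u → sumFin (λ w → ⟦ B u w ⟧)) ≡⟨ sum-cong (λ u → sum-cong (λ w → entry u w)) ⟩
  sumFin (λ u → sumFin (λ w → R u w + (⟦ v == u ⟧ * ⟦ B v w ⟧ + ⟦ v == w ⟧ * ⟦ B u v ⟧)))
    ≡⟨ sum-cong (λ u → trans (sum-+ (R u) (λ w → ⟦ v == u ⟧ * ⟦ B v w ⟧ + ⟦ v == w ⟧ * ⟦ B u v ⟧))
         (cong₂ _+_ (sym (count≡sum (λ w → B u w ∧ (not (v == u) ∧ not (v == w)))))
           (trans (sum-+ (λ w → ⟦ v == u ⟧ * ⟦ B v w ⟧) (λ w → ⟦ v == w ⟧ * ⟦ B u v ⟧))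
             (cong₂ _+_ (trans (sum-* ⟦ v == u ⟧ (λ w → ⟦ B v w ⟧)) (cong (⟦ v == u ⟧ *_) (sym (count≡sum (B v)))))
               (sum-delta v (λ _ → ⟦ B u v ⟧)))))) ⟩
  sumFin (λ u → R′ u + (⟦ v == u ⟧ * count (B v) + ⟦ B u v ⟧))
    ≡⟨ trans (sum-+ R′ (λ u → ⟦ v == u ⟧ * count (B v) + ⟦ B u v ⟧)) (cong (sumFin R′ +_)
         (trans (sum-+ (λ u → ⟦ v == u ⟧ * count (B v)) (λ u → ⟦ B u v ⟧))
           (cong₂ _+_ (sum-delta v (λ _ → count (B v)))
             (trans (sum-cong (λ u → cong ⟦_⟧ (B-sym u v))) (sym (count≡sum (B v))))))) ⟩
  sumFin R′ + (count (B v) + count (B v)) ≡⟨ cong (λ x → sumFin R′ + (count (B v) + x)) (+-identityʳ (count (B v))) ⟨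
  sumFin R′ + 2 * count (B v) ∎
  where
  open ≤-Reasoning
  R : Fin n → Fin n → ℕ
  R u w = ⟦ B u w ∧ (not (v == u) ∧ not (v == w)) ⟧
  R′ : Fin n → ℕ
  R′ u = count (λ w → B u w ∧ (not (v == u) ∧ not (v == w)))
  entry : ∀ u w → ⟦ B u w ⟧ ≡ R u w + (⟦ v == u ⟧ * ⟦ B v w ⟧ + ⟦ v == w ⟧ * ⟦ B u v ⟧)
  entry u w with true⊎false (v == u) | true⊎false (v == w)
  ... | inj₂ e | inj₂ e′ rewrite e | e′ | BP.∧-identityʳ (B u w) = sym (+-identityʳ _)
  ... | inj₁ e | inj₂ e′ rewrite e | e′ | BP.∧-zeroʳ (B u w) | ==⇒≡ e =
        sym (trans (+-identityʳ _) (+-identityʳ _))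
  ... | inj₂ e | inj₁ e′ rewrite e | e′ | BP.∧-zeroʳ (B u w) | ==⇒≡ e′ = sym (+-identityʳ _)
  ... | inj₁ e | inj₁ e′ rewrite e | e′ | BP.∧-zeroʳ (B u w) | sym (==⇒≡ e) | sym (==⇒≡ e′) | Bvv = refl

-- Each inner edge is counted twice, once from either end.
innerEdges : ∀ {n k} → Graph n → (Fin n → Fin k) → ℕ
innerEdges G p = sumFin (inn G p)

innerEdges-cong : ∀ {n k} (G : Graph n) {p q : Fin n → Fin k} → (∀ v → p v ≡ q v) → innerEdges G p ≡ innerEdges G q
innerEdges-cong G h = sum-cong (λ v → count-cong (λ w → cong (adj G v w ∧_) (cong₂ _==_ (h v) (h w))))

-- Recolouring v alone to i keeps all inner pairs that avoid v, so minimality compares just the two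
-- inner degrees of v.
minimal⇒inn≤nbrsIn : ∀ {n k} (G : Graph n) (p : Fin n → Fin k) →
  (∀ q → innerEdges G p ≤ innerEdges G q) → ∀ v i → inn G p v ≤ nbrsIn G p v i
minimal⇒inn≤nbrsIn {n} {k} G p minimal v i = *-cancelˡ {c = 2} (s≤s z≤n) (+-cancelˡ-≤ rest _ _ (begin
  rest + 2 * inn G p v ≡⟨ sum-pairs-split (M p) v (M-sym p) (M-irr p) ⟨
  innerEdges G p       ≤⟨ minimal q ⟩
  innerEdges G q       ≡⟨ sum-pairs-split (M q) v (M-sym q) (M-irr q) ⟩
  sumFin (λ u → count (λ w → M q u w ∧ (not (v == u) ∧ not (v == w)))) + 2 * inn G q v
    ≡⟨ cong₂ (λ a b → a + 2 * b) (sum-cong (λ u → count-cong (λ w → same u w)))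
         (count-cong (λ w → row w)) ⟩
  rest + 2 * nbrsIn G p v i ∎))
  where
  open ≤-Reasoning
  q : Fin n → Fin k
  q u = if v == u then i else p u
  q-v : q v ≡ i
  q-v rewrite ==-refl v = refl
  q-other : ∀ {u} → (v == u) ≡ false → q u ≡ p u
  q-other e rewrite e = refl
  M : (Fin n → Fin k) → Fin n → Fin n → Bool
  M p u w = adj G u w ∧ (p u == p w)
  M-sym : ∀ p u w → M p u w ≡ M p w u
  M-sym p u w = cong₂ _∧_ (adj-sym G u w) (==-sym (p u) (p w))
  M-irr : ∀ p → M p v v ≡ false
  M-irr p rewrite irrefl G v = refl
  rest = sumFin (λ u → count (λ w → M p u w ∧ (not (v == u) ∧ not (v == w))))
  same : ∀ u w → M q u w ∧ (not (v == u) ∧ not (v == w)) ≡ M p u w ∧ (not (v == u) ∧ not (v == w))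
  same u w with true⊎false (v == u) | true⊎false (v == w)
  ... | inj₁ e | _ rewrite e = trans (BP.∧-zeroʳ _) (sym (BP.∧-zeroʳ (M p u w)))
  ... | inj₂ e | inj₁ e′ rewrite e | e′ = trans (BP.∧-zeroʳ _) (sym (BP.∧-zeroʳ (M p u w)))
  ... | inj₂ e | inj₂ e′ rewrite e | e′ = refl
  row : ∀ w → M q v w ≡ adj G v w ∧ (p w == i)
  row w with true⊎false (v == w)
  ... | inj₁ e rewrite sym (==⇒≡ e) | irrefl G v = refl
  ... | inj₂ e = cong (adj G v w ∧_) (trans (cong₂ _==_ q-v (q-other e)) (==-sym i (p w)))

minimal-innerEdges : ∀ {n} j (G : Graph n) → Σ (Vec (Fin (suc j)) n) λ pv →
  ∀ q → innerEdges G (lookup pv) ≤ innerEdges G q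
minimal-innerEdges {n} j G
  -- Minimisation as maximisation of the difference to n ^ 2, which `bound` shows to be untruncated.
  with argmaxL {P = λ _ → ⊤} (λ _ → yes tt) (λ pv _ → n * n ∸ innerEdges G (lookup pv)) (allVecs (suc j) n)
... | inj₁ none = ⊥-elim (none (tabulate (λ _ → zero)) (∈-allVecs _) tt)
... | inj₂ (pv , _ , max) = pv , λ q → begin
  innerEdges G (lookup pv)                      ≡⟨ m∸[m∸n]≡n (bound (lookup pv)) ⟨
  n * n ∸ (n * n ∸ innerEdges G (lookup pv))    ≤⟨ ∸-monoʳ-≤ (n * n) (proj₂ (max (tabulate q) (∈-allVecs _) tt)) ⟩
  n * n ∸ (n * n ∸ innerEdges G (lookup (tabulate q))) ≡⟨ m∸[m∸n]≡n (bound _) ⟩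
  innerEdges G (lookup (tabulate q))            ≡⟨ innerEdges-cong G (VP.lookup∘tabulate q) ⟩
  innerEdges G q                                ∎
  where
  open ≤-Reasoning
  bound : ∀ (q : Fin n → Fin (suc j)) → innerEdges G q ≤ n * n
  bound q = sum-≤const {n} n (λ v → count≤n (λ w → adj G v w ∧ (q v == q w)))

-- The approximate structure of extremal graphs. All linear quantities are
-- measured in multiples of a unit η, which is proportional to n.

record Structured {n : ℕ} {k : ℕ} (G : Graph n) (p : Fin n → Fin k) (η c C : ℕ) : Set where
  field
    part≥cη   : ∀ i → c * η ≤ partSize p i
    -- Kept besides the bound by c η because C is fixed first: c is later chosen in terms of C ^ ρ.
    part≥n/C  : ∀ i → n ≤ C * partSize p i
    miss-sum  : sumFin (miss G p) ≤ η * η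
    inn≤nbrs  : ∀ v i → inn G p v ≤ nbrsIn G p v i

quotient-exists : ∀ Q n → 0 < Q → ∃ λ η → Q * η ≤ n × n < Q * suc η
quotient-exists Q zero    Q>0 = 0 , ≤-reflexive (*-zeroʳ Q) , ≤-trans Q>0 (≤-reflexive (sym (*-identityʳ Q)))
quotient-exists Q (suc n) Q>0 with quotient-exists Q n Q>0
... | η , lo , hi with m≤n⇒m<n∨m≡n hi
...   | inj₁ hi′ = η , m≤n⇒m≤1+n lo , hi′
...   | inj₂ eq = suc η , ≤-reflexive (sym eq) , ≤-trans (≤-reflexive (cong suc eq))
          (≤-trans (+-monoˡ-≤ (Q * suc η) Q>0) (≤-reflexive (sym (*-suc Q (suc η)))))

miss-≤ : ∀ {n k} (G : Graph n) (p : Fin n → Fin k) v → miss G p v ≤ (cross p v ∸ deg G v) + inn G p v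
miss-≤ G p v = +-cancelˡ-≤ (deg G v) _ _ (begin
  deg G v + miss G p v        ≡⟨ deg-balance G p v ⟩
  cross p v + inn G p v       ≤⟨ +-monoˡ-≤ (inn G p v) (m≤n+m∸n (cross p v) (deg G v)) ⟩
  deg G v + (cross p v ∸ deg G v) + inn G p v ≡⟨ +-assoc (deg G v) _ _ ⟩
  deg G v + ((cross p v ∸ deg G v) + inn G p v) ∎)
  where open ≤-Reasoning

deg≤cross+inn : ∀ {n k} (G : Graph n) (p : Fin n → Fin k) v → deg G v ≤ cross p v + inn G p v
deg≤cross+inn G p v = ≤-trans (m≤m+n _ (miss G p v)) (≤-reflexive (deg-balance G p v))

module StructureProof (j ρ c η₀ t : ℕ) where
  k r K C : ℕ
  k = suc j
  r = suc ρ
  K = 3 * k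
  C = partConst k ρ

  C>0 : 0 < C
  C>0 = ≤-trans (pow>0 K (suc r) (s≤s z≤n)) (≤-trans (m≤m+n _ _) (≤-reflexive (sym (partConst-def k ρ))))

  -- Q is the ratio of n to η; E is the accuracy for missing cross edges; g and g₂ are the
  -- parameters given to `deficit-small` for the final partition and for the one from stability; q₁
  -- bounds the density of inner edges, and q is the accuracy demanded of `stability`. Each summand
  -- of q₁ and q serves one later estimate.
  abstract
    Q E g q₁ g₂ q : ℕ
    Q = C * suc c
    E = 8 * (Q * Q)
    g = 2 * E
    q₁ = g ^ r * r + E + (2 * (r * K ^ suc r) + 1)
    g₂ = 4 * q₁
    q = 2 * q₁ + g₂ ^ r * r

    Q≡ : Q ≡ C * suc c
    Q≡ = refl
    Q>0 : 0 < Q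
    Q>0 = *-mono-< C>0 (s≤s z≤n)
    E≡ : E ≡ 8 * (Q * Q)
    E≡ = refl
    g≡ : g ≡ 2 * E
    g≡ = refl
    g₂≡ : g₂ ≡ 4 * q₁
    g₂≡ = refl
    g≤q₁ : g ^ r * r ≤ q₁
    g≤q₁ = ≤-trans (m≤m+n _ E) (m≤m+n _ _)
    E≤q₁ : E ≤ q₁
    E≤q₁ = ≤-trans (m≤n+m E (g ^ r * r)) (m≤m+n _ _)
    K≤q₁ : 2 * (r * K ^ suc r) + 1 ≤ q₁
    K≤q₁ = m≤n+m _ (g ^ r * r + E)
    q₁≤q : 2 * q₁ ≤ q
    q₁≤q = m≤m+n _ _
    g₂≤q : g₂ ^ r * r ≤ q
    g₂≤q = m≤n+m _ (2 * q₁)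

  stab = stability j q
  blow = cliques⇒blowup (suc k) t (proj₁ stab)

  N : ℕ
  N = proj₁ blow + Q * suc η₀ + suc k

  module Extremal {n : ℕ} (n-large : N ≤ n) (G : Graph n) (no-blowup : ¬ Blowup G (suc k) t)
           (optimal : ∀ (p : Fin n → Fin k) → crossPower r p ≤ e r G) where
    open ≤-Reasoning

    n>k : k < n
    n>k = ≤-trans (m≤n+m (suc k) _) n-large

    n>0 : 0 < n
    n>0 = ≤-<-trans z≤n n>k

    η = proj₁ (quotient-exists Q n Q>0)
    Qη≤n = proj₁ (proj₂ (quotient-exists Q n Q>0))
    n<Qη = proj₂ (proj₂ (quotient-exists Q n Q>0))

    η₀<η : η₀ < η
    η₀<η = s≤s⁻¹ (*-cancelˡ-< Q (suc η₀) (suc η) (≤-<-trans (≤-trans (m≤n+m (Q * suc η₀) (proj₁ blow)) (≤-trans (m≤m+n _ (suc k)) n-large)) n<Qη))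

    n≤2Qη : n ≤ 2 * Q * η
    n≤2Qη = begin
      n               ≤⟨ <⇒≤ n<Qη ⟩
      Q * suc η       ≤⟨ *-monoʳ-≤ Q (+-monoˡ-≤ η (≤-trans (s≤s z≤n) η₀<η)) ⟩
      Q * (η + η)     ≡⟨ eq Q η ⟩
      2 * Q * η       ∎
      where
      eq : ∀ Q η → Q * (η + η) ≡ 2 * Q * η
      eq = solve-∀

    Y X : (Fin n → Fin k) → ℕ
    Y p = sumFin (λ v → deg G v ∸ cross p v)
    X p = sumFin (λ v → cross p v ∸ deg G v)

    X-small : ∀ g p → g ^ r * r * Y p ≤ n * n → g * X p ≤ 2 * (n * n)
    X-small g p = deficit-small ρ g (deg G) (cross p) n>0 (deg≤ G) (optimal p)

    Y≤inner : ∀ p → Y p ≤ innerEdges G p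
    Y≤inner p = sum-mono (λ v → m≤n+o⇒m∸n≤o (deg G v) (cross p v) (deg≤cross+inn G p v))

    -- Stability bounds the inner edges by X + ε. Its small excess is fed into `deficit-small`,
    -- where optimality of G against the complete k-partite graph of p₁ makes X small too.
    near : Σ (Fin n → Fin k) λ p₁ → q₁ * innerEdges G p₁ ≤ n * n
    near with proj₂ stab G (λ _ → true)
    ... | inj₁ many = ⊥-elim (no-blowup (proj₂ blow (≤-trans (≤-trans (m≤m+n (proj₁ blow) _) (m≤m+n _ (suc k))) n-large) G many))
    ... | inj₂ (p₁ , ε , qε≤ , Y≤ , I≤) = p₁ , *-cancelˡ {c = 4} (s≤s z≤n) (lin 0
        (+-mono-≤ (*-monoʳ-≤ (4 * q₁) I≤′) (+-mono-≤ X≤ (+-mono-≤ ε≤ ε≤)))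
        (eq q₁ (innerEdges G p₁) (X p₁) ε (n * n)))
      where
      one : (f : Fin n → ℕ) → sumFin (λ v → 1 * f v) ≡ sumFin f
      one f = sum-cong (λ v → +-identityʳ (f v))
      Y≤′ : Y p₁ ≤ ε
      Y≤′ = ≤-trans (≤-reflexive (sym (one (λ v → deg G v ∸ cross p₁ v)))) Y≤
      I≤′ : innerEdges G p₁ ≤ X p₁ + ε
      I≤′ = ≤-trans (≤-reflexive (sym (one (inn G p₁)))) (≤-trans I≤ (≤-reflexive (cong (_+ ε) (one (λ v → cross p₁ v ∸ deg G v)))))
      ε≤ : 2 * q₁ * ε ≤ n * n
      ε≤ = ≤-trans (*-monoˡ-≤ ε q₁≤q) qε≤
      X≤ : 4 * q₁ * X p₁ ≤ 2 * (n * n)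
      X≤ = subst (λ a → a * X p₁ ≤ 2 * (n * n)) g₂≡ (X-small g₂ p₁ (≤-trans (*-mono-≤ g₂≤q Y≤′) qε≤))
      eq : ∀ q I X ε N → 4 * (q * I) + (4 * q * (X + ε) + (2 * N + (N + N))) + 0
        ≡ 4 * N + (4 * q * I + (4 * q * X + (2 * q * ε + 2 * q * ε)))
      eq = solve-∀

    pv = proj₁ (minimal-innerEdges j G)
    p : Fin n → Fin k
    p = lookup pv

    p-minimal : ∀ q → innerEdges G p ≤ innerEdges G q
    p-minimal = proj₂ (minimal-innerEdges j G)

    I = innerEdges G p

    q₁I : q₁ * I ≤ n * n
    q₁I = ≤-trans (*-monoʳ-≤ q₁ (p-minimal (proj₁ near))) (proj₂ near)

    weaken : ∀ {a} → a ≤ q₁ → a * I ≤ n * n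
    weaken h = ≤-trans (*-monoˡ-≤ I h) q₁I

    gX : g * X p ≤ 2 * (n * n)
    gX = X-small g p (≤-trans (*-monoʳ-≤ (g ^ r * r) (Y≤inner p)) (weaken g≤q₁))

    -- A missing cross edge shows up as a deficit or is compensated by an inner edge, so the total
    -- is at most X + I. The 8 in E is 2 for these two terms times 4 from n ≤ 2Qη squared.
    miss-total : sumFin (miss G p) ≤ η * η
    miss-total = *-cancelˡ {c = 8 * (Q * Q)} (*-mono-< {0} {8} (s≤s z≤n) (*-mono-< Q>0 Q>0)) (lin 0
      (+-mono-≤ (*-monoʳ-≤ E M≤) (+-mono-≤ EX (+-mono-≤ (weaken E≤q₁) (+-mono-≤ n² n²))))
      (trans (cong (λ a → a * M + (E * (X p + I) + (n * n + (n * n + (S + S)))) + 0) (sym E≡))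
        (trans (eq E M (X p) I (n * n) S) (cong (_+ (E * M + (E * X p + (E * I + (n * n + n * n)))))
          (eq′ Q η)))))
      where
      M = sumFin (miss G p)
      S = (2 * Q * η) * (2 * Q * η)
      M≤ : sumFin (miss G p) ≤ X p + I
      M≤ = ≤-trans (sum-mono (miss-≤ G p)) (≤-reflexive (sum-+ (λ v → cross p v ∸ deg G v) (inn G p)))
      EX : E * X p ≤ n * n
      EX = *-cancelˡ {c = 2} (s≤s z≤n) (≤-trans (≤-reflexive (trans (sym (*-assoc 2 E (X p))) (cong (_* X p) (sym g≡)))) gX)
      n² : n * n ≤ (2 * Q * η) * (2 * Q * η)
      n² = *-mono-≤ n≤2Qη n≤2Qη
      eq : ∀ E M X I N S → E * M + (E * (X + I) + (N + (N + (S + S)))) + 0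
        ≡ 2 * S + (E * M + (E * X + (E * I + (N + N))))
      eq = solve-∀
      eq′ : ∀ Q η → 2 * ((2 * Q * η) * (2 * Q * η)) ≡ 8 * (Q * Q) * (η * η)
      eq′ = solve-∀

    -- A small part could be rebalanced to a complete k-partite graph better than that of p by order
    -- n ^ (1 + r). By optimality its value is at most that of G, which exceeds the value of p by at
    -- most r n ^ ρ per unit of I, and I is too small for that.
    no-better : (Σ (Fin n → Fin k) λ p′ → Σ ℕ λ h → n ≤ K * h ×
      2 * crossPower r p + h ^ suc r ≤ 2 * crossPower r p′) → ⊥
    no-better (p′ , h , n≤Kh , better) = <⇒≱ (*-mono-< n>0 n>0) (≤-trans n²≤ (≤-trans (*-monoʳ-≤ z I≤0) (≤-reflexive (*-zeroʳ z))))
      where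
      z = 2 * (r * K ^ suc r)
      h≤ : h ^ suc r ≤ 2 * (r * (n ^ ρ * Y p))
      h≤ = lin 0 (+-mono-≤ better (+-mono-≤ (*-monoʳ-≤ 2 (optimal p′)) (*-monoʳ-≤ 2 (power-sum-≤ ρ (deg G) (cross p) (deg≤ G)))))
        (eq (h ^ suc r) (crossPower r p) (crossPower r p′) (e r G) (r * (n ^ ρ * Y p)))
        where
        eq : ∀ H E E′ G Z → H + (2 * E′ + (2 * G + 2 * (E + Z))) + 0 ≡ 2 * Z + (2 * E + H + (2 * E′ + 2 * G))
        eq = solve-∀
      n²≤ : n * n ≤ z * I
      n²≤ = *-cancelˡ (pow>0 n ρ n>0) (begin
        n ^ ρ * (n * n)         ≡⟨ eq₁ (n ^ ρ) n ⟩
        n ^ suc r               ≤⟨ ^-monoˡ-≤ (suc r) n≤Kh ⟩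
        (K * h) ^ suc r         ≡⟨ pow-* K h (suc r) ⟩
        K ^ suc r * h ^ suc r   ≤⟨ *-monoʳ-≤ (K ^ suc r) h≤ ⟩
        K ^ suc r * (2 * (r * (n ^ ρ * Y p))) ≡⟨ eq₂ (K ^ suc r) r (n ^ ρ) (Y p) ⟩
        n ^ ρ * (z * Y p)       ≤⟨ *-monoʳ-≤ (n ^ ρ) (*-monoʳ-≤ z (Y≤inner p)) ⟩
        n ^ ρ * (z * I)         ∎)
        where
        eq₁ : ∀ a n → a * (n * n) ≡ n * (n * a)
        eq₁ = solve-∀
        eq₂ : ∀ A r N Y → A * (2 * (r * (N * Y))) ≡ N * (2 * (r * A) * Y)
        eq₂ = solve-∀
      -- This is why q₁ contains z + 1 and not just z: n ^ 2 ≤ z I and (z + 1) I ≤ n ^ 2 leave only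
      -- I = 0.
      I≤0 : I ≤ 0
      I≤0 = lin 0 (+-mono-≤ n²≤ (weaken K≤q₁)) (eq I z (n * n))
        where
        eq : ∀ I z N → I + (z * I + N) + 0 ≡ 0 + (N + (z + 1) * I)
        eq = solve-∀

    parts : ∀ i → n ≤ C * partSize p i
    parts i = decide (≤-<-connex n (C * partSize p i))
      where
      decide : (n ≤ C * partSize p i) ⊎ (C * partSize p i < n) → n ≤ C * partSize p i
      decide (inj₁ large) = large
      decide (inj₂ small) = ⊥-elim (no-better (rebalance j ρ p i n>k small))

    structured : Structured G p η c C
    structured = record
      { part≥cη = λ i → *-cancelˡ C>0 (begin
          C * (c * η)          ≤⟨ *-monoʳ-≤ C (m≤n+m (c * η) η) ⟩
          C * (suc c * η)      ≡⟨ trans (cong (_* η) Q≡) (*-assoc C (suc c) η) ⟨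
          Q * η                ≤⟨ Qη≤n ⟩
          n                    ≤⟨ parts i ⟩
          C * partSize p i     ∎)
      ; part≥n/C = parts
      ; miss-sum = miss-total
      ; inn≤nbrs = minimal⇒inn≤nbrsIn G p p-minimal
      }

-- The order of quantifiers matters: c and η₀ may be chosen in terms of the forbidden graph and of
-- `partConst`, which depends on neither.
structure : ∀ j ρ c η₀ t → Σ ℕ λ N → ∀ {n} → N ≤ n → (G : Graph n) → ¬ Blowup G (suc (suc j)) t →
  (∀ (p : Fin n → Fin (suc j)) → crossPower (suc ρ) p ≤ e (suc ρ) G) →
  Σ ℕ λ η → Σ (Vec (Fin (suc j)) n) λ pv →
    η₀ < η × Structured G (lookup pv) η c (partConst (suc j) ρ)
structure j ρ c η₀ t = N , λ n-large G no-blowup optimal → conclude n-large G no-blowup optimal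
  where
  open StructureProof j ρ c η₀ t
  conclude : ∀ {n} → N ≤ n → (G : Graph n) → ¬ Blowup G (suc (suc j)) t → (∀ (p : Fin n → Fin (suc j)) → crossPower (suc ρ) p ≤ e (suc ρ) G) →
    Σ ℕ λ η → Σ (Vec (Fin (suc j)) n) λ pv → η₀ < η × Structured G (lookup pv) η c (partConst (suc j) ρ)
  conclude n-large G no-blowup optimal = M.η , M.pv , M.η₀<η , M.structured
    where module M = Extremal n-large G no-blowup optimal

-- Greedy embedding

count-∧not : ∀ {n} (f g : Fin n → Bool) → count f ≤ count (λ v → f v ∧ not (g v)) + count g
count-∧not f g = begin
  count f ≡⟨ count-split f g ⟩
  count (λ v → f v ∧ g v) + count (λ v → f v ∧ not (g v)) ≤⟨ +-monoˡ-≤ _ (count-mono (λ v → ∧-elimʳ {f v})) ⟩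
  count g + count (λ v → f v ∧ not (g v)) ≡⟨ +-comm (count g) _ ⟩
  count (λ v → f v ∧ not (g v)) + count g ∎
  where open ≤-Reasoning

markov : ∀ {n} (f : Fin n → ℕ) t → t * count (λ v → le t (f v)) ≤ sumFin f
markov f t = begin
  t * count (λ v → le t (f v)) ≡⟨ trans (cong (t *_) (count≡sum (λ v → le t (f v)))) (sym (sum-* t (λ v → ⟦ le t (f v) ⟧))) ⟩
  sumFin (λ v → t * ⟦ le t (f v) ⟧) ≤⟨ sum-mono (λ v → point (f v)) ⟩
  sumFin f ∎
  where
  open ≤-Reasoning
  point : ∀ x → t * ⟦ le t x ⟧ ≤ x
  point x with true⊎false (le t x)
  ... | inj₁ e rewrite e = ≤-trans (≤-reflexive (*-identityʳ t)) (le⇒≤ e)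
  ... | inj₂ e rewrite e = ≤-trans (≤-reflexive (*-zeroʳ t)) z≤n

module Embedding {n : ℕ} {k : ℕ} (G : Graph n) (p : Fin n → Fin k) (η : ℕ) where
  open ≤-Reasoning

  -- The tail is embedded first; each of its free vertices then forbids its own image and at most η
  -- missed cross vertices, whence suc η. Fixed vertices forbid nothing here, since the candidate
  -- sets supplied by `embed` already respect them.
  greedy : ∀ m (fix : Fin m → Bool) (s : Fin m → Fin n) (S : Fin m → Fin n → Bool) →
    (∀ u v → fix u ≡ false → S u v ≡ true → miss G p v ≤ η) →
    (∀ u → fix u ≡ false → m * suc η < count (S u)) →
    Σ (Fin m → Fin n) λ f → (∀ u → fix u ≡ true → f u ≡ s u) × (∀ u → fix u ≡ false → S u (f u) ≡ true) ×
      (∀ u w → u ≢ w → fix u ≡ false → fix w ≡ false →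
        f u ≢ f w × (p (f u) ≢ p (f w) → adj G (f u) (f w) ≡ true))
  greedy zero    fix s S good big = (λ ()) , (λ ()) , (λ ()) , (λ ())
  greedy (suc m) fix s S good big = extend-all (greedy m (fix ∘ suc) (s ∘ suc) (S ∘ suc) (good ∘ suc)
      (λ u e → ≤-<-trans (m≤n+m (m * suc η) (suc η)) (big (suc u) e)))
    where
    Result : ∀ m (fix : Fin m → Bool) (s : Fin m → Fin n) (S : Fin m → Fin n → Bool) → Set
    Result m fix s S = Σ (Fin m → Fin n) λ f → (∀ u → fix u ≡ true → f u ≡ s u) × (∀ u → fix u ≡ false → S u (f u) ≡ true) ×
      (∀ u w → u ≢ w → fix u ≡ false → fix w ≡ false →
        f u ≢ f w × (p (f u) ≢ p (f w) → adj G (f u) (f w) ≡ true))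
    extend-all : Result m (fix ∘ suc) (s ∘ suc) (S ∘ suc) → Result (suc m) fix s S
    extend-all (f′ , f′-fix , f′-S , f′-pairs) = extend (true⊎false (fix zero))
     where
     bad : Fin m → Fin n → Bool
     bad j v = not (fix (suc j)) ∧ ((f′ j == v) ∨ (not (p (f′ j) == p v) ∧ not (adj G (f′ j) v)))
     bad-count : ∀ j → count (bad j) ≤ suc η
     bad-count j with true⊎false (fix (suc j))
     ... | inj₁ e = ≤-trans (≤-reflexive (count-none {n} {bad j} (λ v → cong (λ b → not b ∧ ((f′ j == v) ∨ (not (p (f′ j) == p v) ∧ not (adj G (f′ j) v)))) e))) z≤n
     ... | inj₂ e = begin
       count (bad j) ≤⟨ count-mono {n} {bad j} (λ v → ∧-elimʳ {not (fix (suc j))}) ⟩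
       count (λ v → (f′ j == v) ∨ (not (p (f′ j) == p v) ∧ not (adj G (f′ j) v))) ≤⟨ count-∨≤ (f′ j ==_) _ ⟩
       count (f′ j ==_) + miss G p (f′ j) ≤⟨ +-mono-≤ (≤-reflexive (count-≡ (f′ j))) (good (suc j) (f′ j) e (f′-S j e)) ⟩
       suc η ∎
     cons : Fin n → Fin (suc m) → Fin n
     cons x zero    = x
     cons x (suc u) = f′ u
     extend : (fix zero ≡ true) ⊎ (fix zero ≡ false) → Result (suc m) fix s S
     extend (inj₁ e) = cons (s zero) , (λ { zero _ → refl ; (suc u) → f′-fix u }) ,
       (λ { zero e′ → ⊥-elim (true≢false e e′) ; (suc u) → f′-S u }) ,
       λ { zero w _ e′ _ → ⊥-elim (true≢false e e′) ; (suc u) zero _ _ e′ → ⊥-elim (true≢false e e′)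
         ; (suc u) (suc w) u≢w → f′-pairs u w (u≢w ∘ cong suc) }
     extend (inj₂ e) = cons x , (λ { zero e′ → ⊥-elim (true≢false e′ e) ; (suc u) → f′-fix u }) ,
       (λ { zero _ → x∈S ; (suc u) → f′-S u }) ,
       λ { zero zero u≢w → ⊥-elim (u≢w refl)
         ; zero (suc w) _ _ e′ → (λ q → proj₁ (new w e′) (sym q)) , λ q → trans (adj-sym G x (f′ w)) (proj₂ (new w e′) (q ∘ sym))
         ; (suc u) zero _ e′ _ → new u e′
         ; (suc u) (suc w) u≢w → f′-pairs u w (u≢w ∘ cong suc) }
       where
       pick = count>⇒avoiding (S zero) bad (≤-<-trans (≤-trans (sum-≤const (suc η) bad-count) (m≤n+m (m * suc η) (suc η))) (big zero e))
       x = proj₁ pick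
       x∈S = proj₁ (proj₂ pick)
       new : ∀ j → fix (suc j) ≡ false → f′ j ≢ x × (p (f′ j) ≢ p x → adj G (f′ j) x ≡ true)
       new j e′ = (λ q → true≢false (∧-intro (not-intro e′) (∨-introˡ (≡⇒== q))) (proj₂ (proj₂ pick) j)) ,
         λ q → not-false (≢true⇒false (λ h → true≢false (∧-intro (not-intro e′)
           (∨-introʳ {f′ j == x} (∧-intro (not-intro (≢⇒==false q)) h))) (proj₂ (proj₂ pick) j)))

  record Embeds {m : ℕ} (F : Graph m) (fix : Fin m → Bool) (s : Fin m → Fin n) (U : Fin n → Bool) : Set where
    field
      map    : Fin m → Fin n
      inj    : Injective _≡_ _≡_ map
      edges  : ∀ u v → adj F u v ≡ true → adj G (map u) (map v) ≡ true
      fixed  : ∀ u → fix u ≡ true → map u ≡ s u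
      avoids : ∀ u → fix u ≡ false → U (map u) ≡ false

  -- Candidates in `S u` are joined to the seeds that u needs, so only `U` and the seeds themselves
  -- must still be avoided; `used` removes both before the greedy choice.
  embed : ∀ {m} (F : Graph m) (fix : Fin m → Bool) (s : Fin m → Fin n) (c : Fin m → Fin k)
    (S : Fin m → Fin n → Bool) (U : Fin n → Bool) → 0 < η → m + count U ≤ η →
    (∀ u w → fix u ≡ true → fix w ≡ true → adj F u w ≡ true → adj G (s u) (s w) ≡ true) →
    (∀ u w → fix u ≡ true → fix w ≡ true → s u ≡ s w → u ≡ w) →
    (∀ u w → fix u ≡ false → fix w ≡ false → adj F u w ≡ true → c u ≢ c w) →
    (∀ u v → fix u ≡ false → S u v ≡ true → p v ≡ c u × miss G p v ≤ η ×
      (∀ w → fix w ≡ true → adj F u w ≡ true → adj G v (s w) ≡ true)) →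
    (∀ u → fix u ≡ false → (2 * m + 2) * η ≤ count (S u)) →
    Embeds F fix s U
  embed {m} F fix s c S U η>0 U-small fix-adj fix-inj col spec big = build (greedy m fix s S′ (λ u v e h → proj₁ (proj₂ (spec u v e (∧-elimˡ h)))) S′-big)
    where
    used : Fin n → Bool
    used v = U v ∨ someF (λ w → s w == v)
    S′ : Fin m → Fin n → Bool
    S′ u v = S u v ∧ not (used v)
    used-count : count used ≤ η
    used-count = ≤-trans (count-∨≤ U _) (≤-trans (+-monoʳ-≤ (count U) (count-image≤ s)) (≤-trans (≤-reflexive (+-comm (count U) m)) U-small))
    -- Budget of 2m + 2 units: one for `used`, 2m for m (η + 1) ≤ 2mη, and one for strictness, using
    -- η ≥ 1.
    S′-big : ∀ u → fix u ≡ false → m * suc η < count (S′ u)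
    S′-big u e = lin 0 (+-mono-≤ (big u e) (+-mono-≤ (count-∧not (S u) used) (+-mono-≤ used-count (+-mono-≤ (*-monoʳ-≤ m η>0) η>0))))
      (eq m η (count (S u)) (count (S′ u)) (count used))
      where
      eq : ∀ m η a b d → 1 + m * (1 + η) + (a + (b + d + (η + (m * η + η)))) + 0
        ≡ b + ((2 * m + 2) * η + (a + (d + (m * 1 + 1))))
      eq = solve-∀
    build : (Σ (Fin m → Fin n) λ f → (∀ u → fix u ≡ true → f u ≡ s u) × (∀ u → fix u ≡ false → S′ u (f u) ≡ true) ×
      (∀ u w → u ≢ w → fix u ≡ false → fix w ≡ false →
        f u ≢ f w × (p (f u) ≢ p (f w) → adj G (f u) (f w) ≡ true))) → Embeds F fix s U
    build (f , f-fix , f-S′ , f-pairs) = record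
        { map = f ; inj = λ {u} {w} → f-inj u w (true⊎false (fix u)) (true⊎false (fix w)) (u F.≟ w) ; edges = λ u w → f-adj u w (true⊎false (fix u)) (true⊎false (fix w))
        ; fixed = f-fix ; avoids = λ u e → ≢true⇒false (λ h → true≢false (∨-introˡ h) (f-avoid u e)) }
     where
     f-S : ∀ u → fix u ≡ false → S u (f u) ≡ true
     f-S u e = ∧-elimˡ (f-S′ u e)
     f-avoid : ∀ u → fix u ≡ false → used (f u) ≡ false
     f-avoid u e = not-elim (∧-elimʳ {S u (f u)} (f-S′ u e))
     f≢s : ∀ u w → fix u ≡ false → f u ≢ s w
     f≢s u w e q = true≢false (∨-introʳ {U (f u)} (someF-intro _ w (≡⇒== (sym q)))) (f-avoid u e)
     f-inj : ∀ u w → (fix u ≡ true) ⊎ (fix u ≡ false) → (fix w ≡ true) ⊎ (fix w ≡ false) → Dec (u ≡ w) → f u ≡ f w → u ≡ w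
     f-inj u w (inj₁ e) (inj₁ e′) _ q = fix-inj u w e e′ (trans (sym (f-fix u e)) (trans q (f-fix w e′)))
     f-inj u w (inj₁ e) (inj₂ e′) _ q = ⊥-elim (f≢s w u e′ (trans (sym q) (f-fix u e)))
     f-inj u w (inj₂ e) (inj₁ e′) _ q = ⊥-elim (f≢s u w e (trans q (f-fix w e′)))
     f-inj u w (inj₂ e) (inj₂ e′) (yes r) q = r
     f-inj u w (inj₂ e) (inj₂ e′) (no r)  q = ⊥-elim (proj₁ (f-pairs u w r e e′) q)
     f-adj : ∀ u w → (fix u ≡ true) ⊎ (fix u ≡ false) → (fix w ≡ true) ⊎ (fix w ≡ false) →
       adj F u w ≡ true → adj G (f u) (f w) ≡ true
     f-adj u w (inj₁ e) (inj₁ e′) a = subst₂ (λ x y → adj G x y ≡ true) (sym (f-fix u e)) (sym (f-fix w e′)) (fix-adj u w e e′ a)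
     f-adj u w (inj₂ e) (inj₁ e′) a = subst (λ y → adj G (f u) y ≡ true) (sym (f-fix w e′)) (proj₂ (proj₂ (spec u (f u) e (f-S u e))) w e′ a)
     f-adj u w (inj₁ e) (inj₂ e′) a = trans (adj-sym G (f u) (f w)) (subst (λ y → adj G (f w) y ≡ true) (sym (f-fix u e))
       (proj₂ (proj₂ (spec w (f w) e′ (f-S w e′))) u e (trans (adj-sym F w u) a)))
     f-adj u w (inj₂ e) (inj₂ e′) a = proj₂ (f-pairs u w (λ { refl → true≢false a (irrefl F u) }) e e′)
       (λ q → col u w e e′ a (trans (sym (proj₁ (spec u (f u) e (f-S u e)))) (trans q (proj₁ (spec w (f w) e′ (f-S w e′))))))

  module WithStructure {c C : ℕ} (str : Structured G p η c C) (η>0 : 0 < η) where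
    open Structured str public

    poor : Fin n → Bool
    poor v = le (suc η) (miss G p v)

    -- Markov's inequality; the normalisation of `miss-sum` to η ^ 2 is made for it.
    poor-count : count poor ≤ η
    poor-count = *-cancelˡ η>0 (≤-trans (*-monoˡ-≤ (count poor) (n≤1+n η)) (≤-trans (markov (miss G p) (suc η)) miss-sum))

    ¬poor : ∀ {v} → not (poor v) ≡ true → miss G p v ≤ η
    ¬poor h = s≤s⁻¹ (nle⇒> (not-elim h))

    -- By minimality of the partition, x has in every part at least as many neighbours as in its
    -- own, so F without o can be embedded in the neighbourhood of x. The unit beyond the 2m + 2 of
    -- `embed` pays for poor vertices.
    embed-at-apex : ∀ {m} (F : Graph m) (o : Fin m) (col : Fin m → Fin k) (x : Fin n) (U : Fin n → Bool) →
      m + count U ≤ η → (2 * m + 3) * η ≤ inn G p x →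
      (∀ u w → u ≢ o → w ≢ o → adj F u w ≡ true → col u ≢ col w) →
      Embeds F (_== o) (λ _ → x) U
    embed-at-apex {m} F o col x U U-small x-rich col-ok = embed F (_== o) (λ _ → x) col S U η>0 U-small
      (λ u w e e′ a → ⊥-elim (true≢false (subst₂ (λ y z → adj F y z ≡ true) (==⇒≡ e) (==⇒≡ e′) a) (irrefl F o)))
      (λ u w e e′ _ → trans (==⇒≡ e) (sym (==⇒≡ e′)))
      (λ u w e e′ → col-ok u w (==false⇒≢ e) (==false⇒≢ e′))
      (λ u v e h → ==⇒≡ (∧-elimʳ {adj G x v} (∧-elimˡ h)) , ¬poor (∧-elimʳ {adj G x v ∧ (p v == col u)} h) ,
        λ w _ _ → trans (adj-sym G v x) (∧-elimˡ (∧-elimˡ {adj G x v ∧ (p v == col u)} h)))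
      (λ u _ → lin 0 (+-mono-≤ x-rich (+-mono-≤ (inn≤nbrs x (col u)) (+-mono-≤ (count-∧not (λ v → adj G x v ∧ (p v == col u)) poor) poor-count)))
        (eq m η (inn G p x) (nbrsIn G p x (col u)) (count (S u)) (count poor)))
      where
      S : Fin m → Fin n → Bool
      S u v = (adj G x v ∧ (p v == col u)) ∧ not (poor v)
      eq : ∀ m η a b d f → (2 * m + 2) * η + (a + (b + (d + f + η))) + 0 ≡ d + ((2 * m + 3) * η + (a + (b + f)))
      eq = solve-∀

    -- A seed spoils at most bη vertices of a part other than its own. The bound on c leaves mb
    -- units for the seeds, one for poor vertices and 2m + 2 for `embed`.
    embed-at-seeds : ∀ {m} (F : Graph m) (fix : Fin m → Bool) (s : Fin m → Fin n) (col : Fin m → Fin k) (U : Fin n → Bool) b →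
      m + count U ≤ η → 2 * m + 3 + m * b ≤ c →
      (∀ u → fix u ≡ true → miss G p (s u) ≤ b * η) →
      (∀ u w → fix u ≡ true → fix w ≡ true → adj F u w ≡ true → adj G (s u) (s w) ≡ true) →
      (∀ u w → fix u ≡ true → fix w ≡ true → s u ≡ s w → u ≡ w) →
      (∀ u w → fix u ≡ false → fix w ≡ false → adj F u w ≡ true → col u ≢ col w) →
      (∀ u w → fix u ≡ false → fix w ≡ true → adj F u w ≡ true → p (s w) ≢ col u) →
      Embeds F fix s U
    embed-at-seeds {m} F fix s col U b U-small c-large s-good fix-adj fix-inj col-ok seed-col =
      embed F fix s col S U η>0 U-small fix-adj fix-inj col-ok
        (λ u v e h → ==⇒≡ (∧-elimˡ h) , ¬poor (not-intro (≢true⇒false (λ q → true≢false (∨-introˡ q) (not-elim (∧-elimʳ {p v == col u} h))))) ,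
          λ w fw a → trans (adj-sym G v (s w)) (not-false (≢true⇒false (λ q → true≢false
            (∨-introʳ {poor v} (someF-intro (λ w → far u w v) w (∧-intro fw (∧-intro (∧-intro (not-intro (≢⇒==false (seed-col u w e fw a))) (∧-elimˡ h)) q))))
            (not-elim (∧-elimʳ {p v == col u} h))))))
        (λ u _ → S-big u)
      where
      -- The guard that the part of the seed differs from `col u` makes every vertex counted a
      -- missed cross vertex of the seed; within its own part a seed excludes nothing.
      far : Fin m → Fin m → Fin n → Bool
      far u w v = fix w ∧ ((not (p (s w) == col u) ∧ (p v == col u)) ∧ not (adj G (s w) v))
      S : Fin m → Fin n → Bool
      S u v = (p v == col u) ∧ not (poor v ∨ someF (λ w → far u w v))
      far-count : ∀ u w → count (far u w) ≤ b * η
      far-count u w with true⊎false (fix w)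
      ... | inj₂ e = ≤-trans (≤-reflexive (count-none {n} {far u w} (λ v → cong (_∧ _) e))) z≤n
      ... | inj₁ e = ≤-trans (count-mono {n} {far u w} (λ v h → lemma v (∧-elimʳ {fix w} h))) (s-good w e)
        where
        lemma : ∀ v → (not (p (s w) == col u) ∧ (p v == col u)) ∧ not (adj G (s w) v) ≡ true →
          not (p (s w) == p v) ∧ not (adj G (s w) v) ≡ true
        lemma v h = ∧-intro (trans (cong (λ i → not (p (s w) == i)) (==⇒≡ (∧-elimʳ {not (p (s w) == col u)} (∧-elimˡ h))))
            (∧-elimˡ (∧-elimˡ {not (p (s w) == col u) ∧ (p v == col u)} h)))
          (∧-elimʳ {not (p (s w) == col u) ∧ (p v == col u)} h)
      S-big : ∀ u → (2 * m + 2) * η ≤ count (S u)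
      S-big u = lin 0 (+-mono-≤ (part≥cη (col u)) (+-mono-≤ (*-monoˡ-≤ η c-large)
          (+-mono-≤ (count-∧not (λ v → p v == col u) bad) (+-mono-≤ (count-∨≤ poor (λ v → someF (λ w → far u w v)))
            (+-mono-≤ poor-count (≤-trans (count-someF≤ (far u)) (sum-≤const (b * η) (far-count u))))))))
        (eq m η c b (partSize p (col u)) (count (S u)) (count bad) (count poor) (count (λ v → someF (λ w → far u w v))))
        where
        bad : Fin n → Bool
        bad v = poor v ∨ someF (λ w → far u w v)
        eq : ∀ m η c b P S B R T → (2 * m + 2) * η + (P + (c * η + (S + B + (R + T + (η + m * (b * η)))))) + 0
          ≡ S + (c * η + ((2 * m + 3 + m * b) * η + (P + (B + (R + T)))))
        eq = solve-∀

-- Colourings, disjoint unions and blow-ups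

Colorable-mono : ∀ {n c d} (G : Graph n) → c ≤ d → Colorable G c → Colorable G d
Colorable-mono G c≤d (f , ok) = (λ v → inject≤ (f v) c≤d) , λ u v a e → ok u v a (FP.inject≤-injective c≤d c≤d _ _ e)

mkGraph-elim : ∀ {n} (R : Fin n → Fin n → Bool) u v → adj (mkGraph R) u v ≡ true →
  ((R u v ≡ true) ⊎ (R v u ≡ true)) × u ≢ v
mkGraph-elim R u v h = ∨-elim (∧-elimˡ h) , ==false⇒≢ (not-elim (∧-elimʳ {R u v ∨ R v u} h))

mkGraph-intro : ∀ {n} (R : Fin n → Fin n → Bool) u v → R u v ≡ true → u ≢ v → adj (mkGraph R) u v ≡ true
mkGraph-intro R u v h ne = ∧-intro (∨-introˡ h) (not-intro (≢⇒==false ne))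

module _ {m n : ℕ} (G : Graph m) (H : Graph n) where

  disjointUnion-elim : ∀ u v → adj (disjointUnion G H) u v ≡ true →
    (Σ (Fin m) λ a → Σ (Fin m) λ b → splitAt m u ≡ inj₁ a × splitAt m v ≡ inj₁ b × adj G a b ≡ true) ⊎
    (Σ (Fin n) λ a → Σ (Fin n) λ b → splitAt m u ≡ inj₂ a × splitAt m v ≡ inj₂ b × adj H a b ≡ true)
  disjointUnion-elim u v h with splitAt m u | splitAt m v
  ... | inj₁ a | inj₁ b = inj₁ (a , b , refl , refl , lemma (∨-elim (∧-elimˡ h)))
    where
    lemma : (adj G a b ≡ true) ⊎ (adj G b a ≡ true) → adj G a b ≡ true
    lemma (inj₁ e) = e
    lemma (inj₂ e) = trans (adj-sym G a b) e
  ... | inj₂ a | inj₂ b = inj₂ (a , b , refl , refl , lemma (∨-elim (∧-elimˡ h)))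
    where
    lemma : (adj H a b ≡ true) ⊎ (adj H b a ≡ true) → adj H a b ≡ true
    lemma (inj₁ e) = e
    lemma (inj₂ e) = trans (adj-sym H a b) e
  ... | inj₁ a | inj₂ b = case h of λ ()
  ... | inj₂ a | inj₁ b = case h of λ ()

  disjointUnion-left : ∀ a b → adj G a b ≡ true → adj (disjointUnion G H) (a ↑ˡ n) (b ↑ˡ n) ≡ true
  disjointUnion-left a b h rewrite FP.splitAt-↑ˡ m a n | FP.splitAt-↑ˡ m b n =
    ∧-intro (∨-introˡ h) (not-intro (≢⇒==false λ e → true≢false h
      (trans (cong (adj G a) (sym (FP.↑ˡ-injective n a b e))) (irrefl G a))))

  disjointUnion-right : ∀ a b → adj H a b ≡ true → adj (disjointUnion G H) (m ↑ʳ a) (m ↑ʳ b) ≡ true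
  disjointUnion-right a b h rewrite FP.splitAt-↑ʳ m n a | FP.splitAt-↑ʳ m n b =
    ∧-intro (∨-introˡ h) (not-intro (≢⇒==false λ e → true≢false h
      (trans (cong (adj H a) (sym (FP.↑ʳ-injective m a b e))) (irrefl H a))))

  disjointUnion-colorable : ∀ {c} → Colorable G c → Colorable H c → Colorable (disjointUnion G H) c
  disjointUnion-colorable {c} (f , f-ok) (g , g-ok) = (λ u → [ f , g ]′ (splitAt m u)) , ok
    where
    ok : ∀ u v → adj (disjointUnion G H) u v ≡ true → [ f , g ]′ (splitAt m u) ≢ [ f , g ]′ (splitAt m v)
    ok u v h with disjointUnion-elim u v h
    ... | inj₁ (a , b , eu , ev , ab) rewrite eu | ev = f-ok a b ab
    ... | inj₂ (a , b , eu , ev , ab) rewrite eu | ev = g-ok a b ab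

⨆-colorable : ∀ {c} Gs → All (λ H → Colorable (graph H) c) Gs → Colorable (graph (⨆ Gs)) c
⨆-colorable []       []       = (λ ()) , λ ()
⨆-colorable (G ∷ Gs) (h ∷ hs) = disjointUnion-colorable (graph G) (graph (⨆ Gs)) h (⨆-colorable Gs hs)

-- Vertex u takes position u in the block of its colour, so equally coloured vertices get distinct
-- images.
blowup⇒⊆ : ∀ {m n c} (F : Graph m) (G : Graph n) → Colorable F c → Blowup G c m → F ⊆G G
blowup⇒⊆ F G (col , ok) (X , X-inj , X-adj) = (λ u → X (col u) u) , inj , λ u v a → X-adj (ok u v a) u v
  where
  inj : Injective _≡_ _≡_ (λ u → X (col u) u)
  inj {u} {v} e with col u F.≟ col v
  ... | yes q = X-inj (col v) (trans (cong (λ i → X i u) (sym q)) e)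
  ... | no q  = ⊥-elim (true≢false (X-adj q u v) (trans (cong (adj G (X (col u) u)) (sym e)) (irrefl G _)))

unique-of-count-1 : ∀ {n} (f : Fin n → Bool) → count f ≡ 1 → ∀ u v → f u ≡ true → f v ≡ true → u ≡ v
unique-of-count-1 f one u v fu fv = trans (sym (elem-rank E u fu)) (trans (cong (elem E) (same one (rank E u fu) (rank E v fv))) (elem-rank E v fv))
  where
  E = enumerate f
  same : ∀ {m} → m ≡ 1 → (i j : Fin m) → i ≡ j
  same refl zero zero = refl

-- Maximal matchings

-- Edges are peeled off together with both ends. If this stops before j + 1 edges are found, the
-- ends removed so far form a vertex cover.
matching : ∀ {n} (E : Fin n → Fin n → Bool) j →
  (Σ (Fin (suc j) → Fin n × Fin n) λ M → (∀ i → E (proj₁ (M i)) (proj₂ (M i)) ≡ true) ×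
    (∀ i i′ → i ≢ i′ → ∀ v → (v == proj₁ (M i)) ∨ (v == proj₂ (M i)) ≡ true →
      (v == proj₁ (M i′)) ∨ (v == proj₂ (M i′)) ≡ false)) ⊎
  (Σ (Fin n → Bool) λ U → count U ≤ 2 * j × (∀ x y → E x y ≡ true → U x ∨ U y ≡ true))
matching {n} E j with findTrue (λ x → someF (E x))
... | inj₂ none = inj₂ ((λ _ → false) , ≤-trans (≤-reflexive (count-none {n} (λ _ → refl))) z≤n ,
        λ x y h → ⊥-elim (true≢false (someF-intro (E x) y h) (none x)))
... | inj₁ (x , h) with someF-elim (E x) h
matching E zero | inj₁ (x , h) | y , xy = inj₁ ((λ _ → x , y) , (λ _ → xy) , λ { zero zero ne → ⊥-elim (ne refl) })
matching {n} E (suc j) | inj₁ (x , h) | y , xy = extend (matching E′ j)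
  where
  pair : Fin n → Bool
  pair v = (v == x) ∨ (v == y)
  E′ : Fin n → Fin n → Bool
  E′ u w = E u w ∧ (not (pair u) ∧ not (pair w))
  extend : _ → _
  extend (inj₂ (U , U-small , cover)) = inj₂ ((λ v → pair v ∨ U v) , few , cover′)
    where
    few : count (λ v → pair v ∨ U v) ≤ 2 * suc j
    few = ≤-trans (count-∨≤ pair U) (≤-trans (+-mono-≤ (count-∨≤ (_== x) (_== y)) U-small)
      (≤-reflexive (trans (cong₂ (λ a b → a + b + 2 * j) (count-≡ʳ x) (count-≡ʳ y)) (sym (*-suc 2 j)))))
    cover′ : ∀ u w → E u w ≡ true → (pair u ∨ U u) ∨ (pair w ∨ U w) ≡ true
    cover′ u w e with true⊎false (pair u) | true⊎false (pair w)
    ... | inj₁ q | _ = ∨-introˡ (∨-introˡ q)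
    ... | inj₂ q | inj₁ q′ = ∨-introʳ {pair u ∨ U u} (∨-introˡ q′)
    ... | inj₂ q | inj₂ q′ with ∨-elim {U u} (cover u w (∧-intro e (∧-intro (not-intro q) (not-intro q′))))
    ...   | inj₁ z = ∨-introˡ (∨-introʳ {pair u} z)
    ...   | inj₂ z = ∨-introʳ {pair u ∨ U u} (∨-introʳ {pair w} z)
  extend (inj₁ (M , M-E , M-disjoint)) = inj₁ (M⁺ , M⁺-E , M⁺-disjoint)
    where
    M⁺ : Fin (suc (suc j)) → Fin n × Fin n
    M⁺ zero    = x , y
    M⁺ (suc i) = M i
    M⁺-E : ∀ i → E (proj₁ (M⁺ i)) (proj₂ (M⁺ i)) ≡ true
    M⁺-E zero    = xy
    M⁺-E (suc i) = ∧-elimˡ (M-E i)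
    outside-pair : ∀ i v → (v == proj₁ (M i)) ∨ (v == proj₂ (M i)) ≡ true → pair v ≡ false
    outside-pair i v e with ∨-elim {v == proj₁ (M i)} e
    ... | inj₁ q = trans (cong pair (==⇒≡ q)) (not-elim (∧-elimˡ (∧-elimʳ {E (proj₁ (M i)) (proj₂ (M i))} (M-E i))))
    ... | inj₂ q = trans (cong pair (==⇒≡ q)) (not-elim (∧-elimʳ {not (pair (proj₁ (M i)))} (∧-elimʳ {E (proj₁ (M i)) (proj₂ (M i))} (M-E i))))
    M⁺-disjoint : ∀ i i′ → i ≢ i′ → ∀ v → (v == proj₁ (M⁺ i)) ∨ (v == proj₂ (M⁺ i)) ≡ true →
      (v == proj₁ (M⁺ i′)) ∨ (v == proj₂ (M⁺ i′)) ≡ false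
    M⁺-disjoint zero    zero     ne v e = ⊥-elim (ne refl)
    M⁺-disjoint zero    (suc i′) ne v e = ≢true⇒false (λ q → true≢false e (outside-pair i′ v q))
    M⁺-disjoint (suc i) zero     ne v e = outside-pair i v e
    M⁺-disjoint (suc i) (suc i′) ne v e = M-disjoint i i′ (ne ∘ cong suc) v e

-- Replacing a set S of vertices by singleton parts

GoodPartition : (s k : ℕ) {n : ℕ} → (Fin n → Fin (s + k)) → Set
GoodPartition s k p = Surjective p × (∀ i → partSize p (i ↑ˡ k) ≡ 1)

-- Members of `S` are coloured by their rank, all others keep their part, and no part disappears as
-- each has more than s vertices. The last clause says that q refines p and separates `S`, which is
-- how degrees in the new graph are estimated.
isolate : ∀ {n k s} (S : Fin n → Bool) → count S ≡ s → (p : Fin n → Fin k) → (∀ i → s < partSize p i) →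
  Σ (Vec (Fin (s + k)) n) λ q → GoodPartition s k (lookup q) ×
    (∀ v w → v ≢ w → lookup q v ≡ lookup q w → S v ≡ false × S w ≡ false × p v ≡ p w)
isolate {n} {k} S refl p large = tabulate q , (surj , single) , separated
  where
  s = count S
  E = enumerate S
  place : ∀ v → (S v ≡ true) ⊎ (S v ≡ false) → Fin (s + k)
  place v (inj₁ h) = rank E v h ↑ˡ k
  place v (inj₂ _) = s ↑ʳ p v
  q : Fin n → Fin (s + k)
  q v = place v (true⊎false (S v))
  look : ∀ v → lookup (tabulate q) v ≡ q v
  look = VP.lookup∘tabulate q
  clash : ∀ i j → i ↑ˡ k ≢ s ↑ʳ j
  clash i j e with trans (sym (FP.splitAt-↑ˡ s i k)) (trans (cong (splitAt s) e) (FP.splitAt-↑ʳ s k j))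
  ... | ()
  q-elem : ∀ i x → place (elem E i) x ≡ i ↑ˡ k
  q-elem i (inj₁ h) = cong (_↑ˡ k) (elem-inj E (elem-rank E (elem E i) h))
  q-elem i (inj₂ h) = ⊥-elim (true≢false (elem-∈ E i) h)
  q-free : ∀ v x → S v ≡ false → place v x ≡ s ↑ʳ p v
  q-free v (inj₁ h) e = ⊥-elim (true≢false h e)
  q-free v (inj₂ _) e = refl
  surj : Surjective (lookup (tabulate q))
  surj a with splitAt s a in eq
  ... | inj₁ i = elem E i , trans (look _) (trans (q-elem i (true⊎false (S (elem E i)))) (FP.splitAt⁻¹-↑ˡ eq))
  ... | inj₂ j with count>⇒avoiding {m = 1} (λ v → p v == j) (λ _ → S) (≤-<-trans (≤-reflexive (+-identityʳ s)) (large j))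
  ...   | v , pv , v∉S = v , trans (look v) (trans (q-free v (true⊎false (S v)) (v∉S zero)) (trans (cong (s ↑ʳ_) (==⇒≡ pv)) (FP.splitAt⁻¹-↑ʳ eq)))
  hit : ∀ v i x → place v x ≡ i ↑ˡ k → v ≡ elem E i
  hit v i (inj₁ h) e = trans (sym (elem-rank E v h)) (cong (elem E) (FP.↑ˡ-injective k _ i e))
  hit v i (inj₂ h) e = ⊥-elim (clash i (p v) (sym e))
  single : ∀ i → partSize (lookup (tabulate q)) (i ↑ˡ k) ≡ 1
  single i = trans (count-cong (λ v → ⇔⇒≡ (λ h → ≡⇒== (hit v i (true⊎false (S v)) (trans (sym (look v)) (==⇒≡ h))))
      (λ h → ≡⇒== (trans (look v) (trans (cong q (==⇒≡ h)) (q-elem i (true⊎false (S (elem E i))))))))) (count-≡ʳ (elem E i))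
  sep : ∀ v w x y → v ≢ w → place v x ≡ place w y → S v ≡ false × S w ≡ false × p v ≡ p w
  sep v w (inj₁ h) (inj₁ h′) ne e = ⊥-elim (ne (trans (sym (elem-rank E v h)) (trans (cong (elem E) (FP.↑ˡ-injective k _ _ e)) (elem-rank E w h′))))
  sep v w (inj₁ h) (inj₂ h′) ne e = ⊥-elim (clash _ _ e)
  sep v w (inj₂ h) (inj₁ h′) ne e = ⊥-elim (clash _ _ (sym e))
  sep v w (inj₂ h) (inj₂ h′) ne e = h , h′ , FP.↑ʳ-injective s _ _ e
  separated : ∀ v w → v ≢ w → lookup (tabulate q) v ≡ lookup (tabulate q) w → S v ≡ false × S w ≡ false × p v ≡ p w
  separated v w ne e = sep v w (true⊎false (S v)) (true⊎false (S w)) ne (trans (sym (look v)) (trans e (look w)))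

-- Each graph that is not k-colourable needs a vertex in one of the s singleton parts.

vertices-in-singletons : ∀ {n s k} (p : Fin n → Fin (s + k)) (crit others : List AGraph) →
  All (λ H → ¬ Colorable (graph H) k) crit →
  (f : Fin (size (⨆ (crit ++ others))) → Fin n) →
  (∀ u v → adj (graph (⨆ (crit ++ others))) u v ≡ true → p (f u) ≢ p (f v)) →
  Σ (Fin (length crit) → Fin (size (⨆ (crit ++ others)))) λ h → Injective _≡_ _≡_ h ×
    (∀ i → Σ (Fin s) λ a → p (f (h i)) ≡ a ↑ˡ k)
vertices-in-singletons p [] others [] f proper = (λ ()) , (λ { {()} }) , λ ()
vertices-in-singletons {n} {s} {k} p (H ∷ crit) others (not-col ∷ rest) f proper = h , h-inj , h-in
  where
  a = size H
  b = size (⨆ (crit ++ others))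
  isFirst : Fin s ⊎ Fin k → Bool
  isFirst (inj₁ _) = true
  isFirst (inj₂ _) = false
  found : (∃ λ u → isFirst (splitAt s (p (f (u ↑ˡ b)))) ≡ true) ⊎ (∀ u → isFirst (splitAt s (p (f (u ↑ˡ b)))) ≡ false) →
    Σ (Fin a) λ u → Σ (Fin s) λ i → p (f (u ↑ˡ b)) ≡ i ↑ˡ k
  found (inj₁ (u , e)) with splitAt s (p (f (u ↑ˡ b))) in eq
  ... | inj₁ i = u , i , sym (FP.splitAt⁻¹-↑ˡ eq)
  found (inj₂ none) = ⊥-elim (not-col ((λ u → proj₁ (col u)) , ok))
    where
    toCol : ∀ x → isFirst (splitAt s x) ≡ false → Σ (Fin k) λ j → x ≡ s ↑ʳ j
    toCol x e with splitAt s x in eq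
    ... | inj₂ j = j , sym (FP.splitAt⁻¹-↑ʳ eq)
    col : ∀ u → Σ (Fin k) λ j → p (f (u ↑ˡ b)) ≡ s ↑ʳ j
    col u = toCol _ (none u)
    ok : ∀ u v → adj (graph H) u v ≡ true → proj₁ (col u) ≢ proj₁ (col v)
    ok u v uv e = proper (u ↑ˡ b) (v ↑ˡ b) (disjointUnion-left (graph H) (graph (⨆ (crit ++ others))) u v uv)
      (trans (proj₂ (col u)) (trans (cong (s ↑ʳ_) e) (sym (proj₂ (col v)))))
  first = found (findTrue (λ u → isFirst (splitAt s (p (f (u ↑ˡ b))))))
  rec = vertices-in-singletons p crit others rest (f ∘ (a ↑ʳ_))
    (λ u v uv → proper (a ↑ʳ u) (a ↑ʳ v) (disjointUnion-right (graph H) (graph (⨆ (crit ++ others))) u v uv))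
  h : Fin (suc (length crit)) → Fin (a + b)
  h zero    = proj₁ first ↑ˡ b
  h (suc i) = a ↑ʳ proj₁ rec i
  clash : ∀ (x : Fin a) (y : Fin b) → x ↑ˡ b ≢ a ↑ʳ y
  clash x y e with trans (sym (FP.splitAt-↑ˡ a x b)) (trans (cong (splitAt a) e) (FP.splitAt-↑ʳ a b y))
  ... | ()
  h-inj : Injective _≡_ _≡_ h
  h-inj {zero}  {zero}  e = refl
  h-inj {zero}  {suc j} e = ⊥-elim (clash _ _ e)
  h-inj {suc i} {zero}  e = ⊥-elim (clash _ _ (sym e))
  h-inj {suc i} {suc j} e = cong suc (proj₁ (proj₂ rec) (FP.↑ʳ-injective a _ _ e))
  h-in : ∀ i → Σ (Fin s) λ x → p (f (h i)) ≡ x ↑ˡ k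
  h-in zero    = proj₁ (proj₂ first) , proj₂ (proj₂ first)
  h-in (suc i) = proj₂ (proj₂ rec) i

-- Pigeonhole: s + 1 components each need a vertex of their own in one of s singleton parts.
singletons-free : ∀ {n s k} (p : Fin n → Fin (s + k)) → (∀ i → partSize p (i ↑ˡ k) ≡ 1) →
  ∀ crit others → length crit ≡ suc s → All (λ H → ¬ Colorable (graph H) k) crit →
  (graph (⨆ (crit ++ others)) -free) (completeMP p)
singletons-free {s = s} {k} p single crit others len not-col (f , f-inj , f-adj)
  with vertices-in-singletons p crit others not-col f
         (λ u v uv → ==false⇒≢ (not-elim (trans (sym (completeMP-adj p (f u) (f v))) (f-adj u v uv))))
... | h , h-inj , h-in with FP.pigeonhole (≤-reflexive (sym len)) (λ i → proj₁ (h-in i))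
...   | i , j , i<j , e = FP.<⇒≢ i<j (h-inj (f-inj (unique-of-count-1 (λ w → p w == (proj₁ (h-in j) ↑ˡ k)) (single (proj₁ (h-in j))) (f (h i)) (f (h j))
        (≡⇒== (trans (proj₂ (h-in i)) (cong (_↑ˡ k) e))) (≡⇒== (proj₂ (h-in j))))))

-- Disjoint components with colour-critical edges

transpose-injective : ∀ {k} (i j : Fin k) {x y} → PC.transpose i j x ≡ PC.transpose i j y → x ≡ y
transpose-injective i j {x} {y} e = trans (sym (PC.transpose-inverse j i))
  (trans (cong (PC.transpose j i) e) (PC.transpose-inverse j i))

transpose-at : ∀ {k} (i j : Fin k) → PC.transpose i j i ≡ j
transpose-at i j with i F.≟ i
... | yes _ = refl
... | no ne = ⊥-elim (ne refl)

chromatic-unique : ∀ {n} (G : Graph n) {c d} → ChromaticNumber G c → ChromaticNumber G d → c ≡ d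
chromatic-unique G {c} {d} (c-col , c-min) (d-col , d-min) with <-cmp c d
... | tri< c<d _ _ = ⊥-elim (d-min c c<d c-col)
... | tri≈ _ e _   = e
... | tri> _ _ d<c = ⊥-elim (c-min d d<c d-col)

record CriticalColouring {n : ℕ} (H : Graph n) (k : ℕ) : Set where
  field
    x y    : Fin n
    xy     : adj H x y ≡ true
    col    : Fin n → Fin k
    proper : ∀ u w → adj H u w ≡ true → ¬ (u ≡ x × w ≡ y) → ¬ (u ≡ y × w ≡ x) → col u ≢ col w
    col-xy : col x ≡ col y

-- The ends of the critical edge receive the same colour, for otherwise the colouring of H without
-- this edge would be a proper k-colouring of H.
critical-colouring : ∀ {n k} (H : Graph n) → ChromaticNumber H (suc k) → HasColorCriticalEdge H → CriticalColouring H k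
critical-colouring {n} {k} H χ (x , y , xy , c , χ′ , col′) = build (suc-injective (chromatic-unique H χ′ χ)) col′
  where
  build : c ≡ k → Colorable (deleteEdge H x y) c → CriticalColouring H k
  build refl (col , ok) = record { x = x ; y = y ; xy = xy ; col = col ; proper = proper ; col-xy = same (col x F.≟ col y) }
    where
    proper : ∀ u w → adj H u w ≡ true → ¬ (u ≡ x × w ≡ y) → ¬ (u ≡ y × w ≡ x) → col u ≢ col w
    proper u w uw n₁ n₂ = ok u w (mkGraph-intro (λ u v → adj H u v ∧ not (((u == x) ∧ (v == y)) ∨ ((u == y) ∧ (v == x)))) u w (∧-intro uw (not-intro (≢true⇒false λ h → excluded (∨-elim h))))
        (λ { refl → true≢false uw (irrefl H u) }))
      where
      excluded : ((u == x) ∧ (w == y) ≡ true) ⊎ ((u == y) ∧ (w == x) ≡ true) → ⊥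
      excluded (inj₁ h) = n₁ (==⇒≡ (∧-elimˡ h) , ==⇒≡ (∧-elimʳ {u == x} h))
      excluded (inj₂ h) = n₂ (==⇒≡ (∧-elimˡ h) , ==⇒≡ (∧-elimʳ {u == y} h))
    same : Dec (col x ≡ col y) → col x ≡ col y
    same (yes e) = e
    same (no ne) = ⊥-elim (proj₂ χ k ≤-refl (col , λ u w uw e → lemma u w uw e (u F.≟ x) (w F.≟ y) (u F.≟ y) (w F.≟ x)))
      where
      lemma : ∀ u w → adj H u w ≡ true → col u ≡ col w → Dec (u ≡ x) → Dec (w ≡ y) → Dec (u ≡ y) → Dec (w ≡ x) → ⊥
      lemma u w uw e (yes refl) (yes refl) _ _ = ne e
      lemma u w uw e _ _ (yes refl) (yes refl) = ne (sym e)
      lemma u w uw e (no a) _ (no b) _ = proper u w uw (a ∘ proj₁) (b ∘ proj₁) e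
      lemma u w uw e (no a) _ _ (no b) = proper u w uw (a ∘ proj₁) (b ∘ proj₂) e
      lemma u w uw e _ (no a) (no b) _ = proper u w uw (a ∘ proj₂) (b ∘ proj₁) e
      lemma u w uw e _ (no a) _ (no b) = proper u w uw (a ∘ proj₂) (b ∘ proj₂) e

-- The two sources of a critical component: a vertex of large inner degree, or an inner edge whose
-- ends miss few cross vertices.
data Seed (n : ℕ) : Set where
  apex : Fin n → Seed n
  edge : Fin n → Fin n → Seed n

covers : ∀ {n} → Seed n → Fin n → Bool
covers (apex x)   v = v == x
covers (edge x y) v = (v == x) ∨ (v == y)

covers-count : ∀ {n} (σ : Seed n) → count (covers σ) ≤ 2
covers-count (apex x)   = ≤-trans (≤-reflexive (count-≡ʳ x)) (s≤s z≤n)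
covers-count (edge x y) = ≤-trans (count-∨≤ (_== x) (_== y)) (≤-reflexive (cong₂ _+_ (count-≡ʳ x) (count-≡ʳ y)))

Disjoint : ∀ {n} → (Fin n → Bool) → (Fin n → Bool) → Set
Disjoint A A′ = ∀ v → A v ≡ true → A′ v ≡ false

Avoiding : ∀ {m n} → Graph m → Graph n → (Fin n → Bool) → Set
Avoiding {m} {n} F G U = Σ (Fin m → Fin n) λ f → Injective _≡_ _≡_ f ×
  (∀ u v → adj F u v ≡ true → adj G (f u) (f v) ≡ true) × (∀ u → U (f u) ≡ false)

disjointUnion-avoiding : ∀ {l m n} (F₁ : Graph l) (F₂ : Graph m) (G : Graph n) (U : Fin n → Bool) →
  (a₁ : Avoiding F₁ G U) → (Avoiding F₂ G (λ v → U v ∨ someF (λ u → proj₁ a₁ u == v))) →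
  Avoiding (disjointUnion F₁ F₂) G U
disjointUnion-avoiding {l} {m} {n} F₁ F₂ G U (f₁ , inj₁′ , adj₁ , out₁) (f₂ , inj₂′ , adj₂ , out₂) =
  (λ u → f (splitAt l u)) , (λ {u} {v} → f-inj u v) , f-adj , λ u → f-out (splitAt l u)
  where
  f : Fin l ⊎ Fin m → Fin n
  f = [ f₁ , f₂ ]′
  apart : ∀ a b → f₁ a ≢ f₂ b
  apart a b e = true≢false (∨-introʳ {U (f₂ b)} (someF-intro (λ u → f₁ u == f₂ b) a (≡⇒== e))) (out₂ b)
  f-inj′ : ∀ x y → f x ≡ f y → x ≡ y
  f-inj′ (inj₁ a) (inj₁ b) e = cong inj₁ (inj₁′ e)
  f-inj′ (inj₁ a) (inj₂ b) e = ⊥-elim (apart a b e)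
  f-inj′ (inj₂ a) (inj₁ b) e = ⊥-elim (apart b a (sym e))
  f-inj′ (inj₂ a) (inj₂ b) e = cong inj₂ (inj₂′ e)
  f-inj : ∀ u v → f (splitAt l u) ≡ f (splitAt l v) → u ≡ v
  f-inj u v e = trans (sym (FP.join-splitAt l m u)) (trans (cong (F.join l m) (f-inj′ (splitAt l u) (splitAt l v) e)) (FP.join-splitAt l m v))
  f-adj : ∀ u v → adj (disjointUnion F₁ F₂) u v ≡ true → adj G (f (splitAt l u)) (f (splitAt l v)) ≡ true
  f-adj u v h with disjointUnion-elim F₁ F₂ u v h
  ... | inj₁ (a , b , eu , ev , ab) rewrite eu | ev = adj₁ a b ab
  ... | inj₂ (a , b , eu , ev , ab) rewrite eu | ev = adj₂ a b ab
  f-out : ∀ x → U (f x) ≡ false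
  f-out (inj₁ a) = out₁ a
  f-out (inj₂ b) = ≢true⇒false (λ h → true≢false (∨-introˡ h) (out₂ b))

CriticalGraph : ℕ → AGraph → Set
CriticalGraph k H = ChromaticNumber (graph H) (suc k) × HasColorCriticalEdge (graph H)

module SeedEmbedding {n : ℕ} {k : ℕ} (G : Graph n) (p : Fin n → Fin k) (η : ℕ) {c : ℕ} {C : ℕ}
  (str : Structured G p η c C) (η>0 : 0 < η) (x₀ : Fin n) (m b : ℕ) (c-large : 2 * m + 3 + m * b ≤ c) where
  open Embedding G p η
  open WithStructure str η>0

  Valid : Seed n → Set
  Valid (apex x)   = (2 * m + 3) * η ≤ inn G p x
  Valid (edge x y) = adj G x y ≡ true × p x ≡ p y × miss G p x ≤ b * η × miss G p y ≤ b * η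

  shrink : ∀ {m′} → m′ ≤ m → 2 * m′ + 3 + m′ * b ≤ c
  shrink h = ≤-trans (+-mono-≤ (+-monoˡ-≤ 3 (*-monoʳ-≤ 2 h)) (*-monoˡ-≤ b h)) c-large

  avoiding-fixed : ∀ {l} {H : Graph l} (fix : Fin l → Bool) (s : Fin l → Fin n) (U : Fin n → Bool) →
    (∀ u → fix u ≡ true → U (s u) ≡ false) → Embeds H fix s U → Avoiding H G U
  avoiding-fixed fix s U s∉U E = E.map , E.inj , E.edges , λ u → avoid u (true⊎false (fix u))
    where
    module E = Embeds E
    avoid : ∀ u → (fix u ≡ true) ⊎ (fix u ≡ false) → U (E.map u) ≡ false
    avoid u (inj₁ e) = trans (cong U (E.fixed u e)) (s∉U u e)
    avoid u (inj₂ e) = E.avoids u e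

  -- An apex plays the end x of the critical edge, since H without x is properly coloured. An inner
  -- edge plays the critical edge itself, after a transposition of colours that brings the colour of
  -- x to the part containing the seed.
  embed-critical : ∀ {l} (H : Graph l) → CriticalColouring H k → l ≤ m → (σ : Seed n) → Valid σ →
    (U : Fin n → Bool) → l + count U ≤ η → Disjoint (covers σ) U → Avoiding H G U
  embed-critical {l} H crit l≤m (apex a) valid U U-small disjoint =
    avoiding-fixed (_== x) (λ _ → a) U (λ u _ → disjoint a (==-refl a)) (embed-at-apex H x col a U U-small
      (≤-trans (*-monoˡ-≤ η (+-monoˡ-≤ 3 (*-monoʳ-≤ 2 l≤m))) valid)
      (λ u w u≢x w≢x uw → proper u w uw (u≢x ∘ proj₁) (w≢x ∘ proj₂)))
    where
    open CriticalColouring crit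
  embed-critical {l} H crit l≤m (edge a a′) (aa′ , pa≡pa′ , a-good , a′-good) U U-small disjoint =
    avoiding-fixed fix s U s∉U (embed-at-seeds H fix s col′ U b U-small (shrink l≤m) s-good fix-adj fix-inj
      (λ u w h _ uw e → proper′ u w h uw (transpose-injective (col x) (p a) e)) seed-col)
    where
    open CriticalColouring crit
    fix : Fin l → Bool
    fix u = (u == x) ∨ (u == y)
    s : Fin l → Fin n
    s u = if u == x then a else a′
    col′ : Fin l → Fin k
    col′ u = PC.transpose (col x) (p a) (col u)
    a≢a′ : a ≢ a′
    a≢a′ refl = true≢false aa′ (irrefl G a)
    x≢y : x ≢ y
    x≢y e = true≢false xy (trans (cong (adj H x) (sym e)) (irrefl H x))
    data Fixed (u : Fin l) : Set where
      at-x : u ≡ x → s u ≡ a → Fixed u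
      at-y : u ≡ y → s u ≡ a′ → Fixed u
    fixed? : ∀ u → fix u ≡ true → Fixed u
    fixed? u h with ∨-elim {u == x} h
    ... | inj₁ e = at-x (==⇒≡ e) (cong (if_then a else a′) e)
    ... | inj₂ e = at-y (==⇒≡ e) (cong (if_then a else a′) (≢⇒==false λ q → x≢y (trans (sym q) (==⇒≡ e))))
    s-good : ∀ u → fix u ≡ true → miss G p (s u) ≤ b * η
    s-good u h with fixed? u h
    ... | at-x _ e = ≤-trans (≤-reflexive (cong (miss G p) e)) a-good
    ... | at-y _ e = ≤-trans (≤-reflexive (cong (miss G p) e)) a′-good
    p-s : ∀ u → fix u ≡ true → p (s u) ≡ p a
    p-s u h with fixed? u h
    ... | at-x _ e = cong p e
    ... | at-y _ e = trans (cong p e) (sym pa≡pa′)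
    col-fix : ∀ u → fix u ≡ true → col u ≡ col x
    col-fix u h with fixed? u h
    ... | at-x e _ = cong col e
    ... | at-y e _ = trans (cong col e) (sym col-xy)
    fix-adj : ∀ u w → fix u ≡ true → fix w ≡ true → adj H u w ≡ true → adj G (s u) (s w) ≡ true
    fix-adj u w h h′ uw with fixed? u h | fixed? w h′
    ... | at-x e _ | at-x e′ _ = ⊥-elim (true≢false (subst₂ (λ i j → adj H i j ≡ true) e e′ uw) (irrefl H x))
    ... | at-x _ e | at-y _ e′ = trans (cong₂ (adj G) e e′) aa′
    ... | at-y _ e | at-x _ e′ = trans (cong₂ (adj G) e e′) (trans (adj-sym G a′ a) aa′)
    ... | at-y e _ | at-y e′ _ = ⊥-elim (true≢false (subst₂ (λ i j → adj H i j ≡ true) e e′ uw) (irrefl H y))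
    fix-inj : ∀ u w → fix u ≡ true → fix w ≡ true → s u ≡ s w → u ≡ w
    fix-inj u w h h′ q with fixed? u h | fixed? w h′
    ... | at-x e _ | at-x e′ _ = trans e (sym e′)
    ... | at-x _ e | at-y _ e′ = ⊥-elim (a≢a′ (trans (sym e) (trans q e′)))
    ... | at-y _ e | at-x _ e′ = ⊥-elim (a≢a′ (trans (sym e′) (trans (sym q) e)))
    ... | at-y e _ | at-y e′ _ = trans e (sym e′)
    free-left : ∀ u → fix u ≡ false → u ≢ x × u ≢ y
    free-left u h = (λ e → true≢false (∨-introˡ (≡⇒== e)) h) , λ e → true≢false (∨-introʳ {u == x} (≡⇒== e)) h
    proper′ : ∀ u w → fix u ≡ false → adj H u w ≡ true → col u ≢ col w
    proper′ u w h uw = proper u w uw (proj₁ (free-left u h) ∘ proj₁) (proj₂ (free-left u h) ∘ proj₁)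
    seed-col : ∀ u w → fix u ≡ false → fix w ≡ true → adj H u w ≡ true → p (s w) ≢ col′ u
    seed-col u w h h′ uw e = proper′ u w h uw (trans
      (transpose-injective (col x) (p a) (trans (sym e) (trans (p-s w h′) (sym (transpose-at (col x) (p a))))))
      (sym (col-fix w h′)))
    s∉U : ∀ u → fix u ≡ true → U (s u) ≡ false
    s∉U u h with fixed? u h
    ... | at-x _ e = trans (cong U e) (disjoint a (∨-introˡ (==-refl a)))
    ... | at-y _ e = trans (cong U e) (disjoint a′ (∨-introʳ {a′ == a} (==-refl a′)))

  embed-colorable : ∀ {l} (H : Graph l) → Colorable H k → l ≤ m → (U : Fin n → Bool) → l + count U ≤ η → Avoiding H G U
  -- No vertex is a seed; x₀ only gives the seed map a value.
  embed-colorable H (col , ok) l≤m U U-small = avoiding-fixed (λ _ → false) (λ _ → x₀) U (λ _ ())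
    (embed-at-seeds H (λ _ → false) (λ _ → x₀) col U b U-small (shrink l≤m)
      (λ _ ()) (λ _ _ ()) (λ _ _ ()) (λ u w _ _ uw → ok u w uw) (λ _ _ _ ()))

  embed-plain : ∀ others → All (λ H → Colorable (graph H) k) others → size (⨆ others) ≤ m →
    (U : Fin n → Bool) → size (⨆ others) + count U ≤ η → Avoiding (graph (⨆ others)) G U
  embed-plain []           []         _   U _     = (λ ()) , (λ { {()} }) , (λ ()) , λ ()
  embed-plain (H ∷ others) (hc ∷ hs) l≤m U small =
    continue (embed-colorable (graph H) hc (≤-trans (m≤m+n (size H) _) l≤m) U (≤-trans (+-monoˡ-≤ (count U) (m≤m+n (size H) _)) small))
    where
    eq : ∀ a b d → a + (b + d) ≡ d + a + b
    eq = solve-∀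
    continue : Avoiding (graph H) G U → Avoiding (graph (⨆ (H ∷ others))) G U
    continue first = disjointUnion-avoiding (graph H) (graph (⨆ others)) G U first
      (embed-plain others hs (≤-trans (m≤n+m _ (size H)) l≤m) _ (≤-trans (+-monoʳ-≤ (size (⨆ others))
        (≤-trans (count-∨≤ U _) (+-monoʳ-≤ (count U) (count-image≤ (proj₁ first)))))
        (≤-trans (≤-reflexive (eq (size (⨆ others)) (count U) (size H))) small)))

  -- Components are placed one after another. While one is placed, the seeds of the later ones count
  -- as forbidden, at most two vertices each, so that they are still free when their turn comes.
  embed-seeded : ∀ crit others → All (CriticalGraph k) crit → All (λ H → Colorable (graph H) k) others →
    size (⨆ (crit ++ others)) ≤ m → (σ : Fin (length crit) → Seed n) → (∀ i → Valid (σ i)) →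
    (∀ i j → i ≢ j → Disjoint (covers (σ i)) (covers (σ j))) →
    (U : Fin n → Bool) → (∀ i → Disjoint (covers (σ i)) U) →
    size (⨆ (crit ++ others)) + (count U + 2 * length crit) ≤ η → Avoiding (graph (⨆ (crit ++ others))) G U
  embed-seeded [] others [] hs l≤m σ valid disj U U-disj small =
    embed-plain others hs l≤m U (≤-trans (+-monoʳ-≤ (size (⨆ others)) (m≤m+n (count U) 0)) small)
  embed-seeded (H ∷ crit) others ((χ , ce) ∷ cs) hs l≤m σ valid disj U U-disj small =
    continue (embed-critical (graph H) (critical-colouring (graph H) χ ce) (≤-trans (m≤m+n (size H) _) l≤m) (σ zero) (valid zero) U₁
      (≤-trans (+-mono-≤ (m≤m+n (size H) (size R)) (≤-trans (count-∨≤ U later) (+-monoʳ-≤ (count U) (≤-trans later-count (*-monoʳ-≤ 2 (n≤1+n (length crit))))))) small)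
      (λ v h → ≢true⇒false (λ q → clash v h (∨-elim {U v} q))))
    where
    R = ⨆ (crit ++ others)
    later : Fin n → Bool
    later v = someF (λ i → covers (σ (suc i)) v)
    U₁ : Fin n → Bool
    U₁ v = U v ∨ later v
    later-count : count later ≤ 2 * length crit
    later-count = ≤-trans (count-someF≤ (λ i → covers (σ (suc i)))) (≤-trans (sum-≤const 2 (λ i → covers-count (σ (suc i)))) (≤-reflexive (*-comm (length crit) 2)))
    clash : ∀ v → covers (σ zero) v ≡ true → (U v ≡ true) ⊎ (later v ≡ true) → ⊥
    clash v h (inj₁ q) = true≢false q (U-disj zero v h)
    clash v h (inj₂ q) with someF-elim _ q
    ... | i , q′ = true≢false q′ (disj zero (suc i) (λ ()) v h)
    eq₂ : ∀ r u h l → r + (u + h + 2 * l) ≡ h + r + (u + 2 * l)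
    eq₂ = solve-∀
    eq₃ : ∀ h r u l → h + r + (u + 2 * l) + 2 ≡ h + r + (u + 2 * (1 + l))
    eq₃ = solve-∀
    continue : Avoiding (graph H) G U₁ → Avoiding (graph (⨆ ((H ∷ crit) ++ others))) G U
    continue (f , f-inj , f-adj , f-out) =
      disjointUnion-avoiding (graph H) (graph R) G U (f , f-inj , f-adj , f-U)
        (embed-seeded crit others cs hs (≤-trans (m≤n+m _ (size H)) l≤m) (σ ∘ suc) (valid ∘ suc)
          (λ i j ne → disj (suc i) (suc j) (ne ∘ FP.suc-injective)) U₂ U₂-disj
          (≤-trans (+-monoʳ-≤ (size R) (+-monoˡ-≤ (2 * length crit)
            (≤-trans (count-∨≤ U _) (+-monoʳ-≤ (count U) (count-image≤ f)))))
            (≤-trans (≤-reflexive (eq₂ (size R) (count U) (size H) (length crit))) (≤-trans (m≤m+n _ 2)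
              (≤-trans (≤-reflexive (eq₃ (size H) (size R) (count U) (length crit))) small)))))
      where
      f-U : ∀ u → U (f u) ≡ false
      f-U u = ≢true⇒false (λ q → true≢false (∨-introˡ q) (f-out u))
      U₂ : Fin n → Bool
      U₂ v = U v ∨ someF (λ u → f u == v)
      U₂-disj : ∀ i → Disjoint (covers (σ (suc i))) U₂
      U₂-disj i v h = ≢true⇒false (λ q → hit (∨-elim {U v} q))
        where
        hit : (U v ≡ true) ⊎ (someF (λ u → f u == v) ≡ true) → ⊥
        hit (inj₁ q) = true≢false q (U-disj (suc i) v h)
        hit (inj₂ q) with someF-elim _ q
        ... | u , q′ = true≢false (∨-introʳ {U (f u)} (someF-intro (λ i → covers (σ (suc i)) (f u)) i (trans (cong (covers (σ (suc i))) (==⇒≡ q′)) h)))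
                         (f-out u)

-- Part (i)

other : ∀ {j} (i : Fin (suc (suc j))) → ∃ λ l → l ≢ i
other zero    = suc zero , λ ()
other (suc i) = zero , λ ()

partSize≤cross : ∀ {n k} (p : Fin n → Fin k) v i → i ≢ p v → partSize p i ≤ cross p v
partSize≤cross {n} p v i ne = count-mono {n} {λ w → p w == i} {λ w → not (p v == p w)} (λ w h → not-intro (≢⇒==false λ e → ne (trans (sym (==⇒≡ h)) (sym e))))

irreflexive : ∀ {n} (G : Graph n) {u w} → adj G u w ≡ true → u ≢ w
irreflexive G uw refl = true≢false uw (irrefl G _)

¬S-elim : ∀ {a b} → not a ∧ b ≡ true → a ≡ false
¬S-elim {a} h = not-elim (∧-elimˡ h)

-- S ⊇ A is the set of singleton parts of the partition q refining p; the
-- complete multipartite graph of q is the competitor of G.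
module IsolationAccount {n : ℕ} {k : ℕ} {l : ℕ} (G : Graph n) (p : Fin n → Fin k) (q : Fin n → Fin l)
  (A S Z : Fin n → Bool) (α : ℕ)
  (A⊆S : ∀ v → A v ≡ true → S v ≡ true)
  (separated : ∀ v w → v ≢ w → q v ≡ q w → S v ≡ false × S w ≡ false × p v ≡ p w)
  (low : ∀ v → A v ≡ false → inn G p v ≤ α)
  (cover : ∀ v w → adj G v w ∧ (p v == p w) ≡ true → A v ≡ false → A w ≡ false → Z v ∨ Z w ≡ true) where
  open ≤-Reasoning

  P : Fin n → Bool
  P v = not (A v) ∧ Z v

  cross≤ᵠ : ∀ v → cross p v ≤ cross q v
  cross≤ᵠ v = count-mono (λ w h → not-intro (≢⇒==false λ e → ==false⇒≢ (not-elim h)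
    (proj₂ (proj₂ (separated v w (λ e′ → ==false⇒≢ (not-elim h) (cong p e′)) e)))))

  others≤ᵠ : ∀ v → S v ≡ true → count (λ w → not (v == w)) ≤ cross q v
  others≤ᵠ v Sv = count-mono (λ w h → not-intro (≢⇒==false λ e → true≢false Sv (proj₁ (separated v w (==false⇒≢ (not-elim h)) e))))

  deg≤others : ∀ v → deg G v ≤ count (λ w → not (v == w))
  deg≤others v = count-mono {n} {adj G v} {λ w → not (v == w)} (λ w h → not-intro (≢⇒==false (irreflexive G h)))

  deg≤ᵠ-in : ∀ v → S v ≡ true → deg G v ≤ cross q v
  deg≤ᵠ-in v Sv = ≤-trans (deg≤others v) (others≤ᵠ v Sv)

  n≤1+ᵠ : ∀ v → S v ≡ true → n ≤ 1 + cross q v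
  n≤1+ᵠ v Sv = ≤-trans (≤-reflexive (sym (trans (cong (_+ count (λ w → not (v == w))) (sym (count-≡ v))) (count-not (v ==_)))))
    (+-monoʳ-≤ 1 (others≤ᵠ v Sv))

  inner¬A : Fin n → ℕ
  inner¬A v = count (λ w → (adj G v w ∧ (p v == p w)) ∧ not (A w))

  deg≤ᵠ-out : ∀ v → S v ≡ false → deg G v ≤ cross q v + inner¬A v
  deg≤ᵠ-out v Sv = begin
    deg G v ≤⟨ count-mono (λ w vw → lemma w vw (true⊎false (q v == q w))) ⟩
    count (λ w → not (q v == q w) ∨ ((adj G v w ∧ (p v == p w)) ∧ not (A w))) ≤⟨ count-∨≤ (λ w → not (q v == q w)) _ ⟩
    cross q v + inner¬A v ∎
    where
    lemma : ∀ w → adj G v w ≡ true → ((q v == q w) ≡ true) ⊎ ((q v == q w) ≡ false) →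
      not (q v == q w) ∨ ((adj G v w ∧ (p v == p w)) ∧ not (A w)) ≡ true
    lemma w vw (inj₂ e) = ∨-introˡ (not-intro e)
    lemma w vw (inj₁ e) = inside (separated v w (irreflexive G vw) (==⇒≡ e))
      where
      inside : S v ≡ false × S w ≡ false × p v ≡ p w → not (q v == q w) ∨ ((adj G v w ∧ (p v == p w)) ∧ not (A w)) ≡ true
      inside (_ , Sw , pp) = ∨-introʳ {not (q v == q w)} (∧-intro (∧-intro vw (≡⇒== pp))
        (not-intro (≢true⇒false λ h → true≢false (A⊆S w h) Sw)))

  -- Every inner edge outside `A` meets `P`. It is charged through the first term if v itself lies
  -- in `P`, and otherwise through its neighbour in `P`.
  gain : Fin n → ℕ
  gain v = ⟦ P v ⟧ * inn G p v + sumFin (λ w → ⟦ P w ⟧ * ⟦ adj G v w ∧ (p v == p w) ⟧)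

  inner¬A≤gain : ∀ v → A v ≡ false → (Z v ≡ true) ⊎ (Z v ≡ false) → inner¬A v ≤ gain v
  inner¬A≤gain v Av (inj₁ Zv) = begin
    inner¬A v               ≤⟨ count-mono {n} {λ w → (adj G v w ∧ (p v == p w)) ∧ not (A w)} {λ w → adj G v w ∧ (p v == p w)} (λ w → ∧-elimˡ) ⟩
    inn G p v               ≡⟨ trans (cong (λ b → b * inn G p v) (⟦⟧-true (∧-intro {not (A v)} (not-intro Av) Zv))) (+-identityʳ _) ⟨
    ⟦ P v ⟧ * inn G p v     ≤⟨ m≤m+n _ _ ⟩
    gain v                  ∎
  inner¬A≤gain v Av (inj₂ Zv) = begin
    inner¬A v ≡⟨ count≡sum (λ w → (adj G v w ∧ (p v == p w)) ∧ not (A w)) ⟩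
    sumFin (λ w → ⟦ (adj G v w ∧ (p v == p w)) ∧ not (A w) ⟧)
      ≤⟨ sum-mono (λ w → ≤-trans (⟦⟧-mono (λ h → ∧-intro {P w} (∧-intro {not (A w)} (∧-elimʳ {adj G v w ∧ (p v == p w)} h) (hit w h)) (∧-elimˡ h)))
           (≤-reflexive (⟦⟧-∧ (P w) (adj G v w ∧ (p v == p w))))) ⟩
    sumFin (λ w → ⟦ P w ⟧ * ⟦ adj G v w ∧ (p v == p w) ⟧) ≤⟨ m≤n+m _ _ ⟩
    gain v ∎
    where
    hit : ∀ w → (adj G v w ∧ (p v == p w)) ∧ not (A w) ≡ true → Z w ≡ true
    hit w h with ∨-elim {Z v} (cover v w (∧-elimˡ h) Av (not-elim (∧-elimʳ {adj G v w ∧ (p v == p w)} h)))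
    ... | inj₁ z = ⊥-elim (true≢false z Zv)
    ... | inj₂ z = z

  deg∸≤gain : ∀ v → deg G v ∸ cross q v ≤ gain v
  deg∸≤gain v = decide (true⊎false (S v))
    where
    decide : (S v ≡ true) ⊎ (S v ≡ false) → deg G v ∸ cross q v ≤ gain v
    decide (inj₁ Sv) = ≤-trans (≤-reflexive (m≤n⇒m∸n≡0 (deg≤ᵠ-in v Sv))) z≤n
    decide (inj₂ Sv) = ≤-trans (m≤n+o⇒m∸n≤o (deg G v) (cross q v) (deg≤ᵠ-out v Sv))
      (inner¬A≤gain v (≢true⇒false λ h → true≢false (A⊆S v h) Sv) (true⊎false (Z v)))

  weight : sumFin (λ v → ⟦ P v ⟧ * inn G p v) ≤ α * count P
  weight = begin
    sumFin (λ v → ⟦ P v ⟧ * inn G p v) ≤⟨ sum-mono (λ v → point v (true⊎false (P v))) ⟩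
    sumFin (λ v → α * ⟦ P v ⟧) ≡⟨ trans (sum-* α (λ v → ⟦ P v ⟧)) (cong (α *_) (sym (count≡sum P))) ⟩
    α * count P ∎
    where
    point : ∀ v → (P v ≡ true) ⊎ (P v ≡ false) → ⟦ P v ⟧ * inn G p v ≤ α * ⟦ P v ⟧
    point v (inj₁ h) = ≤-trans (*-monoʳ-≤ ⟦ P v ⟧ (low v (¬S-elim {A v} {Z v} h))) (≤-reflexive (*-comm ⟦ P v ⟧ α))
    point v (inj₂ h) = ≤-trans (≤-reflexive (cong (_* inn G p v) (⟦⟧-false h))) z≤n

  -- Summed over v, each of the two terms of `gain` is the total inner degree of `P`.
  gain-sum : sumFin (λ v → deg G v ∸ cross q v) ≤ 2 * (α * count P)
  gain-sum = begin
    sumFin (λ v → deg G v ∸ cross q v) ≤⟨ sum-mono deg∸≤gain ⟩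
    sumFin gain ≡⟨ sum-+ (λ v → ⟦ P v ⟧ * inn G p v) (λ v → sumFin (λ w → ⟦ P w ⟧ * ⟦ adj G v w ∧ (p v == p w) ⟧)) ⟩
    sumFin (λ v → ⟦ P v ⟧ * inn G p v) + sumFin (λ v → sumFin (λ w → ⟦ P w ⟧ * ⟦ adj G v w ∧ (p v == p w) ⟧))
      ≡⟨ cong (sumFin (λ v → ⟦ P v ⟧ * inn G p v) +_) (trans (sum-swap (λ v w → ⟦ P w ⟧ * ⟦ adj G v w ∧ (p v == p w) ⟧))
           (sum-cong (λ w → trans (sum-* ⟦ P w ⟧ (λ v → ⟦ adj G v w ∧ (p v == p w) ⟧))
             (cong (⟦ P w ⟧ *_) (trans (sum-cong (λ v → cong ⟦_⟧ (cong₂ _∧_ (adj-sym G v w) (==-sym (p v) (p w)))))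
               (sym (count≡sum (λ v → adj G w v ∧ (p w == p v))))))))) ⟩
    sumFin (λ v → ⟦ P v ⟧ * inn G p v) + sumFin (λ v → ⟦ P v ⟧ * inn G p v) ≤⟨ +-mono-≤ weight weight ⟩
    α * count P + α * count P ≡⟨ cong (α * count P +_) (+-identityʳ (α * count P)) ⟨
    2 * (α * count P) ∎

module DisjointCritical {n : ℕ} {j : ℕ} (ρ s : ℕ) (crit others : List AGraph) (len : length crit ≡ suc s)
  (crit-ok : All (CriticalGraph (suc (suc j))) crit) (others-ok : All (λ H → Colorable (graph H) (suc (suc j))) others)
  (G : Graph n) (free : (graph (⨆ (crit ++ others)) -free) G) where

  k r m C R a b c₁ c : ℕ
  k = suc (suc j)
  r = suc ρ
  m = size (⨆ (crit ++ others))
  C = partConst k ρ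
  R = suc ρ * C ^ ρ
  -- a is the inner degree that makes an apex. b exceeds a by 2Ra, so that a vertex outside `A`
  -- missing bη cross edges loses 2Raη net. c₁ is what each newly isolated vertex must lose: 6Ra
  -- pays for three vertices at rate 2Ra, and the other summand is the demand of `embed-at-seeds`.
  a = 2 * m + 3
  b = a + 2 * (R * a)
  c₁ = 6 * (R * a) + (2 * m + 3 + m * b)
  c = a + 1 + c₁

  module Bound (p : Fin n → Fin k) (η : ℕ) (η-large : m + 2 * suc s < η) (str : Structured G p η c C) (x₀ : Fin n) where
    open ≤-Reasoning
    open Structured str

    η>0 : 0 < η
    η>0 = ≤-<-trans z≤n η-large

    c-large : 2 * m + 3 + m * b ≤ c
    c-large = ≤-trans (m≤n+m (2 * m + 3 + m * b) (6 * (R * a))) (m≤n+m c₁ (a + 1))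

    open SeedEmbedding G p η str η>0 x₀ m b c-large

    A D : Fin n → Bool
    A v = le (a * η) (inn G p v)
    D v = le (b * η) (miss G p v)

    no-seeds : ∀ l → l ≡ length crit → (σ : Fin l → Seed n) → (∀ i → Valid (σ i)) →
      (∀ i i′ → i ≢ i′ → Disjoint (covers (σ i)) (covers (σ i′))) → ⊥
    no-seeds l refl σ valid disj = contradict (embed-seeded crit others crit-ok others-ok ≤-refl σ valid disj (λ _ → false) (λ _ _ _ → refl)
      (≤-trans (+-monoʳ-≤ m (≤-reflexive (cong₂ _+_ (count-none {n} (λ _ → refl)) (cong (2 *_) len)))) (<⇒≤ η-large)))
      where
      contradict : Avoiding (graph (⨆ (crit ++ others))) G (λ _ → false) → ⊥
      contradict (f , inj , edges , _) = free (f , inj , edges)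

    apex-seeds : ∀ {l} (x : Fin l → Fin n) → Injective _≡_ _≡_ x →
      ∀ i i′ → i ≢ i′ → Disjoint (covers (apex (x i))) (covers (apex (x i′)))
    apex-seeds x x-inj i i′ ne v h = ≢⇒==false (λ e → ne (x-inj (trans (sym (==⇒≡ h)) e)))

    A-few : count A ≤ s
    A-few = decide (≤-<-connex (count A) s)
      where
      decide : (count A ≤ s) ⊎ (s < count A) → count A ≤ s
      decide (inj₁ h) = h
      decide (inj₂ h) = contradict (count≥⇒injection A h)
        where
        contradict : (Σ (Fin (suc s) → Fin n) λ x → Injective _≡_ _≡_ x × (∀ i → A (x i) ≡ true)) → count A ≤ s
        contradict (x , x-inj , x-A) = ⊥-elim (no-seeds (suc s) (sym len) (λ i → apex (x i)) (λ i → le⇒≤ (x-A i)) (apex-seeds x x-inj))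

    -- The singleton parts left over by `A`. A matching of jj + 1 edges of `Inner` would complete
    -- `A` to s + 1 seeds, so `matching` has to return a cover of size at most 2 jj.
    jj : ℕ
    jj = s ∸ count A

    jj-def : count A + jj ≡ s
    jj-def = m+[n∸m]≡n A-few

    Inner : Fin n → Fin n → Bool
    Inner v w = (adj G v w ∧ (p v == p w)) ∧ ((not (A v) ∧ not (A w)) ∧ (not (D v) ∧ not (D w)))

    Matched Covered Result : Set
    Matched = Σ (Fin (suc jj) → Fin n × Fin n) λ M → (∀ i → Inner (proj₁ (M i)) (proj₂ (M i)) ≡ true) ×
      (∀ i i′ → i ≢ i′ → ∀ v → (v == proj₁ (M i)) ∨ (v == proj₂ (M i)) ≡ true →
        (v == proj₁ (M i′)) ∨ (v == proj₂ (M i′)) ≡ false)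
    Covered = Σ (Fin n → Bool) λ U → count U ≤ 2 * jj × (∀ x y → Inner x y ≡ true → U x ∨ U y ≡ true)
    Result = Σ (Vec (Fin (s + k)) n) λ q → GoodPartition s k (lookup q) × e r G ≤ crossPower r (lookup q)

    ¬matched : Matched → ⊥
    ¬matched (M , M-inner , M-disj) = no-seeds (count A + suc jj) (trans (+-suc (count A) jj) (trans (cong suc jj-def) (sym len)))
        (λ i → σ (splitAt (count A) i)) (λ i → valid (splitAt (count A) i))
        (λ i i′ ne → disj (splitAt (count A) i) (splitAt (count A) i′) (λ e → ne (trans (sym (FP.join-splitAt (count A) (suc jj) i))
          (trans (cong (F.join (count A) (suc jj)) e) (FP.join-splitAt (count A) (suc jj) i′)))))
      where
      E = enumerate A
      σ : Fin (count A) ⊎ Fin (suc jj) → Seed n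
      σ (inj₁ i) = apex (elem E i)
      σ (inj₂ i) = edge (proj₁ (M i)) (proj₂ (M i))
      good : ∀ {v} → not (D v) ≡ true → miss G p v ≤ b * η
      good h = <⇒≤ (nle⇒> (not-elim h))
      valid : ∀ x → Valid (σ x)
      valid (inj₁ i) = le⇒≤ (elem-∈ E i)
      valid (inj₂ i) = ∧-elimˡ adj-p , ==⇒≡ (∧-elimʳ {adj G x y} adj-p) , good (∧-elimˡ ¬D) , good (∧-elimʳ {not (D x)} ¬D)
        where
        x = proj₁ (M i)
        y = proj₂ (M i)
        adj-p : adj G x y ∧ (p x == p y) ≡ true
        adj-p = ∧-elimˡ (M-inner i)
        ¬D : not (D x) ∧ not (D y) ≡ true
        ¬D = ∧-elimʳ {not (A x) ∧ not (A y)} (∧-elimʳ {adj G x y ∧ (p x == p y)} (M-inner i))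
      edge∌A : ∀ i v → covers (σ (inj₂ i)) v ≡ true → A v ≡ false
      edge∌A i v h = decide (∨-elim {v == proj₁ (M i)} h)
        where
        ¬A : not (A (proj₁ (M i))) ∧ not (A (proj₂ (M i))) ≡ true
        ¬A = ∧-elimˡ (∧-elimʳ {adj G (proj₁ (M i)) (proj₂ (M i)) ∧ (p (proj₁ (M i)) == p (proj₂ (M i)))} (M-inner i))
        decide : ((v == proj₁ (M i)) ≡ true) ⊎ ((v == proj₂ (M i)) ≡ true) → A v ≡ false
        decide (inj₁ e) = trans (cong A (==⇒≡ e)) (not-elim (∧-elimˡ ¬A))
        decide (inj₂ e) = trans (cong A (==⇒≡ e)) (not-elim (∧-elimʳ {not (A (proj₁ (M i)))} ¬A))
      disj : ∀ x y → x ≢ y → Disjoint (covers (σ x)) (covers (σ y))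
      disj (inj₁ i) (inj₁ i′) ne = apex-seeds (elem E) (elem-inj E) i i′ (ne ∘ cong inj₁)
      disj (inj₁ i) (inj₂ i′) ne v h = ≢true⇒false (λ q → true≢false (trans (cong A (==⇒≡ h)) (elem-∈ E i)) (edge∌A i′ v q))
      disj (inj₂ i) (inj₁ i′) ne v h = ≢⇒==false (λ q → true≢false (trans (cong A q) (elem-∈ E i′)) (edge∌A i v h))
      disj (inj₂ i) (inj₂ i′) ne v h = M-disj i i′ (ne ∘ cong inj₂) v h

    parts>s : ∀ i → s < partSize p i
    parts>s i = begin-strict
      s             ≤⟨ ≤-trans (n≤1+n s) (≤-trans (m≤m+n (suc s) _) (m≤n+m _ m)) ⟩
      m + 2 * suc s <⟨ η-large ⟩
      η             ≡⟨ *-identityˡ η ⟨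
      1 * η         ≤⟨ *-monoˡ-≤ η (≤-trans (m≤n+m 1 a) (m≤m+n (a + 1) c₁)) ⟩
      c * η         ≤⟨ part≥cη i ⟩
      partSize p i  ∎

    module Account (U : Fin n → Bool) (U-few : count U ≤ 2 * jj) (U-cover : ∀ x y → Inner x y ≡ true → U x ∨ U y ≡ true)
      (S : Fin n → Bool) (A⊆S : ∀ v → A v ≡ true → S v ≡ true) (S-size : count S ≡ s)
      (q : Fin n → Fin (s + k))
      (separated : ∀ v w → v ≢ w → q v ≡ q w → S v ≡ false × S w ≡ false × p v ≡ p w) where

      Z : Fin n → Bool
      Z v = D v ∨ U v

      low : ∀ v → A v ≡ false → inn G p v ≤ a * η
      low v h = <⇒≤ (nle⇒> h)

      Z-cover : ∀ v w → adj G v w ∧ (p v == p w) ≡ true → A v ≡ false → A w ≡ false → Z v ∨ Z w ≡ true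
      Z-cover v w vw Av Aw = decide (true⊎false (D v)) (true⊎false (D w))
        where
        decide : (D v ≡ true) ⊎ (D v ≡ false) → (D w ≡ true) ⊎ (D w ≡ false) → Z v ∨ Z w ≡ true
        decide (inj₁ h) _ = ∨-introˡ (∨-introˡ h)
        decide (inj₂ _) (inj₁ h) = ∨-introʳ {Z v} (∨-introˡ h)
        decide (inj₂ h) (inj₂ h′) = hit (∨-elim (U-cover v w (∧-intro vw (∧-intro (∧-intro (not-intro Av) (not-intro Aw)) (∧-intro (not-intro h) (not-intro h′))))))
          where
          hit : (U v ≡ true) ⊎ (U w ≡ true) → Z v ∨ Z w ≡ true
          hit (inj₁ z) = ∨-introˡ (∨-introʳ {D v} z)
          hit (inj₂ z) = ∨-introʳ {Z v} (∨-introʳ {D w} z)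

      open IsolationAccount G p q A S Z (a * η) A⊆S separated low Z-cover

      far new : Fin n → Bool
      far v = not (S v) ∧ D v
      new v = S v ∧ not (A v)

      δ : ℕ
      δ = count far

      new-count : count new ≡ jj
      new-count = +-cancelˡ-≡ (count A) _ _ (begin-equality
        count A + count new ≡⟨ cong (_+ count new) (count-cong (λ v → ⇔⇒≡ (λ h → ∧-intro (A⊆S v h) h) (∧-elimʳ {S v}))) ⟩
        count (λ v → S v ∧ A v) + count new ≡⟨ count-split S A ⟨
        count S ≡⟨ trans S-size (sym jj-def) ⟩
        count A + jj ∎)

      -- Members of `P` outside `U` miss many cross edges and are far or newly isolated. The far
      -- ones pay for themselves; the jj new ones pay for themselves and for the 2 jj vertices of
      -- `U`.
      P-count : count P ≤ δ + 3 * jj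
      P-count = begin
        count P ≤⟨ count-mono (λ v h → lemma v h (true⊎false (S v)) (∨-elim {D v} (∧-elimʳ {not (A v)} h))) ⟩
        count (λ v → (far v ∨ new v) ∨ U v) ≤⟨ ≤-trans (count-∨≤ (λ v → far v ∨ new v) U) (+-monoˡ-≤ (count U) (count-∨≤ far new)) ⟩
        δ + count new + count U ≤⟨ +-mono-≤ (≤-reflexive (cong (δ +_) new-count)) U-few ⟩
        δ + jj + 2 * jj ≡⟨ +-assoc δ jj (2 * jj) ⟩
        δ + 3 * jj ∎
        where
        lemma : ∀ v → P v ≡ true → (S v ≡ true) ⊎ (S v ≡ false) → (D v ≡ true) ⊎ (U v ≡ true) → (far v ∨ new v) ∨ U v ≡ true
        lemma v h _ (inj₂ u) = ∨-introʳ {far v ∨ new v} u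
        lemma v h (inj₁ Sv) (inj₁ d) = ∨-introˡ (∨-introʳ {far v} (∧-intro Sv (∧-elimˡ h)))
        lemma v h (inj₂ Sv) (inj₁ d) = ∨-introˡ (∨-introˡ (∧-intro (not-intro Sv) d))

      b₁ : ℕ
      b₁ = 2 * (R * a)

      loss-far : ∀ v → far v ≡ true → b₁ * η ≤ cross q v ∸ deg G v
      loss-far v h = m+n≤o⇒m≤o∸n (b₁ * η) (lin 0
          (+-mono-≤ (≤-reflexive (deg-balance G p v)) (+-mono-≤ (le⇒≤ {b * η} (∧-elimʳ {not (S v)} h)) (+-mono-≤ (low v Av) (cross≤ᵠ v))))
          (eq b₁ η a (deg G v) (miss G p v) (cross p v) (inn G p v) (cross q v)))
        where
        Av : A v ≡ false
        Av = ≢true⇒false (λ h′ → true≢false (A⊆S v h′) (not-elim (∧-elimˡ h)))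
        eq : ∀ b η a d m c i t → b * η + d + (c + i + (m + (a * η + t))) + 0 ≡ t + (d + m + ((a + b) * η + (i + c)))
        eq = solve-∀

      -- In the competitor v is joined to all other vertices, whereas in G it has at most aη
      -- neighbours in its own part of size at least cη. The unit 1 in c absorbs the vertex v
      -- itself.
      loss-new : ∀ v → new v ≡ true → c₁ * η ≤ cross q v ∸ deg G v
      loss-new v h = m+n≤o⇒m≤o∸n (c₁ * η) (lin 0
          (+-mono-≤ (deg≤cross+inn G p v) (+-mono-≤ (low v (not-elim (∧-elimʳ {S v} h)))
            (+-mono-≤ (part≥cη (p v)) (+-mono-≤ (≤-reflexive (cross+part p v)) (+-mono-≤ (n≤1+ᵠ v (∧-elimˡ h)) η>0)))))
          (eq c₁ η a (deg G v) (cross p v) (inn G p v) (partSize p (p v)) n (cross q v)))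
        where
        eq : ∀ c₁ η a d c i P n t → c₁ * η + d + (c + i + (a * η + (P + (n + (1 + t + η))))) + 0
          ≡ t + (d + (i + ((a + 1 + c₁) * η + (c + P + (n + 1)))))
        eq = solve-∀

      loss-sum : b₁ * η * δ + c₁ * η * jj ≤ sumFin (λ v → cross q v ∸ deg G v)
      loss-sum = begin
        b₁ * η * δ + c₁ * η * jj ≡⟨ cong₂ _+_ (weigh (b₁ * η) far) (trans (cong (c₁ * η *_) (sym new-count)) (weigh (c₁ * η) new)) ⟩
        sumFin (λ v → b₁ * η * ⟦ far v ⟧) + sumFin (λ v → c₁ * η * ⟦ new v ⟧) ≡⟨ sum-+ (λ v → b₁ * η * ⟦ far v ⟧) (λ v → c₁ * η * ⟦ new v ⟧) ⟨
        sumFin (λ v → b₁ * η * ⟦ far v ⟧ + c₁ * η * ⟦ new v ⟧) ≤⟨ sum-mono (λ v → point v (true⊎false (far v)) (true⊎false (new v))) ⟩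
        sumFin (λ v → cross q v ∸ deg G v) ∎
        where
        weigh : ∀ x (T : Fin n → Bool) → x * count T ≡ sumFin (λ v → x * ⟦ T v ⟧)
        weigh x T = trans (cong (x *_) (count≡sum T)) (sym (sum-* x (λ v → ⟦ T v ⟧)))
        one : ∀ x {y} → y ≡ true → x * ⟦ y ⟧ ≡ x
        one x refl = *-identityʳ x
        zer : ∀ x {y} → y ≡ false → x * ⟦ y ⟧ ≡ 0
        zer x refl = *-zeroʳ x
        point : ∀ v → (far v ≡ true) ⊎ (far v ≡ false) → (new v ≡ true) ⊎ (new v ≡ false) →
          b₁ * η * ⟦ far v ⟧ + c₁ * η * ⟦ new v ⟧ ≤ cross q v ∸ deg G v
        point v (inj₁ h) (inj₁ h′) = ⊥-elim (true≢false (∧-elimˡ {S v} h′) (¬S-elim {S v} {D v} h))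
        point v (inj₁ h) (inj₂ h′) = ≤-trans (≤-reflexive (trans (cong₂ _+_ (one (b₁ * η) h) (zer (c₁ * η) h′)) (+-identityʳ _))) (loss-far v h)
        point v (inj₂ h) (inj₁ h′) = ≤-trans (≤-reflexive (cong₂ _+_ (zer (b₁ * η) h) (one (c₁ * η) h′))) (loss-new v h′)
        point v (inj₂ h) (inj₂ h′) = ≤-trans (≤-reflexive (cong₂ _+_ (zer (b₁ * η) h) (zer (c₁ * η) h′))) z≤n

      C>0 : 0 < C
      C>0 = positive C (part≥n/C (p x₀))
        where
        positive : ∀ C → n ≤ C * partSize p (p x₀) → 0 < C
        positive zero    h = ⊥-elim (n≮0 (≤-trans (FP.toℕ<n x₀) h))
        positive (suc _) _ = s≤s z≤n

      balance : R * sumFin (λ v → deg G v ∸ cross q v) ≤ sumFin (λ v → cross q v ∸ deg G v)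
      balance = begin
        R * sumFin (λ v → deg G v ∸ cross q v)  ≤⟨ *-monoʳ-≤ R (≤-trans gain-sum (*-monoʳ-≤ 2 (*-monoʳ-≤ (a * η) P-count))) ⟩
        R * (2 * (a * η * (δ + 3 * jj)))        ≡⟨ eq R a η δ jj ⟩
        b₁ * η * δ + 6 * (R * a) * η * jj       ≤⟨ +-monoʳ-≤ (b₁ * η * δ) (*-monoˡ-≤ jj (*-monoˡ-≤ η (m≤m+n (6 * (R * a)) (2 * m + 3 + m * b)))) ⟩
        b₁ * η * δ + c₁ * η * jj                ≤⟨ loss-sum ⟩
        sumFin (λ v → cross q v ∸ deg G v)      ∎
        where
        eq : ∀ R a η δ j → R * (2 * (a * η * (δ + 3 * j))) ≡ 2 * (R * a) * η * δ + 6 * (R * a) * η * j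
        eq = solve-∀

      conclusion : e r G ≤ crossPower r q
      conclusion = power-sum-compare ρ C (deg G) (cross q) C>0 (deg≤ G)
        -- As k ≥ 2, there is a part other than that of v, and it bounds the degree of v in the
        -- competitor from below.
        (λ v → ≤-trans (part≥n/C (proj₁ (other (p v)))) (*-monoʳ-≤ C (≤-trans (partSize≤cross p v _ (proj₂ (other (p v)))) (cross≤ᵠ v))))
        balance

    result : Result
    result = decide (matching Inner jj)
      where
      isolated : Covered → (Σ (Fin n → Bool) λ S → (∀ v → A v ≡ true → S v ≡ true) × count S ≡ s) → Result
      isolated (U , U-few , U-cover) (S , A⊆S , S-size) = finish (isolate S S-size p parts>s)
        where
        finish : (Σ (Vec (Fin (s + k)) n) λ q → GoodPartition s k (lookup q) ×
          (∀ v w → v ≢ w → lookup q v ≡ lookup q w → S v ≡ false × S w ≡ false × p v ≡ p w)) → Result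
        finish (q , q-good , separated) = q , q-good , Account.conclusion U U-few U-cover S A⊆S S-size (lookup q) separated
      decide : Matched ⊎ Covered → Result
      decide (inj₁ M) = ⊥-elim (¬matched M)
      decide (inj₂ U) = isolated U (superset-of-size A s A-few (≤-trans (<⇒≤ (parts>s (p x₀))) (count≤n _)))

goodPartition? : ∀ s k {n} (p : Fin n → Fin (s + k)) → Dec (GoodPartition s k p)
goodPartition? s k p = FP.all? (λ j → FP.any? (λ v → p v F.≟ j)) ×-dec FP.all? (λ i → partSize p (i ↑ˡ k) ≟ 1)

critical⇒¬colorable : ∀ {k H} → CriticalGraph k H → ¬ Colorable (graph H) k
critical⇒¬colorable {k} ((_ , minimal) , _) = minimal k ≤-refl

All-map : ∀ {X : Set} {P Q : X → Set} {xs} → (∀ {x} → P x → Q x) → All P xs → All Q xs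
All-map f []       = []
All-map f (h ∷ hs) = f h ∷ All-map f hs

All-++ : ∀ {X : Set} {P : X → Set} {xs ys} → All P xs → All P ys → All P (xs ++ ys)
All-++ []       h = h
All-++ (x ∷ xs) h = x ∷ All-++ xs h

extremal-disjoint-critical : ∀ j ρ s (crit others : List AGraph) → length crit ≡ suc s →
  All (CriticalGraph (suc (suc j))) crit → All (λ H → Colorable (graph H) (suc (suc j))) others →
  Σ ℕ λ N → ∀ n → N ≤ n → Σ (Fin n → Fin (s + suc (suc j))) λ p → GoodPartition s (suc (suc j)) p ×
    IsExr n (suc ρ) (graph (⨆ (crit ++ others))) (e (suc ρ) (completeMP p))
extremal-disjoint-critical j ρ s crit others len crit-ok others-ok = N , extremal
  where
  k r m C R a b c₁ c : ℕ
  k = suc (suc j)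
  r = suc ρ
  Fg = ⨆ (crit ++ others)
  m = size Fg
  C = partConst k ρ
  R = suc ρ * C ^ ρ
  a = 2 * m + 3
  b = a + 2 * (R * a)
  c₁ = 6 * (R * a) + (2 * m + 3 + m * b)
  c = a + 1 + c₁
  -- Blocks of size m suffice for a copy of F, and η must exceed m plus two vertices for each of the
  -- s + 1 seeds.
  st = structure (suc j) ρ c (m + 2 * suc s) m
  N = proj₁ st + C * suc s + suc k
  F-colorable : Colorable (graph Fg) (suc k)
  F-colorable = ⨆-colorable (crit ++ others) (All-++ (All-map (proj₁ ∘ proj₁) crit-ok)
    (All-map (λ {H} → Colorable-mono (graph H) (n≤1+n k)) others-ok))
  Extremal : ℕ → Set
  Extremal n = Σ (Fin n → Fin (s + k)) λ p → GoodPartition s k p × IsExr n r (graph Fg) (e r (completeMP p))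
  module _ (n : ℕ) (N≤n : N ≤ n) where
    n>k : k < n
    n>k = ≤-trans (m≤n+m (suc k) _) N≤n
    Val : Vec (Fin (s + k)) n → ℕ
    Val q = crossPower r (lookup q)
    Good : Vec (Fin (s + k)) n → Set
    Good q = GoodPartition s k (lookup q)
    x₀ : Fin n
    x₀ = F.fromℕ< (≤-<-trans z≤n n>k)
    -- The link to the hypothesis of `structure`: isolating s vertices of a best k-partition lowers
    -- no cross degree, so the result is at least every complete k-partite value.
    Dominating : Set
    Dominating = Σ (Vec (Fin (s + k)) n) λ q → Good q × (∀ (p : Fin n → Fin k) → crossPower r p ≤ Val q)
    dominating : Dominating
    dominating = build (maximal-crossPower (suc j) ρ n>k)
      where
      build : (Σ (Vec (Fin k) n) λ pv → (∀ (p : Fin n → Fin k) → crossPower r p ≤ crossPower r (lookup pv)) ×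
        (∀ i → n ≤ C * partSize (lookup pv) i)) → Dominating
      build (pv , max , parts) = isolated (superset-of-size (λ _ → false) s (≤-trans (≤-reflexive (count-none {n} (λ _ → refl))) z≤n)
          (≤-trans (<⇒≤ (large zero)) (count≤n _)))
        where
        large : ∀ i → s < partSize (lookup pv) i
        large i = *-cancelˡ-≤′ (≤-trans (≤-trans (m≤n+m (C * suc s) (proj₁ st)) (≤-trans (m≤m+n _ (suc k)) N≤n)) (parts i))
          where
          *-cancelˡ-≤′ : C * suc s ≤ C * partSize (lookup pv) i → s < partSize (lookup pv) i
          *-cancelˡ-≤′ = *-cancelˡ (≤-trans (pow>0 (3 * k) (suc r) (s≤s z≤n)) (≤-trans (m≤m+n _ _) (≤-reflexive (sym (partConst-def k ρ)))))
        isolated : (Σ (Fin n → Bool) λ S → (∀ v → false ≡ true → S v ≡ true) × count S ≡ s) → Dominating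
        isolated (S , _ , S-size) = finish (isolate S S-size (lookup pv) large)
          where
          finish : (Σ (Vec (Fin (s + k)) n) λ q → Good q ×
            (∀ v w → v ≢ w → lookup q v ≡ lookup q w → S v ≡ false × S w ≡ false × lookup pv v ≡ lookup pv w)) → Dominating
          finish (q , q-good , separated) = q , q-good , λ p → ≤-trans (max p) (sum-mono (λ v → ^-monoˡ-≤ r
            (count-mono (λ w h → not-intro (≢⇒==false λ e → ==false⇒≢ (not-elim h)
              (proj₂ (proj₂ (separated v w (λ e′ → ==false⇒≢ (not-elim h) (cong (lookup pv) e′)) e))))))))
    Best : Set
    Best = Σ (Vec (Fin (s + k)) n) λ q → Good q × (∀ q′ → Good q′ → Val q′ ≤ Val q)
    best : Best
    best = build dominating (argmaxL {P = Good} (λ q → goodPartition? s k (lookup q)) (λ q _ → Val q) (allVecs (s + k) n))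
      where
      build : Dominating → (∀ y → y ∈ allVecs (s + k) n → ¬ Good y) ⊎
        (Σ (Vec (Fin (s + k)) n) λ x → Σ (Good x) λ _ → ∀ y → y ∈ allVecs (s + k) n → Good y → Σ (Good y) λ _ → Val y ≤ Val x) → Best
      build (q , q-good , _) (inj₁ none) = ⊥-elim (none q (∈-allVecs q) q-good)
      build _ (inj₂ (q , q-good , max)) = q , q-good , λ q′ good → proj₂ (max q′ (∈-allVecs q′) good)
    extremal : Extremal n
    extremal = build best dominating
      where
      build : Best → Dominating → Extremal n
      build (q , q-good , q-max) (q₀ , q₀-good , dom) = lookup q , q-good ,
          (completeMP (lookup q) , singletons-free (lookup q) (proj₂ q-good) crit others len (All-map (λ {H} → critical⇒¬colorable {k} {H}) crit-ok) , refl) , upper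
        where
        upper : ∀ (G : Graph n) → (graph Fg -free) G → e r G ≤ e r (completeMP (lookup q))
        upper G free = ≤-trans (either (≤-total (e r G) (Val q))) (≤-reflexive (sym (e-completeMP r (lookup q))))
          where
          either : (e r G ≤ Val q) ⊎ (Val q ≤ e r G) → e r G ≤ Val q
          either (inj₁ h) = h
          either (inj₂ h) = bounded (proj₂ st (≤-trans (≤-trans (m≤m+n (proj₁ st) _) (m≤m+n _ (suc k))) N≤n) G
              (λ blowup → free (blowup⇒⊆ (graph Fg) G F-colorable blowup))
              (λ p → ≤-trans (dom p) (≤-trans (q-max q₀ q₀-good) h)))
            where
            bounded : (Σ ℕ λ η → Σ (Vec (Fin k) n) λ pv → m + 2 * suc s < η × Structured G (lookup pv) η c C) → e r G ≤ Val q
            bounded (η , pv , η-large , str) = finish (DisjointCritical.Bound.result ρ s crit others len crit-ok others-ok G free (lookup pv) η η-large str x₀)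
              where
              finish : (Σ (Vec (Fin (s + k)) n) λ q′ → GoodPartition s k (lookup q′) × e r G ≤ crossPower r (lookup q′)) → e r G ≤ Val q
              finish (q′ , q′-good , bound) = ≤-trans bound (q-max q′ q′-good)

-- Almost regular graphs of girth at least five inside the parts

deg-update : ∀ {n} (H H′ : Graph n) x u → x ≢ u → adj H x u ≡ false → adj H′ x u ≡ true →
  (∀ a b → ¬ (a ≡ x × b ≡ u) → ¬ (a ≡ u × b ≡ x) → adj H′ a b ≡ adj H a b) →
  ∀ a → deg H′ a ≡ deg H a + (⟦ a == x ⟧ + ⟦ a == u ⟧)
deg-update {n} H H′ x u x≢u old new same a = begin-equality
  deg H′ a ≡⟨ count≡sum (adj H′ a) ⟩
  sumFin (λ b → ⟦ adj H′ a b ⟧) ≡⟨ sum-cong (λ b → point b (a F.≟ x) (b F.≟ u) (a F.≟ u) (b F.≟ x)) ⟩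
  sumFin (λ b → ⟦ adj H a b ⟧ + (⟦ u == b ⟧ * ⟦ a == x ⟧ + ⟦ x == b ⟧ * ⟦ a == u ⟧))
    ≡⟨ sum-+ (λ b → ⟦ adj H a b ⟧) (λ b → ⟦ u == b ⟧ * ⟦ a == x ⟧ + ⟦ x == b ⟧ * ⟦ a == u ⟧) ⟩
  sumFin (λ b → ⟦ adj H a b ⟧) + sumFin (λ b → ⟦ u == b ⟧ * ⟦ a == x ⟧ + ⟦ x == b ⟧ * ⟦ a == u ⟧)
    ≡⟨ cong₂ _+_ (sym (count≡sum (adj H a))) (trans (sum-+ (λ b → ⟦ u == b ⟧ * ⟦ a == x ⟧) (λ b → ⟦ x == b ⟧ * ⟦ a == u ⟧))
         (cong₂ _+_ (sum-delta u (λ _ → ⟦ a == x ⟧)) (sum-delta x (λ _ → ⟦ a == u ⟧)))) ⟩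
  deg H a + (⟦ a == x ⟧ + ⟦ a == u ⟧) ∎
  where
  open ≤-Reasoning
  point : ∀ b → Dec (a ≡ x) → Dec (b ≡ u) → Dec (a ≡ u) → Dec (b ≡ x) →
    ⟦ adj H′ a b ⟧ ≡ ⟦ adj H a b ⟧ + (⟦ u == b ⟧ * ⟦ a == x ⟧ + ⟦ x == b ⟧ * ⟦ a == u ⟧)
  point b (yes refl) (yes refl) _ _ rewrite new | old | ==-refl x | ==-refl u | ≢⇒==false x≢u = refl
  point b _ _ (yes refl) (yes refl) rewrite adj-sym H′ u x | adj-sym H u x | new | old | ==-refl x | ==-refl u | ≢⇒==false (x≢u ∘ sym) = refl
  point b (no e) _ (no e′) _ rewrite same a b (e ∘ proj₁) (e′ ∘ proj₁) | ≢⇒==false e | ≢⇒==false e′ | *-zeroʳ ⟦ u == b ⟧ | *-zeroʳ ⟦ x == b ⟧ = sym (+-identityʳ _)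
  point b (no e) _ _ (no e′) rewrite same a b (e ∘ proj₁) (e′ ∘ proj₂) | ≢⇒==false e | ≢⇒==false (e′ ∘ sym) | *-zeroʳ ⟦ u == b ⟧ = sym (+-identityʳ _)
  point b _ (no e) (no e′) _ rewrite same a b (e ∘ proj₂) (e′ ∘ proj₁) | ≢⇒==false (e ∘ sym) | ≢⇒==false e′ | *-zeroʳ ⟦ x == b ⟧ = sym (+-identityʳ _)
  point b _ (no e) _ (no e′) rewrite same a b (e ∘ proj₂) (e′ ∘ proj₂) | ≢⇒==false (e ∘ sym) | ≢⇒==false (e′ ∘ sym) = sym (+-identityʳ _)

degSum : ∀ {n} → Graph n → ℕ
degSum H = sumFin (deg H)

degSum-update : ∀ {n} (H H′ : Graph n) x u → (∀ a → deg H′ a ≡ deg H a + (⟦ a == x ⟧ + ⟦ a == u ⟧)) →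
  degSum H′ ≡ degSum H + 2
degSum-update H H′ x u h = trans (sum-cong h) (trans (sum-+ (deg H) (λ a → ⟦ a == x ⟧ + ⟦ a == u ⟧))
  (cong (degSum H +_) (trans (sum-+ (λ a → ⟦ a == x ⟧) (λ a → ⟦ a == u ⟧))
    (cong₂ _+_ (trans (sym (count≡sum (_== x))) (count-≡ʳ x)) (trans (sym (count≡sum (_== u))) (count-≡ʳ u))))))

addEdge : ∀ {n} → Graph n → Fin n → Fin n → Graph n
addEdge H x u = mkGraph (λ a b → adj H a b ∨ ((a == x) ∧ (b == u)))

module _ {n : ℕ} (H : Graph n) (x u : Fin n) where

  addEdge-elim : ∀ a b → adj (addEdge H x u) a b ≡ true →
    (adj H a b ≡ true) ⊎ ((a ≡ x × b ≡ u) ⊎ (a ≡ u × b ≡ x))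
  addEdge-elim a b h with proj₁ (mkGraph-elim (λ a b → adj H a b ∨ ((a == x) ∧ (b == u))) a b h)
  ... | inj₁ e with ∨-elim {adj H a b} e
  ...   | inj₁ q = inj₁ q
  ...   | inj₂ q = inj₂ (inj₁ (==⇒≡ (∧-elimˡ q) , ==⇒≡ (∧-elimʳ {a == x} q)))
  addEdge-elim a b h | inj₂ e with ∨-elim {adj H b a} e
  ...   | inj₁ q = inj₁ (trans (adj-sym H a b) q)
  ...   | inj₂ q = inj₂ (inj₂ (==⇒≡ (∧-elimʳ {b == x} q) , ==⇒≡ (∧-elimˡ q)))

  addEdge-old : ∀ a b → adj H a b ≡ true → adj (addEdge H x u) a b ≡ true
  addEdge-old a b h = mkGraph-intro (λ a b → adj H a b ∨ ((a == x) ∧ (b == u))) a b (∨-introˡ h) (irreflexive H h)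

  addEdge-new : x ≢ u → adj (addEdge H x u) x u ≡ true
  addEdge-new ne = mkGraph-intro (λ a b → adj H a b ∨ ((a == x) ∧ (b == u))) x u
    (∨-introʳ {adj H x u} (∧-intro (==-refl x) (==-refl u))) ne

  addEdge-deg : x ≢ u → adj H x u ≡ false → ∀ a → deg (addEdge H x u) a ≡ deg H a + (⟦ a == x ⟧ + ⟦ a == u ⟧)
  addEdge-deg ne old = deg-update H (addEdge H x u) x u ne old (addEdge-new ne)
    (λ a b n₁ n₂ → ⇔⇒≡ (λ h → case addEdge-elim a b h of λ
      { (inj₁ q) → q ; (inj₂ (inj₁ q)) → ⊥-elim (n₁ q) ; (inj₂ (inj₂ q)) → ⊥-elim (n₂ q) }) (addEdge-old a b))

module _ {n : ℕ} (H : Graph n) (x u : Fin n) where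

  deleted : Fin n → Fin n → Bool
  deleted a b = adj H a b ∧ not (((a == x) ∧ (b == u)) ∨ ((a == u) ∧ (b == x)))

  private
    not-pair : ∀ a b → not (((a == x) ∧ (b == u)) ∨ ((a == u) ∧ (b == x))) ≡ true → ¬ (a ≡ x × b ≡ u) × ¬ (a ≡ u × b ≡ x)
    not-pair a b h = (λ { (refl , refl) → true≢false (∨-introˡ (∧-intro (==-refl a) (==-refl b))) (not-elim h) }) ,
      (λ { (refl , refl) → true≢false (∨-introʳ {(a == x) ∧ (b == u)} (∧-intro (==-refl a) (==-refl b))) (not-elim h) })

  deleteEdge-elim : ∀ a b → adj (deleteEdge H x u) a b ≡ true →
    adj H a b ≡ true × ¬ (a ≡ x × b ≡ u) × ¬ (a ≡ u × b ≡ x)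
  deleteEdge-elim a b h with proj₁ (mkGraph-elim deleted a b h)
  ... | inj₁ e = ∧-elimˡ e , not-pair a b (∧-elimʳ {adj H a b} e)
  ... | inj₂ e = trans (adj-sym H a b) (∧-elimˡ e) ,
        (λ { (q , q′) → proj₂ (not-pair b a (∧-elimʳ {adj H b a} e)) (q′ , q) }) ,
        (λ { (q , q′) → proj₁ (not-pair b a (∧-elimʳ {adj H b a} e)) (q′ , q) })

  deleteEdge-deg : adj H x u ≡ true → ∀ a → deg H a ≡ deg (deleteEdge H x u) a + (⟦ a == x ⟧ + ⟦ a == u ⟧)
  deleteEdge-deg xu = deg-update (deleteEdge H x u) H x u (irreflexive H xu)
    (≢true⇒false (λ h → proj₁ (proj₂ (deleteEdge-elim x u h)) (refl , refl))) xu
    (λ a b n₁ n₂ → ⇔⇒≡ (λ h → mkGraph-intro deleted a b (∧-intro h (not-intro (≢true⇒false (λ q → excluded a b n₁ n₂ (∨-elim q))))) (irreflexive H h))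
      (λ h → proj₁ (deleteEdge-elim a b h)))
    where
    excluded : ∀ a b → ¬ (a ≡ x × b ≡ u) → ¬ (a ≡ u × b ≡ x) → ((a == x) ∧ (b == u) ≡ true) ⊎ ((a == u) ∧ (b == x) ≡ true) → ⊥
    excluded a b n₁ n₂ (inj₁ q) = n₁ (==⇒≡ (∧-elimˡ q) , ==⇒≡ (∧-elimʳ {a == x} q))
    excluded a b n₁ n₂ (inj₂ q) = n₂ (==⇒≡ (∧-elimˡ q) , ==⇒≡ (∧-elimʳ {a == u} q))

-- The freeness proof has to exclude 4-cycles. Triangles are excluded for the improvement step: if
-- the deficiency sits at a single vertex x, replacing uv by xu and xv would turn a triangle uzv
-- into a 4-cycle xuzv.
record Girth5 {n : ℕ} {k : ℕ} (p : Fin n → Fin k) (ℓ : ℕ) (H : Graph n) : Set where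
  field
    inner    : ∀ a b → adj H a b ≡ true → p a ≡ p b
    deg≤ℓ    : ∀ a → deg H a ≤ ℓ
    triangle : ∀ a b c → adj H a b ≡ true → adj H b c ≡ true → adj H c a ≡ true → ⊥
    square   : ∀ a b c d → a ≢ c → b ≢ d → adj H a b ≡ true → adj H b c ≡ true → adj H c d ≡ true → adj H d a ≡ true → ⊥

module _ {n : ℕ} {k : ℕ} {p : Fin n → Fin k} {ℓ : ℕ} {H : Graph n} (valid : Girth5 p ℓ H) where
  open Girth5 valid

  deleteEdge-girth5 : ∀ x u → adj H x u ≡ true → Girth5 p ℓ (deleteEdge H x u)
  deleteEdge-girth5 x u xu = record
    { inner    = λ a b h → inner a b (old a b h)
    ; deg≤ℓ    = λ a → ≤-trans (≤-trans (m≤m+n _ _) (≤-reflexive (sym (deleteEdge-deg H x u xu a)))) (deg≤ℓ a)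
    ; triangle = λ a b c h₁ h₂ h₃ → triangle a b c (old a b h₁) (old b c h₂) (old c a h₃)
    ; square   = λ a b c d n₁ n₂ h₁ h₂ h₃ h₄ → square a b c d n₁ n₂ (old a b h₁) (old b c h₂) (old c d h₃) (old d a h₄)
    }
    where
    old : ∀ a b → adj (deleteEdge H x u) a b ≡ true → adj H a b ≡ true
    old a b h = proj₁ (deleteEdge-elim H x u a b h)

  addEdge-girth5 : ∀ x u → p x ≡ p u → x ≢ u → deg H x < ℓ → deg H u < ℓ → adj H x u ≡ false →
    (∀ w → adj H x w ≡ true → adj H w u ≡ true → ⊥) →
    (∀ w z → adj H x w ≡ true → adj H w z ≡ true → adj H z u ≡ true → ⊥) →
    Girth5 p ℓ (addEdge H x u)
  addEdge-girth5 x u px≡pu x≢u dx du no₁ no₂ no₃ = record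
    { inner    = λ a b h → inner′ a b (addEdge-elim H x u a b h)
    ; deg≤ℓ    = λ a → ≤-trans (≤-reflexive (addEdge-deg H x u x≢u no₁ a)) (bound a (a F.≟ x) (a F.≟ u))
    ; triangle = λ a b c h₁ h₂ h₃ → tri a b c h₁ h₂ h₃ (elim a b h₁) (elim b c h₂) (elim c a h₃)
    ; square   = λ a b c d n₁ n₂ h₁ h₂ h₃ h₄ → sq a b c d n₁ n₂ h₁ h₂ h₃ h₄ (elim a b h₁) (elim b c h₂) (elim c d h₃) (elim d a h₄)
    }
    where
    H′ = addEdge H x u
    elim = addEdge-elim H x u
    flip : ∀ a b → adj H a b ≡ true → adj H b a ≡ true
    flip a b h = trans (adj-sym H b a) h
    flip′ : ∀ a b → adj H′ a b ≡ true → adj H′ b a ≡ true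
    flip′ a b h = trans (adj-sym H′ b a) h
    loop : ∀ {a} → adj H′ a a ≡ true → ⊥
    loop {a} h = true≢false h (irrefl H′ a)
    New : Fin n → Fin n → Set
    New a b = (a ≡ x × b ≡ u) ⊎ (a ≡ u × b ≡ x)
    inner′ : ∀ a b → (adj H a b ≡ true) ⊎ New a b → p a ≡ p b
    inner′ a b (inj₁ h) = inner a b h
    inner′ a b (inj₂ (inj₁ (refl , refl))) = px≡pu
    inner′ a b (inj₂ (inj₂ (refl , refl))) = sym px≡pu
    bound : ∀ a → Dec (a ≡ x) → Dec (a ≡ u) → deg H a + (⟦ a == x ⟧ + ⟦ a == u ⟧) ≤ ℓ
    bound a (yes refl) (yes refl) = ⊥-elim (x≢u refl)
    bound a (yes refl) (no e) rewrite ==-refl x | ≢⇒==false e = ≤-trans (≤-reflexive (+-comm _ 1)) dx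
    bound a (no e) (yes refl) rewrite ==-refl u | ≢⇒==false e = ≤-trans (≤-reflexive (+-comm _ 1)) du
    bound a (no e) (no e′) rewrite ≢⇒==false e | ≢⇒==false e′ = ≤-trans (≤-reflexive (+-identityʳ _)) (deg≤ℓ a)
    walk₂ : ∀ c → adj H′ u c ≡ true → adj H′ c x ≡ true → (adj H u c ≡ true) ⊎ New u c → (adj H c x ≡ true) ⊎ New c x → ⊥
    walk₂ c h h′ (inj₁ e) (inj₁ e′) = no₂ c (flip c x e′) (flip u c e)
    walk₂ c h h′ (inj₂ (inj₁ (e , _))) _ = x≢u (sym e)
    walk₂ c h h′ (inj₂ (inj₂ (_ , refl))) _ = loop h′
    walk₂ c h h′ _ (inj₂ (inj₁ (_ , e))) = x≢u e
    walk₂ c h h′ _ (inj₂ (inj₂ (refl , _))) = loop h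
    -- A short cycle is rotated, and reversed if necessary, until it starts with the new edge from x
    -- to u; what remains is a walk from u back to x.
    through₂ : ∀ a b c → New a b → adj H′ b c ≡ true → adj H′ c a ≡ true → ⊥
    through₂ a b c (inj₁ (refl , refl)) h h′ = walk₂ c h h′ (elim u c h) (elim c x h′)
    through₂ a b c (inj₂ (refl , refl)) h h′ = walk₂ c (flip′ c u h′) (flip′ x c h) (elim u c (flip′ c u h′)) (elim c x (flip′ x c h))
    tri : ∀ a b c → adj H′ a b ≡ true → adj H′ b c ≡ true → adj H′ c a ≡ true →
      (adj H a b ≡ true) ⊎ New a b → (adj H b c ≡ true) ⊎ New b c → (adj H c a ≡ true) ⊎ New c a → ⊥
    tri a b c h₁ h₂ h₃ (inj₂ e) _ _ = through₂ a b c e h₂ h₃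
    tri a b c h₁ h₂ h₃ _ (inj₂ e) _ = through₂ b c a e h₃ h₁
    tri a b c h₁ h₂ h₃ _ _ (inj₂ e) = through₂ c a b e h₁ h₂
    tri a b c h₁ h₂ h₃ (inj₁ e₁) (inj₁ e₂) (inj₁ e₃) = triangle a b c e₁ e₂ e₃
    walk₃ : ∀ c d → c ≢ x → d ≢ u → adj H′ u c ≡ true →
      (adj H u c ≡ true) ⊎ New u c → (adj H c d ≡ true) ⊎ New c d → (adj H d x ≡ true) ⊎ New d x → ⊥
    walk₃ c d n₁ n₂ h (inj₁ e₁) (inj₁ e₂) (inj₁ e₃) = no₃ d c (flip d x e₃) (flip c d e₂) (flip u c e₁)
    walk₃ c d n₁ n₂ h (inj₂ (inj₁ (e , _))) _ _ = x≢u (sym e)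
    walk₃ c d n₁ n₂ h (inj₂ (inj₂ (_ , e))) _ _ = n₁ e
    walk₃ c d n₁ n₂ h _ _ (inj₂ (inj₁ (_ , e))) = x≢u e
    walk₃ c d n₁ n₂ h _ _ (inj₂ (inj₂ (e , _))) = n₂ e
    walk₃ c d n₁ n₂ h _ (inj₂ (inj₁ (e , _))) _ = n₁ e
    walk₃ c d n₁ n₂ h _ (inj₂ (inj₂ (refl , _))) _ = loop h
    through₃ : ∀ a b c d → a ≢ c → b ≢ d → New a b → adj H′ b c ≡ true → adj H′ c d ≡ true → adj H′ d a ≡ true → ⊥
    through₃ a b c d n₁ n₂ (inj₁ (refl , refl)) h h′ h″ = walk₃ c d (n₁ ∘ sym) (n₂ ∘ sym) h (elim u c h) (elim c d h′) (elim d x h″)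
    through₃ a b c d n₁ n₂ (inj₂ (refl , refl)) h h′ h″ = walk₃ d c (n₂ ∘ sym) (n₁ ∘ sym) (flip′ d u h″)
      (elim u d (flip′ d u h″)) (elim d c (flip′ c d h′)) (elim c x (flip′ x c h))
    sq : ∀ a b c d → a ≢ c → b ≢ d → adj H′ a b ≡ true → adj H′ b c ≡ true → adj H′ c d ≡ true → adj H′ d a ≡ true →
      (adj H a b ≡ true) ⊎ New a b → (adj H b c ≡ true) ⊎ New b c → (adj H c d ≡ true) ⊎ New c d → (adj H d a ≡ true) ⊎ New d a → ⊥
    sq a b c d n₁ n₂ h₁ h₂ h₃ h₄ (inj₂ e) _ _ _ = through₃ a b c d n₁ n₂ e h₂ h₃ h₄
    sq a b c d n₁ n₂ h₁ h₂ h₃ h₄ _ (inj₂ e) _ _ = through₃ b c d a n₂ (n₁ ∘ sym) e h₃ h₄ h₁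
    sq a b c d n₁ n₂ h₁ h₂ h₃ h₄ _ _ (inj₂ e) _ = through₃ c d a b (n₁ ∘ sym) (n₂ ∘ sym) e h₄ h₁ h₂
    sq a b c d n₁ n₂ h₁ h₂ h₃ h₄ _ _ _ (inj₂ e) = through₃ d a b c (n₂ ∘ sym) n₁ e h₁ h₂ h₃
    sq a b c d n₁ n₂ h₁ h₂ h₃ h₄ (inj₁ e₁) (inj₁ e₂) (inj₁ e₃) (inj₁ e₄) = square a b c d n₁ n₂ e₁ e₂ e₃ e₄

module _ {n : ℕ} {k : ℕ} {p : Fin n → Fin k} {ℓ : ℕ} {H : Graph n} (valid : Girth5 p ℓ H) where
  open Girth5 valid

  -- A vertex u far from the deficient vertices x and y is joined to x if it is
  -- itself deficient; otherwise an edge uv is replaced by xu and yv.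
  swap-improves : ∀ x y i → p x ≡ i → p y ≡ i → deg H x < ℓ → deg H y + ⟦ y == x ⟧ < ℓ →
    suc ℓ * (suc ℓ * (suc ℓ * (suc ℓ * 2))) < partSize p i →
    Σ (Graph n) λ H′ → Girth5 p ℓ H′ × degSum H < degSum H′
  swap-improves x y i px py dx dy large = far-vertex (count>⇒avoiding {m = 1} (λ v → p v == i) (λ _ → ball₄) (≤-<-trans (≤-reflexive (+-identityʳ _)) (≤-<-trans ball₄-count large)))
    where
    grow : (Fin n → Bool) → Fin n → Bool
    grow S v = S v ∨ someF (λ w → S w ∧ adj H w v)
    grow-count : ∀ S → count (grow S) ≤ suc ℓ * count S
    grow-count S = begin
      count (grow S) ≤⟨ count-∨≤ S _ ⟩
      count S + count (λ v → someF (λ w → S w ∧ adj H w v)) ≤⟨ +-monoʳ-≤ (count S) (count-someF≤ (λ w v → S w ∧ adj H w v)) ⟩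
      count S + sumFin (λ w → count (λ v → S w ∧ adj H w v)) ≤⟨ +-monoʳ-≤ (count S) (sum-mono (λ w → row w (true⊎false (S w)))) ⟩
      count S + sumFin (λ w → ℓ * ⟦ S w ⟧) ≡⟨ cong (count S +_) (trans (sum-* ℓ (λ w → ⟦ S w ⟧)) (cong (ℓ *_) (sym (count≡sum S)))) ⟩
      suc ℓ * count S ∎
      where
      open ≤-Reasoning
      row : ∀ w → (S w ≡ true) ⊎ (S w ≡ false) → count (λ v → S w ∧ adj H w v) ≤ ℓ * ⟦ S w ⟧
      row w (inj₁ e) rewrite e = ≤-trans (deg≤ℓ w) (≤-reflexive (sym (*-identityʳ ℓ)))
      row w (inj₂ e) rewrite e = ≤-trans (≤-reflexive (count-none {n} (λ _ → refl))) z≤n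
    -- Radius four for u puts every neighbour v of u outside radius three, which excludes walks of
    -- length at most three from x or y to either of them.
    ball₀ ball₁ ball₂ ball₃ ball₄ : Fin n → Bool
    ball₀ v = (v == x) ∨ (v == y)
    ball₁ = grow ball₀
    ball₂ = grow ball₁
    ball₃ = grow ball₂
    ball₄ = grow ball₃
    ball₄-count : count ball₄ ≤ suc ℓ * (suc ℓ * (suc ℓ * (suc ℓ * 2)))
    ball₄-count = ≤-trans (grow-count ball₃) (*-monoʳ-≤ (suc ℓ) (≤-trans (grow-count ball₂) (*-monoʳ-≤ (suc ℓ)
      (≤-trans (grow-count ball₁) (*-monoʳ-≤ (suc ℓ) (≤-trans (grow-count ball₀) (*-monoʳ-≤ (suc ℓ)
        (≤-trans (count-∨≤ (_== x) (_== y)) (≤-reflexive (cong₂ _+_ (count-≡ʳ x) (count-≡ʳ y)))))))))))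
    grow-step : ∀ S {w v} → S w ≡ true → adj H w v ≡ true → grow S v ≡ true
    grow-step S {w} {v} h h′ = ∨-introʳ {S v} (someF-intro (λ w → S w ∧ adj H w v) w (∧-intro h h′))
    grow-mono : ∀ S {v} → S v ≡ true → grow S v ≡ true
    grow-mono S h = ∨-introˡ h
    far-back : ∀ S {v} → grow S v ≡ false → S v ≡ false
    far-back S h = ≢true⇒false (λ e → true≢false (grow-mono S e) h)
    Far : Fin n → Set
    Far v = ball₃ v ≡ false
    x₀ : ball₀ x ≡ true
    x₀ = ∨-introˡ (==-refl x)
    y₀ : ball₀ y ≡ true
    y₀ = ∨-introʳ {y == x} (==-refl y)
    module Walks {v : Fin n} (far : Far v) where
      far₂ : ball₂ v ≡ false
      far₂ = far-back ball₂ far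
      far₁ : ball₁ v ≡ false
      far₁ = far-back ball₁ far₂
      apart : ∀ {z} → ball₀ z ≡ true → z ≢ v
      apart h refl = true≢false h (far-back ball₀ far₁)
      walk₁ : ∀ {z} → ball₀ z ≡ true → adj H z v ≡ true → ⊥
      walk₁ h e = true≢false (grow-step ball₀ h e) far₁
      walk₂ : ∀ {z} w → ball₀ z ≡ true → adj H z w ≡ true → adj H w v ≡ true → ⊥
      walk₂ w h e e′ = true≢false (grow-step ball₁ (grow-step ball₀ h e) e′) far₂
      walk₃ : ∀ {z} w w′ → ball₀ z ≡ true → adj H z w ≡ true → adj H w w′ ≡ true → adj H w′ v ≡ true → ⊥
      walk₃ w w′ h e e′ e″ = true≢false (grow-step ball₂ (grow-step ball₁ (grow-step ball₀ h e) e′) e″) far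
    Goal : Set
    Goal = Σ (Graph n) λ H′ → Girth5 p ℓ H′ × degSum H < degSum H′
    flip : ∀ {a b} → adj H a b ≡ true → adj H b a ≡ true
    flip {a} {b} h = trans (adj-sym H b a) h
    far-vertex : (∃ λ u → (p u == i) ≡ true × (∀ (_ : Fin 1) → ball₄ u ≡ false)) → Goal
    far-vertex (u , pu , far₄) = decide (m≤n⇒m<n∨m≡n (deg≤ℓ u))
      where
      farᵤ : Far u
      farᵤ = far-back ball₃ (far₄ zero)
      module U = Walks farᵤ
      x≢u : x ≢ u
      x≢u = U.apart x₀
      px≡pu : p x ≡ p u
      px≡pu = trans px (sym (==⇒≡ pu))
      ¬xu : adj H x u ≡ false
      ¬xu = ≢true⇒false (U.walk₁ x₀)
      replace : (∃ λ v → adj H u v ≡ true) → Goal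
      replace (v , uv) = H₃ , H₃-valid , ≤-trans (n≤1+n _) (≤-reflexive (sym total))
        where
        farᵥ : Far v
        farᵥ = ≢true⇒false (λ h → true≢false (grow-step ball₃ h (flip uv)) (far₄ zero))
        module V = Walks farᵥ
        u≢v : u ≢ v
        u≢v = irreflexive H uv
        H₁ = deleteEdge H u v
        H₂ = addEdge H₁ x u
        H₃ = addEdge H₂ y v
        old₁ : ∀ {a b} → adj H₁ a b ≡ true → adj H a b ≡ true
        old₁ {a} {b} h = proj₁ (deleteEdge-elim H u v a b h)
        deg₁ = deleteEdge-deg H u v uv
        deg₁-other : ∀ {a} → a ≢ u → a ≢ v → deg H₁ a ≡ deg H a
        deg₁-other {a} e e′ = sym (trans (deg₁ a) (trans (cong (deg H₁ a +_) (cong₂ (λ b c → ⟦ b ⟧ + ⟦ c ⟧) (≢⇒==false e) (≢⇒==false e′))) (+-identityʳ _)))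
        deg₁-u : deg H₁ u < ℓ
        deg₁-u = ≤-trans (≤-reflexive (sym (trans (deg₁ u) (trans (cong (deg H₁ u +_) (cong₂ (λ b c → ⟦ b ⟧ + ⟦ c ⟧) (==-refl u) (≢⇒==false u≢v))) (+-comm _ 1))))) (deg≤ℓ u)
        deg₁-v : deg H₁ v < ℓ
        deg₁-v = ≤-trans (≤-reflexive (sym (trans (deg₁ v) (trans (cong (deg H₁ v +_) (cong₂ (λ b c → ⟦ b ⟧ + ⟦ c ⟧) (≢⇒==false (u≢v ∘ sym)) (==-refl v))) (+-comm _ 1))))) (deg≤ℓ v)
        ¬xu₁ : adj H₁ x u ≡ false
        ¬xu₁ = ≢true⇒false (λ h → U.walk₁ x₀ (old₁ h))
        H₁-valid : Girth5 p ℓ H₁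
        H₁-valid = deleteEdge-girth5 valid u v uv
        H₂-valid : Girth5 p ℓ H₂
        H₂-valid = addEdge-girth5 H₁-valid x u px≡pu x≢u (≤-<-trans (≤-reflexive (deg₁-other x≢u (V.apart x₀))) dx) deg₁-u ¬xu₁
          (λ w h h′ → U.walk₂ w x₀ (old₁ h) (old₁ h′)) (λ w z h h′ h″ → U.walk₃ w z x₀ (old₁ h) (old₁ h′) (old₁ h″))
        y≢u : y ≢ u
        y≢u = U.apart y₀
        y≢v : y ≢ v
        y≢v = V.apart y₀
        x≢v : x ≢ v
        x≢v = V.apart x₀
        deg₂ = addEdge-deg H₁ x u x≢u ¬xu₁
        -- If y = x, the edge xu has already used one unit of the deficiency; the summand for y = x
        -- in the hypothesis reserves a second one.
        deg₂-y : deg H₂ y < ℓ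
        deg₂-y = ≤-<-trans (≤-reflexive (trans (deg₂ y) (cong₂ _+_ (deg₁-other y≢u y≢v)
          (trans (cong (λ b → ⟦ y == x ⟧ + ⟦ b ⟧) (≢⇒==false y≢u)) (+-identityʳ _))))) dy
        deg₂-v : deg H₂ v < ℓ
        deg₂-v = ≤-<-trans (≤-reflexive (trans (deg₂ v) (trans (cong (deg H₁ v +_) (cong₂ (λ b c → ⟦ b ⟧ + ⟦ c ⟧) (≢⇒==false (x≢v ∘ sym)) (≢⇒==false (u≢v ∘ sym)))) (+-identityʳ _)))) deg₁-v
        New : Fin n → Fin n → Set
        New a b = (a ≡ x × b ≡ u) ⊎ (a ≡ u × b ≡ x)
        elim₂ : ∀ a b → adj H₂ a b ≡ true → (adj H₁ a b ≡ true) ⊎ New a b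
        elim₂ = addEdge-elim H₁ x u
        ¬uv₁ : adj H₁ u v ≡ true → ⊥
        ¬uv₁ h = proj₁ (proj₂ (deleteEdge-elim H u v u v h)) (refl , refl)
        -- The only new edge xu starts in the ball, but leads back to v only
        -- through the deleted edge uv or a short cycle of H through it.
        no₁ : (adj H₁ y v ≡ true) ⊎ New y v → ⊥
        no₁ (inj₁ h) = V.walk₁ y₀ (old₁ h)
        no₁ (inj₂ (inj₁ (_ , e))) = u≢v (sym e)
        no₁ (inj₂ (inj₂ (e , _))) = y≢u e
        no₂ : ∀ w → (adj H₁ y w ≡ true) ⊎ New y w → (adj H₁ w v ≡ true) ⊎ New w v → ⊥
        no₂ w (inj₁ h) (inj₁ h′) = V.walk₂ w y₀ (old₁ h) (old₁ h′)
        no₂ w (inj₂ (inj₁ (_ , refl))) (inj₁ h′) = ¬uv₁ h′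
        no₂ w (inj₂ (inj₂ (e , _))) _ = y≢u e
        no₂ w _ (inj₂ (inj₁ (_ , e))) = u≢v (sym e)
        no₂ w _ (inj₂ (inj₂ (_ , e))) = x≢v (sym e)
        no₃ : ∀ w z → (adj H₁ y w ≡ true) ⊎ New y w → (adj H₁ w z ≡ true) ⊎ New w z → (adj H₁ z v ≡ true) ⊎ New z v → ⊥
        no₃ w z (inj₁ h) (inj₁ h′) (inj₁ h″) = V.walk₃ w z y₀ (old₁ h) (old₁ h′) (old₁ h″)
        no₃ w z (inj₁ h) (inj₂ (inj₁ (_ , refl))) (inj₁ h″) = ¬uv₁ h″
        no₃ w z (inj₁ h) (inj₂ (inj₂ (refl , _))) (inj₁ h″) = U.walk₁ y₀ (old₁ h)
        no₃ w z (inj₂ (inj₁ (_ , refl))) (inj₁ h′) (inj₁ h″) = triangle u z v (old₁ h′) (old₁ h″) (flip uv)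
        no₃ w z (inj₂ (inj₁ (_ , refl))) (inj₂ (inj₁ (e , _))) _ = x≢u (sym e)
        no₃ w z (inj₂ (inj₁ (_ , refl))) (inj₂ (inj₂ (_ , refl))) (inj₁ h″) = V.walk₁ x₀ (old₁ h″)
        no₃ w z (inj₂ (inj₂ (e , _))) _ _ = y≢u e
        no₃ w z _ _ (inj₂ (inj₁ (_ , e))) = u≢v (sym e)
        no₃ w z _ _ (inj₂ (inj₂ (_ , e))) = x≢v (sym e)
        ¬yv₂ : adj H₂ y v ≡ false
        ¬yv₂ = ≢true⇒false (λ h → no₁ (elim₂ y v h))
        H₃-valid : Girth5 p ℓ H₃
        H₃-valid = addEdge-girth5 H₂-valid y v (trans py (trans (sym (==⇒≡ pu)) (inner u v uv))) y≢v deg₂-y deg₂-v ¬yv₂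
          (λ w h h′ → no₂ w (elim₂ y w h) (elim₂ w v h′)) (λ w z h h′ h″ → no₃ w z (elim₂ y w h) (elim₂ w z h′) (elim₂ z v h″))
        total : degSum H₃ ≡ suc (suc (degSum H))
        total = trans (degSum-update H₂ H₃ y v (addEdge-deg H₂ y v y≢v ¬yv₂))
          (trans (cong (_+ 2) (trans (degSum-update H₁ H₂ x u deg₂) (sym (degSum-update H₁ H u v deg₁)))) (+-comm _ 2))
      decide : (deg H u < ℓ) ⊎ (deg H u ≡ ℓ) → Goal
      decide (inj₁ du) = addEdge H x u , addEdge-girth5 valid x u px≡pu x≢u dx du ¬xu
          (λ w → U.walk₂ w x₀) (λ w z → U.walk₃ w z x₀) ,
        ≤-trans (≤-trans (≤-reflexive (+-comm 1 _)) (+-monoʳ-≤ (degSum H) (s≤s z≤n)))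
          (≤-reflexive (sym (degSum-update H (addEdge H x u) x u (addEdge-deg H x u x≢u ¬xu))))
      decide (inj₂ du) = replace (count>0⇒some (adj H u) (≤-<-trans z≤n (≤-trans dx (≤-reflexive (sym du)))))

AlmostRegular : ∀ {n k} → (Fin n → Fin k) → ℕ → Graph n → Fin k → Set
AlmostRegular {n} p ℓ H j = (∀ v → p v ≡ j → deg H v ≡ ℓ) ⊎
  (Σ (Fin n) λ v₀ → p v₀ ≡ j × suc (deg H v₀) ≡ ℓ × (∀ v → p v ≡ j → v ≢ v₀ → deg H v ≡ ℓ))

all-or-one : ∀ {k} {P : Fin k → Set} {Q : Set} → (∀ j → P j ⊎ Q) → (∀ j → P j) ⊎ Q
all-or-one {zero}  f = inj₁ λ ()
all-or-one {suc k} f with f zero | all-or-one (f ∘ suc)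
... | inj₂ q | _      = inj₂ q
... | inj₁ _ | inj₂ q = inj₂ q
... | inj₁ h | inj₁ g = inj₁ λ { zero → h ; (suc j) → g j }

swapBound : ℕ → ℕ
swapBound ℓ = suc ℓ * (suc ℓ * (suc ℓ * (suc ℓ * 2)))

module Regularise {n : ℕ} {k : ℕ} (p : Fin n → Fin k) (ℓ : ℕ) (large : ∀ j → swapBound ℓ < partSize p j) where

  Improved : Graph n → Set
  Improved H = Σ (Graph n) λ H′ → Girth5 p ℓ H′ × degSum H < degSum H′

  -- A part that is not almost regular has two deficient vertices, or one whose degree is at most ℓ
  -- - 2. The latter is the case y = x of `swap-improves`.
  check : ∀ H → Girth5 p ℓ H → ∀ j → AlmostRegular p ℓ H j ⊎ Improved H
  check H valid j = first (findTrue (λ x → (p x == j) ∧ le (suc (deg H x)) ℓ))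
    where
    open Girth5 valid
    full : ∀ v → p v ≡ j → le (suc (deg H v)) ℓ ≡ false → deg H v ≡ ℓ
    full v _ h = ≤-antisym (deg≤ℓ v) (s≤s⁻¹ (nle⇒> h))
    drop : ∀ {a b} → a ≡ true → a ∧ b ≡ false → b ≡ false
    drop refl h = h
    second : ∀ x → p x ≡ j → deg H x < ℓ →
      (∃ λ y → ((p y == j) ∧ not (y == x)) ∧ le (suc (deg H y)) ℓ ≡ true) ⊎
      (∀ y → ((p y == j) ∧ not (y == x)) ∧ le (suc (deg H y)) ℓ ≡ false) → AlmostRegular p ℓ H j ⊎ Improved H
    second x px dx (inj₁ (y , h)) = inj₂ (swap-improves valid x y j px (==⇒≡ (∧-elimˡ (∧-elimˡ h))) dx
      (≤-trans (≤-reflexive (cong suc (trans (cong (λ b → deg H y + ⟦ b ⟧) (not-elim (∧-elimʳ {p y == j} (∧-elimˡ h)))) (+-identityʳ _))))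
        (le⇒≤ (∧-elimʳ {(p y == j) ∧ not (y == x)} h))) (large j))
    second x px dx (inj₂ none) with m≤n⇒m<n∨m≡n dx
    ... | inj₂ e = inj₁ (inj₂ (x , px , e , λ v pv ne → full v pv (drop (∧-intro (≡⇒== pv) (not-intro (≢⇒==false ne))) (none v))))
    ... | inj₁ l = inj₂ (swap-improves valid x x j px px dx
      (≤-trans (≤-reflexive (cong suc (trans (cong (λ b → deg H x + ⟦ b ⟧) (==-refl x)) (+-comm _ 1)))) l) (large j))
    first : (∃ λ x → (p x == j) ∧ le (suc (deg H x)) ℓ ≡ true) ⊎ (∀ x → (p x == j) ∧ le (suc (deg H x)) ℓ ≡ false) →
      AlmostRegular p ℓ H j ⊎ Improved H
    first (inj₂ none) = inj₁ (inj₁ (λ v pv → full v pv (drop (≡⇒== pv) (none v))))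
    first (inj₁ (x , h)) = second x (==⇒≡ (∧-elimˡ h)) (le⇒≤ (∧-elimʳ {p x == j} h))
      (findTrue (λ y → ((p y == j) ∧ not (y == x)) ∧ le (suc (deg H y)) ℓ))

  Regular : Set
  Regular = Σ (Graph n) λ H → Girth5 p ℓ H × (∀ j → AlmostRegular p ℓ H j)

  -- The degree sum is at most nℓ and grows with each improvement, so the gap to nℓ serves as fuel.
  iterate : ∀ fuel H → Girth5 p ℓ H → n * ℓ ≤ degSum H + fuel → Regular
  iterate fuel H valid enough = continue fuel enough (all-or-one (check H valid))
    where
    continue : ∀ fuel → n * ℓ ≤ degSum H + fuel → (∀ j → AlmostRegular p ℓ H j) ⊎ Improved H → Regular
    continue fuel enough (inj₁ reg) = H , valid , reg
    continue zero enough (inj₂ (H′ , valid′ , more)) = ⊥-elim (<⇒≱ more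
      (≤-trans (sum-≤const ℓ (Girth5.deg≤ℓ valid′)) (≤-trans enough (≤-reflexive (+-identityʳ _)))))
    continue (suc fuel) enough (inj₂ (H′ , valid′ , more)) = iterate fuel H′ valid′
      (≤-trans enough (≤-trans (≤-reflexive (+-suc (degSum H) fuel)) (+-monoˡ-≤ fuel more)))

  empty : Graph n
  empty = mkGraph (λ _ _ → false)

  empty-girth5 : Girth5 p ℓ empty
  empty-girth5 = record
    { inner = λ _ _ () ; deg≤ℓ = λ a → ≤-trans (≤-reflexive (count-none {n} (λ _ → refl))) z≤n
    ; triangle = λ _ _ _ () ; square = λ _ _ _ _ _ _ () }

  regular : Regular
  regular = iterate (n * ℓ) empty empty-girth5 (m≤n+m _ (degSum empty))

-- Complete multipartite graphs with a graph added inside the parts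

overlay : ∀ {n k} → (Fin n → Fin k) → Graph n → Graph n
overlay p H = mkGraph (λ u v → not (p u == p v) ∨ adj H u v)

module Overlay {n : ℕ} {k : ℕ} {ℓ : ℕ} (p : Fin n → Fin k) (H : Graph n) (valid : Girth5 p ℓ H) where
  open Girth5 valid

  T : Graph n
  T = overlay p H

  T-adj : ∀ u v → adj T u v ≡ not (p u == p v) ∨ adj H u v
  T-adj u v = ⇔⇒≡ (λ h → case proj₁ (mkGraph-elim (λ u v → not (p u == p v) ∨ adj H u v) u v h) of λ
      { (inj₁ e) → e
      ; (inj₂ e) → trans (cong₂ (λ b c → not b ∨ c) (==-sym (p u) (p v)) (adj-sym H u v)) e })
    (λ h → mkGraph-intro (λ u v → not (p u == p v) ∨ adj H u v) u v h (distinct (∨-elim h)))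
    where
    distinct : (not (p u == p v) ≡ true) ⊎ (adj H u v ≡ true) → u ≢ v
    distinct (inj₁ e) refl = true≢false (==-refl (p u)) (not-elim e)
    distinct (inj₂ e) = irreflexive H e

  T-deg : ∀ v → deg T v ≡ cross p v + deg H v
  T-deg v = begin-equality
    deg T v ≡⟨ count≡sum (adj T v) ⟩
    sumFin (λ w → ⟦ adj T v w ⟧) ≡⟨ sum-cong (λ w → trans (cong ⟦_⟧ (T-adj v w)) (point w (true⊎false (p v == p w)))) ⟩
    sumFin (λ w → ⟦ not (p v == p w) ⟧ + ⟦ adj H v w ⟧) ≡⟨ sum-+ (λ w → ⟦ not (p v == p w) ⟧) (λ w → ⟦ adj H v w ⟧) ⟩
    sumFin (λ w → ⟦ not (p v == p w) ⟧) + sumFin (λ w → ⟦ adj H v w ⟧)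
      ≡⟨ cong₂ _+_ (count≡sum (λ w → not (p v == p w))) (count≡sum (adj H v)) ⟨
    cross p v + deg H v ∎
    where
    open ≤-Reasoning
    point : ∀ w → ((p v == p w) ≡ true) ⊎ ((p v == p w) ≡ false) →
      ⟦ not (p v == p w) ∨ adj H v w ⟧ ≡ ⟦ not (p v == p w) ⟧ + ⟦ adj H v w ⟧
    point w (inj₁ e) rewrite e = refl
    point w (inj₂ e) rewrite e | ≢true⇒false {adj H v w} (λ h → true≢false (≡⇒== (inner v w h)) e) = refl

  T-innerDeg : ∀ v → innerDeg T p v ≡ deg H v
  T-innerDeg v = count-cong (λ w → ⇔⇒≡ (λ h → lemma w h (∨-elim (trans (sym (T-adj v w)) (∧-elimˡ h))))
      (λ h → ∧-intro (trans (T-adj v w) (∨-introʳ {not (p v == p w)} h)) (≡⇒== (sym (inner v w h)))))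
    where
    lemma : ∀ w → adj T v w ∧ (p w == p v) ≡ true → (not (p v == p w) ≡ true) ⊎ (adj H v w ≡ true) → adj H v w ≡ true
    lemma w h (inj₁ e) = ⊥-elim (==false⇒≢ (not-elim e) (sym (==⇒≡ (∧-elimʳ {adj T v w} h))))
    lemma w h (inj₂ e) = e

  T-InT0 : (∀ j → AlmostRegular p ℓ H j) → (∀ j → 0 < partSize p j) → InT0 n k ℓ T
  T-InT0 reg nonempty = p , (λ j → proj₁ (count>0⇒some _ (nonempty j)) , ==⇒≡ (proj₂ (count>0⇒some (λ v → p v == j) (nonempty j)))) ,
      (λ u v ne → trans (T-adj u v) (∨-introˡ (not-intro (≢⇒==false ne)))) , λ j → almost j (reg j)
    where
    almost : ∀ j → AlmostRegular p ℓ H j → AlmostRegularPart T p ℓ j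
    almost j (inj₁ h) = inj₁ (λ v pv → trans (T-innerDeg v) (h v pv))
    almost j (inj₂ (v₀ , pv₀ , d₀ , h)) = inj₂ (v₀ , pv₀ , trans (cong suc (T-innerDeg v₀)) d₀ , λ v pv ne → trans (T-innerDeg v) (h v pv ne))

-- The graph K_{1,a,…,a}

K1a-part : (k a : ℕ) → Fin (suc (k * a)) → Fin (suc k)
K1a-part k a zero    = zero
K1a-part k a (suc i) = suc (quotient {k} a i)

K1a-adj : ∀ k a u v → adj (K1a k a) u v ≡ not (K1a-part k a u == K1a-part k a v)
K1a-adj k a zero    zero    = completeMP-adj (K1a-part k a) zero zero
K1a-adj k a zero    (suc j) = completeMP-adj (K1a-part k a) zero (suc j)
K1a-adj k a (suc i) zero    = completeMP-adj (K1a-part k a) (suc i) zero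
K1a-adj k a (suc i) (suc j) = completeMP-adj (K1a-part k a) (suc i) (suc j)

quotRem-injective : ∀ {k} a (i j : Fin (k * a)) → quotient {k} a i ≡ quotient {k} a j →
  remainder {k} a i ≡ remainder {k} a j → i ≡ j
quotRem-injective {k} a i j eq er = trans (sym (FP.combine-remQuot {k} a i)) (trans (cong₂ combine eq er) (FP.combine-remQuot {k} a j))

K1a-class : ∀ k ℓ i → count (λ w → K1a-part k (suc ℓ) w == i) ≤ suc ℓ
K1a-class k ℓ i = ≤-trans (count-inj (λ w → K1a-part k a w == i) (λ _ → true) φ
    (λ u v hu hv → φ-inj u v (trans (==⇒≡ hu) (sym (==⇒≡ hv)))) (λ _ _ → refl)) (count≤n {a} (λ _ → true))
  where
  a = suc ℓ
  φ : Fin (suc (k * a)) → Fin a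
  φ zero    = zero
  φ (suc w) = remainder {k} a w
  φ-inj : ∀ u v → K1a-part k a u ≡ K1a-part k a v → φ u ≡ φ v → u ≡ v
  φ-inj zero    zero    _ _ = refl
  φ-inj (suc u) (suc v) e e′ = cong suc (quotRem-injective a u v (FP.suc-injective e) e′)

-- A part of the overlay contains at least a + 1 vertices of a copy of
-- K_{1,a,…,a}; by the degree bound each of them has a twin (a vertex of the same
-- class) in this part, and two pairs of twins span a 4-cycle.
overlay-free : ∀ {n k} ℓ (p : Fin n → Fin k) (H : Graph n) → Girth5 p ℓ H → (K1a k (suc ℓ) -free) (overlay p H)
overlay-free {n} {k} ℓ p H valid (f , f-inj , f-adj) = contradiction
  where
  open Girth5 valid
  open Overlay p H valid
  a = suc ℓ
  m = suc (k * a)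
  cls = K1a-part k a
  heavy : ∃ λ j → a < partSize (p ∘ f) j
  heavy = sum>const⇒term> (partSize (p ∘ f)) a (≤-reflexive (sym (sum-partSize (p ∘ f))))
  j = proj₁ heavy
  S : Fin m → Bool
  S u = p (f u) == j
  S-large : a < count S
  S-large = proj₂ heavy
  joined : ∀ u w → S u ≡ true → S w ≡ true → cls u ≢ cls w → adj H (f u) (f w) ≡ true
  joined u w Su Sw ne = decide (∨-elim (trans (sym (T-adj (f u) (f w))) (f-adj u w (trans (K1a-adj k a u w) (not-intro (≢⇒==false ne))))))
    where
    decide : (not (p (f u) == p (f w)) ≡ true) ⊎ (adj H (f u) (f w) ≡ true) → adj H (f u) (f w) ≡ true
    decide (inj₁ e) = ⊥-elim (==false⇒≢ (not-elim e) (trans (==⇒≡ Su) (sym (==⇒≡ Sw))))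
    decide (inj₂ e) = e
  twins : ∀ u → S u ≡ true → 1 < count (λ w → S w ∧ (cls u == cls w))
  twins u Su = +-cancelʳ-≤ (count (λ w → S w ∧ not (cls u == cls w))) _ _
    (≤-trans (+-monoʳ-≤ 2 (≤-trans (count-inj (λ w → S w ∧ not (cls u == cls w)) (adj H (f u)) f (λ _ _ _ _ → f-inj)
        (λ w h → joined u w Su (∧-elimˡ h) (==false⇒≢ (not-elim (∧-elimʳ {S w} h))))) (deg≤ℓ (f u))))
      (≤-trans S-large (≤-reflexive (count-split S (λ w → cls u == cls w)))))
  twin : ∀ u → S u ≡ true → ∃ λ w → S w ≡ true × cls u ≡ cls w × w ≢ u
  twin u Su = build (count>⇒avoiding {m = 1} (λ w → S w ∧ (cls u == cls w)) (λ _ w → w == u)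
      (≤-<-trans (≤-reflexive (trans (+-identityʳ _) (count-≡ʳ u))) (twins u Su)))
    where
    build : (∃ λ w → S w ∧ (cls u == cls w) ≡ true × (∀ (_ : Fin 1) → (w == u) ≡ false)) → ∃ λ w → S w ≡ true × cls u ≡ cls w × w ≢ u
    build (w , h , ne) = w , ∧-elimˡ h , ==⇒≡ (∧-elimʳ {S w} h) , ==false⇒≢ (ne zero)
  contradiction : ⊥
  contradiction = start (count>0⇒some S (≤-<-trans z≤n S-large))
    where
    start : (∃ λ u → S u ≡ true) → ⊥
    -- A class has at most a vertices and `S` has more, so `S` meets a second class.
    start (u , Su) = second (count>⇒avoiding {m = 1} S (λ _ w → cls w == cls u) (≤-<-trans (≤-trans (≤-reflexive (+-identityʳ _)) (K1a-class k ℓ (cls u))) S-large))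
      where
      second : (∃ λ w → S w ≡ true × (∀ (_ : Fin 1) → (cls w == cls u) ≡ false)) → ⊥
      second (w , Sw , ne) = finish (twin u Su) (twin w Sw)
        where
        w≁u : cls w ≢ cls u
        w≁u = ==false⇒≢ (ne zero)
        finish : (∃ λ u′ → S u′ ≡ true × cls u ≡ cls u′ × u′ ≢ u) → (∃ λ w′ → S w′ ≡ true × cls w ≡ cls w′ × w′ ≢ w) → ⊥
        finish (u′ , Su′ , cu , u′≢u) (w′ , Sw′ , cw , w′≢w) = square (f u) (f w) (f u′) (f w′)
          (λ e → u′≢u (sym (f-inj e))) (λ e → w′≢w (sym (f-inj e)))
          (joined u w Su Sw (w≁u ∘ sym)) (joined w u′ Sw Su′ (λ e → w≁u (trans e (sym cu))))
          (joined u′ w′ Su′ Sw′ (λ e → w≁u (trans cw (trans (sym e) (sym cu)))))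
          (joined w′ u Sw′ Su (λ e → w≁u (trans cw e)))

-- Parity of inner degree sums

handshake : ∀ {n} (M : Fin n → Fin n → Bool) → (∀ u w → M u w ≡ M w u) → (∀ u → M u u ≡ false) →
  ∃ λ h → sumFin (λ u → count (M u)) ≡ 2 * h
handshake {zero}  M M-sym M-irr = 0 , refl
handshake {suc n} M M-sym M-irr with handshake (λ u w → M (suc u) (suc w)) (λ u w → M-sym (suc u) (suc w)) (M-irr ∘ suc)
... | h , e = count (M zero ∘ suc) + h , (begin-equality
  ⟦ M zero zero ⟧ + c + sumFin (λ u → ⟦ M (suc u) zero ⟧ + count (M (suc u) ∘ suc))
    ≡⟨ cong₂ _+_ (cong (λ b → ⟦ b ⟧ + c) (M-irr zero)) (sum-+ (λ u → ⟦ M (suc u) zero ⟧) (λ u → count (M (suc u) ∘ suc))) ⟩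
  c + (sumFin (λ u → ⟦ M (suc u) zero ⟧) + sumFin (λ u → count (M (suc u) ∘ suc)))
    ≡⟨ cong₂ (λ x y → c + (x + y)) (trans (sum-cong (λ u → cong ⟦_⟧ (M-sym (suc u) zero))) (sym (count≡sum (M zero ∘ suc)))) e ⟩
  c + (c + 2 * h) ≡⟨ eq c h ⟩
  2 * (c + h) ∎)
  where
  open ≤-Reasoning
  c = count (M zero ∘ suc)
  eq : ∀ c h → c + (c + 2 * h) ≡ 2 * (c + h)
  eq = solve-∀

inn-even : ∀ {n k} (G : Graph n) (p : Fin n → Fin k) j → ∃ λ h → sumFin (λ v → ⟦ p v == j ⟧ * inn G p v) ≡ 2 * h
inn-even {n} G p j with handshake M M-sym M-irr
  where
  M : Fin n → Fin n → Bool
  M u w = (p u == j) ∧ (adj G u w ∧ (p u == p w))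
  M-irr : ∀ u → M u u ≡ false
  M-irr u rewrite irrefl G u = BP.∧-zeroʳ (p u == j)
  M-sym : ∀ u w → M u w ≡ M w u
  M-sym u w = ⇔⇒≡ (flip u w) (flip w u)
    where
    flip : ∀ u w → M u w ≡ true → M w u ≡ true
    flip u w h = ∧-intro (≡⇒== (trans (sym pp) (==⇒≡ (∧-elimˡ h)))) (∧-intro (trans (adj-sym G w u) (∧-elimˡ (∧-elimʳ {p u == j} h))) (≡⇒== (sym pp)))
      where
      pp : p u ≡ p w
      pp = ==⇒≡ (∧-elimʳ {adj G u w} (∧-elimʳ {p u == j} h))
... | h , e = h , trans (sum-cong (λ v → row v (true⊎false (p v == j)))) e
  where
  row : ∀ v → ((p v == j) ≡ true) ⊎ ((p v == j) ≡ false) → ⟦ p v == j ⟧ * inn G p v ≡ count (λ w → (p v == j) ∧ (adj G v w ∧ (p v == p w)))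
  row v (inj₁ q) rewrite q = +-identityʳ _
  row v (inj₂ q) rewrite q = sym (count-none {n} (λ _ → refl))

-- Vertices missing a linear number of cross edges are too expensive

module BadVertices {n : ℕ} {k : ℕ} (ρ : ℕ) (G : Graph n) (p : Fin n → Fin k) (η : ℕ) (α C : ℕ) where
  open ≤-Reasoning

  R b : ℕ
  R = suc ρ * C ^ ρ
  -- After its inner degree of at most αη is deducted, a bad vertex still loses R (α + 1) η: at the
  -- rate R this covers the αη that it adds to inner degrees elsewhere and one further η.
  b = α + R * (α + 1)

  D : Fin n → Bool
  D v = le (b * η) (miss G p v)

  inn-bad inn-good : Fin n → ℕ
  inn-bad  v = count (λ w → (adj G v w ∧ (p v == p w)) ∧ D w)
  inn-good v = count (λ w → (adj G v w ∧ (p v == p w)) ∧ not (D w))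

  inn-split : ∀ v → inn G p v ≡ inn-bad v + inn-good v
  inn-split v = count-split (λ w → adj G v w ∧ (p v == p w)) D

  module _ (inn-small : ∀ v → inn G p v ≤ α * η) where

    inn-bad-sum : sumFin inn-bad ≤ α * η * count D
    inn-bad-sum = begin
      sumFin inn-bad ≡⟨ sum-cong (λ v → trans (count≡sum (λ w → (adj G v w ∧ (p v == p w)) ∧ D w)) (sum-cong (λ w → entry v w))) ⟩
      sumFin (λ v → sumFin (λ w → ⟦ D w ⟧ * ⟦ adj G w v ∧ (p w == p v) ⟧)) ≡⟨ sum-swap (λ v w → ⟦ D w ⟧ * ⟦ adj G w v ∧ (p w == p v) ⟧) ⟩
      sumFin (λ w → sumFin (λ v → ⟦ D w ⟧ * ⟦ adj G w v ∧ (p w == p v) ⟧))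
        ≡⟨ sum-cong (λ w → trans (sum-* ⟦ D w ⟧ (λ v → ⟦ adj G w v ∧ (p w == p v) ⟧)) (cong (⟦ D w ⟧ *_) (sym (count≡sum (λ v → adj G w v ∧ (p w == p v)))))) ⟩
      sumFin (λ w → ⟦ D w ⟧ * inn G p w) ≤⟨ sum-mono (λ w → ≤-trans (*-monoʳ-≤ ⟦ D w ⟧ (inn-small w)) (≤-reflexive (*-comm ⟦ D w ⟧ (α * η)))) ⟩
      sumFin (λ w → α * η * ⟦ D w ⟧) ≡⟨ trans (sum-* (α * η) (λ w → ⟦ D w ⟧)) (cong (α * η *_) (sym (count≡sum D))) ⟩
      α * η * count D ∎
      where
      entry : ∀ v w → ⟦ (adj G v w ∧ (p v == p w)) ∧ D w ⟧ ≡ ⟦ D w ⟧ * ⟦ adj G w v ∧ (p w == p v) ⟧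
      entry v w = trans (⟦⟧-∧ (adj G v w ∧ (p v == p w)) (D w)) (trans (*-comm ⟦ adj G v w ∧ (p v == p w) ⟧ ⟦ D w ⟧)
        (cong (λ b → ⟦ D w ⟧ * ⟦ b ⟧) (cong₂ _∧_ (adj-sym G v w) (==-sym (p v) (p w)))))

    bad-deg : ∀ v → D v ≡ true → R * (α + 1) * η + deg G v ≤ cross p v
    bad-deg v h = lin 0 (+-mono-≤ (≤-reflexive (deg-balance G p v)) (+-mono-≤ (le⇒≤ {b * η} h) (inn-small v)))
      (eq (R * (α + 1)) η α (deg G v) (miss G p v) (cross p v) (inn G p v))
      where
      eq : ∀ β η a d m c i → β * η + d + (c + i + (m + a * η)) + 0 ≡ c + (d + m + ((a + β) * η + i))
      eq = solve-∀

    -- `τ` is the degree sequence of the competitor, and `x` what G may exceed it by at good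
    -- vertices besides the neighbours in `D`. One bad vertex is enough to cover the total of `x`,
    -- which is at most η.
    bad-vertices-lose : 0 < C → (τ x : Fin n → ℕ) → (∀ v → cross p v ≤ τ v) → (∀ v → n ≤ C * τ v) →
      (∀ v → D v ≡ false → deg G v ≤ τ v + (inn-bad v + x v)) → sumFin x ≤ η → 0 < count D →
      e (suc ρ) G ≤ sumFin (λ v → τ v ^ suc ρ)
    bad-vertices-lose C>0 τ x cross≤τ n≤Cτ good-deg x-small D>0 = power-sum-compare ρ C (deg G) τ C>0 (deg≤ G) n≤Cτ (begin
      R * sumFin (λ v → deg G v ∸ τ v) ≤⟨ *-monoʳ-≤ R (sum-mono (λ v → gain v (true⊎false (D v)))) ⟩
      R * sumFin (λ v → inn-bad v + x v) ≡⟨ cong (R *_) (sum-+ inn-bad x) ⟩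
      R * (sumFin inn-bad + sumFin x) ≤⟨ *-monoʳ-≤ R (+-mono-≤ inn-bad-sum (≤-trans x-small (≤-trans (≤-reflexive (sym (*-identityʳ η))) (*-monoʳ-≤ η D>0)))) ⟩
      R * (α * η * count D + η * count D) ≡⟨ eq R α η (count D) ⟩
      R * (α + 1) * η * count D ≡⟨ trans (cong (R * (α + 1) * η *_) (count≡sum D)) (sym (sum-* (R * (α + 1) * η) (λ v → ⟦ D v ⟧))) ⟩
      sumFin (λ v → R * (α + 1) * η * ⟦ D v ⟧) ≤⟨ sum-mono (λ v → loss v (true⊎false (D v))) ⟩
      sumFin (λ v → τ v ∸ deg G v) ∎)
      where
      eq : ∀ R a h d → R * (a * h * d + h * d) ≡ R * (a + 1) * h * d
      eq = solve-∀
      gain : ∀ v → (D v ≡ true) ⊎ (D v ≡ false) → deg G v ∸ τ v ≤ inn-bad v + x v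
      gain v (inj₁ h) = ≤-trans (≤-reflexive (m≤n⇒m∸n≡0 (≤-trans (≤-trans (m≤n+m (deg G v) _) (bad-deg v h)) (cross≤τ v)))) z≤n
      gain v (inj₂ h) = m≤n+o⇒m∸n≤o (deg G v) (τ v) (good-deg v h)
      loss : ∀ v → (D v ≡ true) ⊎ (D v ≡ false) → R * (α + 1) * η * ⟦ D v ⟧ ≤ τ v ∸ deg G v
      loss v (inj₁ h) = ≤-trans (≤-reflexive (trans (cong (λ b → R * (α + 1) * η * ⟦ b ⟧) h) (*-identityʳ _)))
        (m+n≤o⇒m≤o∸n (R * (α + 1) * η) (≤-trans (bad-deg v h) (cross≤τ v)))
      loss v (inj₂ h) = ≤-trans (≤-reflexive (trans (cong (λ b → R * (α + 1) * η * ⟦ b ⟧) h) (*-zeroʳ (R * (α + 1) * η)))) z≤n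

-- Part (ii)

sum-fibres-mono : ∀ {n k} (p : Fin n → Fin k) (f g : Fin n → ℕ) →
  (∀ j → sumFin (λ v → ⟦ p v == j ⟧ * f v) ≤ sumFin (λ v → ⟦ p v == j ⟧ * g v)) → sumFin f ≤ sumFin g
sum-fibres-mono p f g h = begin
  sumFin f ≡⟨ sum-fibres p f ⟩
  sumFin (λ j → sumFin (λ v → ⟦ p v == j ⟧ * f v)) ≤⟨ sum-mono h ⟩
  sumFin (λ j → sumFin (λ v → ⟦ p v == j ⟧ * g v)) ≡⟨ sum-fibres p g ⟨
  sumFin g ∎
  where open ≤-Reasoning

cross-fibre : ∀ {n k} (p : Fin n → Fin k) u v → p u ≡ p v → cross p u ≡ cross p v
cross-fibre p u v e = count-cong (λ w → cong (λ i → not (i == p w)) e)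

module RegularCompare {n : ℕ} {k : ℕ} (ρ ℓ : ℕ) (G : Graph n) (p : Fin n → Fin k) (H : Graph n) (valid : Girth5 p ℓ H)
  (reg : ∀ j → AlmostRegular p ℓ H j) (inn≤ℓ : ∀ v → inn G p v ≤ ℓ) where
  open ≤-Reasoning
  open Girth5 valid

  r : ℕ
  r = suc ρ

  τ : Fin n → ℕ
  τ v = cross p v + deg H v

  on : ∀ (b : Bool) {x y} → (b ≡ true → x ≤ y) → ⟦ b ⟧ * x ≤ ⟦ b ⟧ * y
  on true  h = *-monoʳ-≤ 1 (h refl)
  on false h = z≤n

  -- If H has a vertex v₀ of degree ℓ - 1 in part j, then ℓ times the size of the
  -- part is odd; inner degree sums are even, so G has a deficient vertex v₁ too.
  part-≤ : ∀ j → sumFin (λ v → ⟦ p v == j ⟧ * deg G v ^ r) ≤ sumFin (λ v → ⟦ p v == j ⟧ * τ v ^ r)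
  part-≤ j = decide (reg j)
    where
    Goal : Set
    Goal = sumFin (λ v → ⟦ p v == j ⟧ * deg G v ^ r) ≤ sumFin (λ v → ⟦ p v == j ⟧ * τ v ^ r)
    decide : AlmostRegular p ℓ H j → Goal
    decide (inj₁ full) = sum-mono (λ v → on (p v == j) (λ e → ^-monoˡ-≤ r (≤-trans (deg≤cross+inn G p v)
      (+-monoʳ-≤ (cross p v) (≤-trans (inn≤ℓ v) (≤-reflexive (sym (full v (==⇒≡ e)))))))))
    decide (inj₂ (v₀ , pv₀ , d₀ , full)) = deficient (findTrue (λ v → (p v == j) ∧ le (suc (inn G p v)) ℓ))
      where
      κ = cross p v₀
      top low Δ : ℕ
      top = (κ + ℓ) ^ r
      low = (κ + deg H v₀) ^ r
      Δ = top ∸ low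
      low+Δ : low + Δ ≡ top
      low+Δ = m+[n∸m]≡n (^-monoˡ-≤ r (+-monoʳ-≤ κ (deg≤ℓ v₀)))
      κ-eq : ∀ v → p v ≡ j → cross p v ≡ κ
      κ-eq v e = cross-fibre p v v₀ (trans e (sym pv₀))
      τ-total : sumFin (λ v → ⟦ p v == j ⟧ * top) ≡ sumFin (λ v → ⟦ p v == j ⟧ * τ v ^ r) + Δ
      τ-total = trans (sum-cong (λ v → point v (v₀ F.≟ v) (true⊎false (p v == j))))
        (trans (sum-+ (λ v → ⟦ p v == j ⟧ * τ v ^ r) (λ v → ⟦ v₀ == v ⟧ * Δ)) (cong (sumFin (λ v → ⟦ p v == j ⟧ * τ v ^ r) +_) (sum-delta v₀ (λ _ → Δ))))
        where
        point : ∀ v → Dec (v₀ ≡ v) → ((p v == j) ≡ true) ⊎ ((p v == j) ≡ false) →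
          ⟦ p v == j ⟧ * top ≡ ⟦ p v == j ⟧ * τ v ^ r + ⟦ v₀ == v ⟧ * Δ
        point v (yes refl) _ rewrite ==-refl v₀ | ≡⇒== pv₀ = trans (+-identityʳ top) (trans (sym low+Δ) (sym (cong₂ _+_ (+-identityʳ low) (+-identityʳ Δ))))
        point v (no ne) (inj₂ e) rewrite e | ≢⇒==false ne = refl
        point v (no ne) (inj₁ e) rewrite ≢⇒==false ne | e = trans (cong (λ x → x ^ r + 0)
          (sym (cong₂ _+_ (κ-eq v (==⇒≡ e)) (full v (==⇒≡ e) (ne ∘ sym))))) (sym (trans (+-identityʳ _) refl))
      even-H : ∃ λ h → sumFin (λ v → ⟦ p v == j ⟧ * inn H p v) ≡ 2 * h
      even-H = inn-even H p j
      inn-H : ∀ v → inn H p v ≡ deg H v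
      inn-H v = count-cong (λ w → ⇔⇒≡ ∧-elimˡ (λ h → ∧-intro h (≡⇒== (inner v w h))))
      sizes : ℕ
      sizes = sumFin (λ v → ⟦ p v == j ⟧ * ℓ)
      H-odd : sizes ≡ suc (sumFin (λ v → ⟦ p v == j ⟧ * inn H p v))
      H-odd = trans (sum-cong (λ v → point v (v₀ F.≟ v) (true⊎false (p v == j))))
        (trans (sum-+ (λ v → ⟦ p v == j ⟧ * inn H p v) (λ v → ⟦ v₀ == v ⟧ * 1)) (trans (cong (sumFin (λ v → ⟦ p v == j ⟧ * inn H p v) +_) (sum-delta v₀ (λ _ → 1))) (+-comm _ 1)))
        where
        point : ∀ v → Dec (v₀ ≡ v) → ((p v == j) ≡ true) ⊎ ((p v == j) ≡ false) →
          ⟦ p v == j ⟧ * ℓ ≡ ⟦ p v == j ⟧ * inn H p v + ⟦ v₀ == v ⟧ * 1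
        point v (yes refl) _ rewrite ==-refl v₀ | ≡⇒== pv₀ | inn-H v₀ = trans (+-identityʳ ℓ) (trans (sym d₀) (trans (+-comm 1 _) (cong (_+ 1) (sym (+-identityʳ _)))))
        point v (no ne) (inj₂ e) rewrite e | ≢⇒==false ne = refl
        point v (no ne) (inj₁ e) rewrite e | ≢⇒==false ne | inn-H v | full v (==⇒≡ e) (ne ∘ sym) = sym (+-identityʳ _)
      deficient : (∃ λ v → (p v == j) ∧ le (suc (inn G p v)) ℓ ≡ true) ⊎ (∀ v → (p v == j) ∧ le (suc (inn G p v)) ℓ ≡ false) → Goal
      deficient (inj₂ none) = ⊥-elim (even≢odd (proj₁ even-G) (proj₁ even-H) (trans (sym (proj₂ even-G)) (trans (sum-cong point) (trans H-odd (cong suc (proj₂ even-H))))))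
        where
        even-G = inn-even G p j
        point : ∀ v → ⟦ p v == j ⟧ * inn G p v ≡ ⟦ p v == j ⟧ * ℓ
        point v with true⊎false (p v == j)
        ... | inj₂ e rewrite e = refl
        ... | inj₁ e = cong (⟦ p v == j ⟧ *_) (≤-antisym (inn≤ℓ v) (s≤s⁻¹ (nle⇒> (trans (cong (_∧ le (suc (inn G p v)) ℓ) (sym e)) (none v)))))
      -- Both graphs are compared with a part in which every vertex contributes `top`: the
      -- competitor falls short of it by exactly Δ, at v₀, and G by at least Δ, at v₁.
      deficient (inj₁ (v₁ , h)) = +-cancelʳ-≤ Δ _ _ (begin
        sumFin (λ v → ⟦ p v == j ⟧ * deg G v ^ r) + Δ
          ≡⟨ trans (sum-+ (λ v → ⟦ p v == j ⟧ * deg G v ^ r) (λ v → ⟦ v₁ == v ⟧ * Δ)) (cong (sumFin (λ v → ⟦ p v == j ⟧ * deg G v ^ r) +_) (sum-delta v₁ (λ _ → Δ))) ⟨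
        sumFin (λ v → ⟦ p v == j ⟧ * deg G v ^ r + ⟦ v₁ == v ⟧ * Δ) ≤⟨ sum-mono (λ v → point v (v₁ F.≟ v) (true⊎false (p v == j))) ⟩
        sumFin (λ v → ⟦ p v == j ⟧ * top) ≡⟨ τ-total ⟩
        sumFin (λ v → ⟦ p v == j ⟧ * τ v ^ r) + Δ ∎)
        where
        pv₁ : p v₁ ≡ j
        pv₁ = ==⇒≡ (∧-elimˡ h)
        low₁ : deg G v₁ ^ r ≤ low
        low₁ = ^-monoˡ-≤ r (≤-trans (deg≤cross+inn G p v₁) (+-mono-≤ (≤-reflexive (κ-eq v₁ pv₁))
          (s≤s⁻¹ (≤-trans (le⇒≤ (∧-elimʳ {p v₁ == j} h)) (≤-reflexive (sym d₀))))))
        point : ∀ v → Dec (v₁ ≡ v) → ((p v == j) ≡ true) ⊎ ((p v == j) ≡ false) →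
          ⟦ p v == j ⟧ * deg G v ^ r + ⟦ v₁ == v ⟧ * Δ ≤ ⟦ p v == j ⟧ * top
        point v (yes refl) _ rewrite ==-refl v₁ | ≡⇒== pv₁ = ≤-trans (≤-reflexive (cong₂ _+_ (+-identityʳ (deg G v₁ ^ r)) (+-identityʳ Δ)))
          (≤-trans (+-monoˡ-≤ Δ low₁) (≤-trans (≤-reflexive low+Δ) (≤-reflexive (sym (+-identityʳ top)))))
        point v (no ne) (inj₂ e) rewrite e | ≢⇒==false ne = z≤n
        point v (no ne) (inj₁ e) rewrite ≢⇒==false ne | e = ≤-trans (≤-reflexive (trans (+-identityʳ _) (+-identityʳ _)))
          (≤-trans (^-monoˡ-≤ r (≤-trans (deg≤cross+inn G p v) (+-mono-≤ (≤-reflexive (κ-eq v (==⇒≡ e))) (inn≤ℓ v)))) (≤-reflexive (sym (+-identityʳ top))))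

  conclusion : e r G ≤ sumFin (λ v → τ v ^ r)
  conclusion = sum-fibres-mono p (λ v → deg G v ^ r) (λ v → τ v ^ r) part-≤

deficient-count : ∀ {n k} (p : Fin n → Fin k) ℓ (H : Graph n) → (∀ v → deg H v ≤ ℓ) → (∀ j → AlmostRegular p ℓ H j) →
  sumFin (λ v → ℓ ∸ deg H v) ≤ k
deficient-count {n} {k} p ℓ H deg≤ℓ reg = begin
  sumFin (λ v → ℓ ∸ deg H v) ≡⟨ sum-fibres p (λ v → ℓ ∸ deg H v) ⟩
  sumFin (λ j → sumFin (λ v → ⟦ p v == j ⟧ * (ℓ ∸ deg H v))) ≤⟨ sum-≤const 1 (λ j → part j (reg j)) ⟩
  k * 1 ≡⟨ *-identityʳ k ⟩
  k ∎
  where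
  open ≤-Reasoning
  part : ∀ j → AlmostRegular p ℓ H j → sumFin (λ v → ⟦ p v == j ⟧ * (ℓ ∸ deg H v)) ≤ 1
  part j (inj₁ full) = ≤-trans (≤-reflexive (trans (sum-cong (λ v → zeroed v (true⊎false (p v == j)))) (sum-0 n))) z≤n
    where
    zeroed : ∀ v → ((p v == j) ≡ true) ⊎ ((p v == j) ≡ false) → ⟦ p v == j ⟧ * (ℓ ∸ deg H v) ≡ 0
    zeroed v (inj₂ e) rewrite e = refl
    zeroed v (inj₁ e) rewrite full v (==⇒≡ e) | n∸n≡0 ℓ = *-zeroʳ ⟦ p v == j ⟧
  part j (inj₂ (v₀ , pv₀ , d₀ , full)) = ≤-trans (sum-mono (λ v → point v (v₀ F.≟ v) (true⊎false (p v == j)))) (≤-reflexive (sum-delta v₀ (λ _ → 1)))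
    where
    point : ∀ v → Dec (v₀ ≡ v) → ((p v == j) ≡ true) ⊎ ((p v == j) ≡ false) → ⟦ p v == j ⟧ * (ℓ ∸ deg H v) ≤ ⟦ v₀ == v ⟧ * 1
    point v _ (inj₂ e) rewrite e = z≤n
    point v (yes refl) (inj₁ e) rewrite e | ==-refl v₀ = ≤-reflexive (trans (+-identityʳ _) (trans (cong (_∸ deg H v₀) (sym d₀)) (m+n∸n≡m 1 (deg H v₀))))
    point v (no ne) (inj₁ e) rewrite full v (==⇒≡ e) (ne ∘ sym) | n∸n≡0 ℓ = ≤-trans (≤-reflexive (*-zeroʳ ⟦ p v == j ⟧)) z≤n

module StarFree {n : ℕ} {j : ℕ} (ρ ℓ : ℕ) (G : Graph n) (free : (K1a (suc (suc j)) (suc ℓ) -free) G) where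

  k a m α C : ℕ
  k = suc (suc j)
  a = suc ℓ
  m = suc (k * a)
  α = 2 * m + 3
  C = partConst k ρ

  module Bound (p : Fin n → Fin k) (η : ℕ) (η-large : m + k < η)
    (str : Structured G p η (2 * m + 3 + m * BadVertices.b ρ G p η α C) C) where
    open ≤-Reasoning
    open BadVertices ρ G p η α C
    η>0 : 0 < η
    η>0 = ≤-<-trans z≤n η-large
    open Embedding G p η
    open WithStructure str η>0

    unused : m + count {n} (λ _ → false) ≤ η
    unused = ≤-trans (≤-reflexive (trans (cong (m +_) (count-none {n} (λ _ → refl))) (+-identityʳ m))) (≤-trans (m≤m+n m k) (<⇒≤ η-large))

    impossible : ∀ {fix s} → Embeds (K1a k a) fix s (λ _ → false) → ⊥
    impossible E = free (Embeds.map E , Embeds.inj E , Embeds.edges E)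

    K1a-proper : ∀ u w → adj (K1a k a) u w ≡ true → K1a-part k a u ≢ K1a-part k a w
    K1a-proper u w h = ==false⇒≢ (not-elim (trans (sym (K1a-adj k a u w)) h))

    inn-small : ∀ v → inn G p v ≤ α * η
    inn-small v = decide (≤-total (inn G p v) (α * η))
      where
      decide : (inn G p v ≤ α * η) ⊎ (α * η ≤ inn G p v) → inn G p v ≤ α * η
      decide (inj₁ h) = h
      decide (inj₂ h) = ⊥-elim (impossible (embed-at-apex (K1a k a) zero col v (λ _ → false) unused h ok))
        where
        col : Fin m → Fin k
        col zero    = zero
        col (suc i) = quotient {k} a i
        ok : ∀ u w → u ≢ zero → w ≢ zero → adj (K1a k a) u w ≡ true → col u ≢ col w
        ok zero    w       n₁ n₂ h = ⊥-elim (n₁ refl)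
        ok (suc u) zero    n₁ n₂ h = ⊥-elim (n₂ refl)
        ok (suc u) (suc w) n₁ n₂ h e = K1a-proper (suc u) (suc w) h (cong suc e)

    -- Otherwise v and a good inner neighbours would be seeds for K_{1,a,...,a}: v as the singleton
    -- class, the neighbours as the class coloured by the part of v, and the other classes greedily
    -- in the other parts.
    inn-good≤ℓ : ∀ v → D v ≡ false → inn-good v ≤ ℓ
    inn-good≤ℓ v Dv = decide (≤-<-connex (inn-good v) ℓ)
      where
      star : (Σ (Fin a → Fin n) λ g → Injective _≡_ _≡_ g × (∀ i → (adj G v (g i) ∧ (p v == p (g i))) ∧ not (D (g i)) ≡ true)) → ⊥
      star (g , g-inj , g-ok) = impossible (embed-at-seeds (K1a k a) fix s col (λ _ → false) b unused ≤-refl s-good fix-adj fix-inj col-ok seed-col)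
        where
        vg : ∀ i → adj G v (g i) ≡ true
        vg i = ∧-elimˡ (∧-elimˡ (g-ok i))
        pg : ∀ i → p (g i) ≡ p v
        pg i = sym (==⇒≡ (∧-elimʳ {adj G v (g i)} (∧-elimˡ (g-ok i))))
        fix : Fin m → Bool
        fix zero    = true
        fix (suc i) = quotient {k} a i == p v
        s : Fin m → Fin n
        s zero    = v
        s (suc i) = g (remainder {k} a i)
        col : Fin m → Fin k
        col zero    = zero
        col (suc i) = quotient {k} a i
        s-good : ∀ u → fix u ≡ true → miss G p (s u) ≤ b * η
        s-good zero    _ = <⇒≤ (nle⇒> Dv)
        s-good (suc i) _ = <⇒≤ (nle⇒> (not-elim (∧-elimʳ {adj G v (g (remainder {k} a i)) ∧ (p v == p (g (remainder {k} a i)))} (g-ok (remainder {k} a i)))))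
        p-s : ∀ u → p (s u) ≡ p v
        p-s zero    = refl
        p-s (suc i) = pg _
        fix-adj : ∀ u w → fix u ≡ true → fix w ≡ true → adj (K1a k a) u w ≡ true → adj G (s u) (s w) ≡ true
        fix-adj zero    zero    _ _ h = ⊥-elim (K1a-proper zero zero h refl)
        fix-adj zero    (suc i) _ _ _ = vg _
        fix-adj (suc i) zero    _ _ _ = trans (adj-sym G _ v) (vg _)
        fix-adj (suc i) (suc i′) e e′ h = ⊥-elim (K1a-proper (suc i) (suc i′) h (cong suc (trans (==⇒≡ e) (sym (==⇒≡ e′)))))
        fix-inj : ∀ u w → fix u ≡ true → fix w ≡ true → s u ≡ s w → u ≡ w
        fix-inj zero    zero    _ _ _ = refl
        fix-inj zero    (suc i) _ _ q = ⊥-elim (irreflexive G (vg _) q)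
        fix-inj (suc i) zero    _ _ q = ⊥-elim (irreflexive G (vg _) (sym q))
        fix-inj (suc i) (suc i′) e e′ q = cong suc (quotRem-injective a i i′ (trans (==⇒≡ e) (sym (==⇒≡ e′))) (g-inj q))
        col-ok : ∀ u w → fix u ≡ false → fix w ≡ false → adj (K1a k a) u w ≡ true → col u ≢ col w
        col-ok (suc i) (suc i′) _ _ h e = K1a-proper (suc i) (suc i′) h (cong suc e)
        seed-col : ∀ u w → fix u ≡ false → fix w ≡ true → adj (K1a k a) u w ≡ true → p (s w) ≢ col u
        seed-col (suc i) w e _ _ q = ==false⇒≢ e (trans (sym q) (p-s w))
      decide : (inn-good v ≤ ℓ) ⊎ (ℓ < inn-good v) → inn-good v ≤ ℓ
      decide (inj₁ h) = h
      decide (inj₂ h) = ⊥-elim (star (count≥⇒injection (λ w → (adj G v w ∧ (p v == p w)) ∧ not (D w)) h))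

    n≤C·cross : ∀ v → n ≤ C * cross p v
    n≤C·cross v = ≤-trans (part≥n/C (proj₁ (other (p v)))) (*-monoʳ-≤ C (partSize≤cross p v _ (proj₂ (other (p v)))))

    -- Without bad vertices all inner degrees are at most ℓ and the parity argument applies.
    -- Otherwise the competitor falls short of inner degree ℓ by at most one per part, a total of k
    -- < η that the bad vertices outweigh.
    bounded : ∀ H → Girth5 p ℓ H → (∀ i → AlmostRegular p ℓ H i) → 0 < C → e (suc ρ) G ≤ sumFin (λ v → (cross p v + deg H v) ^ suc ρ)
    bounded H valid reg C>0 = decide (≤-<-connex (count D) 0)
      where
      decide : (count D ≤ 0) ⊎ (0 < count D) → e (suc ρ) G ≤ sumFin (λ v → (cross p v + deg H v) ^ suc ρ)
      decide (inj₁ none) = RegularCompare.conclusion ρ ℓ G p H valid reg (λ v → begin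
          inn G p v              ≡⟨ inn-split v ⟩
          inn-bad v + inn-good v ≤⟨ +-mono-≤ (≤-trans (count-mono {n} {λ w → (adj G v w ∧ (p v == p w)) ∧ D w} {D} (λ w h → ∧-elimʳ {adj G v w ∧ (p v == p w)} h)) none)
                                      (inn-good≤ℓ v (no-bad v)) ⟩
          ℓ ∎)
        where
        no-bad : ∀ v → D v ≡ false
        no-bad v = ≢true⇒false (λ h → <⇒≱ (≤-trans (≤-reflexive (sym (⟦⟧-true h))) (≤-trans (term≤sum (λ v → ⟦ D v ⟧) v) (≤-reflexive (sym (count≡sum D))))) none)
      decide (inj₂ some) = bad-vertices-lose inn-small C>0 (λ v → cross p v + deg H v) (λ v → ℓ ∸ deg H v) (λ v → m≤m+n _ _)
        (λ v → ≤-trans (n≤C·cross v) (*-monoʳ-≤ C (m≤m+n _ _)))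
        (λ v h → lin 0 (+-mono-≤ (deg≤cross+inn G p v) (+-mono-≤ (≤-reflexive (inn-split v)) (+-mono-≤ (inn-good≤ℓ v h) (m≤n+m∸n ℓ (deg H v)))))
          (eq (deg G v) (cross p v) (inn G p v) (inn-bad v) (inn-good v) ℓ (deg H v) (ℓ ∸ deg H v)))
        (≤-trans (deficient-count p ℓ H (Girth5.deg≤ℓ valid) reg) (≤-trans (m≤n+m k m) (<⇒≤ η-large))) some
        where
        eq : ∀ d c i x g l h z → d + (c + i + (x + g + (l + (h + z)))) + 0 ≡ c + h + (x + z) + (d + (i + (g + l)))
        eq = solve-∀

extremal-K1a : ∀ j ρ ℓ → Σ ℕ λ N → ∀ n → N ≤ n → Σ (Graph n) λ T → InT0 n (suc (suc j)) ℓ T ×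
  IsExr n (suc ρ) (K1a (suc (suc j)) (suc ℓ)) (e (suc ρ) T)
extremal-K1a j ρ ℓ = N , extremal
  where
  k r a m α C b c : ℕ
  k = suc (suc j)
  r = suc ρ
  a = suc ℓ
  m = suc (k * a)
  α = 2 * m + 3
  C = partConst k ρ
  b = α + suc ρ * C ^ ρ * (α + 1)
  c = 2 * m + 3 + m * b
  M = swapBound ℓ
  st = structure (suc j) ρ c (m + k) m
  N = proj₁ st + C * suc M + suc k
  C>0 : 0 < C
  C>0 = ≤-trans (pow>0 (3 * k) (suc r) (s≤s z≤n)) (≤-trans (m≤m+n _ _) (≤-reflexive (sym (partConst-def k ρ))))
  K1a-colorable : Colorable (K1a k a) (suc k)
  K1a-colorable = K1a-part k a , λ u w h → ==false⇒≢ (not-elim (trans (sym (K1a-adj k a u w)) h))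
  Extremal : ℕ → Set
  Extremal n = Σ (Graph n) λ T → InT0 n k ℓ T × IsExr n r (K1a k a) (e r T)
  module _ (n : ℕ) (N≤n : N ≤ n) where
    n>k : k < n
    n>k = ≤-trans (m≤n+m (suc k) _) N≤n
    Large : Vec (Fin k) n → Set
    Large q = ∀ i → M < partSize (lookup q) i
    large? : ∀ q → Dec (Large q)
    large? q = FP.all? (λ i → M <? partSize (lookup q) i)
    large : ∀ q → (∀ i → n ≤ C * partSize (lookup q) i) → Large q
    large q parts i = *-cancelˡ C>0 (≤-trans (≤-trans (m≤n+m (C * suc M) (proj₁ st)) (≤-trans (m≤m+n _ (suc k)) N≤n)) (parts i))
    inside : ∀ q → Large q → Graph n
    inside q h = proj₁ (Regularise.regular (lookup q) ℓ h)
    inside-girth5 : ∀ q h → Girth5 (lookup q) ℓ (inside q h)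
    inside-girth5 q h = proj₁ (proj₂ (Regularise.regular (lookup q) ℓ h))
    inside-regular : ∀ q h i → AlmostRegular (lookup q) ℓ (inside q h) i
    inside-regular q h = proj₂ (proj₂ (Regularise.regular (lookup q) ℓ h))
    Val : ∀ q → Large q → ℕ
    Val q h = sumFin (λ v → (cross (lookup q) v + deg (inside q h) v) ^ r)
    crossPower≤Val : ∀ q h → crossPower r (lookup q) ≤ Val q h
    crossPower≤Val q h = sum-mono {n} (λ v → ^-monoˡ-≤ r (m≤m+n (cross (lookup q) v) (deg (inside q h) v)))
    e-overlay : ∀ q h → e r (overlay (lookup q) (inside q h)) ≡ Val q h
    e-overlay q h = sum-cong (λ v → cong (_^ r) (Overlay.T-deg (lookup q) (inside q h) (inside-girth5 q h) v))
    Best : Set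
    Best = Σ (Vec (Fin k) n) λ q → Σ (Large q) λ h → ∀ y → Large y → Σ (Large y) λ hy → Val y hy ≤ Val q h
    start : Σ (Vec (Fin k) n) λ pv → (∀ (p : Fin n → Fin k) → crossPower r p ≤ crossPower r (lookup pv)) ×
      (∀ i → n ≤ C * partSize (lookup pv) i)
    start = maximal-crossPower (suc j) ρ n>k
    best : Best
    best = build start (argmaxL large? Val (allVecs k n))
      where
      build : (Σ (Vec (Fin k) n) λ pv → (∀ (p : Fin n → Fin k) → crossPower r p ≤ crossPower r (lookup pv)) ×
          (∀ i → n ≤ C * partSize (lookup pv) i)) →
        (∀ y → y ∈ allVecs k n → ¬ Large y) ⊎
        (Σ (Vec (Fin k) n) λ x → Σ (Large x) λ px → ∀ y → y ∈ allVecs k n → Large y → Σ (Large y) λ py → Val y py ≤ Val x px) → Best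
      build (pv , _ , parts) (inj₁ none) = ⊥-elim (none pv (∈-allVecs pv) (large pv parts))
      build _ (inj₂ (q , h , max)) = q , h , λ y hy → max y (∈-allVecs y) hy
    extremal : Extremal n
    extremal = build best
      where
      build : Best → Extremal n
      build (q , h , max) = T , Overlay.T-InT0 (lookup q) H valid (inside-regular q h) (λ i → ≤-<-trans z≤n (h i)) ,
          (T , overlay-free ℓ (lookup q) H valid , refl) , λ G free → ≤-trans (either G free (≤-total (e r G) (Val q h))) (≤-reflexive (sym (e-overlay q h)))
        where
        H = inside q h
        valid = inside-girth5 q h
        T = overlay (lookup q) H
        dominates : ∀ (p : Fin n → Fin k) → crossPower r p ≤ Val q h
        dominates p = from start
          where
          from : (Σ (Vec (Fin k) n) λ pv → (∀ (p : Fin n → Fin k) → crossPower r p ≤ crossPower r (lookup pv)) ×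
            (∀ i → n ≤ C * partSize (lookup pv) i)) → crossPower r p ≤ Val q h
          from (pv , pmax , parts) = ≤-trans (pmax p) (≤-trans (crossPower≤Val pv (proj₁ (max pv (large pv parts)))) (proj₂ (max pv (large pv parts))))
        either : ∀ G → (K1a k a -free) G → (e r G ≤ Val q h) ⊎ (Val q h ≤ e r G) → e r G ≤ Val q h
        either G free (inj₁ small) = small
        either G free (inj₂ big) = from (proj₂ st (≤-trans (≤-trans (m≤m+n (proj₁ st) _) (m≤m+n _ (suc k))) N≤n) G
            (λ blowup → free (blowup⇒⊆ (K1a k a) G K1a-colorable blowup)) (λ p → ≤-trans (dominates p) big))
          where
          from : (Σ ℕ λ η → Σ (Vec (Fin k) n) λ pv → m + k < η × Structured G (lookup pv) η c C) → e r G ≤ Val q h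
          from (η , pv , η-large , str) = choose (max pv pv-large)
            where
            pv-large : Large pv
            pv-large = large pv (Structured.part≥n/C str)
            -- The comparison with G is made for the inner graph belonging to the proof `hy`
            -- returned by the maximisation.
            choose : (Σ (Large pv) λ hy → Val pv hy ≤ Val q h) → e r G ≤ Val q h
            choose (hy , le₁) = ≤-trans (StarFree.Bound.bounded ρ ℓ G free (lookup pv) η η-large str (inside pv hy) (inside-girth5 pv hy) (inside-regular pv hy) C>0) le₁

-- Part (iii)

-- Names for the vertices of the bow-tie; seeds and colourings are defined by cases here and
-- transported along `Bview`.
data BVertex (k : ℕ) : Set where
  centre : BVertex k
  left right : Fin k → BVertex k

data BAdj {k : ℕ} : BVertex k → BVertex k → Set where
  centre-left  : ∀ {a} → BAdj centre (left a)
  centre-right : ∀ {a} → BAdj centre (right a)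
  left-centre  : ∀ {a} → BAdj (left a) centre
  right-centre : ∀ {a} → BAdj (right a) centre
  left-left    : ∀ {a b} → a ≢ b → BAdj (left a) (left b)
  right-right  : ∀ {a b} → a ≢ b → BAdj (right a) (right b)

module _ (k : ℕ) where

  Bcopy : Fin k ⊎ Fin k → BVertex k
  Bcopy (inj₁ a) = left a
  Bcopy (inj₂ a) = right a

  Bview : Fin (suc (k + k)) → BVertex k
  Bview zero    = centre
  Bview (suc i) = Bcopy (splitAt k i)

  Bindex : BVertex k → Fin (suc (k + k))
  Bindex centre    = zero
  Bindex (left a)  = suc (a ↑ˡ k)
  Bindex (right a) = suc (k ↑ʳ a)

  Bindex-Bview : ∀ u → Bindex (Bview u) ≡ u
  Bindex-Bview zero    = refl
  Bindex-Bview (suc i) = trans (copy (splitAt k i)) (cong suc (FP.join-splitAt k k i))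
    where
    copy : ∀ x → Bindex (Bcopy x) ≡ suc (F.join k k x)
    copy (inj₁ a) = refl
    copy (inj₂ a) = refl

  Bview-Bindex : ∀ u → Bview (Bindex u) ≡ u
  Bview-Bindex centre    = refl
  Bview-Bindex (left a)  = cong Bcopy (FP.splitAt-↑ˡ k a k)
  Bview-Bindex (right a) = cong Bcopy (FP.splitAt-↑ʳ k k a)

  Bview-injective : ∀ {u w} → Bview u ≡ Bview w → u ≡ w
  Bview-injective {u} {w} e = trans (sym (Bindex-Bview u)) (trans (cong Bindex e) (Bindex-Bview w))

  Bcopy-distinct : ∀ i i′ → suc i ≢ suc i′ → splitAt k i ≢ splitAt k i′
  Bcopy-distinct i i′ ne e = ne (cong suc (trans (sym (FP.join-splitAt k k i)) (trans (cong (F.join k k) e) (FP.join-splitAt k k i′))))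

  B-elim : ∀ u w → adj (B k) u w ≡ true → BAdj (Bview u) (Bview w)
  B-elim zero    zero    h = case h of λ ()
  B-elim zero    (suc i) h with splitAt k i
  ... | inj₁ _ = centre-left
  ... | inj₂ _ = centre-right
  B-elim (suc i) zero    h with splitAt k i
  ... | inj₁ _ = left-centre
  ... | inj₂ _ = right-centre
  B-elim (suc i) (suc i′) h with Bcopy-distinct i i′ (irreflexive (B k) h)
  ... | ne with splitAt k i | splitAt k i′
  ...   | inj₁ a | inj₁ b = left-left (ne ∘ cong inj₁)
  ...   | inj₂ a | inj₂ b = right-right (ne ∘ cong inj₂)
  ...   | inj₁ a | inj₂ b = case h of λ ()
  ...   | inj₂ a | inj₁ b = case h of λ ()

  B-intro : ∀ u w → BAdj u w → adj (B k) (Bindex u) (Bindex w) ≡ true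
  B-intro _ _ centre-left  = refl
  B-intro _ _ centre-right = refl
  B-intro (left a)  _ left-centre  = refl
  B-intro (right a) _ right-centre = refl
  B-intro (left a) (left b) (left-left ne) rewrite FP.splitAt-↑ˡ k a k | FP.splitAt-↑ˡ k b k =
    not-intro (≢⇒==false (λ e → ne (FP.↑ˡ-injective k a b (FP.suc-injective e))))
  B-intro (right a) (right b) (right-right ne) rewrite FP.splitAt-↑ʳ k k a | FP.splitAt-↑ʳ k k b =
    not-intro (≢⇒==false (λ e → ne (FP.↑ʳ-injective k a b (FP.suc-injective e))))

  Bcol : BVertex k → Fin (suc k)
  Bcol centre    = zero
  Bcol (left a)  = suc a
  Bcol (right a) = suc a

  B-colorable : Colorable (B k) (suc k)
  B-colorable = (λ u → Bcol (Bview u)) , λ u w h → proper (B-elim u w h)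
    where
    proper : ∀ {u w} → BAdj u w → Bcol u ≢ Bcol w
    proper centre-left  ()
    proper centre-right ()
    proper left-centre  ()
    proper right-centre ()
    proper (left-left ne)   e = ne (FP.suc-injective e)
    proper (right-right ne) e = ne (FP.suc-injective e)

module PlusEdge {n : ℕ} {k : ℕ} (p : Fin n → Fin k) (x y : Fin n) where

  T : Graph n
  T = completeMPplusEdge p x y

  T-rel : Fin n → Fin n → Bool
  T-rel u v = not (p u == p v) ∨ ((u == x) ∧ (v == y))

  T-cross : ∀ u v → p u ≢ p v → adj T u v ≡ true
  T-cross u v ne = mkGraph-intro T-rel u v (∨-introˡ (not-intro (≢⇒==false ne))) (ne ∘ cong p)

  T-edge : x ≢ y → adj T x y ≡ true
  T-edge ne = mkGraph-intro T-rel x y (∨-introʳ {not (p x == p y)} (∧-intro (==-refl x) (==-refl y))) ne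

  T-elim : ∀ u v → adj T u v ≡ true → p u ≡ p v → (u ≡ x × v ≡ y) ⊎ (u ≡ y × v ≡ x)
  T-elim u v h e with proj₁ (mkGraph-elim T-rel u v h)
  ... | inj₁ q with ∨-elim {not (p u == p v)} q
  ...   | inj₁ z = ⊥-elim (==false⇒≢ (not-elim z) e)
  ...   | inj₂ z = inj₁ (==⇒≡ (∧-elimˡ z) , ==⇒≡ (∧-elimʳ {u == x} z))
  T-elim u v h e | inj₂ q with ∨-elim {not (p v == p u)} q
  ...   | inj₁ z = ⊥-elim (==false⇒≢ (not-elim z) (sym e))
  ...   | inj₂ z = inj₂ (==⇒≡ (∧-elimʳ {v == x} z) , ==⇒≡ (∧-elimˡ z))

  cross≤deg : ∀ v → cross p v ≤ deg T v
  cross≤deg v = count-mono {n} {λ w → not (p v == p w)} {adj T v} (λ w h → T-cross v w (==false⇒≢ (not-elim h)))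

  leftClique rightClique : Fin (suc k) → BVertex k
  leftClique zero     = centre
  leftClique (suc a)  = left a
  rightClique zero    = centre
  rightClique (suc a) = right a

  -- Both copies of K_{k+1} must use the extra edge xy, but they share one vertex only.
  T-free : x ≢ y → (B k -free) T
  T-free x≢y (f , f-inj , f-adj) = x≢y (trans (sym (meet x (proj₁ (contains-xy leftClique left-adj)) (proj₁ (contains-xy rightClique right-adj))))
      (meet y (proj₂ (contains-xy leftClique left-adj)) (proj₂ (contains-xy rightClique right-adj))))
    where
    F′ : BVertex k → Fin n
    F′ u = f (Bindex k u)
    contains-xy : (c : Fin (suc k) → BVertex k) → (∀ i i′ → i ≢ i′ → BAdj (c i) (c i′)) →
      (∃ λ i → F′ (c i) ≡ x) × (∃ λ i → F′ (c i) ≡ y)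
    contains-xy c c-adj with FP.pigeonhole ≤-refl (λ i → p (F′ (c i)))
    ... | i , i′ , i<i′ , e with T-elim _ _ (f-adj _ _ (B-intro k _ _ (c-adj i i′ (FP.<⇒≢ i<i′)))) e
    ...   | inj₁ (ex , ey) = (i , ex) , (i′ , ey)
    ...   | inj₂ (ey , ex) = (i′ , ex) , (i , ey)
    left-adj : ∀ i i′ → i ≢ i′ → BAdj (leftClique i) (leftClique i′)
    left-adj zero    zero    ne = ⊥-elim (ne refl)
    left-adj zero    (suc b) ne = centre-left
    left-adj (suc a) zero    ne = left-centre
    left-adj (suc a) (suc b) ne = left-left (ne ∘ cong suc)
    right-adj : ∀ i i′ → i ≢ i′ → BAdj (rightClique i) (rightClique i′)
    right-adj zero    zero    ne = ⊥-elim (ne refl)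
    right-adj zero    (suc b) ne = centre-right
    right-adj (suc a) zero    ne = right-centre
    right-adj (suc a) (suc b) ne = right-right (ne ∘ cong suc)
    apart : ∀ i i′ → leftClique i ≡ rightClique i′ → leftClique i ≡ centre
    apart zero    _    _ = refl
    apart (suc a) zero ()
    apart (suc a) (suc b) ()
    Bindex-injective : ∀ {u w} → Bindex k u ≡ Bindex k w → u ≡ w
    Bindex-injective {u} {w} e = trans (sym (Bview-Bindex k u)) (trans (cong (Bview k) e) (Bview-Bindex k w))
    meet : ∀ z → (∃ λ i → F′ (leftClique i) ≡ z) → (∃ λ i → F′ (rightClique i) ≡ z) → F′ centre ≡ z
    meet z (i , e) (i′ , e′) = trans (cong F′ (sym (apart i i′ (Bindex-injective (f-inj (trans e (sym e′))))))) e

transpose-other : ∀ {k} {i j x : Fin k} → x ≢ i → x ≢ j → PC.transpose i j x ≡ x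
transpose-other {i = i} {j} {x} n₁ n₂ with x F.≟ i
... | yes e = ⊥-elim (n₁ e)
... | no _ with x F.≟ j
...   | yes e = ⊥-elim (n₂ e)
...   | no _  = refl

-- Two transpositions: one sends 0 to i, the next sends the image t of 1 to l and fixes i, which
-- differs from both. The labels 0 and 1 can then be reserved for seeds.
arrange : ∀ {j} (i l : Fin (suc (suc j))) → i ≢ l → Σ (Fin (suc (suc j)) → Fin (suc (suc j))) λ τ →
  τ zero ≡ i × τ (suc zero) ≡ l × (∀ {a b} → a ≢ b → τ a ≢ τ b)
arrange i l i≢l = (λ a → PC.transpose t l (PC.transpose zero i a)) ,
    trans (cong (PC.transpose t l) (transpose-at zero i)) (transpose-other i≢t i≢l) , transpose-at t l ,
    λ ne e → ne (transpose-injective zero i (transpose-injective t l e))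
  where
  t = PC.transpose zero i (suc zero)
  i≢t : i ≢ t
  i≢t e = case transpose-injective zero i {zero} {suc zero} (trans (transpose-at zero i) e) of λ ()

module Bowtie {n : ℕ} {j : ℕ} (ρ : ℕ) (G : Graph n) (free : (B (suc (suc j)) -free) G) where

  k m α C : ℕ
  k = suc (suc j)
  m = suc (k + k)
  α = 2 * m + 3
  C = partConst k ρ

  module Bound (p : Fin n → Fin k) (η : ℕ) (η-large : m + k * 2 < η)
    (str : Structured G p η (2 * m + 3 + m * BadVertices.b ρ G p η α C) C) where
    open ≤-Reasoning
    open BadVertices ρ G p η α C
    η>0 : 0 < η
    η>0 = ≤-<-trans z≤n η-large
    open Embedding G p η
    open WithStructure str η>0

    unused : m + count {n} (λ _ → false) ≤ η
    unused = ≤-trans (≤-reflexive (trans (cong (m +_) (count-none {n} (λ _ → refl))) (+-identityʳ m))) (≤-trans (m≤m+n m (k * 2)) (<⇒≤ η-large))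

    impossible : ∀ {fix s} → Embeds (B k) fix s (λ _ → false) → ⊥
    impossible E = free (Embeds.map E , Embeds.inj E , Embeds.edges E)

    bowtie : (fix : BVertex k → Bool) (s : BVertex k → Fin n) (col : BVertex k → Fin k) →
      (∀ u → fix u ≡ true → D (s u) ≡ false) →
      (∀ {u w} → fix u ≡ true → fix w ≡ true → BAdj u w → adj G (s u) (s w) ≡ true) →
      (∀ u w → fix u ≡ true → fix w ≡ true → s u ≡ s w → u ≡ w) →
      (∀ {u w} → fix u ≡ false → fix w ≡ false → BAdj u w → col u ≢ col w) →
      (∀ {u w} → fix u ≡ false → fix w ≡ true → BAdj u w → p (s w) ≢ col u) → ⊥
    bowtie fix s col good fix-adj fix-inj col-ok seed-col = impossible (embed-at-seeds (B k) (fix ∘ Bview k) (s ∘ Bview k) (col ∘ Bview k)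
      (λ _ → false) b unused ≤-refl (λ u h → <⇒≤ (nle⇒> (good (Bview k u) h)))
      (λ u w h h′ a → fix-adj h h′ (B-elim k u w a)) (λ u w h h′ e → Bview-injective k (fix-inj _ _ h h′ e))
      (λ u w h h′ a → col-ok h h′ (B-elim k u w a)) (λ u w h h′ a → seed-col h h′ (B-elim k u w a)))

    inn-small : ∀ v → inn G p v ≤ α * η
    inn-small v = decide (≤-total (inn G p v) (α * η))
      where
      decide : (inn G p v ≤ α * η) ⊎ (α * η ≤ inn G p v) → inn G p v ≤ α * η
      decide (inj₁ h) = h
      decide (inj₂ h) = ⊥-elim (impossible (embed-at-apex (B k) zero (col ∘ Bview k) v (λ _ → false) unused h
          (λ u w n₁ n₂ a → ok (λ e → n₁ (Bview-injective k e)) (λ e → n₂ (Bview-injective k e)) (B-elim k u w a))))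
        where
        col : BVertex k → Fin k
        col centre    = zero
        col (left a)  = a
        col (right a) = a
        ok : ∀ {u w} → u ≢ centre → w ≢ centre → BAdj u w → col u ≢ col w
        ok n₁ n₂ centre-left  = ⊥-elim (n₁ refl)
        ok n₁ n₂ centre-right = ⊥-elim (n₁ refl)
        ok n₁ n₂ left-centre  = ⊥-elim (n₂ refl)
        ok n₁ n₂ right-centre = ⊥-elim (n₂ refl)
        ok n₁ n₂ (left-left ne)   = ne
        ok n₁ n₂ (right-right ne) = ne

    record GoodEdge (x y : Fin n) : Set where
      constructor goodEdge
      field
        joined : adj G x y ≡ true
        same   : p x ≡ p y
        good₁  : D x ≡ false
        good₂  : D y ≡ false
    open GoodEdge

    reverse : ∀ {x y} → GoodEdge x y → GoodEdge y x
    reverse {x} {y} (goodEdge xy e h h′) = goodEdge (trans (adj-sym G y x) xy) (sym e) h′ h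

    -- The bow-tie is centred at x, with y and w as the vertices of its two cliques that are
    -- coloured by the part of x.
    no-cherry : ∀ x y w → GoodEdge x y → GoodEdge x w → y ≢ w → ⊥
    no-cherry x y w xy xw y≢w = cherry (arrange (p x) (proj₁ (other (p x))) (proj₂ (other (p x)) ∘ sym))
      where
      cherry : (Σ (Fin k → Fin k) λ τ → τ zero ≡ p x × τ (suc zero) ≡ proj₁ (other (p x)) × (∀ {a b} → a ≢ b → τ a ≢ τ b)) → ⊥
      cherry (τ , τ₀ , _ , τ-inj) = bowtie fix s col good fix-adj fix-inj col-ok seed-col
        where
        fix : BVertex k → Bool
        fix centre          = true
        fix (left zero)     = true
        fix (left (suc _))  = false
        fix (right zero)    = true
        fix (right (suc _)) = false
        s : BVertex k → Fin n
        s centre    = x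
        s (left _)  = y
        s (right _) = w
        col : BVertex k → Fin k
        col centre    = zero
        col (left a)  = τ a
        col (right a) = τ a
        good : ∀ u → fix u ≡ true → D (s u) ≡ false
        good centre       _ = good₁ xy
        good (left zero)  _ = good₂ xy
        good (right zero) _ = good₂ xw
        p-s : ∀ u → p (s u) ≡ τ zero
        p-s centre    = sym τ₀
        p-s (left _)  = trans (sym (same xy)) (sym τ₀)
        p-s (right _) = trans (sym (same xw)) (sym τ₀)
        fix-adj : ∀ {u w′} → fix u ≡ true → fix w′ ≡ true → BAdj u w′ → adj G (s u) (s w′) ≡ true
        fix-adj _ _ centre-left  = joined xy
        fix-adj _ _ centre-right = joined xw
        fix-adj _ _ left-centre  = joined (reverse xy)
        fix-adj _ _ right-centre = joined (reverse xw)
        fix-adj {left zero} {left zero} _ _ (left-left ne) = ⊥-elim (ne refl)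
        fix-adj {right zero} {right zero} _ _ (right-right ne) = ⊥-elim (ne refl)
        fix-inj : ∀ u w′ → fix u ≡ true → fix w′ ≡ true → s u ≡ s w′ → u ≡ w′
        fix-inj centre       centre       _ _ _ = refl
        fix-inj centre       (left zero)  _ _ e = ⊥-elim (irreflexive G (joined xy) e)
        fix-inj centre       (right zero) _ _ e = ⊥-elim (irreflexive G (joined xw) e)
        fix-inj (left zero)  centre       _ _ e = ⊥-elim (irreflexive G (joined xy) (sym e))
        fix-inj (left zero)  (left zero)  _ _ _ = refl
        fix-inj (left zero)  (right zero) _ _ e = ⊥-elim (y≢w e)
        fix-inj (right zero) centre       _ _ e = ⊥-elim (irreflexive G (joined xw) (sym e))
        fix-inj (right zero) (left zero)  _ _ e = ⊥-elim (y≢w (sym e))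
        fix-inj (right zero) (right zero) _ _ _ = refl
        col-ok : ∀ {u w′} → fix u ≡ false → fix w′ ≡ false → BAdj u w′ → col u ≢ col w′
        col-ok _ _ (left-left ne)   = τ-inj ne
        col-ok _ _ (right-right ne) = τ-inj ne
        seed-col : ∀ {u w′} → fix u ≡ false → fix w′ ≡ true → BAdj u w′ → p (s w′) ≢ col u
        seed-col {left (suc a)}  {w′} _ _ _ e = τ-inj {zero} {suc a} (λ ()) (trans (sym (p-s w′)) e)
        seed-col {right (suc a)} {w′} _ _ _ e = τ-inj {zero} {suc a} (λ ()) (trans (sym (p-s w′)) e)

    -- Each clique receives one of the two edges. The centre is a free vertex of another part: it
    -- takes the colour `τ (suc zero)`, which the second end of the edge vacates in both cliques.
    no-matching : ∀ x y z w → GoodEdge x y → GoodEdge z w → p x ≡ p z → x ≢ z → x ≢ w → y ≢ z → y ≢ w → ⊥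
    no-matching x y z w xy zw px≡pz x≢z x≢w y≢z y≢w = match (arrange (p x) (proj₁ (other (p x))) (proj₂ (other (p x)) ∘ sym))
      where
      match : (Σ (Fin k → Fin k) λ τ → τ zero ≡ p x × τ (suc zero) ≡ proj₁ (other (p x)) × (∀ {a b} → a ≢ b → τ a ≢ τ b)) → ⊥
      match (τ , τ₀ , _ , τ-inj) = bowtie fix s col good fix-adj fix-inj col-ok seed-col
        where
        fix : BVertex k → Bool
        fix centre                = false
        fix (left zero)           = true
        fix (left (suc zero))     = true
        fix (left (suc (suc _)))  = false
        fix (right zero)          = true
        fix (right (suc zero))    = true
        fix (right (suc (suc _))) = false
        s : BVertex k → Fin n
        s centre          = x
        s (left zero)     = x
        s (left (suc _))  = y
        s (right zero)    = z
        s (right (suc _)) = w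
        col : BVertex k → Fin k
        col centre    = τ (suc zero)
        col (left a)  = τ a
        col (right a) = τ a
        good : ∀ u → fix u ≡ true → D (s u) ≡ false
        good (left zero)        _ = good₁ xy
        good (left (suc zero))  _ = good₂ xy
        good (right zero)       _ = good₁ zw
        good (right (suc zero)) _ = good₂ zw
        p-s : ∀ u → p (s u) ≡ τ zero
        p-s centre          = sym τ₀
        p-s (left zero)     = sym τ₀
        p-s (left (suc _))  = trans (sym (same xy)) (sym τ₀)
        p-s (right zero)    = trans (sym px≡pz) (sym τ₀)
        p-s (right (suc _)) = trans (sym (same zw)) (trans (sym px≡pz) (sym τ₀))
        fix-adj : ∀ {u w′} → fix u ≡ true → fix w′ ≡ true → BAdj u w′ → adj G (s u) (s w′) ≡ true
        fix-adj {left zero} {left zero} _ _ (left-left ne) = ⊥-elim (ne refl)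
        fix-adj {left zero} {left (suc zero)} _ _ _ = joined xy
        fix-adj {left (suc zero)} {left zero} _ _ _ = joined (reverse xy)
        fix-adj {left (suc zero)} {left (suc zero)} _ _ (left-left ne) = ⊥-elim (ne refl)
        fix-adj {right zero} {right zero} _ _ (right-right ne) = ⊥-elim (ne refl)
        fix-adj {right zero} {right (suc zero)} _ _ _ = joined zw
        fix-adj {right (suc zero)} {right zero} _ _ _ = joined (reverse zw)
        fix-adj {right (suc zero)} {right (suc zero)} _ _ (right-right ne) = ⊥-elim (ne refl)
        fix-inj : ∀ u w′ → fix u ≡ true → fix w′ ≡ true → s u ≡ s w′ → u ≡ w′
        fix-inj (left zero)        (left zero)        _ _ _ = refl
        fix-inj (left zero)        (left (suc zero))  _ _ e = ⊥-elim (irreflexive G (joined xy) e)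
        fix-inj (left zero)        (right zero)       _ _ e = ⊥-elim (x≢z e)
        fix-inj (left zero)        (right (suc zero)) _ _ e = ⊥-elim (x≢w e)
        fix-inj (left (suc zero))  (left zero)        _ _ e = ⊥-elim (irreflexive G (joined xy) (sym e))
        fix-inj (left (suc zero))  (left (suc zero))  _ _ _ = refl
        fix-inj (left (suc zero))  (right zero)       _ _ e = ⊥-elim (y≢z e)
        fix-inj (left (suc zero))  (right (suc zero)) _ _ e = ⊥-elim (y≢w e)
        fix-inj (right zero)       (left zero)        _ _ e = ⊥-elim (x≢z (sym e))
        fix-inj (right zero)       (left (suc zero))  _ _ e = ⊥-elim (y≢z (sym e))
        fix-inj (right zero)       (right zero)       _ _ _ = refl
        fix-inj (right zero)       (right (suc zero)) _ _ e = ⊥-elim (irreflexive G (joined zw) e)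
        fix-inj (right (suc zero)) (left zero)        _ _ e = ⊥-elim (x≢w (sym e))
        fix-inj (right (suc zero)) (left (suc zero))  _ _ e = ⊥-elim (y≢w (sym e))
        fix-inj (right (suc zero)) (right zero)       _ _ e = ⊥-elim (irreflexive G (joined zw) (sym e))
        fix-inj (right (suc zero)) (right (suc zero)) _ _ _ = refl
        col-ok : ∀ {u w′} → fix u ≡ false → fix w′ ≡ false → BAdj u w′ → col u ≢ col w′
        col-ok {centre} {left (suc (suc a))}  _ _ _ = τ-inj (λ ())
        col-ok {centre} {right (suc (suc a))} _ _ _ = τ-inj (λ ())
        col-ok {left (suc (suc a))}  {centre} _ _ _ = τ-inj (λ ())
        col-ok {right (suc (suc a))} {centre} _ _ _ = τ-inj (λ ())
        col-ok _ _ (left-left ne)   = τ-inj ne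
        col-ok _ _ (right-right ne) = τ-inj ne
        seed-col : ∀ {u w′} → fix u ≡ false → fix w′ ≡ true → BAdj u w′ → p (s w′) ≢ col u
        seed-col {centre} {w′} _ _ _ e = τ-inj {zero} {suc zero} (λ ()) (trans (sym (p-s w′)) e)
        seed-col {left (suc (suc a))}  {w′} _ _ _ e = τ-inj {zero} {suc (suc a)} (λ ()) (trans (sym (p-s w′)) e)
        seed-col {right (suc (suc a))} {w′} _ _ _ e = τ-inj {zero} {suc (suc a)} (λ ()) (trans (sym (p-s w′)) e)

    -- The centre is z. One clique contains z and the edge xy; the other contains the edge zw and a
    -- free vertex in the part of x.
    no-dominating : ∀ x y z w → GoodEdge x y → GoodEdge z w → p x ≢ p z → adj G z x ≡ true → adj G z y ≡ true → ⊥
    no-dominating x y z w xy zw px≢pz zx zy = dominate (arrange (p x) (p z) px≢pz)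
      where
      dominate : (Σ (Fin k → Fin k) λ τ → τ zero ≡ p x × τ (suc zero) ≡ p z × (∀ {a b} → a ≢ b → τ a ≢ τ b)) → ⊥
      dominate (τ , τ₀ , τ₁ , τ-inj) = bowtie fix s col good fix-adj fix-inj col-ok seed-col
        where
        fix : BVertex k → Bool
        fix centre                = true
        fix (left zero)           = true
        fix (left (suc zero))     = true
        fix (left (suc (suc _)))  = false
        fix (right zero)          = false
        fix (right (suc zero))    = true
        fix (right (suc (suc _))) = false
        s : BVertex k → Fin n
        s centre         = z
        s (left zero)    = x
        s (left (suc _)) = y
        s (right _)      = w
        col : BVertex k → Fin k
        col centre    = zero
        col (left a)  = τ a
        col (right a) = τ a
        good : ∀ u → fix u ≡ true → D (s u) ≡ false
        good centre             _ = good₁ zw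
        good (left zero)        _ = good₁ xy
        good (left (suc zero))  _ = good₂ xy
        good (right (suc zero)) _ = good₂ zw
        left-apart : ∀ a → s (left a) ≢ z × s (left a) ≢ w
        left-apart zero    = (λ e → px≢pz (cong p e)) , (λ e → px≢pz (trans (cong p e) (sym (same zw))))
        left-apart (suc _) = (λ e → px≢pz (trans (same xy) (cong p e))) , (λ e → px≢pz (trans (same xy) (trans (cong p e) (sym (same zw)))))
        fix-adj : ∀ {u w′} → fix u ≡ true → fix w′ ≡ true → BAdj u w′ → adj G (s u) (s w′) ≡ true
        fix-adj {centre} {left zero} _ _ _ = zx
        fix-adj {centre} {left (suc zero)} _ _ _ = zy
        fix-adj {centre} {right (suc zero)} _ _ _ = joined zw
        fix-adj {left zero} {centre} _ _ _ = trans (adj-sym G x z) zx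
        fix-adj {left (suc zero)} {centre} _ _ _ = trans (adj-sym G y z) zy
        fix-adj {right (suc zero)} {centre} _ _ _ = joined (reverse zw)
        fix-adj {left zero} {left zero} _ _ (left-left ne) = ⊥-elim (ne refl)
        fix-adj {left zero} {left (suc zero)} _ _ _ = joined xy
        fix-adj {left (suc zero)} {left zero} _ _ _ = joined (reverse xy)
        fix-adj {left (suc zero)} {left (suc zero)} _ _ (left-left ne) = ⊥-elim (ne refl)
        fix-adj {right (suc zero)} {right (suc zero)} _ _ (right-right ne) = ⊥-elim (ne refl)
        fix-inj : ∀ u w′ → fix u ≡ true → fix w′ ≡ true → s u ≡ s w′ → u ≡ w′
        fix-inj centre             centre             _ _ _ = refl
        fix-inj centre             (left a)           _ _ e = ⊥-elim (proj₁ (left-apart a) (sym e))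
        fix-inj centre             (right (suc zero)) _ _ e = ⊥-elim (irreflexive G (joined zw) e)
        fix-inj (left a)           centre             _ _ e = ⊥-elim (proj₁ (left-apart a) e)
        fix-inj (left zero)        (left zero)        _ _ _ = refl
        fix-inj (left zero)        (left (suc zero))  _ _ e = ⊥-elim (irreflexive G (joined xy) e)
        fix-inj (left (suc zero))  (left zero)        _ _ e = ⊥-elim (irreflexive G (joined xy) (sym e))
        fix-inj (left (suc zero))  (left (suc zero))  _ _ _ = refl
        fix-inj (left a)           (right b)          _ _ e = ⊥-elim (proj₂ (left-apart a) e)
        fix-inj (right (suc zero)) centre             _ _ e = ⊥-elim (irreflexive G (joined zw) (sym e))
        fix-inj (right b)          (left a)           _ _ e = ⊥-elim (proj₂ (left-apart a) (sym e))
        fix-inj (right (suc zero)) (right (suc zero)) _ _ _ = refl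
        col-ok : ∀ {u w′} → fix u ≡ false → fix w′ ≡ false → BAdj u w′ → col u ≢ col w′
        col-ok _ _ (left-left ne)   = τ-inj ne
        col-ok _ _ (right-right ne) = τ-inj ne
        p-left : ∀ a → p (s (left a)) ≡ τ zero
        p-left zero    = sym τ₀
        p-left (suc _) = trans (sym (same xy)) (sym τ₀)
        seed-col : ∀ {u w′} → fix u ≡ false → fix w′ ≡ true → BAdj u w′ → p (s w′) ≢ col u
        seed-col {left (suc (suc a))}  {centre}  _ _ _ e = τ-inj {suc zero} {suc (suc a)} (λ ()) (trans τ₁ e)
        seed-col {left (suc (suc a))}  {left a′} _ _ _ e = τ-inj {zero} {suc (suc a)} (λ ()) (trans (sym (p-left a′)) e)
        seed-col {right zero}          {centre}  _ _ _ e = τ-inj {suc zero} {zero} (λ ()) (trans τ₁ e)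
        seed-col {right zero}          {right _} _ _ _ e = τ-inj {suc zero} {zero} (λ ()) (trans τ₁ (trans (same zw) e))
        seed-col {right (suc (suc a))} {centre}  _ _ _ e = τ-inj {suc zero} {suc (suc a)} (λ ()) (trans τ₁ e)
        seed-col {right (suc (suc a))} {right _} _ _ _ e = τ-inj {suc zero} {suc (suc a)} (λ ()) (trans τ₁ (trans (same zw) e))

    Same : Fin n → Fin n → Fin n → Fin n → Set
    Same x y v w = (v ≡ x × w ≡ y) ⊎ (v ≡ y × w ≡ x)

    unique-in-part : ∀ x y v w → GoodEdge x y → GoodEdge v w → p x ≡ p v → Same x y v w
    unique-in-part x y v w xy vw e = decide (v F.≟ x) (v F.≟ y) (w F.≟ x) (w F.≟ y)
      where
      decide : Dec (v ≡ x) → Dec (v ≡ y) → Dec (w ≡ x) → Dec (w ≡ y) → Same x y v w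
      decide (yes vx) _ _ (yes wy) = inj₁ (vx , wy)
      decide _ (yes vy) (yes wx) _ = inj₂ (vy , wx)
      decide (yes refl) _ _ (no wy) = ⊥-elim (no-cherry x y w xy vw (wy ∘ sym))
      decide _ (yes refl) (no wx) _ = ⊥-elim (no-cherry y x w (reverse xy) vw (wx ∘ sym))
      decide (no vx) (no vy) (yes refl) _ = ⊥-elim (no-cherry x y v xy (reverse vw) (vy ∘ sym))
      decide (no vx) (no vy) _ (yes refl) = ⊥-elim (no-cherry y x v (reverse xy) (reverse vw) (vx ∘ sym))
      decide (no vx) (no vy) (no wx) (no wy) = ⊥-elim (no-matching x y v w xy vw e (vx ∘ sym) (wx ∘ sym) (vy ∘ sym) (wy ∘ sym))

    edgeB : Fin n → Fin n → Bool
    edgeB v w = not (D v) ∧ ((adj G v w ∧ (p v == p w)) ∧ not (D w))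

    edgeB⇒ : ∀ {v w} → edgeB v w ≡ true → GoodEdge v w
    edgeB⇒ {v} {w} h = goodEdge (∧-elimˡ (∧-elimˡ h′)) (==⇒≡ (∧-elimʳ {adj G v w} (∧-elimˡ h′))) (not-elim (∧-elimˡ h))
      (not-elim (∧-elimʳ {adj G v w ∧ (p v == p w)} h′))
      where
      h′ : (adj G v w ∧ (p v == p w)) ∧ not (D w) ≡ true
      h′ = ∧-elimʳ {not (D v)} h

    -- By `unique-in-part` each part has at most one good edge, seen from both ends. This is the
    -- remainder that bad vertices have to outweigh.
    edge-total : sumFin (λ v → count (edgeB v)) ≤ k * 2
    edge-total = ≤-trans (≤-reflexive (sum-fibres p (λ v → count (edgeB v)))) (sum-≤const 2 (λ i → part i (findTrue (λ v → (p v == i) ∧ someF (edgeB v)))))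
      where
      part : ∀ i → (∃ λ v → (p v == i) ∧ someF (edgeB v) ≡ true) ⊎ (∀ v → (p v == i) ∧ someF (edgeB v) ≡ false) →
        sumFin (λ v → ⟦ p v == i ⟧ * count (edgeB v)) ≤ 2
      part i (inj₂ none) = ≤-trans (≤-reflexive (trans (sum-cong (λ v → row v (true⊎false (p v == i)))) (sum-0 n))) z≤n
        where
        row : ∀ v → ((p v == i) ≡ true) ⊎ ((p v == i) ≡ false) → ⟦ p v == i ⟧ * count (edgeB v) ≡ 0
        row v (inj₂ e) rewrite e = refl
        row v (inj₁ e) = trans (cong (⟦ p v == i ⟧ *_) (count-none (λ w → someF-none (edgeB v) w (trans (cong (_∧ someF (edgeB v)) (sym e)) (none v)))))
          (*-zeroʳ ⟦ p v == i ⟧)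
      part i (inj₁ (x , h)) = pair (someF-elim (edgeB x) (∧-elimʳ {p x == i} h))
        where
        px : p x ≡ i
        px = ==⇒≡ (∧-elimˡ h)
        pair : (∃ λ y → edgeB x y ≡ true) → sumFin (λ v → ⟦ p v == i ⟧ * count (edgeB v)) ≤ 2
        pair (y , xy) = begin
          sumFin (λ v → ⟦ p v == i ⟧ * count (edgeB v)) ≤⟨ sum-mono (λ v → row v (true⊎false (p v == i))) ⟩
          sumFin (λ v → ⟦ x == v ⟧ * 1 + ⟦ y == v ⟧ * 1) ≡⟨ trans (sum-+ (λ v → ⟦ x == v ⟧ * 1) (λ v → ⟦ y == v ⟧ * 1))
             (cong₂ _+_ (sum-delta x (λ _ → 1)) (sum-delta y (λ _ → 1))) ⟩
          2 ∎
          where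
          nbr : ∀ v w → p v ≡ i → edgeB v w ≡ true → ⟦ w == y ⟧ * ⟦ x == v ⟧ + ⟦ w == x ⟧ * ⟦ y == v ⟧ ≥ 1
          nbr v w pv e with unique-in-part x y v w (edgeB⇒ xy) (edgeB⇒ e) (trans px (sym pv))
          ... | inj₁ (refl , refl) rewrite ==-refl v | ==-refl w = s≤s z≤n
          ... | inj₂ (refl , refl) rewrite ==-refl v | ==-refl w = m≤n+m 1 (⟦ w == v ⟧ * ⟦ w == v ⟧)
          row : ∀ v → ((p v == i) ≡ true) ⊎ ((p v == i) ≡ false) → ⟦ p v == i ⟧ * count (edgeB v) ≤ ⟦ x == v ⟧ * 1 + ⟦ y == v ⟧ * 1
          row v (inj₂ e) rewrite e = z≤n
          row v (inj₁ e) = begin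
            ⟦ p v == i ⟧ * count (edgeB v) ≡⟨ trans (cong (λ b → ⟦ b ⟧ * count (edgeB v)) e) (+-identityʳ _) ⟩
            count (edgeB v) ≡⟨ count≡sum (edgeB v) ⟩
            sumFin (λ w → ⟦ edgeB v w ⟧) ≤⟨ sum-mono (λ w → entry w (true⊎false (edgeB v w))) ⟩
            sumFin (λ w → ⟦ y == w ⟧ * ⟦ x == v ⟧ + ⟦ x == w ⟧ * ⟦ y == v ⟧)
              ≡⟨ trans (sum-+ (λ w → ⟦ y == w ⟧ * ⟦ x == v ⟧) (λ w → ⟦ x == w ⟧ * ⟦ y == v ⟧))
                   (cong₂ _+_ (trans (sum-delta y (λ _ → ⟦ x == v ⟧)) (sym (*-identityʳ ⟦ x == v ⟧)))
                     (trans (sum-delta x (λ _ → ⟦ y == v ⟧)) (sym (*-identityʳ ⟦ y == v ⟧)))) ⟩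
            ⟦ x == v ⟧ * 1 + ⟦ y == v ⟧ * 1 ∎
            where
            entry : ∀ w → (edgeB v w ≡ true) ⊎ (edgeB v w ≡ false) → ⟦ edgeB v w ⟧ ≤ ⟦ y == w ⟧ * ⟦ x == v ⟧ + ⟦ x == w ⟧ * ⟦ y == v ⟧
            entry w (inj₂ q) rewrite q = z≤n
            entry w (inj₁ q) = ≤-trans (⟦⟧≤1 (edgeB v w)) (≤-trans (nbr v w (==⇒≡ e) q)
              (≤-reflexive (cong₂ (λ b c → ⟦ b ⟧ * ⟦ x == v ⟧ + ⟦ c ⟧ * ⟦ y == v ⟧) (==-sym w y) (==-sym w x))))

    n≤C·cross : ∀ v → n ≤ C * cross p v
    n≤C·cross v = ≤-trans (part≥n/C (proj₁ (other (p v)))) (*-monoʳ-≤ C (partSize≤cross p v _ (proj₂ (other (p v)))))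

    Result : Set
    Result = Σ (Fin n) λ x → Σ (Fin n) λ y → x ≢ y × p x ≡ p y × e (suc ρ) G ≤ e (suc ρ) (completeMPplusEdge p x y)

    from-cross : ∀ x y → x ≢ y → p x ≡ p y → e (suc ρ) G ≤ crossPower (suc ρ) p → Result
    from-cross x y x≢y px≡py h = x , y , x≢y , px≡py , ≤-trans h (sum-mono (λ v → ^-monoˡ-≤ (suc ρ) (PlusEdge.cross≤deg p x y v)))

    -- Any two vertices of one part will do as the added edge, because it only raises degrees.
    from-any : e (suc ρ) G ≤ crossPower (suc ρ) p → Result
    from-any h = pick (count≥⇒injection (λ v → p v == zero) 2≤)
      where
      2≤ : 2 ≤ partSize p zero
      2≤ = ≤-trans (≤-trans (s≤s (s≤s z≤n)) (≤-trans (m≤m+n m (k * 2)) (<⇒≤ η-large)))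
        (≤-trans (≤-reflexive (sym (*-identityˡ η))) (≤-trans (*-monoˡ-≤ η (≤-trans (m≤n+m 1 (2 * m + 2)) (≤-trans (≤-reflexive (+-assoc (2 * m) 2 1)) (m≤m+n (2 * m + 3) (m * b))))) (part≥cη zero)))
      pick : (Σ (Fin 2 → Fin n) λ φ → Injective _≡_ _≡_ φ × (∀ i → (p (φ i) == zero) ≡ true)) → Result
      pick (φ , φ-inj , φ-0) = from-cross (φ zero) (φ (suc zero)) (λ e → case φ-inj e of λ ()) (trans (==⇒≡ (φ-0 zero)) (sym (==⇒≡ (φ-0 (suc zero))))) h

    from-deg : (∀ v → deg G v ≤ cross p v) → e (suc ρ) G ≤ crossPower (suc ρ) p
    from-deg h = sum-mono (λ v → ^-monoˡ-≤ (suc ρ) (h v))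

    module NoBad (no-bad : ∀ v → D v ≡ false) where

      innerB : Fin n → Fin n → Bool
      innerB v w = adj G v w ∧ (p v == p w)

      inner⇒good : ∀ {v w} → innerB v w ≡ true → GoodEdge v w
      inner⇒good {v} {w} h = goodEdge (∧-elimˡ h) (==⇒≡ (∧-elimʳ {adj G v w} h)) (no-bad v) (no-bad w)

      no-inner : (∀ v → someF (innerB v) ≡ false) → Result
      no-inner none = from-any (from-deg (λ v → ≤-trans (deg≤cross+inn G p v)
        (≤-reflexive (trans (cong (cross p v +_) (count-none (λ w → someF-none (innerB v) w (none v)))) (+-identityʳ _)))))

      one-inner : ∀ x y → GoodEdge x y → (∀ v w → innerB v w ≡ true → Same x y v w) → Result
      one-inner x y xy only = x , y , irreflexive G (joined xy) , same xy , sum-mono (λ v → ^-monoˡ-≤ (suc ρ) (deg≤deg-T v))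
        where
        open PlusEdge p x y
        sameEdge : ∀ v w → Same x y v w → adj T v w ≡ true
        sameEdge v w (inj₁ (refl , refl)) = T-edge (irreflexive G (joined xy))
        sameEdge v w (inj₂ (refl , refl)) = trans (adj-sym T v w) (T-edge (irreflexive G (joined xy)))
        edge-T : ∀ v w → adj G v w ≡ true → Dec (p v ≡ p w) → adj T v w ≡ true
        edge-T v w vw (no ne) = T-cross v w ne
        edge-T v w vw (yes e) = sameEdge v w (only v w (∧-intro vw (≡⇒== e)))
        deg≤deg-T : ∀ v → deg G v ≤ deg T v
        deg≤deg-T v = count-mono {n} {adj G v} {adj T v} (λ w vw → edge-T v w vw (p v F.≟ p w))

      -- With inner edges in two parts, every endpoint of an inner edge misses
      -- an endpoint of an inner edge in another part.
      two-inner : ∀ x y u w → GoodEdge x y → GoodEdge u w → p x ≢ p u → Result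
      two-inner x y u w xy uw px≢pu = from-any (from-deg (λ v → decide v (findTrue (innerB v))))
        where
        missing : ∀ v v′ a b → GoodEdge v v′ → GoodEdge a b → p a ≢ p v → 1 ≤ miss G p v
        missing v v′ a b vv′ ab ne = lost (true⊎false (adj G v a)) (true⊎false (adj G v b))
          where
          witness : ∀ z → p z ≢ p v → adj G v z ≡ false → 1 ≤ miss G p v
          witness z pz h = ≤-trans (≤-reflexive (sym (⟦⟧-true (∧-intro (not-intro (≢⇒==false (pz ∘ sym))) (not-intro h)))))
            (≤-trans (term≤sum (λ w → ⟦ not (p v == p w) ∧ not (adj G v w) ⟧) z) (≤-reflexive (sym (count≡sum (λ w → not (p v == p w) ∧ not (adj G v w))))))
          lost : (adj G v a ≡ true) ⊎ (adj G v a ≡ false) → (adj G v b ≡ true) ⊎ (adj G v b ≡ false) → 1 ≤ miss G p v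
          lost (inj₁ va) (inj₁ vb) = ⊥-elim (no-dominating a b v v′ ab vv′ ne va vb)
          lost (inj₂ va) _ = witness a ne va
          lost _ (inj₂ vb) = witness b (λ e → ne (trans (same ab) e)) vb
        decide : ∀ v → (∃ λ v′ → innerB v v′ ≡ true) ⊎ (∀ v′ → innerB v v′ ≡ false) → deg G v ≤ cross p v
        decide v (inj₂ none) = ≤-trans (deg≤cross+inn G p v) (≤-reflexive (trans (cong (cross p v +_) (count-none none)) (+-identityʳ _)))
        decide v (inj₁ (v′ , vv′)) = lin 0 (+-mono-≤ (≤-reflexive (deg-balance G p v)) (+-mono-≤ inn≤1 (miss≥1 (p x F.≟ p v))))
            (eq (deg G v) (miss G p v) (cross p v) (inn G p v))
          where
          eq : ∀ d m c i → d + (c + i + (1 + m)) + 0 ≡ c + (d + m + (i + 1))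
          eq = solve-∀
          inn≤1 : inn G p v ≤ 1
          inn≤1 = ≤-trans (count-mono {n} {innerB v} {λ w → w == v′} (λ w h → only w h (w F.≟ v′))) (≤-reflexive (count-≡ʳ v′))
            where
            only : ∀ w → innerB v w ≡ true → Dec (w ≡ v′) → (w == v′) ≡ true
            only w h (yes e) = ≡⇒== e
            only w h (no ne) = ⊥-elim (no-cherry v w v′ (inner⇒good h) (inner⇒good vv′) ne)
          -- At least one of the edges xy and uw lies in a part other than that of v.
          miss≥1 : Dec (p x ≡ p v) → 1 ≤ miss G p v
          miss≥1 (no ne)  = missing v v′ x y (inner⇒good vv′) xy ne
          miss≥1 (yes e) = missing v v′ u w (inner⇒good vv′) uw (λ q → px≢pu (trans e (sym q)))

      sameB : Fin n → Fin n → Fin n → Fin n → Bool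
      sameB x y v w = ((v == x) ∧ (w == y)) ∨ ((v == y) ∧ (w == x))

      sameB⇒ : ∀ x y v w → sameB x y v w ≡ true → Same x y v w
      sameB⇒ x y v w h with ∨-elim {(v == x) ∧ (w == y)} h
      ... | inj₁ q = inj₁ (==⇒≡ (∧-elimˡ q) , ==⇒≡ (∧-elimʳ {v == x} q))
      ... | inj₂ q = inj₂ (==⇒≡ (∧-elimˡ q) , ==⇒≡ (∧-elimʳ {v == y} q))

      ⇒sameB : ∀ x y v w → Same x y v w → sameB x y v w ≡ true
      ⇒sameB x y v w (inj₁ (q , q′)) = ∨-introˡ (∧-intro (≡⇒== q) (≡⇒== q′))
      ⇒sameB x y v w (inj₂ (q , q′)) = ∨-introʳ {(v == x) ∧ (w == y)} (∧-intro (≡⇒== q) (≡⇒== q′))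

      result : Result
      result = decide (findTrue (λ v → someF (innerB v)))
        where
        another : ∀ x y → GoodEdge x y → (∃ λ v → someF (λ w → innerB v w ∧ not (sameB x y v w)) ≡ true) ⊎
          (∀ v → someF (λ w → innerB v w ∧ not (sameB x y v w)) ≡ false) → Result
        another x y xy (inj₂ none) = one-inner x y xy (λ v w h → sameB⇒ x y v w (not-false (trans (cong (_∧ not (sameB x y v w)) (sym h)) (someF-none _ w (none v)))))
        another x y xy (inj₁ (v , h)) = clash (someF-elim _ h)
          where
          clash : (∃ λ w → innerB v w ∧ not (sameB x y v w) ≡ true) → Result
          clash (w , h) = two-inner x y v w xy (inner⇒good (∧-elimˡ h))
            (λ e → true≢false (⇒sameB x y v w (unique-in-part x y v w xy (inner⇒good (∧-elimˡ h)) e)) (not-elim (∧-elimʳ {innerB v w} h)))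
        decide : (∃ λ v → someF (innerB v) ≡ true) ⊎ (∀ v → someF (innerB v) ≡ false) → Result
        decide (inj₂ none) = no-inner none
        decide (inj₁ (x , h)) = first (someF-elim (innerB x) h)
          where
          first : (∃ λ y → innerB x y ≡ true) → Result
          first (y , xy) = another x y (inner⇒good xy) (findTrue (λ v → someF (λ w → innerB v w ∧ not (sameB x y v w))))

    result : 0 < C → Result
    result C>0 = decide (≤-<-connex (count D) 0)
      where
      decide : (count D ≤ 0) ⊎ (0 < count D) → Result
      decide (inj₁ none) = NoBad.result (λ v → ≢true⇒false (λ h → <⇒≱ (≤-trans (≤-reflexive (sym (⟦⟧-true h)))
        (≤-trans (term≤sum (λ v → ⟦ D v ⟧) v) (≤-reflexive (sym (count≡sum D))))) none))
      decide (inj₂ some) = from-any (bad-vertices-lose inn-small C>0 (cross p) (λ v → count (edgeB v)) (λ v → ≤-refl) n≤C·cross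
        (λ v h → ≤-trans (deg≤cross+inn G p v) (+-monoʳ-≤ (cross p v) (≤-trans (≤-reflexive (inn-split v))
          (+-monoʳ-≤ (inn-bad v) (count-mono {n} {λ w → (adj G v w ∧ (p v == p w)) ∧ not (D w)} {edgeB v} (λ w q → ∧-intro (not-intro h) q))))))
        (≤-trans edge-total (≤-trans (m≤n+m (k * 2) m) (<⇒≤ η-large))) some)

extremal-B : ∀ j ρ → Σ ℕ λ N → ∀ n → N ≤ n → Σ (Fin n → Fin (suc (suc j))) λ p → Surjective p ×
  Σ (Fin n) λ x → Σ (Fin n) λ y → x ≢ y × p x ≡ p y ×
    IsExr n (suc ρ) (B (suc (suc j))) (e (suc ρ) (completeMPplusEdge p x y))
extremal-B j ρ = N , extremal
  where
  k r m α C b c : ℕ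
  k = suc (suc j)
  r = suc ρ
  m = suc (k + k)
  α = 2 * m + 3
  C = partConst k ρ
  b = α + suc ρ * C ^ ρ * (α + 1)
  c = 2 * m + 3 + m * b
  st = structure (suc j) ρ c (m + k * 2) m
  -- The term C * 2 gives parts of size at least n / C two vertices each, enough room for the extra
  -- edge.
  N = proj₁ st + C * 2 + suc k
  C>0 : 0 < C
  C>0 = ≤-trans (pow>0 (3 * k) (suc r) (s≤s z≤n)) (≤-trans (m≤m+n _ _) (≤-reflexive (sym (partConst-def k ρ))))
  Extremal : ℕ → Set
  Extremal n = Σ (Fin n → Fin k) λ p → Surjective p × Σ (Fin n) λ x → Σ (Fin n) λ y → x ≢ y × p x ≡ p y ×
    IsExr n r (B k) (e r (completeMPplusEdge p x y))
  module _ (n : ℕ) (N≤n : N ≤ n) where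
    Triple : Set
    Triple = Vec (Fin k) n × Fin n × Fin n
    Admissible : Triple → Set
    Admissible (q , x , y) = Surjective (lookup q) × x ≢ y × lookup q x ≡ lookup q y
    admissible? : ∀ t → Dec (Admissible t)
    admissible? (q , x , y) = FP.all? (λ i → FP.any? (λ v → lookup q v F.≟ i)) ×-dec (¬? (x F.≟ y) ×-dec (lookup q x F.≟ lookup q y))
    Val : Triple → ℕ
    Val (q , x , y) = e r (completeMPplusEdge (lookup q) x y)
    triples : List Triple
    triples = L.cartesianProduct (allVecs k n) (L.cartesianProduct (L.allFin n) (L.allFin n))
    ∈-triples : ∀ t → t ∈ triples
    ∈-triples (q , x , y) = MP.∈-cartesianProduct⁺ (∈-allVecs q) (MP.∈-cartesianProduct⁺ (MP.∈-allFin x) (MP.∈-allFin y))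
    surjective : ∀ q → (∀ i → n ≤ C * partSize (lookup q) i) → Surjective (lookup q)
    surjective q parts i = hit (count>0⇒some (λ v → lookup q v == i) (<-≤-trans (s≤s z≤n) (two q parts i)))
      where
      two : ∀ q → (∀ i → n ≤ C * partSize (lookup q) i) → ∀ i → 2 ≤ partSize (lookup q) i
      two q parts i = *-cancelˡ C>0 (≤-trans (≤-trans (m≤n+m (C * 2) (proj₁ st)) (≤-trans (m≤m+n _ (suc k)) N≤n)) (parts i))
      hit : (∃ λ v → (lookup q v == i) ≡ true) → Σ (Fin n) λ v → lookup q v ≡ i
      hit (v , e) = v , ==⇒≡ e
    Dominating : Set
    Dominating = Σ Triple λ t → Admissible t × (∀ (p : Fin n → Fin k) → crossPower r p ≤ Val t)
    dominating : Dominating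
    dominating = build (maximal-crossPower (suc j) ρ (≤-trans (m≤n+m (suc k) _) N≤n))
      where
      build : (Σ (Vec (Fin k) n) λ pv → (∀ (p : Fin n → Fin k) → crossPower r p ≤ crossPower r (lookup pv)) ×
        (∀ i → n ≤ C * partSize (lookup pv) i)) → Dominating
      build (pv , max , parts) = pick (count≥⇒injection {m = 2} (λ v → lookup pv v == zero)
          (*-cancelˡ C>0 (≤-trans (≤-trans (m≤n+m (C * 2) (proj₁ st)) (≤-trans (m≤m+n _ (suc k)) N≤n)) (parts zero))))
        where
        pick : (Σ (Fin 2 → Fin n) λ φ → Injective _≡_ _≡_ φ × (∀ i → (lookup pv (φ i) == zero) ≡ true)) → Dominating
        pick (φ , φ-inj , φ-0) = (pv , φ zero , φ (suc zero)) ,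
          (surjective pv parts , (λ e → case φ-inj e of λ ()) , trans (==⇒≡ (φ-0 zero)) (sym (==⇒≡ (φ-0 (suc zero))))) ,
          λ p → ≤-trans (max p) (sum-mono {n} (λ v → ^-monoˡ-≤ r (PlusEdge.cross≤deg (lookup pv) (φ zero) (φ (suc zero)) v)))
    Best : Set
    Best = Σ Triple λ t → Admissible t × (∀ t′ → Admissible t′ → Val t′ ≤ Val t)
    best : Best
    best = build dominating (argmaxL {P = Admissible} admissible? (λ t _ → Val t) triples)
      where
      build : Dominating → (∀ y → y ∈ triples → ¬ Admissible y) ⊎
        (Σ Triple λ t → Σ (Admissible t) λ _ → ∀ y → y ∈ triples → Admissible y → Σ (Admissible y) λ _ → Val y ≤ Val t) → Best
      build (t , ok , _) (inj₁ none) = ⊥-elim (none t (∈-triples t) ok)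
      build _ (inj₂ (t , ok , max)) = t , ok , λ t′ ok′ → proj₂ (max t′ (∈-triples t′) ok′)
    extremal : Extremal n
    extremal = build best dominating
      where
      build : Best → Dominating → Extremal n
      build ((q , x , y) , (surj , x≢y , qx≡qy) , max) (t₀ , ok₀ , dom) = lookup q , surj , x , y , x≢y , qx≡qy ,
          (completeMPplusEdge (lookup q) x y , PlusEdge.T-free (lookup q) x y x≢y , refl) ,
          λ G free → either G free (≤-total (e r G) best-value)
        where
        best-value : ℕ
        best-value = Val (q , x , y)
        either : ∀ G → (B k -free) G → (e r G ≤ best-value) ⊎ (best-value ≤ e r G) → e r G ≤ best-value
        either G free (inj₁ small) = small
        either G free (inj₂ big) = from (proj₂ st (≤-trans (≤-trans (m≤m+n (proj₁ st) _) (m≤m+n _ (suc k))) N≤n) G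
            (λ blowup → free (blowup⇒⊆ (B k) G (B-colorable k) blowup)) (λ p → ≤-trans (dom p) (≤-trans (max t₀ ok₀) big)))
          where
          from : (Σ ℕ λ η → Σ (Vec (Fin k) n) λ pv → m + k * 2 < η × Structured G (lookup pv) η c C) → e r G ≤ best-value
          from (η , pv , η-large , str) = finish (Bowtie.Bound.result ρ G free (lookup pv) η η-large str C>0)
            where
            finish : (Σ (Fin n) λ x → Σ (Fin n) λ y → x ≢ y × lookup pv x ≡ lookup pv y × e r G ≤ e r (completeMPplusEdge (lookup pv) x y)) → e r G ≤ best-value
            finish (x′ , y′ , x′≢y′ , same , bound) = ≤-trans bound
              (max (pv , x′ , y′) (surjective pv (Structured.part≥n/C str) , x′≢y′ , same))

theorem1p8 : (k r : ℕ) → 2 ≤ k → 1 ≤ r →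
    ((s : ℕ) → 1 < s → (crit others : List AGraph) → length crit ≡ s →
    All (λ H → Connected (graph H) × ChromaticNumber (graph H) (suc k)
    × HasColorCriticalEdge (graph H)) crit →
    All (λ H → Connected (graph H) × Colorable (graph H) k) others →
    Σ ℕ λ N → (n : ℕ) → N ≤ n →
    Σ (Fin n → Fin ((s ∸ 1) + k)) λ p → Surjective p ×
    (∀ (i : Fin (s ∸ 1)) → partSize p (i ↑ˡ k) ≡ 1) ×
    IsExr n r (graph (⨆ (crit ++ others))) (e r (completeMP p)))
    ×
    ((a : ℕ) → 1 ≤ a →
    Σ ℕ λ N → (n : ℕ) → N ≤ n →
    Σ (Graph n) λ T → InT0 n k (a ∸ 1) T × IsExr n r (K1a k a) (e r T))
    ×
    (Σ ℕ λ N → (n : ℕ) → N ≤ n →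
    Σ (Fin n → Fin k) λ p → Surjective p ×
    Σ (Fin n) λ x → Σ (Fin n) λ y → x ≢ y × p x ≡ p y ×
    IsExr n r (B k) (e r (completeMPplusEdge p x y)))
theorem1p8 (suc zero) _ (s≤s ()) _
theorem1p8 (suc (suc j)) (suc ρ) _ _ = part-i , part-ii , extremal-B j ρ
  where
  k r : ℕ
  k = suc (suc j)
  r = suc ρ
  part-i : (s : ℕ) → 1 < s → (crit others : List AGraph) → length crit ≡ s →
    All (λ H → Connected (graph H) × ChromaticNumber (graph H) (suc k) × HasColorCriticalEdge (graph H)) crit →
    All (λ H → Connected (graph H) × Colorable (graph H) k) others →
    Σ ℕ λ N → (n : ℕ) → N ≤ n →
    Σ (Fin n → Fin ((s ∸ 1) + k)) λ p → Surjective p × (∀ (i : Fin (s ∸ 1)) → partSize p (i ↑ˡ k) ≡ 1) ×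
    IsExr n r (graph (⨆ (crit ++ others))) (e r (completeMP p))
  -- With s + 1 critical components the number of singleton parts in the statement reduces to s.
  part-i (suc s) _ crit others len crit-ok others-ok = proj₁ result , λ n N≤n → reorder (proj₂ result n N≤n)
    where
    result = extremal-disjoint-critical j ρ s crit others len (All-map proj₂ crit-ok) (All-map proj₂ others-ok)
    reorder : ∀ {n} → (Σ (Fin n → Fin (s + k)) λ p → GoodPartition s k p × IsExr n r (graph (⨆ (crit ++ others))) (e r (completeMP p))) →
      Σ (Fin n → Fin (s + k)) λ p → Surjective p × (∀ i → partSize p (i ↑ˡ k) ≡ 1) × IsExr n r (graph (⨆ (crit ++ others))) (e r (completeMP p))
    reorder (p , (surj , single) , extremal) = p , surj , single , extremal
  part-ii : (a : ℕ) → 1 ≤ a → Σ ℕ λ N → (n : ℕ) → N ≤ n →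
    Σ (Graph n) λ T → InT0 n k (a ∸ 1) T × IsExr n r (K1a k a) (e r T)
  part-ii (suc ℓ) _ = extremal-K1a j ρ ℓ
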